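{- For any integers $n,r\ge1$ there is an isomorphism of ungraded $(\mathbb{Z}_r\wr\mathfrak{S}_n)$-modules $$SR_{n,r}\cong\mathbb{C}[\widetilde{\mathcal{OP}}_{n,r}]\otimes\det .$$
   Context: Write $[n]=\{1,\dots,n\}$ and $\zeta=\exp(2\pi i/r)$. $\mathbb{Z}_r\wr\mathfrak{S}_n\subseteq GL_n(\mathbb{C})$ is the group of $n\times n$ monomial matrices (exactly one nonzero entry in each row and column) whose nonzero entries are $r$-th roots of unity; $\det$ is the one-dimensional module given by the determinant of matrices. $\Omega=\mathbb{C}[x_1,\dots,x_n]\otimes\wedge\{\theta_1,\dots,\theta_n\}$ is the unital associative $\mathbb{C}$-algebra generated by $x_i,\theta_i$ with relations $x_ix_j=x_jx_i$, $x_i\theta_j=\theta_jx_i$, $\theta_i\theta_j=-\theta_j\theta_i$. The group acts on $\Omega$ by algebra automorphisms: $\mathrm{diag}(\zeta^{c_1},\dots,\zeta^{c_n})$ sends $x_i\mapsto\zeta^{ -c_i}x_i$, $\theta_i\mapsto\zeta^{ -c_i}\theta_i$, and a permutation matrix $w$ sends $x_i\mapsto x_{w(i)}$, $\theta_i\mapsto\theta_{w(i)}$. $SI_{n,r}\subseteq\Omega$ is the two-sided ideal generated by all invariants with vanishing constant term, and $SR_{n,r}:=\Omega/SI_{n,r}$. An $r$-ified ordered set partition is a pair $\sigma=(Z,\mathcal{B})$ where $Z\subseteq[n]$ (the zero block, possibly empty) has each element decorated by a color in $\{0,\dots,r-2\}$, and $\mathcal{B}=(B_1\mid\cdots\mid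 B_k)$ is an ordered set partition of $[n]-Z$ into nonempty blocks, each element of which is decorated by a color in $\{0,\dots,r-1\}$. (For $r=1$ the zero block must be empty.) $\widetilde{\mathcal{OP}}_{n,r}$ is the set of all of these, and $\mathbb{C}[\widetilde{\mathcal{OP}}_{n,r}]$ is the vector space with basis $\widetilde{\mathcal{OP}}_{n,r}$, with the following $(\mathbb{Z}_r\wr\mathfrak{S}_n)$-action. A permutation $w\in\mathfrak{S}_n$ replaces each number $a$ by $w(a)$ while keeping colors (and blocks) in place. A diagonal element $g=\mathrm{diag}(\zeta^{c_1},\dots,\zeta^{c_n})$ acts on $\sigma$ by changing the color $k$ of each $i$ in a nonzero block to $k+c_i\pmod r$, leaving the colors of zero block elements unchanged, and multiplying the result by the scalar $\prod_{i\in Z}\zeta^{k_ic_i}$, where $k_i$ is the color of $i\in Z$. -}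

module Defs where

import Algebra.Consequences.Setoid as Consequences
open import Algebra.Bundles using (CommutativeMonoid; CommutativeRing; Semiring)
open import Algebra.Definitions
  using (Associative; Commutative; Congruent₂; LeftIdentity; _DistributesOverˡ_)
import Algebra.Solver.Ring.NaturalCoefficients.Default as SemiringSolver
open import Algebra.Structures using (IsCommutativeRing)
open import Algebra.Module.Bundles using (Module)
import Algebra.Definitions.RawSemiring as RawSemiringOps
import Algebra.Module.Construct.TensorUnit as TensorUnit
import Algebra.Module.Morphism.Construct.Composition as Composition
import Algebra.Module.Morphism.Structures as ModuleMorphism
open import Algebra.Module.Structures.Biased using (IsModuleFromLeft)
import Algebra.Properties.AbelianGroup as AbelianGroupProperties
import Algebra.Properties.CommutativeSemigroup as CommutativeSemigroupProperties
import Algebra.Properties.Ring as RingProperties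
open import Data.Bool.Base using (if_then_else_)
open import Data.Empty using (⊥)
open import Data.Fin.Base using (Fin; zero; suc; toℕ; punchIn)
open import Data.Fin.Permutation using (Permutation′; _⟨$⟩ʳ_; _⟨$⟩ˡ_; inverseˡ)
import Data.Fin.Properties as Fin
open import Data.Nat.Base as ℕ using (ℕ; zero; suc; NonZero)
open import Data.Nat.DivMod using (_mod_)
import Data.Nat.Properties as ℕ
open import Data.Product.Base using (∃; _×_; _,_)
open import Data.Rational.Base as ℚ using (ℚ; 0ℚ; 1ℚ; ½)
import Data.Rational.Properties as ℚ
open import Data.Rational.Solver using (module +-*-Solver)
open import Data.Sum.Base using (_⊎_; inj₁; inj₂)
open import Data.Vec.Base using (Vec; lookup; tabulate)
open import Data.Vec.Properties using (lookup∘tabulate)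
open import Level using (0ℓ)
open import Relation.Binary.Bundles using (Setoid)
open import Relation.Binary.Core using (Rel)
open import Relation.Binary.PropositionalEquality.Core
  using (_≡_; refl; sym; trans; cong; subst)
import Relation.Binary.Reasoning.Setoid as SetoidReasoning
open import Relation.Binary.Structures using (IsEquivalence)
open import Relation.Nullary.Decidable.Core using (does)
open import Relation.Nullary.Negation.Core using (¬_)

------------------------------------------------------------------------
-- Complex numbers

-- The reals are Cauchy sequences of rationals, two of which are equal
-- when their difference tends to 0.

Close : ℚ → ℚ → ℚ → Set
Close ε p q = ℚ.∣ p ℚ.- q ∣ ℚ.< ε

record ℝ : Set where
  constructor mkℝ
  field
    seq    : ℕ → ℚ
    cauchy : ∀ ε → 0ℚ ℚ.< ε →
             ∃ λ N → ∀ m n → N ℕ.≤ m → N ℕ.≤ n → Close ε (seq m) (seq n)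

open ℝ public

infix 4 _≈ℝ_

record _≈ℝ_ (a b : ℝ) : Set where
  constructor mk≈
  field
    close : ∀ ε → 0ℚ ℚ.< ε → ∃ λ N → ∀ n → N ℕ.≤ n → Close ε (seq a n) (seq b n)

open _≈ℝ_ public

private
  ½ε : ∀ {ε} → 0ℚ ℚ.< ε → 0ℚ ℚ.< ½ ℚ.* ε
  ½ε {ε} 0<ε = subst (ℚ._< ½ ℚ.* ε) (ℚ.*-zeroʳ ½) (ℚ.*-monoʳ-<-pos ½ 0<ε)

  half+half : ∀ ε → ½ ℚ.* ε ℚ.+ ½ ℚ.* ε ≡ ε
  half+half ε = trans (sym (ℚ.*-distribʳ-+ ε ½ ½)) (ℚ.*-identityˡ ε)

  ∣+∣< : ∀ {ε} p q → ℚ.∣ p ∣ ℚ.< ½ ℚ.* ε → ℚ.∣ q ∣ ℚ.< ½ ℚ.* ε → ℚ.∣ p ℚ.+ q ∣ ℚ.< ε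
  ∣+∣< {ε} p q p< q< = ℚ.≤-<-trans (ℚ.∣p+q∣≤∣p∣+∣q∣ p q)
    (subst (ℚ.∣ p ∣ ℚ.+ ℚ.∣ q ∣ ℚ.<_) (half+half ε) (ℚ.+-mono-< p< q<))

  close-refl : ∀ {ε} p {q} → 0ℚ ℚ.< ε → p ≡ q → Close ε p q
  close-refl {ε} p 0<ε refl = subst (ℚ._< ε) (cong ℚ.∣_∣ (sym (ℚ.+-inverseʳ p))) 0<ε

  close-sym : ∀ {ε} p q → Close ε p q → Close ε q p
  close-sym {ε} p q = subst (ℚ._< ε)
    (trans (sym (ℚ.∣-p∣≡∣p∣ (p ℚ.- q))) (cong ℚ.∣_∣ (eq p q)))
    where
    open +-*-Solver
    eq : ∀ p q → ℚ.- (p ℚ.- q) ≡ q ℚ.- p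
    eq = solve 2 (λ p q → (:- (p :- q)) , (q :- p)) refl

  close-trans : ∀ {ε} p q s → Close (½ ℚ.* ε) p q → Close (½ ℚ.* ε) q s → Close ε p s
  close-trans {ε} p q s pq qs = subst (ℚ._< ε) (cong ℚ.∣_∣ (eq p q s))
    (∣+∣< (p ℚ.- q) (q ℚ.- s) pq qs)
    where
    open +-*-Solver
    eq : ∀ p q s → (p ℚ.- q) ℚ.+ (q ℚ.- s) ≡ p ℚ.- s
    eq = solve 3 (λ p q s → ((p :- q) :+ (q :- s)) , (p :- s)) refl

  close-+ : ∀ {ε} p p′ q q′ → Close (½ ℚ.* ε) p p′ → Close (½ ℚ.* ε) q q′ →
            Close ε (p ℚ.+ q) (p′ ℚ.+ q′)
  close-+ {ε} p p′ q q′ pp qq = subst (ℚ._< ε) (cong ℚ.∣_∣ (eq p p′ q q′))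
    (∣+∣< (p ℚ.- p′) (q ℚ.- q′) pp qq)
    where
    open +-*-Solver
    eq : ∀ p p′ q q′ → (p ℚ.- p′) ℚ.+ (q ℚ.- q′) ≡ (p ℚ.+ q) ℚ.- (p′ ℚ.+ q′)
    eq = solve 4 (λ p p′ q q′ → ((p :- p′) :+ (q :- q′)) , ((p :+ q) :- (p′ :+ q′))) refl

  close-neg : ∀ {ε} p q → Close ε p q → Close ε (ℚ.- p) (ℚ.- q)
  close-neg {ε} p q = subst (ℚ._< ε)
    (trans (sym (ℚ.∣-p∣≡∣p∣ (p ℚ.- q))) (cong ℚ.∣_∣ (eq p q)))
    where
    open +-*-Solver
    eq : ∀ p q → ℚ.- (p ℚ.- q) ≡ (ℚ.- p) ℚ.- (ℚ.- q)
    eq = solve 2 (λ p q → (:- (p :- q)) , ((:- p) :- (:- q))) refl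

  divide : ∀ B → 0ℚ ℚ.< B → ∀ {ε} → 0ℚ ℚ.< ε →
           ∃ λ δ → 0ℚ ℚ.< δ ×
             (∀ p q → ℚ.∣ p ∣ ℚ.< B → ℚ.∣ q ∣ ℚ.< δ → ℚ.∣ p ℚ.* q ∣ ℚ.< ε)
  divide B 0<B {ε} 0<ε = δ , 0<δ , bound
    where
    instance
      B-pos : ℚ.Positive B
      B-pos = ℚ.positive 0<B
      B-nz : ℚ.NonZero B
      B-nz = ℚ.pos⇒nonZero B
      1/B-pos : ℚ.Positive (ℚ.1/ B)
      1/B-pos = ℚ.1/pos⇒pos B
    δ : ℚ
    δ = ℚ.1/ B ℚ.* ε
    0<δ : 0ℚ ℚ.< δ
    0<δ = subst (ℚ._< δ) (ℚ.*-zeroʳ (ℚ.1/ B)) (ℚ.*-monoʳ-<-pos (ℚ.1/ B) 0<ε)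
    Bδ≡ε : B ℚ.* δ ≡ ε
    Bδ≡ε = trans (sym (ℚ.*-assoc B (ℚ.1/ B) ε))
             (trans (cong (ℚ._* ε) (ℚ.*-inverseʳ B)) (ℚ.*-identityˡ ε))
    bound : ∀ p q → ℚ.∣ p ∣ ℚ.< B → ℚ.∣ q ∣ ℚ.< δ → ℚ.∣ p ℚ.* q ∣ ℚ.< ε
    bound p q p< q< = subst (ℚ._< ε) (sym (ℚ.∣p*q∣≡∣p∣*∣q∣ p q))
      (ℚ.≤-<-trans
        (ℚ.*-monoʳ-≤-nonNeg ℚ.∣ q ∣ {{ℚ.∣-∣-nonNeg q}} (ℚ.<⇒≤ p<))
        (subst (B ℚ.* ℚ.∣ q ∣ ℚ.<_) Bδ≡ε (ℚ.*-monoʳ-<-pos B q<)))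

  EventuallyBounded : (ℕ → ℚ) → Set
  EventuallyBounded s = ∃ λ B → 0ℚ ℚ.< B × (∃ λ N → ∀ n → N ℕ.≤ n → ℚ.∣ s n ∣ ℚ.< B)

  bounded : ∀ a → EventuallyBounded (seq a)
  bounded a with cauchy a 1ℚ (ℚ.positive⁻¹ 1ℚ)
  ... | N , near = B , 0<B , N , bound
    where
    B : ℚ
    B = ℚ.∣ seq a N ∣ ℚ.+ 1ℚ
    0<B : 0ℚ ℚ.< B
    0<B = ℚ.+-mono-≤-< (ℚ.0≤∣p∣ (seq a N)) (ℚ.positive⁻¹ 1ℚ)
    open +-*-Solver
    eq : ∀ p q → p ℚ.+ (q ℚ.- p) ≡ q
    eq = solve 2 (λ p q → (p :+ (q :- p)) , q) refl
    bound : ∀ n → N ℕ.≤ n → ℚ.∣ seq a n ∣ ℚ.< B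
    bound n N≤n = subst (λ t → ℚ.∣ t ∣ ℚ.< B) (eq (seq a N) (seq a n))
      (ℚ.≤-<-trans (ℚ.∣p+q∣≤∣p∣+∣q∣ (seq a N) (seq a n ℚ.- seq a N))
        (ℚ.+-monoʳ-< ℚ.∣ seq a N ∣ (near n N N≤n ℕ.≤-refl)))

  close-* : ∀ {s t} → EventuallyBounded s → EventuallyBounded t → ∀ {ε} → 0ℚ ℚ.< ε →
            ∃ λ δ → 0ℚ ℚ.< δ × (∃ λ N → ∀ m n → N ℕ.≤ m → N ℕ.≤ n → ∀ p′ q →
              Close δ (s m) p′ → Close δ q (t n) →
              Close ε (s m ℚ.* q) (p′ ℚ.* t n))
  close-* {s} {t} (B , 0<B , M , sB) (C , 0<C , N , tC) {ε} 0<ε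
    with divide B 0<B (½ε 0<ε) | divide C 0<C (½ε 0<ε)
  ... | δ₁ , 0<δ₁ , b₁ | δ₂ , 0<δ₂ , b₂ =
    δ₁ ℚ.⊓ δ₂ , 0<δ , M ℕ.⊔ N , λ m n m≥ n≥ p′ q sp qt →
      subst (ℚ._< ε) (cong ℚ.∣_∣ (eq (s m) p′ q (t n)))
        (∣+∣< (s m ℚ.* (q ℚ.- t n)) (t n ℚ.* (s m ℚ.- p′))
          (b₁ (s m) (q ℚ.- t n) (sB m (ℕ.≤-trans (ℕ.m≤m⊔n M N) m≥))
            (ℚ.<-≤-trans qt (ℚ.p⊓q≤p δ₁ δ₂)))
          (b₂ (t n) (s m ℚ.- p′) (tC n (ℕ.≤-trans (ℕ.m≤n⊔m M N) n≥))
            (ℚ.<-≤-trans sp (ℚ.p⊓q≤q δ₁ δ₂))))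
    where
    open +-*-Solver
    eq : ∀ p p′ q q′ → p ℚ.* (q ℚ.- q′) ℚ.+ q′ ℚ.* (p ℚ.- p′) ≡ p ℚ.* q ℚ.- p′ ℚ.* q′
    eq = solve 4 (λ p p′ q q′ →
      (p :* (q :- q′) :+ q′ :* (p :- p′)) , (p :* q :- p′ :* q′)) refl
    0<δ : 0ℚ ℚ.< δ₁ ℚ.⊓ δ₂
    0<δ with ℚ.⊓-sel δ₁ δ₂
    ... | inj₁ e = subst (0ℚ ℚ.<_) (sym e) 0<δ₁
    ... | inj₂ e = subst (0ℚ ℚ.<_) (sym e) 0<δ₂

  left : ∀ {M N n} → M ℕ.⊔ N ℕ.≤ n → M ℕ.≤ n
  left {M} {N} = ℕ.≤-trans (ℕ.m≤m⊔n M N)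

  right : ∀ {M N n} → M ℕ.⊔ N ℕ.≤ n → N ℕ.≤ n
  right {M} {N} = ℕ.≤-trans (ℕ.m≤n⊔m M N)

-- Arithmetic of ℚ behind an opaque boundary: otherwise conversion checking
-- unfolds sums of fractions to a common denominator.
opaque
  infixl 6 _+ᵒ_
  infixl 7 _*ᵒ_
  infix  8 -ᵒ_

  _+ᵒ_ _*ᵒ_ : ℚ → ℚ → ℚ
  _+ᵒ_ = ℚ._+_
  _*ᵒ_ = ℚ._*_

  -ᵒ_ : ℚ → ℚ
  -ᵒ_ = ℚ.-_

opaque
  unfolding _+ᵒ_

  ℚ-isCommutativeRing : IsCommutativeRing _≡_ _+ᵒ_ _*ᵒ_ -ᵒ_ 0ℚ 1ℚ
  ℚ-isCommutativeRing = ℚ.+-*-isCommutativeRing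

  private
    close-+ᵒ : ∀ {ε} p p′ q q′ → Close (½ ℚ.* ε) p p′ → Close (½ ℚ.* ε) q q′ →
              Close ε (p +ᵒ q) (p′ +ᵒ q′)
    close-+ᵒ = close-+

    close-negᵒ : ∀ {ε} p q → Close ε p q → Close ε (-ᵒ p) (-ᵒ q)
    close-negᵒ = close-neg

    close-*ᵒ : ∀ {s t} → EventuallyBounded s → EventuallyBounded t → ∀ {ε} → 0ℚ ℚ.< ε →
              ∃ λ δ → 0ℚ ℚ.< δ × (∃ λ N → ∀ m n → N ℕ.≤ m → N ℕ.≤ n → ∀ p′ q →
                Close δ (s m) p′ → Close δ q (t n) →
                Close ε (s m *ᵒ q) (p′ *ᵒ t n))
    close-*ᵒ = close-*

fromℚ : ℚ → ℝ
fromℚ q = mkℝ (λ _ → q) (λ ε 0<ε → 0 , λ _ _ _ _ → close-refl q 0<ε refl)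

infixl 6 _+ℝ_
infixl 7 _*ℝ_
infix  8 -ℝ_

_+ℝ_ : ℝ → ℝ → ℝ
a +ℝ b = mkℝ (λ n → seq a n +ᵒ seq b n) λ ε 0<ε →
  let M , ca = cauchy a (½ ℚ.* ε) (½ε 0<ε)
      N , cb = cauchy b (½ ℚ.* ε) (½ε 0<ε)
  in M ℕ.⊔ N , λ m n m≥ n≥ → close-+ᵒ (seq a m) (seq a n) (seq b m) (seq b n)
       (ca m n (left m≥) (left n≥)) (cb m n (right {M} m≥) (right {M} n≥))

-ℝ_ : ℝ → ℝ
-ℝ a = mkℝ (λ n → -ᵒ seq a n) λ ε 0<ε →
  let N , ca = cauchy a ε 0<ε
  in N , λ m n m≥ n≥ → close-negᵒ (seq a m) (seq a n) (ca m n m≥ n≥)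

_*ℝ_ : ℝ → ℝ → ℝ
a *ℝ b = mkℝ (λ n → seq a n *ᵒ seq b n) λ ε 0<ε →
  let δ , 0<δ , L , bound = close-*ᵒ (bounded a) (bounded b) 0<ε
      M , ca = cauchy a δ 0<δ
      N , cb = cauchy b δ 0<δ
  in L ℕ.⊔ (M ℕ.⊔ N) , λ m n m≥ n≥ →
       bound m n (left m≥) (left n≥) (seq a n) (seq b m)
         (ca m n (left (right {L} m≥)) (left (right {L} n≥)))
         (cb m n (right {M} (right {L} m≥)) (right {M} (right {L} n≥)))

private
  pointwise : ∀ {a b} → (∀ n → seq a n ≡ seq b n) → a ≈ℝ b
  pointwise {a} eq = mk≈ λ ε 0<ε → 0 , λ n _ → close-refl (seq a n) 0<ε (eq n)

  ≈ℝ-refl : ∀ {a} → a ≈ℝ a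
  ≈ℝ-refl = pointwise λ _ → refl

  ≈ℝ-sym : ∀ {a b} → a ≈ℝ b → b ≈ℝ a
  ≈ℝ-sym {a} {b} e = mk≈ λ ε 0<ε →
    let N , c = close e ε 0<ε in N , λ n n≥ → close-sym (seq a n) (seq b n) (c n n≥)

  ≈ℝ-trans : ∀ {a b c} → a ≈ℝ b → b ≈ℝ c → a ≈ℝ c
  ≈ℝ-trans {a} {b} {c} e f = mk≈ λ ε 0<ε →
    let M , p = close e (½ ℚ.* ε) (½ε 0<ε)
        N , q = close f (½ ℚ.* ε) (½ε 0<ε)
    in M ℕ.⊔ N , λ n n≥ → close-trans (seq a n) (seq b n) (seq c n)
         (p n (left n≥)) (q n (right {M} n≥))

  +ℝ-cong : ∀ {a a′ b b′} → a ≈ℝ a′ → b ≈ℝ b′ → a +ℝ b ≈ℝ a′ +ℝ b′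
  +ℝ-cong {a} {a′} {b} {b′} e f = mk≈ λ ε 0<ε →
    let M , p = close e (½ ℚ.* ε) (½ε 0<ε)
        N , q = close f (½ ℚ.* ε) (½ε 0<ε)
    in M ℕ.⊔ N , λ n n≥ → close-+ᵒ (seq a n) (seq a′ n) (seq b n) (seq b′ n)
         (p n (left n≥)) (q n (right {M} n≥))

  -ℝ-cong : ∀ {a a′} → a ≈ℝ a′ → -ℝ a ≈ℝ -ℝ a′
  -ℝ-cong {a} {a′} e = mk≈ λ ε 0<ε →
    let N , p = close e ε 0<ε in N , λ n n≥ → close-negᵒ (seq a n) (seq a′ n) (p n n≥)

  *ℝ-cong : ∀ {a a′ b b′} → a ≈ℝ a′ → b ≈ℝ b′ → a *ℝ b ≈ℝ a′ *ℝ b′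
  *ℝ-cong {a} {a′} {b} {b′} e f = mk≈ λ ε 0<ε →
    let δ , 0<δ , L , bound = close-*ᵒ (bounded a) (bounded b′) 0<ε
        M , p = close e δ 0<δ
        N , q = close f δ 0<δ
    in L ℕ.⊔ (M ℕ.⊔ N) , λ n n≥ →
         bound n n (left n≥) (left n≥) (seq a′ n) (seq b n)
           (p n (left (right {L} n≥))) (q n (right {M} (right {L} n≥)))

ℝ-commutativeRing : CommutativeRing 0ℓ 0ℓ
ℝ-commutativeRing = record
  { Carrier = ℝ
  ; _≈_ = _≈ℝ_
  ; _+_ = _+ℝ_
  ; _*_ = _*ℝ_
  ; -_  = -ℝ_
  ; 0#  = fromℚ 0ℚ
  ; 1#  = fromℚ 1ℚ
  ; isCommutativeRing = record
    { isRing = record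
      { +-isAbelianGroup = record
        { isGroup = record
          { isMonoid = record
            { isSemigroup = record
              { isMagma = record
                { isEquivalence = record
                  { refl = ≈ℝ-refl ; sym = ≈ℝ-sym ; trans = ≈ℝ-trans }
                ; ∙-cong = +ℝ-cong
                }
              ; assoc = λ a b c → pointwise λ n → ℚ′.+-assoc (seq a n) (seq b n) (seq c n)
              }
            ; identity = (λ a → pointwise λ n → ℚ′.+-identityˡ (seq a n))
                       , (λ a → pointwise λ n → ℚ′.+-identityʳ (seq a n))
            }
          ; inverse = (λ a → pointwise λ n → ℚ′.-‿inverseˡ (seq a n))
                    , (λ a → pointwise λ n → ℚ′.-‿inverseʳ (seq a n))
          ; ⁻¹-cong = -ℝ-cong
          }
        ; comm = λ a b → pointwise λ n → ℚ′.+-comm (seq a n) (seq b n)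
        }
      ; *-cong = *ℝ-cong
      ; *-assoc = λ a b c → pointwise λ n → ℚ′.*-assoc (seq a n) (seq b n) (seq c n)
      ; *-identity = (λ a → pointwise λ n → ℚ′.*-identityˡ (seq a n))
                   , (λ a → pointwise λ n → ℚ′.*-identityʳ (seq a n))
      ; distrib =
          (λ a b c → pointwise λ n → ℚ′.distribˡ (seq a n) (seq b n) (seq c n))
        , (λ a b c → pointwise λ n → ℚ′.distribʳ (seq a n) (seq b n) (seq c n))
      }
    ; *-comm = λ a b → pointwise λ n → ℚ′.*-comm (seq a n) (seq b n)
    }
  }
  where module ℚ′ = IsCommutativeRing ℚ-isCommutativeRing

-- R[i] with i² = -1.
module Complexification (R : CommutativeRing 0ℓ 0ℓ) where
  open CommutativeRing R renaming (refl to ≈-refl; sym to ≈-sym; trans to ≈-trans)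

  record R[i] : Set where
    constructor _+i_
    field
      re im : Carrier

  open R[i] public

  infix 4 _≈ℂ_

  _≈ℂ_ : Rel R[i] 0ℓ
  z ≈ℂ w = re z ≈ re w × im z ≈ im w

  infixl 6 _+ℂ_
  infixl 7 _*ℂ_
  infix  8 -ℂ_

  _+ℂ_ _*ℂ_ : R[i] → R[i] → R[i]
  z +ℂ w = (re z + re w) +i (im z + im w)
  z *ℂ w = (re z * re w + - (im z * im w)) +i (re z * im w + im z * re w)

  -ℂ_ : R[i] → R[i]
  -ℂ z = (- re z) +i (- im z)

  0ℂ 1ℂ : R[i]
  0ℂ = 0# +i 0#
  1ℂ = 1# +i 0#

  private
    open RingProperties ring
    open SetoidReasoning setoid
    open SemiringSolver commutativeSemiring

    -- The solver knows no subtraction, so subtraction becomes multiplication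
    -- by an indeterminate n, specialised to -1.
    n : Carrier
    n = - 1#

    sub : ∀ x y → x + - y ≈ x + n * y
    sub x y = +-congˡ (≈-sym (-1*x≈-x y))

    assoc-re : ∀ a b c d e f →
      (a * c + - (b * d)) * e + - ((a * d + b * c) * f) ≈
      a * (c * e + - (d * f)) + - (b * (c * f + d * e))
    assoc-re a b c d e f = begin
      (a * c + - (b * d)) * e + - ((a * d + b * c) * f)     ≈⟨ sub _ _ ⟩
      (a * c + - (b * d)) * e + n * ((a * d + b * c) * f)   ≈⟨ +-congʳ (*-congʳ (sub _ _)) ⟩
      (a * c + n * (b * d)) * e + n * ((a * d + b * c) * f) ≈⟨ solve 7 (λ n a b c d e f →
          (((a :* c) :+ n :* (b :* d)) :* e) :+ n :* (((a :* d) :+ (b :* c)) :* f) :=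
          a :* ((c :* e) :+ n :* (d :* f)) :+ n :* (b :* ((c :* f) :+ (d :* e))))
          ≈-refl n a b c d e f ⟩
      a * (c * e + n * (d * f)) + n * (b * (c * f + d * e)) ≈⟨ +-congʳ (*-congˡ (sub _ _)) ⟨
      a * (c * e + - (d * f)) + n * (b * (c * f + d * e))   ≈⟨ sub _ _ ⟨
      a * (c * e + - (d * f)) + - (b * (c * f + d * e))     ∎

    assoc-im : ∀ a b c d e f →
      (a * c + - (b * d)) * f + (a * d + b * c) * e ≈
      a * (c * f + d * e) + b * (c * e + - (d * f))
    assoc-im a b c d e f = begin
      (a * c + - (b * d)) * f + (a * d + b * c) * e   ≈⟨ +-congʳ (*-congʳ (sub _ _)) ⟩
      (a * c + n * (b * d)) * f + (a * d + b * c) * e ≈⟨ solve 7 (λ n a b c d e f →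
          (((a :* c) :+ n :* (b :* d)) :* f) :+ (((a :* d) :+ (b :* c)) :* e) :=
          a :* ((c :* f) :+ (d :* e)) :+ (b :* ((c :* e) :+ n :* (d :* f))))
          ≈-refl n a b c d e f ⟩
      a * (c * f + d * e) + b * (c * e + n * (d * f)) ≈⟨ +-congˡ (*-congˡ (sub _ _)) ⟨
      a * (c * f + d * e) + b * (c * e + - (d * f))   ∎

    idˡ-re : ∀ a b → 1# * a + - (0# * b) ≈ a
    idˡ-re a b = begin
      1# * a + - (0# * b) ≈⟨ sub _ _ ⟩
      1# * a + n * (0# * b) ≈⟨ solve 3 (λ n a b → con 1 :* a :+ n :* (con 0 :* b) := a) ≈-refl n a b ⟩
      a ∎

    idˡ-im : ∀ a b → 1# * b + 0# * a ≈ b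
    idˡ-im = solve 2 (λ a b → con 1 :* b :+ con 0 :* a := b) ≈-refl

    distribˡ-re : ∀ a b c d e f →
      a * (c + e) + - (b * (d + f)) ≈ (a * c + - (b * d)) + (a * e + - (b * f))
    distribˡ-re a b c d e f = begin
      a * (c + e) + - (b * (d + f))                 ≈⟨ sub _ _ ⟩
      a * (c + e) + n * (b * (d + f))               ≈⟨ solve 7 (λ n a b c d e f →
          a :* (c :+ e) :+ n :* (b :* (d :+ f)) :=
          ((a :* c) :+ n :* (b :* d)) :+ ((a :* e) :+ n :* (b :* f)))
          ≈-refl n a b c d e f ⟩
      (a * c + n * (b * d)) + (a * e + n * (b * f)) ≈⟨ +-cong (sub _ _) (sub _ _) ⟨
      (a * c + - (b * d)) + (a * e + - (b * f))     ∎

    distribˡ-im : ∀ a b c d e f →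
      a * (d + f) + b * (c + e) ≈ (a * d + b * c) + (a * f + b * e)
    distribˡ-im = solve 6 (λ a b c d e f →
      a :* (d :+ f) :+ b :* (c :+ e) :=
      ((a :* d) :+ (b :* c)) :+ ((a :* f) :+ (b :* e))) ≈-refl

    comm-re : ∀ a b c d → a * c + - (b * d) ≈ c * a + - (d * b)
    comm-re a b c d = +-cong (*-comm a c) (-‿cong (*-comm b d))

    comm-im : ∀ a b c d → a * d + b * c ≈ c * b + d * a
    comm-im = solve 4 (λ a b c d → (a :* d) :+ (b :* c) := (c :* b) :+ (d :* a)) ≈-refl

    isEquivalence-ℂ : IsEquivalence _≈ℂ_
    isEquivalence-ℂ = record
      { refl  = ≈-refl , ≈-refl
      ; sym   = λ (e , f) → ≈-sym e , ≈-sym f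
      ; trans = λ (e , f) (e′ , f′) → ≈-trans e e′ , ≈-trans f f′
      }

    ℂ-setoid : Setoid 0ℓ 0ℓ
    ℂ-setoid = record { isEquivalence = isEquivalence-ℂ }

    open Consequences ℂ-setoid

    +ℂ-cong : Congruent₂ _≈ℂ_ _+ℂ_
    +ℂ-cong (e , f) (e′ , f′) = +-cong e e′ , +-cong f f′

    *ℂ-cong : Congruent₂ _≈ℂ_ _*ℂ_
    *ℂ-cong (e , f) (e′ , f′) =
      +-cong (*-cong e e′) (-‿cong (*-cong f f′)) , +-cong (*-cong e f′) (*-cong f e′)

    +ℂ-comm : Commutative _≈ℂ_ _+ℂ_
    +ℂ-comm z w = +-comm (re z) (re w) , +-comm (im z) (im w)

    *ℂ-comm : Commutative _≈ℂ_ _*ℂ_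
    *ℂ-comm z w = comm-re (re z) (im z) (re w) (im w) , comm-im (re z) (im z) (re w) (im w)

    *ℂ-assoc : Associative _≈ℂ_ _*ℂ_
    *ℂ-assoc z w v =
      assoc-re (re z) (im z) (re w) (im w) (re v) (im v) ,
      assoc-im (re z) (im z) (re w) (im w) (re v) (im v)

    *ℂ-identityˡ : LeftIdentity _≈ℂ_ 1ℂ _*ℂ_
    *ℂ-identityˡ z = idˡ-re (re z) (im z) , idˡ-im (re z) (im z)

    distribˡ-ℂ : _DistributesOverˡ_ _≈ℂ_ _*ℂ_ _+ℂ_
    distribˡ-ℂ z w v =
      distribˡ-re (re z) (im z) (re w) (im w) (re v) (im v) ,
      distribˡ-im (re z) (im z) (re w) (im w) (re v) (im v)

    isCommutativeRing-ℂ : IsCommutativeRing _≈ℂ_ _+ℂ_ _*ℂ_ -ℂ_ 0ℂ 1ℂ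
    isCommutativeRing-ℂ = record
      { isRing = record
        { +-isAbelianGroup = record
          { isGroup = record
            { isMonoid = record
              { isSemigroup = record
                { isMagma = record { isEquivalence = isEquivalence-ℂ ; ∙-cong = +ℂ-cong }
                ; assoc = λ z w v → +-assoc (re z) (re w) (re v) , +-assoc (im z) (im w) (im v)
                }
              ; identity = comm∧idˡ⇒id +ℂ-comm
                  (λ z → +-identityˡ (re z) , +-identityˡ (im z))
              }
            ; inverse = comm∧invˡ⇒inv +ℂ-comm
                (λ z → -‿inverseˡ (re z) , -‿inverseˡ (im z))
            ; ⁻¹-cong = λ (e , f) → -‿cong e , -‿cong f
            }
          ; comm = +ℂ-comm
          }
        ; *-cong = *ℂ-cong
        ; *-assoc = *ℂ-assoc
        ; *-identity = comm∧idˡ⇒id *ℂ-comm *ℂ-identityˡ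
        ; distrib = comm∧distrˡ⇒distr +ℂ-cong *ℂ-comm distribˡ-ℂ
        }
      ; *-comm = *ℂ-comm
      }

  commutativeRing : CommutativeRing 0ℓ 0ℓ
  commutativeRing = record { isCommutativeRing = isCommutativeRing-ℂ }

ℂ : CommutativeRing 0ℓ 0ℓ
ℂ = Complexification.commutativeRing ℝ-commutativeRing

------------------------------------------------------------------------
-- Linear algebra and group representations over K

module Representations (K : CommutativeRing 0ℓ 0ℓ) where
  open CommutativeRing K
    renaming (refl to ≈-refl; sym to ≈-sym; trans to ≈-trans; setoid to K-setoid)

  KModule : Set₁
  KModule = Module K 0ℓ 0ℓ

  IsLinear : (V W : KModule) → (Module.Carrierᴹ V → Module.Carrierᴹ W) → Set
  IsLinear V W = ModuleMorphism.ModuleMorphisms.IsModuleHomomorphism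
    (Module.rawModule V) (Module.rawModule W)

  IsLinearIsomorphism : (V W : KModule) → (Module.Carrierᴹ V → Module.Carrierᴹ W) → Set
  IsLinearIsomorphism V W = ModuleMorphism.ModuleMorphisms.IsModuleIsomorphism
    (Module.rawModule V) (Module.rawModule W)

  module _ (V W : KModule) where
    private
      module V = Module V
      module W = Module W

    mkLinear :
      (f : V.Carrierᴹ → W.Carrierᴹ) →
      (∀ {u v} → u V.≈ᴹ v → f u W.≈ᴹ f v) →
      (∀ u v → f (u V.+ᴹ v) W.≈ᴹ f u W.+ᴹ f v) →
      (∀ c v → f (c V.*ₗ v) W.≈ᴹ c W.*ₗ f v) →
      IsLinear V W f
    mkLinear f f-cong f-+ f-* = record
      { isBimoduleHomomorphism = record
        { +ᴹ-isGroupHomomorphism = record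
          { isMonoidHomomorphism = record
            { isMagmaHomomorphism = record
              { isRelHomomorphism = record { cong = f-cong }
              ; homo = f-+
              }
            ; ε-homo = f-0
            }
          ; ⁻¹-homo = f-neg
          }
        ; *ₗ-homo = f-*
        ; *ᵣ-homo = λ c v → W.≈ᴹ-trans (f-cong (V.≈ᴹ-sym (V.*ₗ-*ᵣ-coincident c v)))
                              (W.≈ᴹ-trans (f-* c v) (W.*ₗ-*ᵣ-coincident c (f v)))
        }
      }
      where
      module G = AbelianGroupProperties W.+ᴹ-abelianGroup
      f-0 : f V.0ᴹ W.≈ᴹ W.0ᴹ
      f-0 = W.≈ᴹ-trans (f-cong (V.≈ᴹ-sym (V.*ₗ-zeroˡ V.0ᴹ)))
              (W.≈ᴹ-trans (f-* 0# V.0ᴹ) (W.*ₗ-zeroˡ (f V.0ᴹ)))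
      f-neg : ∀ v → f (V.-ᴹ v) W.≈ᴹ W.-ᴹ (f v)
      f-neg v = G.inverseˡ-unique (f (V.-ᴹ v)) (f v)
        (W.≈ᴹ-trans (W.≈ᴹ-sym (f-+ (V.-ᴹ v) v)) (W.≈ᴹ-trans (f-cong (V.-ᴹ‿inverseˡ v)) f-0))

  module _ {M : Set} {_≈ᴹ_ : Rel M 0ℓ} {_+ᴹ_ : M → M → M} {0ᴹ : M} {_•_ : Carrier → M → M}
    (isEquivalence : IsEquivalence _≈ᴹ_)
    (+ᴹ-cong  : Congruent₂ _≈ᴹ_ _+ᴹ_)
    (+ᴹ-assoc : Associative _≈ᴹ_ _+ᴹ_)
    (+ᴹ-comm  : Commutative _≈ᴹ_ _+ᴹ_)
    (+ᴹ-idˡ   : LeftIdentity _≈ᴹ_ 0ᴹ _+ᴹ_)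
    (•-cong   : ∀ {c d u v} → c ≈ d → u ≈ᴹ v → (c • u) ≈ᴹ (d • v))
    (•-+ˡ     : ∀ c d u → ((c + d) • u) ≈ᴹ ((c • u) +ᴹ (d • u)))
    (•-+ʳ     : ∀ c u v → (c • (u +ᴹ v)) ≈ᴹ ((c • u) +ᴹ (c • v)))
    (•-assoc  : ∀ c d u → ((c * d) • u) ≈ᴹ (c • (d • u)))
    (•-one    : ∀ u → (1# • u) ≈ᴹ u)
    (•-zero   : ∀ u → (0# • u) ≈ᴹ 0ᴹ)
    where

    private
      S : Setoid 0ℓ 0ℓ
      S = record { isEquivalence = isEquivalence }

      open SetoidReasoning S
      open Consequences S
      module E = IsEquivalence isEquivalence

      •-zeroʳ : ∀ c → (c • 0ᴹ) ≈ᴹ 0ᴹ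
      •-zeroʳ c = begin
        c • 0ᴹ          ≈⟨ •-cong ≈-refl (•-zero 0ᴹ) ⟨
        c • (0# • 0ᴹ)   ≈⟨ •-assoc c 0# 0ᴹ ⟨
        (c * 0#) • 0ᴹ   ≈⟨ •-cong (zeroʳ c) E.refl ⟩
        0# • 0ᴹ         ≈⟨ •-zero 0ᴹ ⟩
        0ᴹ              ∎

      neg-inverseˡ : ∀ u → (((- 1#) • u) +ᴹ u) ≈ᴹ 0ᴹ
      neg-inverseˡ u = begin
        ((- 1#) • u) +ᴹ u         ≈⟨ +ᴹ-cong E.refl (•-one u) ⟨
        ((- 1#) • u) +ᴹ (1# • u)  ≈⟨ •-+ˡ (- 1#) 1# u ⟨
        (- 1# + 1#) • u         ≈⟨ •-cong (-‿inverseˡ 1#) E.refl ⟩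
        0# • u                  ≈⟨ •-zero u ⟩
        0ᴹ                      ∎

    mkModule : KModule
    mkModule = record
      { Carrierᴹ = M
      ; _≈ᴹ_ = _≈ᴹ_
      ; _+ᴹ_ = _+ᴹ_
      ; _*ₗ_ = _•_
      ; _*ᵣ_ = λ u c → c • u
      ; 0ᴹ   = 0ᴹ
      ; -ᴹ_  = λ u → (- 1#) • u
      ; isModule = IsModuleFromLeft.isModule {commutativeRing = K} record
        { isLeftModule = record
          { isLeftSemimodule = record
            { +ᴹ-isCommutativeMonoid = record
              { isMonoid = record
                { isSemigroup = record
                  { isMagma = record { isEquivalence = isEquivalence ; ∙-cong = +ᴹ-cong }
                  ; assoc = +ᴹ-assoc
                  }
                ; identity = comm∧idˡ⇒id +ᴹ-comm +ᴹ-idˡ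
                }
              ; comm = +ᴹ-comm
              }
            ; isPreleftSemimodule = record
              { *ₗ-cong      = •-cong
              ; *ₗ-zeroˡ     = •-zero
              ; *ₗ-distribʳ  = λ u c d → •-+ˡ c d u
              ; *ₗ-identityˡ = •-one
              ; *ₗ-assoc     = •-assoc
              ; *ₗ-zeroʳ     = •-zeroʳ
              ; *ₗ-distribˡ  = •-+ʳ
              }
            }
          ; -ᴹ‿cong    = •-cong ≈-refl
          ; -ᴹ‿inverse = comm∧invˡ⇒inv +ᴹ-comm neg-inverseˡ
          }
        }
      }

  module _ (V : KModule) where
    open Module V

    record Submodule : Set₁ where
      field
        _∈S   : Carrierᴹ → Set
        resp  : ∀ {u v} → u ≈ᴹ v → u ∈S → v ∈S
        0∈    : 0ᴹ ∈S
        +∈    : ∀ {u v} → u ∈S → v ∈S → (u +ᴹ v) ∈S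
        *∈    : ∀ c {u} → u ∈S → (c *ₗ u) ∈S

    -- V/S has the elements of V, with u equal to v when u - v lies in S.
    module _ (S : Submodule) where
      open Submodule S

      infix 4 _∼_

      _∼_ : Rel Carrierᴹ 0ℓ
      u ∼ v = (u +ᴹ -ᴹ v) ∈S

      private
        module G = AbelianGroupProperties +ᴹ-abelianGroup
        open CommutativeSemigroupProperties
          (CommutativeMonoid.commutativeSemigroup +ᴹ-commutativeMonoid)
          using (interchange)
        open SetoidReasoning ≈ᴹ-setoid

        *ₗ-neg : ∀ c u → c *ₗ (-ᴹ u) ≈ᴹ -ᴹ (c *ₗ u)
        *ₗ-neg c u = G.inverseˡ-unique _ _ (begin
          c *ₗ (-ᴹ u) +ᴹ c *ₗ u ≈⟨ *ₗ-distribˡ c (-ᴹ u) u ⟨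
          c *ₗ (-ᴹ u +ᴹ u)      ≈⟨ *ₗ-congˡ (-ᴹ‿inverseˡ u) ⟩
          c *ₗ 0ᴹ               ≈⟨ *ₗ-zeroʳ c ⟩
          0ᴹ                    ∎)

        neg-*ₗ : ∀ u → - 1# *ₗ u ≈ᴹ -ᴹ u
        neg-*ₗ u = G.inverseˡ-unique _ _ (begin
          - 1# *ₗ u +ᴹ u        ≈⟨ +ᴹ-congˡ (*ₗ-identityˡ u) ⟨
          - 1# *ₗ u +ᴹ 1# *ₗ u  ≈⟨ *ₗ-distribʳ u (- 1#) 1# ⟨
          (- 1# + 1#) *ₗ u      ≈⟨ *ₗ-congʳ (-‿inverseˡ 1#) ⟩
          0# *ₗ u               ≈⟨ *ₗ-zeroˡ u ⟩
          0ᴹ                    ∎)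

        telescope : ∀ u v w → (u +ᴹ -ᴹ v) +ᴹ (v +ᴹ -ᴹ w) ≈ᴹ u +ᴹ -ᴹ w
        telescope u v w = begin
          (u +ᴹ -ᴹ v) +ᴹ (v +ᴹ -ᴹ w) ≈⟨ +ᴹ-assoc u (-ᴹ v) _ ⟩
          u +ᴹ (-ᴹ v +ᴹ (v +ᴹ -ᴹ w)) ≈⟨ +ᴹ-congˡ (+ᴹ-assoc (-ᴹ v) v (-ᴹ w)) ⟨
          u +ᴹ ((-ᴹ v +ᴹ v) +ᴹ -ᴹ w) ≈⟨ +ᴹ-congˡ (+ᴹ-congʳ (-ᴹ‿inverseˡ v)) ⟩
          u +ᴹ (0ᴹ +ᴹ -ᴹ w)          ≈⟨ +ᴹ-congˡ (+ᴹ-identityˡ (-ᴹ w)) ⟩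
          u +ᴹ -ᴹ w                  ∎

        ≈⇒∼ : ∀ {u v} → u ≈ᴹ v → u ∼ v
        ≈⇒∼ {u} {v} u≈v =
          resp (≈ᴹ-sym (≈ᴹ-trans (+ᴹ-congʳ u≈v) (-ᴹ‿inverseʳ v))) 0∈

        ∼-sym : ∀ {u v} → u ∼ v → v ∼ u
        ∼-sym {u} {v} p = resp (begin
          - 1# *ₗ (u +ᴹ -ᴹ v)   ≈⟨ neg-*ₗ _ ⟩
          -ᴹ (u +ᴹ -ᴹ v)        ≈⟨ G.⁻¹-anti-homo‿- u v ⟩
          v +ᴹ -ᴹ u             ∎) (*∈ (- 1#) p)

        ∼-trans : ∀ {u v w} → u ∼ v → v ∼ w → u ∼ w
        ∼-trans {u} {v} {w} p q = resp (telescope u v w) (+∈ p q)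

        +-∼ : ∀ {u u′ v v′} → u ∼ u′ → v ∼ v′ → (u +ᴹ v) ∼ (u′ +ᴹ v′)
        +-∼ {u} {u′} {v} {v′} p q = resp (begin
          (u +ᴹ -ᴹ u′) +ᴹ (v +ᴹ -ᴹ v′) ≈⟨ interchange u (-ᴹ u′) v (-ᴹ v′) ⟩
          (u +ᴹ v) +ᴹ (-ᴹ u′ +ᴹ -ᴹ v′) ≈⟨ +ᴹ-congˡ (G.⁻¹-∙-comm u′ v′) ⟩
          (u +ᴹ v) +ᴹ -ᴹ (u′ +ᴹ v′)    ∎) (+∈ p q)

        *-∼ : ∀ {c d u v} → c ≈ d → u ∼ v → (c *ₗ u) ∼ (d *ₗ v)
        *-∼ {c} {d} {u} {v} c≈d p = ∼-trans {c *ₗ u} {c *ₗ v} {d *ₗ v}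
          (resp (begin
            c *ₗ (u +ᴹ -ᴹ v)      ≈⟨ *ₗ-distribˡ c u (-ᴹ v) ⟩
            c *ₗ u +ᴹ c *ₗ (-ᴹ v) ≈⟨ +ᴹ-congˡ (*ₗ-neg c v) ⟩
            c *ₗ u +ᴹ -ᴹ (c *ₗ v) ∎) (*∈ c p))
          (≈⇒∼ (*ₗ-congʳ c≈d))

      Quotient : KModule
      Quotient = mkModule {_≈ᴹ_ = _∼_} {_+ᴹ_} {0ᴹ} {_*ₗ_}
        (record { refl  = ≈⇒∼ ≈ᴹ-refl
                ; sym   = λ {u} {v} → ∼-sym {u} {v}
                ; trans = λ {u} {v} {w} → ∼-trans {u} {v} {w} })
        (λ {u} {u′} {v} {v′} → +-∼ {u} {u′} {v} {v′})
        (λ u v w → ≈⇒∼ (+ᴹ-assoc u v w))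
        (λ u v → ≈⇒∼ (+ᴹ-comm u v))
        (λ u → ≈⇒∼ (+ᴹ-identityˡ u))
        (λ {c} {d} {u} {v} → *-∼ {c} {d} {u} {v})
        (λ c d u → ≈⇒∼ (*ₗ-distribʳ u c d))
        (λ c u v → ≈⇒∼ (*ₗ-distribˡ c u v))
        (λ c d u → ≈⇒∼ (*ₗ-assoc c d u))
        (λ u → ≈⇒∼ (*ₗ-identityˡ u))
        (λ u → ≈⇒∼ (*ₗ-zeroˡ u))

      -- A linear endomorphism of V preserving S descends to V/S.
      quotient-linear : (f : Carrierᴹ → Carrierᴹ) → IsLinear V V f →
                        (∀ {u} → u ∈S → f u ∈S) → IsLinear Quotient Quotient f
      quotient-linear f f-linear f-S = mkLinear Quotient Quotient f
        (λ {u} {v} p → resp (≈ᴹ-trans (F.+ᴹ-homo u (-ᴹ v)) (+ᴹ-congˡ (F.-ᴹ-homo v))) (f-S p))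
        (λ u v → ≈⇒∼ (F.+ᴹ-homo u v))
        (λ c u → ≈⇒∼ (F.*ₗ-homo c u))
        where module F = ModuleMorphism.ModuleMorphisms.IsModuleHomomorphism f-linear

  -- Modules presented by generators and relations.

  infixl 6 _+̇_
  infixr 7 _•_

  data Combination (A : Set) : Set where
    gen  : A → Combination A
    0̇    : Combination A
    _+̇_  : Combination A → Combination A → Combination A
    _•_  : Carrier → Combination A → Combination A

  module _ {A : Set} (R : Rel (Combination A) 0ℓ) where

    infix 4 _≈ᴾ_

    data _≈ᴾ_ : Rel (Combination A) 0ℓ where
      rel      : ∀ {s t} → R s t → s ≈ᴾ t
      reflᴾ     : ∀ {s} → s ≈ᴾ s
      symᴾ      : ∀ {s t} → s ≈ᴾ t → t ≈ᴾ s
      transᴾ    : ∀ {s t u} → s ≈ᴾ t → t ≈ᴾ u → s ≈ᴾ u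
      +̇-cong   : ∀ {s s′ t t′} → s ≈ᴾ s′ → t ≈ᴾ t′ → s +̇ t ≈ᴾ s′ +̇ t′
      +̇-assoc  : ∀ s t u → (s +̇ t) +̇ u ≈ᴾ s +̇ (t +̇ u)
      +̇-comm   : ∀ s t → s +̇ t ≈ᴾ t +̇ s
      +̇-idˡ    : ∀ s → 0̇ +̇ s ≈ᴾ s
      •-cong   : ∀ {c d s t} → c ≈ d → s ≈ᴾ t → c • s ≈ᴾ d • t
      •-+ˡ     : ∀ c d s → (c + d) • s ≈ᴾ c • s +̇ d • s
      •-+ʳ     : ∀ c s t → c • (s +̇ t) ≈ᴾ c • s +̇ c • t
      •-assoc  : ∀ c d s → (c * d) • s ≈ᴾ c • d • s
      •-one    : ∀ s → 1# • s ≈ᴾ s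
      •-zero   : ∀ s → 0# • s ≈ᴾ 0̇

    Presented : KModule
    Presented = mkModule (record { refl = reflᴾ ; sym = symᴾ ; trans = transᴾ })
      +̇-cong +̇-assoc +̇-comm +̇-idˡ •-cong •-+ˡ •-+ʳ •-assoc •-one •-zero

  extend : {A B : Set} → (A → Combination B) → Combination A → Combination B
  extend f (gen a) = f a
  extend f 0̇       = 0̇
  extend f (s +̇ t) = extend f s +̇ extend f t
  extend f (c • s) = c • extend f s

  extend-linear : {A B : Set} (R : Rel (Combination A) 0ℓ) (S : Rel (Combination B) 0ℓ)
    (f : A → Combination B) →
    (∀ {s t} → R s t → _≈ᴾ_ S (extend f s) (extend f t)) →
    IsLinear (Presented R) (Presented S) (extend f)
  extend-linear R S f f-rel =
    mkLinear (Presented R) (Presented S) (extend f) ext-cong (λ _ _ → reflᴾ) (λ _ _ → reflᴾ)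
    where
    ext-cong : ∀ {s t} → _≈ᴾ_ R s t → _≈ᴾ_ S (extend f s) (extend f t)
    ext-cong (rel p)         = f-rel p
    ext-cong reflᴾ            = reflᴾ
    ext-cong (symᴾ p)         = symᴾ (ext-cong p)
    ext-cong (transᴾ p q)     = transᴾ (ext-cong p) (ext-cong q)
    ext-cong (+̇-cong p q)    = +̇-cong (ext-cong p) (ext-cong q)
    ext-cong (+̇-assoc s t u) = +̇-assoc _ _ _
    ext-cong (+̇-comm s t)    = +̇-comm _ _
    ext-cong (+̇-idˡ s)       = +̇-idˡ _
    ext-cong (•-cong e p)    = •-cong e (ext-cong p)
    ext-cong (•-+ˡ c d s)    = •-+ˡ c d _
    ext-cong (•-+ʳ c s t)    = •-+ʳ c _ _
    ext-cong (•-assoc c d s) = •-assoc c d _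
    ext-cong (•-one s)       = •-one _
    ext-cong (•-zero s)      = •-zero _

  -- The vector space with basis A.
  Free : Set → KModule
  Free A = Presented {A} λ _ _ → ⊥

  module _ (V W : KModule) where
    private
      module V = Module V
      module W = Module W

    data Bilinear : Rel (Combination (V.Carrierᴹ × W.Carrierᴹ)) 0ℓ where
      ⊗-cong : ∀ {v v′ w w′} → v V.≈ᴹ v′ → w W.≈ᴹ w′ → Bilinear (gen (v , w)) (gen (v′ , w′))
      +-⊗    : ∀ v v′ w → Bilinear (gen (v V.+ᴹ v′ , w)) (gen (v , w) +̇ gen (v′ , w))
      ⊗-+    : ∀ v w w′ → Bilinear (gen (v , w W.+ᴹ w′)) (gen (v , w) +̇ gen (v , w′))
      *-⊗    : ∀ c v w → Bilinear (gen (c V.*ₗ v , w)) (c • gen (v , w))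
      ⊗-*    : ∀ c v w → Bilinear (gen (v , c W.*ₗ w)) (c • gen (v , w))

    Tensor : KModule
    Tensor = Presented Bilinear

  -- The representations built below are homomorphic in the group element; this
  -- law is not recorded since isomorphism of G-modules does not refer to it.
  record Rep (G : Set) : Set₁ where
    field
      space  : KModule
      ρ      : G → Module.Carrierᴹ space → Module.Carrierᴹ space
      linear : ∀ g → IsLinear space space (ρ g)

    open Module space public

  infixl 7 _⊗_
  infix  4 _≅_

  _⊗_ : ∀ {G} → Rep G → Rep G → Rep G
  V ⊗ W = record
    { space  = Tensor V.space W.space
    ; ρ      = λ g → extend (λ (v , w) → gen (V.ρ g v , W.ρ g w))
    ; linear = λ g → extend-linear _ _ _ (respects g)
    }
    where
    module V = Rep V
    module W = Rep W
    respects : ∀ g {s t} → Bilinear V.space W.space s t →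
               _≈ᴾ_ (Bilinear V.space W.space)
                 (extend (λ (v , w) → gen (V.ρ g v , W.ρ g w)) s)
                 (extend (λ (v , w) → gen (V.ρ g v , W.ρ g w)) t)
    respects g b = go b
      where
      open ModuleMorphism.ModuleMorphisms.IsModuleHomomorphism
      lV = V.linear g
      lW = W.linear g
      go : ∀ {s t} → Bilinear V.space W.space s t →
           _≈ᴾ_ (Bilinear V.space W.space)
             (extend (λ (v , w) → gen (V.ρ g v , W.ρ g w)) s)
             (extend (λ (v , w) → gen (V.ρ g v , W.ρ g w)) t)
      go (⊗-cong p q)  = rel (⊗-cong (⟦⟧-cong lV p) (⟦⟧-cong lW q))
      go (+-⊗ v v′ w)  = transᴾ (rel (⊗-cong (+ᴹ-homo lV v v′) W.≈ᴹ-refl)) (rel (+-⊗ _ _ _))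
      go (⊗-+ v w w′)  = transᴾ (rel (⊗-cong V.≈ᴹ-refl (+ᴹ-homo lW w w′))) (rel (⊗-+ _ _ _))
      go (*-⊗ c v w)   = transᴾ (rel (⊗-cong (*ₗ-homo lV c v) W.≈ᴹ-refl)) (rel (*-⊗ _ _ _))
      go (⊗-* c v w)   = transᴾ (rel (⊗-cong V.≈ᴹ-refl (*ₗ-homo lW c w))) (rel (⊗-* _ _ _))

  record _≅_ {G : Set} (V W : Rep G) : Set where
    private
      module V = Rep V
      module W = Rep W
    field
      to            : V.Carrierᴹ → W.Carrierᴹ
      isIsomorphism : IsLinearIsomorphism V.space W.space to
      equivariant   : ∀ g v → to (V.ρ g v) W.≈ᴹ W.ρ g (to v)

  -- The one-dimensional representation in which g acts by the scalar χ g.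
  character : ∀ {G} → (G → Carrier) → Rep G
  character χ = record
    { space  = TensorUnit.⟨module⟩ {R = K}
    ; ρ      = λ g c → χ g * c
    ; linear = λ g → mkLinear TensorUnit.⟨module⟩ TensorUnit.⟨module⟩ _ *-congˡ
        (distribˡ (χ g))
        (λ c d → x∙yz≈y∙xz (χ g) c d)
    }
    where open CommutativeSemigroupProperties *-commutativeSemigroup

------------------------------------------------------------------------
-- Superspace coinvariants and r-ified ordered set partitions

-- The element (c , w) stands for the monomial matrix diag(ζ^c₁,…,ζ^cₙ) · P_w,
-- where P_w sends the basis vector e_j to e_{w(j)}.
record ℤ_≀𝔖_ (r n : ℕ) : Set where
  constructor _⋉_
  field
    colour : Fin n → Fin r
    perm   : Permutation′ n

open ℤ_≀𝔖_ public

-- An r-ified ordered set partition with k nonzero blocks is given by placing each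
-- element of [n] either in the zero block, with a colour below r - 1, or in one of
-- the blocks B₁,…,B_k, with a colour below r.
Place : ℕ → ℕ → Set
Place r k = Fin (r ℕ.∸ 1) ⊎ (Fin k × Fin r)

NoEmptyBlock : ∀ {n r k} → Vec (Place r k) n → Set
NoEmptyBlock {n} {r} {k} place =
  ∀ (j : Fin k) → ∃ λ (i : Fin n) → ∃ λ (c : Fin r) → lookup place i ≡ inj₂ (j , c)

-- Nonemptiness is irrelevant so that _≡_ compares only the number of blocks and
-- the places of the elements.
record OP̃ (n r : ℕ) : Set where
  constructor mkOP̃
  field
    blocks    : ℕ
    place     : Vec (Place r blocks) n
    .nonempty : NoEmptyBlock place

-- w replaces each a by w(a): the new place of b is the old place of w⁻¹(b).
permute : ∀ {n r} → Permutation′ n → OP̃ n r → OP̃ n r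
permute {n} {r} w (mkOP̃ m place nonempty) = mkOP̃ m place′ (nonempty′ nonempty)
  where
  place′ : Vec (Place r m) n
  place′ = tabulate λ b → lookup place (w ⟨$⟩ˡ b)

  nonempty′ : NoEmptyBlock place → NoEmptyBlock place′
  nonempty′ ne j = let i , c , eq = ne j in (w ⟨$⟩ʳ i) , c ,
    trans (lookup∘tabulate _ (w ⟨$⟩ʳ i)) (trans (cong (lookup place) (inverseˡ w)) eq)

module _ {r : ℕ} .{{_ : NonZero r}} where

  recolourPlace : ∀ {m} → Fin r → Place r m → Place r m
  recolourPlace c (inj₁ k)       = inj₁ k
  recolourPlace c (inj₂ (j , k)) = inj₂ (j , (toℕ k ℕ.+ toℕ c) mod r)

  recolour : ∀ {n} → (Fin n → Fin r) → OP̃ n r → OP̃ n r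
  recolour {n} c (mkOP̃ m place nonempty) = mkOP̃ m place′ (nonempty′ nonempty)
    where
    place′ : Vec (Place r m) n
    place′ = tabulate λ i → recolourPlace (c i) (lookup place i)

    nonempty′ : NoEmptyBlock place → NoEmptyBlock place′
    nonempty′ ne j = let i , k , eq = ne j in i , _ ,
      trans (lookup∘tabulate _ i) (cong (recolourPlace (c i)) eq)

module Superspace (K : CommutativeRing 0ℓ 0ℓ) (n r : ℕ) .{{_ : NonZero r}}
  (ζ : CommutativeRing.Carrier K) where

  open CommutativeRing K hiding (zero; refl; sym; trans)
  open RawSemiringOps (Semiring.rawSemiring semiring) using (_^_; sum; product)
  open Representations K

  Matrix : ℕ → Set
  Matrix m = Fin m → Fin m → Carrier

  -- Laplace expansion along the first row.
  determinant : ∀ {m} → Matrix m → Carrier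
  determinant {zero}  A = 1#
  determinant {suc m} A = sum λ j →
    (- 1#) ^ toℕ j * (A zero j * determinant (λ i k → A (suc i) (punchIn j k)))

  matrix : ℤ r ≀𝔖 n → Matrix n
  matrix (c ⋉ w) i j = if does (i Fin.≟ (w ⟨$⟩ʳ j)) then ζ ^ toℕ (c i) else 0#

  det : Rep (ℤ r ≀𝔖 n)
  det = character λ g → determinant (matrix g)

  infix  4 _≈Ω_
  infixl 6 _∔_
  infixl 7 _∙_

  data Ω : Set where
    κ   : Carrier → Ω
    x θ : Fin n → Ω
    _∔_ : Ω → Ω → Ω
    _∙_ : Ω → Ω → Ω

  data _≈Ω_ : Rel Ω 0ℓ where
    reflΩ      : ∀ {f} → f ≈Ω f
    symΩ       : ∀ {f g} → f ≈Ω g → g ≈Ω f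
    transΩ     : ∀ {f g h} → f ≈Ω g → g ≈Ω h → f ≈Ω h

    ∔-cong    : ∀ {f f′ g g′} → f ≈Ω f′ → g ≈Ω g′ → f ∔ g ≈Ω f′ ∔ g′
    ∔-assoc   : ∀ f g h → (f ∔ g) ∔ h ≈Ω f ∔ (g ∔ h)
    ∔-comm    : ∀ f g → f ∔ g ≈Ω g ∔ f
    ∔-idˡ     : ∀ f → κ 0# ∔ f ≈Ω f

    ∙-cong    : ∀ {f f′ g g′} → f ≈Ω f′ → g ≈Ω g′ → f ∙ g ≈Ω f′ ∙ g′
    ∙-assoc   : ∀ f g h → (f ∙ g) ∙ h ≈Ω f ∙ (g ∙ h)
    ∙-idˡ     : ∀ f → κ 1# ∙ f ≈Ω f
    ∙-zeroˡ   : ∀ f → κ 0# ∙ f ≈Ω κ 0#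
    ∙-distribˡ  : ∀ f g h → f ∙ (g ∔ h) ≈Ω f ∙ g ∔ f ∙ h
    ∙-distribʳ  : ∀ f g h → (g ∔ h) ∙ f ≈Ω g ∙ f ∔ h ∙ f

    κ-cong    : ∀ {c d} → c ≈ d → κ c ≈Ω κ d
    κ-+       : ∀ c d → κ (c + d) ≈Ω κ c ∔ κ d
    κ-*       : ∀ c d → κ (c * d) ≈Ω κ c ∙ κ d
    κ-central : ∀ c f → κ c ∙ f ≈Ω f ∙ κ c

    xx-comm   : ∀ i j → x i ∙ x j ≈Ω x j ∙ x i
    xθ-comm   : ∀ i j → x i ∙ θ j ≈Ω θ j ∙ x i
    θθ-anti   : ∀ i j → θ i ∙ θ j ≈Ω κ (- 1#) ∙ (θ j ∙ θ i)

  Ω-module : KModule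
  Ω-module = mkModule {_≈ᴹ_ = _≈Ω_} {_∔_} {κ 0#} {λ c f → κ c ∙ f}
    (record { refl = reflΩ ; sym = symΩ ; trans = transΩ })
    ∔-cong ∔-assoc ∔-comm ∔-idˡ
    (λ e p → ∙-cong (κ-cong e) p)
    (λ c d f → transΩ (∙-cong (κ-+ c d) reflΩ) (∙-distribʳ f (κ c) (κ d)))
    (λ c → ∙-distribˡ (κ c))
    (λ c d f → transΩ (∙-cong (κ-* c d) reflΩ) (∙-assoc (κ c) (κ d) f))
    ∙-idˡ
    ∙-zeroˡ

  Ω-setoid : Setoid 0ℓ 0ℓ
  Ω-setoid = Module.≈ᴹ-setoid Ω-module

  constantTerm : Ω → Carrier
  constantTerm (κ c)   = c
  constantTerm (x i)   = 0#
  constantTerm (θ i)   = 0#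
  constantTerm (f ∔ g) = constantTerm f + constantTerm g
  constantTerm (f ∙ g) = constantTerm f * constantTerm g

  substitute : (X Θ : Fin n → Ω) → Ω → Ω
  substitute X Θ (κ c)   = κ c
  substitute X Θ (x i)   = X i
  substitute X Θ (θ i)   = Θ i
  substitute X Θ (f ∔ g) = substitute X Θ f ∔ substitute X Θ g
  substitute X Θ (f ∙ g) = substitute X Θ f ∙ substitute X Θ g

  -- Since ζ ^ r = 1 the exponent r - c represents -c.
  ζ⁻ : Fin r → Carrier
  ζ⁻ c = ζ ^ (r ℕ.∸ toℕ c)

  diagAct : (Fin n → Fin r) → Ω → Ω
  diagAct c = substitute (λ i → κ (ζ⁻ (c i)) ∙ x i) (λ i → κ (ζ⁻ (c i)) ∙ θ i)

  permAct : Permutation′ n → Ω → Ω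
  permAct w = substitute (λ i → x (w ⟨$⟩ʳ i)) (λ i → θ (w ⟨$⟩ʳ i))

  act : ℤ r ≀𝔖 n → Ω → Ω
  act (c ⋉ w) f = diagAct c (permAct w f)

  private
    module _ (X Θ : Fin n → Ω)
      (XX : ∀ i j → X i ∙ X j ≈Ω X j ∙ X i)
      (XΘ : ∀ i j → X i ∙ Θ j ≈Ω Θ j ∙ X i)
      (ΘΘ : ∀ i j → Θ i ∙ Θ j ≈Ω κ (- 1#) ∙ (Θ j ∙ Θ i)) where

      substitute-cong : ∀ {f g} → f ≈Ω g → substitute X Θ f ≈Ω substitute X Θ g
      substitute-cong reflΩ             = reflΩ
      substitute-cong (symΩ p)          = symΩ (substitute-cong p)
      substitute-cong (transΩ p q)      = transΩ (substitute-cong p) (substitute-cong q)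
      substitute-cong (∔-cong p q)     = ∔-cong (substitute-cong p) (substitute-cong q)
      substitute-cong (∔-assoc f g h)  = ∔-assoc _ _ _
      substitute-cong (∔-comm f g)     = ∔-comm _ _
      substitute-cong (∔-idˡ f)        = ∔-idˡ _
      substitute-cong (∙-cong p q)     = ∙-cong (substitute-cong p) (substitute-cong q)
      substitute-cong (∙-assoc f g h)  = ∙-assoc _ _ _
      substitute-cong (∙-idˡ f)        = ∙-idˡ _
      substitute-cong (∙-zeroˡ f)      = ∙-zeroˡ _
      substitute-cong (∙-distribˡ f g h) = ∙-distribˡ _ _ _
      substitute-cong (∙-distribʳ f g h) = ∙-distribʳ _ _ _
      substitute-cong (κ-cong e)       = κ-cong e
      substitute-cong (κ-+ c d)        = κ-+ c d
      substitute-cong (κ-* c d)        = κ-* c d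
      substitute-cong (κ-central c f)  = κ-central c _
      substitute-cong (xx-comm i j)    = XX i j
      substitute-cong (xθ-comm i j)    = XΘ i j
      substitute-cong (θθ-anti i j)    = ΘΘ i j

    scalars-out : ∀ a b f g → (κ a ∙ f) ∙ (κ b ∙ g) ≈Ω κ (a * b) ∙ (f ∙ g)
    scalars-out a b f g = begin
      (κ a ∙ f) ∙ (κ b ∙ g)   ≈⟨ ∙-assoc (κ a) f _ ⟩
      κ a ∙ (f ∙ (κ b ∙ g))   ≈⟨ ∙-cong reflΩ (∙-assoc f (κ b) g) ⟨
      κ a ∙ ((f ∙ κ b) ∙ g)   ≈⟨ ∙-cong reflΩ (∙-cong (κ-central b f) reflΩ) ⟨
      κ a ∙ ((κ b ∙ f) ∙ g)   ≈⟨ ∙-cong reflΩ (∙-assoc (κ b) f g) ⟩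
      κ a ∙ (κ b ∙ (f ∙ g))   ≈⟨ ∙-assoc (κ a) (κ b) _ ⟨
      (κ a ∙ κ b) ∙ (f ∙ g)   ≈⟨ ∙-cong (κ-* a b) reflΩ ⟨
      κ (a * b) ∙ (f ∙ g)     ∎
      where open SetoidReasoning Ω-setoid

    scaled-comm : ∀ a b {f g} → f ∙ g ≈Ω g ∙ f → (κ a ∙ f) ∙ (κ b ∙ g) ≈Ω (κ b ∙ g) ∙ (κ a ∙ f)
    scaled-comm a b {f} {g} p = begin
      (κ a ∙ f) ∙ (κ b ∙ g)   ≈⟨ scalars-out a b f g ⟩
      κ (a * b) ∙ (f ∙ g)     ≈⟨ ∙-cong (κ-cong (*-comm a b)) p ⟩
      κ (b * a) ∙ (g ∙ f)     ≈⟨ scalars-out b a g f ⟨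
      (κ b ∙ g) ∙ (κ a ∙ f)   ∎
      where open SetoidReasoning Ω-setoid

    scaled-anti : ∀ a b {f g} → f ∙ g ≈Ω κ (- 1#) ∙ (g ∙ f) →
                  (κ a ∙ f) ∙ (κ b ∙ g) ≈Ω κ (- 1#) ∙ ((κ b ∙ g) ∙ (κ a ∙ f))
    scaled-anti a b {f} {g} p = begin
      (κ a ∙ f) ∙ (κ b ∙ g)               ≈⟨ scalars-out a b f g ⟩
      κ (a * b) ∙ (f ∙ g)                 ≈⟨ ∙-cong (κ-cong (*-comm a b)) p ⟩
      κ (b * a) ∙ (κ (- 1#) ∙ (g ∙ f))    ≈⟨ ∙-assoc _ _ _ ⟨
      (κ (b * a) ∙ κ (- 1#)) ∙ (g ∙ f)    ≈⟨ ∙-cong (κ-central _ _) reflΩ ⟩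
      (κ (- 1#) ∙ κ (b * a)) ∙ (g ∙ f)    ≈⟨ ∙-assoc _ _ _ ⟩
      κ (- 1#) ∙ (κ (b * a) ∙ (g ∙ f))    ≈⟨ ∙-cong reflΩ (scalars-out b a g f) ⟨
      κ (- 1#) ∙ ((κ b ∙ g) ∙ (κ a ∙ f))  ∎
      where open SetoidReasoning Ω-setoid

  act-cong : ∀ g {f h} → f ≈Ω h → act g f ≈Ω act g h
  act-cong (c ⋉ w) p =
    substitute-cong _ _
      (λ i j → scaled-comm _ _ (xx-comm i j))
      (λ i j → scaled-comm _ _ (xθ-comm i j))
      (λ i j → scaled-anti _ _ (θθ-anti i j))
      (substitute-cong _ _
        (λ i j → xx-comm _ _) (λ i j → xθ-comm _ _) (λ i j → θθ-anti _ _) p)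

  act-linear : ∀ g → IsLinear Ω-module Ω-module (act g)
  act-linear g = mkLinear Ω-module Ω-module (act g) (act-cong g) (λ _ _ → reflΩ) (λ _ _ → reflΩ)

  Invariant : Ω → Set
  Invariant f = ∀ g → act g f ≈Ω f

  data SI : Ω → Set where
    invariant : ∀ {f} → Invariant f → constantTerm f ≈ 0# → SI f
    resp      : ∀ {f g} → f ≈Ω g → SI f → SI g
    zero      : SI (κ 0#)
    add       : ∀ {f g} → SI f → SI g → SI (f ∔ g)
    mulˡ      : ∀ h {f} → SI f → SI (h ∙ f)
    mulʳ      : ∀ h {f} → SI f → SI (f ∙ h)

  act-SI : ∀ g {f} → SI f → SI (act g f)
  act-SI g (invariant p e) = resp (symΩ (p g)) (invariant p e)
  act-SI g (resp p s)      = resp (act-cong g p) (act-SI g s)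
  act-SI g zero            = zero
  act-SI g (add s t)       = add (act-SI g s) (act-SI g t)
  act-SI g (mulˡ h s)      = mulˡ (act g h) (act-SI g s)
  act-SI g (mulʳ h s)      = mulʳ (act g h) (act-SI g s)

  SI-submodule : Submodule Ω-module
  SI-submodule = record
    { _∈S = SI ; resp = resp ; 0∈ = zero ; +∈ = add ; *∈ = λ c → mulˡ (κ c) }

  SR : Rep (ℤ r ≀𝔖 n)
  SR = record
    { space  = Quotient Ω-module SI-submodule
    ; ρ      = act
    ; linear = λ g →
        quotient-linear Ω-module SI-submodule (act g) (act-linear g) (act-SI g)
    }

  -- The factor contributed by an element of the given place on which diag(ζ^c) acts.
  weight : ∀ {m} → Fin r → Place r m → Carrier
  weight c (inj₁ k) = ζ ^ (toℕ k ℕ.* toℕ c)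
  weight c (inj₂ _) = 1#

  scalar : (Fin n → Fin r) → OP̃ n r → Carrier
  scalar c σ = product λ i → weight (c i) (lookup (OP̃.place σ) i)

  diagActOP : (Fin n → Fin r) → Combination (OP̃ n r) → Combination (OP̃ n r)
  diagActOP c = extend λ σ → scalar c σ • gen (recolour c σ)

  permActOP : Permutation′ n → Combination (OP̃ n r) → Combination (OP̃ n r)
  permActOP w = extend λ σ → gen (permute w σ)

  K[OP̃] : Rep (ℤ r ≀𝔖 n)
  K[OP̃] = record
    { space  = Free (OP̃ n r)
    ; ρ      = λ (c ⋉ w) s → diagActOP c (permActOP w s)
    ; linear = λ (c ⋉ w) → Composition.isModuleHomomorphism
        (Module.≈ᴹ-trans (Free (OP̃ n r)))
        (extend-linear (λ _ _ → ⊥) (λ _ _ → ⊥) _ λ ())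
        (extend-linear (λ _ _ → ⊥) (λ _ _ → ⊥) _ λ ())
    }

-- exp(2πi/r) is one such ζ in ℂ; no particular primitive root is singled out.
IsPrimitiveRoot : (K : CommutativeRing 0ℓ 0ℓ) → ℕ → CommutativeRing.Carrier K → Set
IsPrimitiveRoot K r ζ = ζ ^ r ≈ 1# × (∀ k → 0 ℕ.< k → k ℕ.< r → ¬ (ζ ^ k ≈ 1#))
  where
  open CommutativeRing K
  open RawSemiringOps (Semiring.rawSemiring semiring) using (_^_)

-- Put yᵢ = xᵢʳ and dyᵢ = xᵢʳ⁻¹θᵢ. A partition σ with nonzero blocks B₁ | ⋯ | B_q gives the functional taking f to
-- the coefficient of θ₁⋯θₙ in dy_{B_q}⋯dy_{B₁} f, where dy_B = Σ_{i∈B} dyᵢ, at a point whose coordinates are constant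
-- up to roots of unity on the blocks (on Z a coefficient in the xᵢ is extracted instead). The values on the blocks
-- are chosen such that their elementary symmetric polynomials weighted by the block sizes depend on q only; hence
-- the invariants Σ yᵢᵃ⁺¹ and Σ yᵢᵃdyᵢ lower the filtration by degree. Modulo these invariants Ω is spanned by elements
-- s_c indexed by the partitions (straightening), while interpolation and a Fourier transform in the colours show
-- that the functionals separate the partitions. So both are bases, and an average over the group of the leading
-- parts of the functionals is equivariant up to det, with kernel the ideal generated by these invariants. Colour
-- changes and transpositions force all invariants without constant term into that kernel.
module Submission where

open import Algebra.Bundles using (CommutativeRing)
open import Data.Nat.Base using (ℕ; NonZero)
open import Defs
open import Algebra.Bundles using (CommutativeMonoid; RawRing; Semiring)
import Algebra.Definitions.RawSemiring as RawSemiringOps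
open import Algebra.Module.Bundles using (Module)
open import Algebra.Module.Morphism.Structures using (module ModuleMorphisms)
open ModuleMorphisms using (module IsModuleHomomorphism)
import Algebra.Properties.AbelianGroup as AbelianGroupProperties
import Algebra.Properties.CommutativeMonoid.Sum as MonoidSum
import Algebra.Properties.CommutativeSemiring.Exp as CExp
import Algebra.Properties.CommutativeSemigroup as CommutativeSemigroupProperties
import Algebra.Properties.Ring as RingProperties
import Algebra.Properties.Semiring.Exp as Exp
import Algebra.Properties.Semiring.Mult as Mult
import Algebra.Properties.Semiring.Sum as SemiringSum
import Algebra.Solver.Ring as RingSolver
import Algebra.Solver.Ring.AlmostCommutativeRing as ACR
import Algebra.Solver.Ring.NaturalCoefficients.Default as SemiringSolver
open import Data.Bool.Base using (Bool; true; false; if_then_else_)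
open import Data.Fin.Base using (Fin; zero; suc; toℕ; fromℕ<; punchIn; punchOut)
open import Data.Fin.Permutation as Perm
  using (Permutation; Permutation′; _⟨$⟩ʳ_; _⟨$⟩ˡ_; flip; _∘ₚ_; permutation)
import Data.Fin.Properties as Fin
import Data.Integer.Base as ℤ
import Data.Integer.Properties as ℤ
open import Data.List.Base as List
  using (List; []; _∷_; _++_; map; take; length; allFin; concatMap; cartesianProductWith; deduplicate)
open import Data.List.Membership.Propositional using () renaming (_∈_ to _∈ˡ_)
import Data.List.Membership.Propositional.Properties as ∈
import Data.List.Properties as List
open import Data.List.Relation.Unary.All as All using (All; []; _∷_)
open import Data.List.Relation.Unary.AllPairs using ([]; _∷_)
open import Data.List.Relation.Unary.Any as Any using (Any; here; there)
import Data.List.Relation.Unary.Any.Properties as Any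
open import Data.List.Relation.Unary.Unique.DecPropositional.Properties using (deduplicate-!)
open import Data.List.Relation.Unary.Unique.Propositional using (Unique)
open import Data.Maybe.Base using (Maybe; just; nothing)
import Data.Maybe.Properties as Maybe
open import Data.Nat.Base as ℕ using (zero; suc; _/_; _%_; _∸_; s≤s; z≤n)
import Data.Nat.DivMod as ℕ
import Data.Nat.Divisibility as ℕ
open import Data.Nat.Induction using (<-rec)
import Data.Nat.Properties as ℕ
open import Data.Nat.Solver using (module +-*-Solver)
open import Data.Product.Base using (∃; _×_; _,_; proj₁; proj₂)
import Data.Product.Properties as Product
open import Data.Rational.Base as ℚ using (ℚ; 0ℚ; 1ℚ)
import Data.Rational.Properties as ℚ
import Data.Rational.Unnormalised.Base as ℚᵘ
import Data.Rational.Unnormalised.Properties as ℚᵘ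
open import Data.Sum.Base as Sum using (_⊎_; inj₁; inj₂)
import Data.Sum.Properties as Sum
open import Data.Unit.Base using (⊤; tt)
open import Data.Vec.Base as Vec using (Vec; []; _∷_; replicate; lookup; tabulate; insertAt; updateAt)
import Data.Vec.Properties as Vec
open import Function.Base using (_∘_; id)
open import Level using (0ℓ)
open import Relation.Binary.Definitions using (DecidableEquality; Tri; tri<; tri≈; tri>)
open import Relation.Binary.PropositionalEquality.Core using (_≡_; _≢_)
import Relation.Binary.PropositionalEquality.Core as ≡
import Relation.Binary.Reasoning.Setoid as SetoidReasoning
open import Relation.Nullary.Decidable.Core using (Dec; does; yes; no; recompute; toWitness; _→-dec_; _×-dec_; ¬?)
open import Relation.Nullary.Negation.Core using (¬_; contradiction)

-- Equality of complex numbers is undecidable, so neither dimension counts nor case distinctions on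
-- zero are available. Invertibility is exhibited throughout, and the field property in use is that
-- of two numbers with sum 1 one is invertible. Instead of comparing dimensions, the square matrix
-- of the values of the functionals on the spanning elements is inverted. The power sums Σ |B| Y_B^a
-- over all a, for distinct nonzero Y_B, would determine the block sizes, so they cannot depend on q
-- alone. The weighted elementary polynomials can: only those of degree 1 to q are nontrivial, one
-- equation for each unknown. Newton's identities recover the power sums from them, with elementary
-- symmetric polynomials of Y as coefficients. These act as elements of Ω: a monomial seen by a
-- functional lacks its θ on a transversal of the blocks, where the yᵢ take the values Y. The
-- equations are solved by contraction for coordinates of different orders of magnitude, where they
-- nearly decouple. The function on partitions given by an invariant is determined by its value at
-- the singletons, so modulo the kernel every invariant is a constant.

private variable k n q r′ : ℕ

private module ℕΣ = MonoidSum ℕ.+-0-commutativeMonoid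

-- Commutative ring solver with subtraction

-- The coefficients are formal differences of naturals.
module Solver (K : CommutativeRing 0ℓ 0ℓ) where
  open CommutativeRing K
  open RingProperties ring
  open Mult semiring using (×-homo-+; ×1-homo-*) renaming (_×_ to _·_)
  open SetoidReasoning setoid

  private
    module S = SemiringSolver commutativeSemiring

    normalise : ℕ × ℕ → ℕ × ℕ
    normalise (suc a , suc b) = normalise (a , b)
    normalise c = c

    _+̂_ _*̂_ : ℕ × ℕ → ℕ × ℕ → ℕ × ℕ
    (a , b) +̂ (c , d) = a ℕ.+ c , b ℕ.+ d
    (a , b) *̂ (c , d) = a ℕ.* c ℕ.+ b ℕ.* d , a ℕ.* d ℕ.+ b ℕ.* c

    Diff : RawRing 0ℓ 0ℓ
    Diff = record
      { Carrier = ℕ × ℕ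
      ; _≈_ = _≡_
      ; _+_ = λ c d → normalise (c +̂ d)
      ; _*_ = λ c d → normalise (c *̂ d)
      ; -_ = λ (a , b) → b , a
      ; 0# = 0 , 0
      ; 1# = 1 , 0
      }

    val : ℕ × ℕ → Carrier
    val (a , b) = a · 1# + - 1# * (b · 1#)

    ⟦_⟧ : ℕ × ℕ → Carrier
    ⟦ 0 , 0 ⟧ = 0#
    ⟦ 1 , 0 ⟧ = 1#
    ⟦ c ⟧ = val c

    ⟦⟧≈val : ∀ c → ⟦ c ⟧ ≈ val c
    ⟦⟧≈val (0 , 0) = S.solve 1 (λ n → S.con 0 S.:= S.con 0 S.:+ n S.:* S.con 0) refl (- 1#)
    ⟦⟧≈val (1 , 0) = S.solve 1 (λ n → S.con 1 S.:= (S.con 1 S.:+ S.con 0) S.:+ n S.:* S.con 0) refl (- 1#)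
    ⟦⟧≈val (0 , suc b) = refl
    ⟦⟧≈val (1 , suc b) = refl
    ⟦⟧≈val (suc (suc a) , b) = refl

    -1²≈1 : - 1# * - 1# ≈ 1#
    -1²≈1 = begin
      - 1# * - 1# ≈⟨ -1*x≈-x (- 1#) ⟩
      - (- 1#) ≈⟨ -‿involutive 1# ⟩
      1# ∎

    val-+ : ∀ c d → val (c +̂ d) ≈ val c + val d
    val-+ (a , b) (c , d) = begin
      (a ℕ.+ c) · 1# + - 1# * ((b ℕ.+ d) · 1#) ≈⟨ +-cong (×-homo-+ 1# a c) (*-congˡ (×-homo-+ 1# b d)) ⟩
      (a · 1# + c · 1#) + - 1# * (b · 1# + d · 1#)
        ≈⟨ S.solve 5 (λ n a b c d → (a S.:+ c) S.:+ n S.:* (b S.:+ d) S.:= (a S.:+ n S.:* b) S.:+ (c S.:+ n S.:* d))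
             refl (- 1#) _ _ _ _ ⟩
      val (a , b) + val (c , d) ∎

    val-* : ∀ c d → val (c *̂ d) ≈ val c * val d
    val-* (a , b) (c , d) = begin
      (a ℕ.* c ℕ.+ b ℕ.* d) · 1# + - 1# * ((a ℕ.* d ℕ.+ b ℕ.* c) · 1#) ≈⟨ +-cong (hom a c b d) (*-congˡ (hom a d b c)) ⟩
      (A * C + B * D) + - 1# * (A * D + B * C) ≈⟨ +-congʳ (+-congˡ (trans (sym (*-identityˡ _)) (*-congʳ (sym -1²≈1)))) ⟩
      (A * C + (- 1# * - 1#) * (B * D)) + - 1# * (A * D + B * C)
        ≈⟨ S.solve 5 (λ n a b c d → (a S.:* c S.:+ (n S.:* n) S.:* (b S.:* d)) S.:+ n S.:* (a S.:* d S.:+ b S.:* c)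
             S.:= (a S.:+ n S.:* b) S.:* (c S.:+ n S.:* d)) refl (- 1#) A B C D ⟩
      val (a , b) * val (c , d) ∎ where
      A = a · 1#
      B = b · 1#
      C = c · 1#
      D = d · 1#
      hom : ∀ a c b d → (a ℕ.* c ℕ.+ b ℕ.* d) · 1# ≈ (a · 1#) * (c · 1#) + (b · 1#) * (d · 1#)
      hom a c b d = trans (×-homo-+ 1# (a ℕ.* c) (b ℕ.* d)) (+-cong (×1-homo-* a c) (×1-homo-* b d))

    val-neg : ∀ c → val (RawRing.-_ Diff c) ≈ - val c
    val-neg (a , b) = begin
      B + - 1# * A ≈⟨ +-congʳ (trans (sym (*-identityˡ _)) (*-congʳ (sym -1²≈1))) ⟩
      (- 1# * - 1#) * B + - 1# * A
        ≈⟨ S.solve 3 (λ n a b → (n S.:* n) S.:* b S.:+ n S.:* a S.:= n S.:* (a S.:+ n S.:* b)) refl (- 1#) A B ⟩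
      - 1# * (A + - 1# * B) ≈⟨ -1*x≈-x _ ⟩
      - val (a , b) ∎ where
      A = a · 1#
      B = b · 1#

    cancel : ∀ X → X + - 1# * X ≈ 0#
    cancel X = trans (+-congˡ (-1*x≈-x X)) (-‿inverseʳ X)
    shift : ∀ A B D → A + - 1# * B ≈ (A + D) + - 1# * (B + D)
    shift A B D = begin
      A + - 1# * B ≈⟨ +-identityʳ _ ⟨
      (A + - 1# * B) + 0# ≈⟨ +-congˡ (cancel D) ⟨
      (A + - 1# * B) + (D + - 1# * D)
        ≈⟨ S.solve 4 (λ n a b d → (a S.:+ n S.:* b) S.:+ (d S.:+ n S.:* d) S.:= (a S.:+ d) S.:+ n S.:* (b S.:+ d))
             refl (- 1#) A B D ⟩
      (A + D) + - 1# * (B + D) ∎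
    val-normalise : ∀ c → val (normalise c) ≈ val c
    val-normalise (zero , b) = refl
    val-normalise (suc a , zero) = refl
    val-normalise (suc a , suc b) = trans (val-normalise (a , b)) (trans (shift (a · 1#) (b · 1#) 1#)
      (+-cong (+-comm _ _) (*-congˡ (+-comm _ _))))

    morphism : Diff ACR.-Raw-AlmostCommutative⟶ ACR.fromCommutativeRing K
    morphism = record
      { ⟦_⟧ = ⟦_⟧
      ; +-homo = λ c d → trans (⟦⟧≈val (normalise (c +̂ d)))
                   (trans (val-normalise (c +̂ d)) (trans (val-+ c d) (sym (+-cong (⟦⟧≈val c) (⟦⟧≈val d)))))
      ; *-homo = λ c d → trans (⟦⟧≈val (normalise (c *̂ d)))
                   (trans (val-normalise (c *̂ d)) (trans (val-* c d) (sym (*-cong (⟦⟧≈val c) (⟦⟧≈val d)))))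
      ; -‿homo = λ c → trans (⟦⟧≈val (RawRing.-_ Diff c))
                   (trans (val-neg c) (sym (-‿cong (⟦⟧≈val c))))
      ; 0-homo = refl
      ; 1-homo = refl
      }

    decide : ∀ c d → Maybe (⟦ c ⟧ ≈ ⟦ d ⟧)
    decide (a , b) (c , d) with a ℕ.+ d ℕ.≟ c ℕ.+ b
    ... | no _ = nothing
    ... | yes e = just (trans (⟦⟧≈val (a , b)) (trans eq (sym (⟦⟧≈val (c , d))))) where
      A = a · 1#
      B = b · 1#
      C = c · 1#
      D = d · 1#
      e′ : A + D ≈ C + B
      e′ = trans (sym (×-homo-+ 1# a d)) (trans (reflexive (≡.cong (_· 1#) e)) (×-homo-+ 1# c b))
      eq : A + - 1# * B ≈ C + - 1# * D
      eq = begin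
        A + - 1# * B ≈⟨ shift A B D ⟩
        (A + D) + - 1# * (B + D) ≈⟨ +-cong e′ (*-congˡ (+-comm B D)) ⟩
        (C + B) + - 1# * (D + B) ≈⟨ shift C D B ⟨
        C + - 1# * D ∎

  open RingSolver Diff (ACR.fromCommutativeRing K) morphism decide public
    using (solve; _:=_; _:+_; _:*_; _:-_; :-_; con; Polynomial)

  :0 :1 : ∀ {n} → Polynomial n
  :0 = con (0 , 0)
  :1 = con (1 , 0)

-- Linear algebra over a local ring

module LinearAlgebra (K : CommutativeRing 0ℓ 0ℓ) where
  open CommutativeRing K hiding (zero)
  open CommutativeSemigroupProperties *-commutativeSemigroup public
    using (interchange; x∙yz≈y∙xz; x∙yz≈z∙xy; x∙yz≈yz∙x; x∙yz≈xy∙z; x∙yz≈yx∙z; x∙yz≈xz∙y; xy∙z≈xz∙y; xy∙z≈y∙xz; xy∙z≈zx∙y)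
  open RawSemiringOps (Semiring.rawSemiring semiring) public using (_^_; product)
  private module Σ = SemiringSum semiring
  open Solver K
  open SetoidReasoning setoid

  opaque
    sum : (Fin n → Carrier) → Carrier
    sum = Σ.sum

    sum-unfold : (f : Fin n → Carrier) → sum f ≡ Σ.sum f
    sum-unfold _ = ≡.refl

    sum-[] : (f : Fin 0 → Carrier) → sum f ≈ 0#
    sum-[] _ = refl

    sum-∷ : (f : Fin (suc n) → Carrier) → sum f ≈ f zero + sum (λ i → f (suc i))
    sum-∷ _ = refl

    sum-cong : ∀ {f g : Fin n → Carrier} → (∀ i → f i ≈ g i) → sum f ≈ sum g
    sum-cong = Σ.sum-cong-≋

    sum-remove : (i : Fin (suc n)) (f : Fin (suc n) → Carrier) → sum f ≈ f i + sum (λ k → f (punchIn i k))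
    sum-remove i f = Σ.sum-remove {i = i} f

    sum-+ : (f g : Fin n → Carrier) → sum (λ i → f i + g i) ≈ sum f + sum g
    sum-+ = Σ.∑-distrib-+

    sum-swap : ∀ {m n} (f : Fin m → Fin n → Carrier) → sum (λ i → sum (λ j → f i j)) ≈ sum (λ j → sum (λ i → f i j))
    sum-swap = Σ.∑-comm

    sum-*ˡ : ∀ c (f : Fin n → Carrier) → c * sum f ≈ sum (λ i → c * f i)
    sum-*ˡ = Σ.*-distribˡ-sum

    sum-*ʳ : ∀ c (f : Fin n → Carrier) → sum f * c ≈ sum (λ i → f i * c)
    sum-*ʳ = Σ.*-distribʳ-sum

    sum-permute : ∀ {m n} (f : Fin n → Carrier) (π : Permutation m n) → sum f ≈ sum (λ i → f (π ⟨$⟩ʳ i))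
    sum-permute = Σ.sum-permute

    sum-zero : ∀ {f : Fin n → Carrier} → (∀ i → f i ≈ 0#) → sum f ≈ 0#
    sum-zero {n} z = trans (Σ.sum-cong-≋ z) (Σ.sum-replicate-zero n)

  sum-single : (i : Fin n) (f : Fin n → Carrier) → (∀ j → j ≢ i → f j ≈ 0#) → sum f ≈ f i
  sum-single {suc n} i f z = begin
    sum f ≈⟨ sum-remove i f ⟩
    f i + sum (λ k → f (punchIn i k)) ≈⟨ +-congˡ (sum-zero λ k → z (punchIn i k) (Fin.punchInᵢ≢i i k)) ⟩
    f i + 0# ≈⟨ +-identityʳ _ ⟩
    f i ∎

  ⟦_⟧? : ∀ {A : Set} → Dec A → Carrier
  ⟦ d ⟧? = if does d then 1# else 0#

  ⟦⟧?-yes : ∀ {A : Set} (d : Dec A) → A → ⟦ d ⟧? ≈ 1#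
  ⟦⟧?-yes (yes _) _ = refl
  ⟦⟧?-yes (no ¬a) a = contradiction a ¬a

  ⟦⟧?-no : ∀ {A : Set} (d : Dec A) → (A → 0# ≈ 1#) → ⟦ d ⟧? ≈ 0#
  ⟦⟧?-no (yes a) f = sym (f a)
  ⟦⟧?-no (no _) _ = refl

  δ : Fin n → Fin n → Carrier
  δ i j = ⟦ i Fin.≟ j ⟧?

  δ-yes : (i : Fin n) → δ i i ≈ 1#
  δ-yes i = ⟦⟧?-yes (i Fin.≟ i) ≡.refl

  δ-no : ∀ {i j : Fin n} → i ≢ j → δ i j ≈ 0#
  δ-no {i = i} {j} i≢j with i Fin.≟ j
  ... | yes e = contradiction e i≢j
  ... | no _ = refl

  δ-injective : ∀ {m n} (f : Fin m → Fin n) → (∀ {i j} → f i ≡ f j → i ≡ j) → ∀ i j → δ (f i) (f j) ≈ δ i j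
  δ-injective f f-inj i j with i Fin.≟ j
  ... | yes ≡.refl = δ-yes (f i)
  ... | no i≢j = δ-no (i≢j ∘ f-inj)

  sum-δˡ : (i : Fin n) (f : Fin n → Carrier) → sum (λ j → δ i j * f j) ≈ f i
  sum-δˡ i f = begin
    sum (λ j → δ i j * f j) ≈⟨ sum-single i _ (λ j j≢i → trans (*-congʳ (δ-no (j≢i ∘ ≡.sym))) (zeroˡ _)) ⟩
    δ i i * f i ≈⟨ *-congʳ (δ-yes i) ⟩
    1# * f i ≈⟨ *-identityˡ _ ⟩
    f i ∎

  sum-δʳ : (i : Fin n) (f : Fin n → Carrier) → sum (λ j → f j * δ j i) ≈ f i
  sum-δʳ i f = begin
    sum (λ j → f j * δ j i) ≈⟨ sum-single i _ (λ j j≢i → trans (*-congˡ (δ-no j≢i)) (zeroʳ _)) ⟩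
    f i * δ i i ≈⟨ *-congˡ (δ-yes i) ⟩
    f i * 1# ≈⟨ *-identityʳ _ ⟩
    f i ∎

  one^ : ∀ m → 1# ^ m ≈ 1#
  one^ zero = refl
  one^ (suc m) = trans (*-identityˡ _) (one^ m)

  fromℕ : ℕ → Carrier
  fromℕ zero = 0#
  fromℕ (suc m) = 1# + fromℕ m

  fromℕ-+ : ∀ a b → fromℕ (a ℕ.+ b) ≈ fromℕ a + fromℕ b
  fromℕ-+ zero b = sym (+-identityˡ _)
  fromℕ-+ (suc a) b = trans (+-congˡ (fromℕ-+ a b)) (sym (+-assoc _ _ _))

  Unit : Carrier → Set
  Unit a = ∃ λ b → a * b ≈ 1#

  unit-1 : Unit 1#
  unit-1 = 1# , *-identityˡ 1#

  unit-cong : ∀ {a b} → a ≈ b → Unit a → Unit b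
  unit-cong e (c , ac) = c , trans (*-congʳ (sym e)) ac

  unit-* : ∀ {a b} → Unit a → Unit b → Unit (a * b)
  unit-* {a} {b} (c , ac) (d , bd) = c * d , (begin
    (a * b) * (c * d) ≈⟨ interchange a b c d ⟩
    (a * c) * (b * d) ≈⟨ *-cong ac bd ⟩
    1# * 1# ≈⟨ *-identityˡ 1# ⟩
    1# ∎)

  unit-factor : ∀ {a b} → Unit (a * b) → Unit a
  unit-factor {a} {b} (c , abc) = b * c , trans (sym (*-assoc a b c)) abc

  unit-neg : ∀ {a} → Unit a → Unit (- a)
  unit-neg {a} (b , ab) = - b , trans (solve 2 (λ a b → (:- a) :* (:- b) := a :* b) refl a b) ab

  unit-cancel : ∀ {a b} → Unit a → a * b ≈ 0# → b ≈ 0#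
  unit-cancel {a} {b} (c , ac) ab = begin
    b ≈⟨ *-identityˡ b ⟨
    1# * b ≈⟨ *-congʳ ac ⟨
    (a * c) * b ≈⟨ xy∙z≈y∙xz a c b ⟩
    c * (a * b) ≈⟨ *-congˡ ab ⟩
    c * 0# ≈⟨ zeroʳ c ⟩
    0# ∎

  -- Constructive substitute for a field: whether a complex number vanishes cannot be decided, but
  -- of two numbers with sum 1 one is apart from 0.
  IsLocal : Set
  IsLocal = ∀ a b → a + b ≈ 1# → Unit a ⊎ Unit b

  module _ (local : IsLocal) where

    unit-summand : (t : Fin (suc n) → Carrier) → Unit (sum t) → ∃ λ i → Unit (t i)
    unit-summand {zero} t u = zero , unit-cong (trans (sum-∷ t) (trans (+-congˡ (sum-[] _)) (+-identityʳ _))) u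
    unit-summand {suc n} t (c , tc)
      with local (t zero * c) (sum (t ∘ suc) * c) (trans (sym (distribʳ c _ _)) (trans (*-congʳ (sym (sum-∷ t))) tc))
    ... | inj₁ u = zero , unit-factor u
    ... | inj₂ u = let i , v = unit-summand (t ∘ suc) (unit-factor u) in suc i , v

    -- Gaussian elimination: some entry of the first row is invertible because the
    -- first row times the first column of B is 1.
    kernel-trivial : ∀ {N} (A B : Fin N → Fin N → Carrier) → (∀ i l → sum (λ k → A i k * B k l) ≈ δ i l) →
      ∀ (x : Fin N → Carrier) → (∀ i → sum (λ k → A i k * x k) ≈ 0#) → ∀ k → x k ≈ 0#
    kernel-trivial {zero} A B AB x Ax ()
    kernel-trivial {suc N} A B AB x Ax = vanish where
      pivot : ∃ λ j → Unit (A zero j * B j zero)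
      pivot = unit-summand (λ k → A zero k * B k zero) (unit-cong (sym (AB zero zero)) unit-1)
      j = proj₁ pivot
      u = proj₁ (unit-factor (proj₂ pivot))
      au : A zero j * u ≈ 1#
      au = proj₂ (unit-factor (proj₂ pivot))
      π : Fin N → Fin (suc N)
      π = punchIn j
      A′ B′ : Fin N → Fin N → Carrier
      A′ i k = A (suc i) (π k) + - (A (suc i) j * u * A zero (π k))
      B′ k l = B (π k) (suc l)
      -- Effect of eliminating coordinate j by the pivot row on a system with right-hand sides s and
      -- t. It serves twice: for the columns of B, whence A′ again has a right inverse, and for the
      -- vector x.
      row : ∀ i (y : Fin (suc N) → Carrier) s t → sum (λ k → A (suc i) k * y k) ≈ s → sum (λ k → A zero k * y k) ≈ t →
        sum (λ k → A′ i k * y (π k)) ≈ s + - (A (suc i) j * u * t)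
      row i y s t es et = begin
        sum (λ k → A′ i k * y (π k))
          ≈⟨ sum-cong (λ k → solve 4 (λ a c b y → (a :+ :- (c :* b)) :* y := a :* y :+ (:- c) :* (b :* y)) refl
               (A (suc i) (π k)) c (A zero (π k)) (y (π k))) ⟩
        sum (λ k → A (suc i) (π k) * y (π k) + - c * (A zero (π k) * y (π k))) ≈⟨ sum-+ _ _ ⟩
        P + sum (λ k → - c * (A zero (π k) * y (π k))) ≈⟨ +-congˡ (sum-*ˡ (- c) _) ⟨
        P + - c * Q ≈⟨ solve 6 (λ a u p q a0 y → p :+ (:- (a :* u)) :* q :=
                        (a :* y :+ p) :+ :- (a :* u :* (a0 :* y :+ q)) :+ a :* y :* (a0 :* u :- :1))
               refl (A (suc i) j) u P Q (A zero j) (y j) ⟩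
        (A (suc i) j * y j + P) + - (A (suc i) j * u * (A zero j * y j + Q)) + A (suc i) j * y j * (A zero j * u - 1#)
          ≈⟨ +-cong (+-cong (trans (sym (sum-remove j (λ k → A (suc i) k * y k))) es)
                       (-‿cong (*-congˡ (trans (sym (sum-remove j (λ k → A zero k * y k))) et))))
               (trans (*-congˡ (trans (+-congʳ au) (-‿inverseʳ 1#))) (zeroʳ _)) ⟩
        s + - (A (suc i) j * u * t) + 0# ≈⟨ +-identityʳ _ ⟩
        s + - (A (suc i) j * u * t) ∎ where
        c = A (suc i) j * u
        P = sum (λ k → A (suc i) (π k) * y (π k))
        Q = sum (λ k → A zero (π k) * y (π k))
      drop0 : ∀ s a → s + - (a * 0#) ≈ s
      drop0 = solve 2 (λ s a → s :+ :- (a :* :0) := s) refl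
      A′B′ : ∀ i l → sum (λ k → A′ i k * B′ k l) ≈ δ i l
      A′B′ i l = begin
        sum (λ k → A′ i k * B′ k l) ≈⟨ row i (λ k → B k (suc l)) _ _ (AB (suc i) (suc l)) (AB zero (suc l)) ⟩
        δ (suc i) (suc l) + - (A (suc i) j * u * 0#) ≈⟨ drop0 _ _ ⟩
        δ (suc i) (suc l) ≈⟨ δ-injective suc Fin.suc-injective i l ⟩
        δ i l ∎
      rest : ∀ k → x (π k) ≈ 0#
      rest = kernel-trivial A′ B′ A′B′ (x ∘ π) λ i → trans (row i x _ _ (Ax (suc i)) (Ax zero)) (drop0 _ _)
      pivotal : x j ≈ 0#
      pivotal = unit-cancel (u , au) (begin
        A zero j * x j ≈⟨ +-identityʳ _ ⟨
        A zero j * x j + 0# ≈⟨ +-congˡ (sum-zero (λ k → trans (*-congˡ (rest k)) (zeroʳ _))) ⟨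
        A zero j * x j + sum (λ k → A zero (π k) * x (π k)) ≈⟨ sum-remove j (λ k → A zero k * x k) ⟨
        sum (λ k → A zero k * x k) ≈⟨ Ax zero ⟩
        0# ∎)
      vanish : ∀ k → x k ≈ 0#
      vanish k with j Fin.≟ k
      ... | yes ≡.refl = pivotal
      ... | no j≢k = trans (reflexive (≡.cong x (≡.sym (Fin.punchIn-punchOut j≢k)))) (rest (punchOut j≢k))

    -- Since A B = 1, the matrix A kills every column of B A - 1, and its kernel is trivial.
    right-inverse⇒left-inverse : ∀ {N} (A B : Fin N → Fin N → Carrier) → (∀ i l → sum (λ k → A i k * B k l) ≈ δ i l) →
      ∀ i l → sum (λ k → B i k * A k l) ≈ δ i l
    right-inverse⇒left-inverse A B AB i l =
      x≈y (kernel-trivial A B AB (λ m → sum (λ k → B m k * A k l) + - δ m l) image i) where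
      x≈y : ∀ {x y} → x + - y ≈ 0# → x ≈ y
      x≈y {x} {y} e = begin
        x ≈⟨ solve 2 (λ x y → x := x :+ :- y :+ y) refl x y ⟩
        x + - y + y ≈⟨ +-congʳ e ⟩
        0# + y ≈⟨ +-identityˡ y ⟩
        y ∎
      image : ∀ i → sum (λ m → A i m * (sum (λ k → B m k * A k l) + - δ m l)) ≈ 0#
      image i = begin
        sum (λ m → A i m * (sum (λ k → B m k * A k l) + - δ m l)) ≈⟨ sum-cong (λ m → trans (distribˡ _ _ _) (+-cong
               (trans (sum-*ˡ (A i m) _) (sum-cong λ k → sym (*-assoc _ _ _)))
               (solve 2 (λ a d → a :* (:- d) := (:- :1) :* (a :* d)) refl (A i m) (δ m l)))) ⟩
        sum (λ m → sum (λ k → A i m * B m k * A k l) + - 1# * (A i m * δ m l)) ≈⟨ sum-+ _ _ ⟩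
        sum (λ m → sum (λ k → A i m * B m k * A k l)) + sum (λ m → - 1# * (A i m * δ m l))
          ≈⟨ +-cong (sum-swap _) (sym (sum-*ˡ (- 1#) _)) ⟩
        sum (λ k → sum (λ m → A i m * B m k * A k l)) + - 1# * sum (λ m → A i m * δ m l)
          ≈⟨ +-cong (sum-cong (λ k → trans (sym (sum-*ʳ (A k l) _)) (*-congʳ (AB i k)))) (*-congˡ (sum-δʳ l (A i))) ⟩
        sum (λ k → δ i k * A k l) + - 1# * A i l ≈⟨ +-congʳ (sum-δˡ i (λ k → A k l)) ⟩
        A i l + - 1# * A i l ≈⟨ solve 1 (λ a → a :+ (:- :1) :* a := :0) refl (A i l) ⟩
        0# ∎

-- Finite sums in modules

module ModuleSums (K : CommutativeRing 0ℓ 0ℓ) (V : Representations.KModule K) where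
  open CommutativeRing K hiding (zero; refl; sym; trans)
  open Representations K
  open Module V
  open LinearAlgebra K using (δ; δ-yes; δ-no)
  private
    module Σ = MonoidSum +ᴹ-commutativeMonoid
    module G = AbelianGroupProperties +ᴹ-abelianGroup
  open SetoidReasoning ≈ᴹ-setoid

  opaque
    sumᴹ : (Fin n → Carrierᴹ) → Carrierᴹ
    sumᴹ = Σ.sum

    sumᴹ-[] : (f : Fin 0 → Carrierᴹ) → sumᴹ f ≈ᴹ 0ᴹ
    sumᴹ-[] _ = ≈ᴹ-refl

    sumᴹ-∷ : (f : Fin (suc n) → Carrierᴹ) → sumᴹ f ≈ᴹ f zero +ᴹ sumᴹ (λ i → f (suc i))
    sumᴹ-∷ _ = ≈ᴹ-refl

    sumᴹ-cong : ∀ {f g : Fin n → Carrierᴹ} → (∀ i → f i ≈ᴹ g i) → sumᴹ f ≈ᴹ sumᴹ g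
    sumᴹ-cong = Σ.sum-cong-≋

    sumᴹ-remove : (i : Fin (suc n)) (f : Fin (suc n) → Carrierᴹ) → sumᴹ f ≈ᴹ f i +ᴹ sumᴹ (λ k → f (punchIn i k))
    sumᴹ-remove i f = Σ.sum-remove {i = i} f

    sumᴹ-+ : (f g : Fin n → Carrierᴹ) → sumᴹ (λ i → f i +ᴹ g i) ≈ᴹ sumᴹ f +ᴹ sumᴹ g
    sumᴹ-+ = Σ.∑-distrib-+

    sumᴹ-permute : ∀ {m n} (f : Fin n → Carrierᴹ) (π : Permutation m n) → sumᴹ f ≈ᴹ sumᴹ (λ i → f (π ⟨$⟩ʳ i))
    sumᴹ-permute = Σ.sum-permute

    sumᴹ-zero : ∀ {f : Fin n → Carrierᴹ} → (∀ i → f i ≈ᴹ 0ᴹ) → sumᴹ f ≈ᴹ 0ᴹ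
    sumᴹ-zero {n} z = ≈ᴹ-trans (Σ.sum-cong-≋ z) (Σ.sum-replicate-zero n)

  sumᴹ-single : (i : Fin n) (f : Fin n → Carrierᴹ) → (∀ j → j ≢ i → f j ≈ᴹ 0ᴹ) → sumᴹ f ≈ᴹ f i
  sumᴹ-single {suc n} i f z = begin
    sumᴹ f ≈⟨ sumᴹ-remove i f ⟩
    f i +ᴹ sumᴹ (λ k → f (punchIn i k)) ≈⟨ +ᴹ-congˡ (sumᴹ-zero λ k → z (punchIn i k) (Fin.punchInᵢ≢i i k)) ⟩
    f i +ᴹ 0ᴹ ≈⟨ +ᴹ-identityʳ _ ⟩
    f i ∎

  sumᴹ-δ : (i : Fin n) (f : Fin n → Carrierᴹ) → sumᴹ (λ j → δ j i *ₗ f j) ≈ᴹ f i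
  sumᴹ-δ i f = begin
    sumᴹ (λ j → δ j i *ₗ f j) ≈⟨ sumᴹ-single i _ (λ j j≢i → ≈ᴹ-trans (*ₗ-congʳ (δ-no j≢i)) (*ₗ-zeroˡ _)) ⟩
    δ i i *ₗ f i ≈⟨ *ₗ-congʳ (δ-yes i) ⟩
    1# *ₗ f i ≈⟨ *ₗ-identityˡ _ ⟩
    f i ∎

  module _ (S : Submodule V) where
    open Submodule S

    sum∈ : (f : Fin n → Carrierᴹ) → (∀ i → f i ∈S) → sumᴹ f ∈S
    sum∈ {zero} f h = resp (≈ᴹ-sym (sumᴹ-[] f)) 0∈
    sum∈ {suc n} f h = resp (≈ᴹ-sym (sumᴹ-∷ f)) (+∈ (h zero) (sum∈ (f ∘ suc) (h ∘ suc)))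

    -‿*ₗ : ∀ u → - 1# *ₗ u ≈ᴹ -ᴹ u
    -‿*ₗ u = G.inverseˡ-unique _ _ (begin
      - 1# *ₗ u +ᴹ u ≈⟨ +ᴹ-congˡ (*ₗ-identityˡ u) ⟨
      - 1# *ₗ u +ᴹ 1# *ₗ u ≈⟨ *ₗ-distribʳ u (- 1#) 1# ⟨
      (- 1# + 1#) *ₗ u ≈⟨ *ₗ-congʳ (-‿inverseˡ 1#) ⟩
      0# *ₗ u ≈⟨ *ₗ-zeroˡ u ⟩
      0ᴹ ∎)

    difference∈ : ∀ {u v} → (u +ᴹ v) ∈S → v ∈S → u ∈S
    difference∈ {u} {v} p q = resp (begin
      (u +ᴹ v) +ᴹ - 1# *ₗ v ≈⟨ +ᴹ-assoc _ _ _ ⟩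
      u +ᴹ (v +ᴹ - 1# *ₗ v) ≈⟨ +ᴹ-congˡ (+ᴹ-congˡ (-‿*ₗ v)) ⟩
      u +ᴹ (v +ᴹ -ᴹ v) ≈⟨ +ᴹ-congˡ (-ᴹ‿inverseʳ v) ⟩
      u +ᴹ 0ᴹ ≈⟨ +ᴹ-identityʳ u ⟩
      u ∎) (+∈ p (*∈ (- 1#) q))

    summand∈ : (i : Fin n) (f : Fin n → Carrierᴹ) → sumᴹ f ∈S → (∀ j → j ≢ i → f j ∈S) → f i ∈S
    summand∈ {suc n} i f p h = difference∈ (resp (sumᴹ-remove i f) p)
      (sum∈ _ λ k → h (punchIn i k) (Fin.punchInᵢ≢i i k))

  module _ (g : Carrierᴹ → Carrierᴹ) (linear : IsLinear V V g) where
    open IsModuleHomomorphism linear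

    sumᴹ-linear : (f : Fin n → Carrierᴹ) → g (sumᴹ f) ≈ᴹ sumᴹ (λ i → g (f i))
    sumᴹ-linear {zero} f = ≈ᴹ-trans (⟦⟧-cong (sumᴹ-[] f)) (≈ᴹ-trans 0ᴹ-homo (≈ᴹ-sym (sumᴹ-[] _)))
    sumᴹ-linear {suc n} f = begin
      g (sumᴹ f) ≈⟨ ⟦⟧-cong (sumᴹ-∷ f) ⟩
      g (f zero +ᴹ sumᴹ (f ∘ suc)) ≈⟨ +ᴹ-homo _ _ ⟩
      g (f zero) +ᴹ g (sumᴹ (f ∘ suc)) ≈⟨ +ᴹ-congˡ (sumᴹ-linear (f ∘ suc)) ⟩
      g (f zero) +ᴹ sumᴹ (λ i → g (f (suc i))) ≈⟨ sumᴹ-∷ _ ⟨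
      sumᴹ (λ i → g (f i)) ∎

-- Codes of partitions, and straightening with commuting operators

-- An r-ified ordered set partition (r = suc r′) of k elements into q blocks, built by
-- inserting the elements from last to first: an element goes to the zero block, joins one of the present blocks,
-- or forms a new block in one of the gaps.
data Code (r′ : ℕ) : ℕ → ℕ → Set where
  [] : Code r′ 0 0
  zer : Fin r′ → Code r′ k q → Code r′ (suc k) q
  joi : Fin q → Fin (suc r′) → Code r′ k q → Code r′ (suc k) q
  new : Fin (suc q) → Fin (suc r′) → Code r′ k q → Code r′ (suc k) (suc q)

-- true marks the elements which do not start a block.
Cell : ℕ → Set
Cell r′ = Bool × Fin (suc r′)

-- Colour c of the zero block is stored like colour c + 1 of a joined element. Over a given cell, a
-- tail with q blocks thus has q extensions for (true, zero) and q + 1 for any other cell, which is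
-- the length of `factors`.
shape : Code r′ k q → Vec (Cell r′) k
shape [] = []
shape (zer c t) = (true , suc c) ∷ shape t
shape (joi b ρ t) = (true , ρ) ∷ shape t
shape (new e ρ t) = (false , ρ) ∷ shape t

roots : (Fin k → Fin n) → Vec (Cell r′) k → List (Fin n)
roots ι [] = []
roots ι ((false , _) ∷ cs) = ι zero ∷ roots (ι ∘ suc) cs
roots ι ((true , _) ∷ cs) = roots (ι ∘ suc) cs

justs : List (Fin n) → List (Maybe (Fin n))
justs = map just

-- With z the element of the cell, `nothing` stands for the factor Y z and `just l` for Y z - Y l.
-- Their product annihilates the element being straightened. For (true, zero) the factor Y z is
-- absent because the base monomial already contains dy z.
factors : Cell r′ → List (Fin n) → List (Maybe (Fin n))
factors (true , zero) Λ = justs Λ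
factors (true , suc _) Λ = nothing ∷ justs Λ
factors (false , _) Λ = nothing ∷ justs Λ

roots-length : (ι : Fin k → Fin n) (c : Code r′ k q) → length (roots ι (shape c)) ≡ q
roots-length ι [] = ≡.refl
roots-length ι (zer _ c) = roots-length (ι ∘ suc) c
roots-length ι (joi _ _ c) = roots-length (ι ∘ suc) c
roots-length ι (new _ _ c) = ≡.cong suc (roots-length (ι ∘ suc) c)

-- Only commuting operators occur here; the noncommutative algebra enters through the relations
-- assumed of v. The degree d is a label which every operator raises by r.
module Straightening (K : CommutativeRing 0ℓ 0ℓ) (V : Representations.KModule K) (n r′ r : ℕ)
  (Y : Fin n → Module.Carrierᴹ V → Module.Carrierᴹ V) (Y-linear : ∀ i → Representations.IsLinear K V V (Y i))
  (Y-comm : ∀ i j u → Module._≈ᴹ_ V (Y i (Y j u)) (Y j (Y i u))) where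
  open CommutativeRing K hiding (zero; refl; sym; trans)
  open Representations K
  open Module V
  open LinearAlgebra K using (Unit; fromℕ; fromℕ-+)
  open ModuleSums K V
  open SetoidReasoning ≈ᴹ-setoid

  private
    module Y i = IsModuleHomomorphism (Y-linear i)
    infix 4 _∈_
    _∈_ : Carrierᴹ → Submodule V → Set
    u ∈ S = Submodule._∈S S u

  ap : Fin n → Maybe (Fin n) → Carrierᴹ → Carrierᴹ
  ap z nothing u = Y z u
  ap z (just l) u = Y z u +ᴹ - 1# *ₗ Y l u

  aps : Fin n → List (Maybe (Fin n)) → Carrierᴹ → Carrierᴹ
  aps z [] u = u
  aps z (f ∷ fs) u = aps z fs (ap z f u)

  ups : ∀ {A : Set} → List A → ℕ → ℕ
  ups [] d = d
  ups (_ ∷ fs) d = ups fs (r ℕ.+ d)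

  ups-suc : ∀ {A : Set} (fs : List A) d → ups fs (r ℕ.+ d) ≡ r ℕ.+ ups fs d
  ups-suc [] d = ≡.refl
  ups-suc (_ ∷ fs) d = ups-suc fs (r ℕ.+ d)

  -- The label of the chosen block or gap is the number of factors applied. For a joined element of
  -- nonzero colour it is shifted by one, the value 0 being reserved for the zero block.
  taken : Code r′ (suc k) q → ℕ
  taken (zer c t) = 0
  taken (joi b zero t) = toℕ b
  taken (joi b (suc _) t) = suc (toℕ b)
  taken (new e ρ t) = toℕ e

  -- The spanning element obtained from v by multiplying, for each element z of the code, with an
  -- initial segment of the product of the factors of z.
  selem : (Fin k → Fin n) → Code r′ k q → Carrierᴹ → Carrierᴹ
  selem ι [] v = v
  selem ι c@(zer ρ t) v = selem (ι ∘ suc) t v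
  selem ι c@(joi b ρ t) v = selem (ι ∘ suc) t
    (aps (ι zero) (take (taken c) (factors (true , ρ) (roots (ι ∘ suc) (shape t)))) v)
  selem ι c@(new e ρ t) v = selem (ι ∘ suc) t
    (aps (ι zero) (take (taken c) (factors (false , ρ) (roots (ι ∘ suc) (shape t)))) v)

  sdeg : (Fin k → Fin n) → Code r′ k q → ℕ → ℕ
  sdeg ι [] d = d
  sdeg ι c@(zer ρ t) d = sdeg (ι ∘ suc) t d
  sdeg ι c@(joi b ρ t) d = sdeg (ι ∘ suc) t
    (ups (take (taken c) (factors (true , ρ) (roots (ι ∘ suc) (shape t)))) d)
  sdeg ι c@(new e ρ t) d = sdeg (ι ∘ suc) t
    (ups (take (taken c) (factors (false , ρ) (roots (ι ∘ suc) (shape t)))) d)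

  Y-scaled-comm : ∀ i c j u → Y i (c *ₗ Y j u) ≈ᴹ c *ₗ Y j (Y i u)
  Y-scaled-comm i c j u = ≈ᴹ-trans (Y.*ₗ-homo i c _) (*ₗ-congˡ (Y-comm i j u))

  Y-ap : ∀ i z f u → Y i (ap z f u) ≈ᴹ ap z f (Y i u)
  Y-ap i z nothing u = Y-comm i z u
  Y-ap i z (just l) u = ≈ᴹ-trans (Y.+ᴹ-homo i _ _)
    (+ᴹ-cong (Y-comm i z u) (Y-scaled-comm i (- 1#) l u))

  ap-cong : ∀ z f {u v} → u ≈ᴹ v → ap z f u ≈ᴹ ap z f v
  ap-cong z nothing e = Y.⟦⟧-cong z e
  ap-cong z (just l) e = +ᴹ-cong (Y.⟦⟧-cong z e) (*ₗ-congˡ (Y.⟦⟧-cong l e))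

  ap-linear : ∀ z f → IsLinear V V (ap z f)
  ap-linear z nothing = Y-linear z
  ap-linear z (just l) = mkLinear V V _ (ap-cong z (just l))
    (λ u v → begin
      Y z (u +ᴹ v) +ᴹ - 1# *ₗ Y l (u +ᴹ v)
        ≈⟨ +ᴹ-cong (Y.+ᴹ-homo z u v) (≈ᴹ-trans (*ₗ-congˡ (Y.+ᴹ-homo l u v)) (*ₗ-distribˡ _ _ _)) ⟩
      (Y z u +ᴹ Y z v) +ᴹ (- 1# *ₗ Y l u +ᴹ - 1# *ₗ Y l v) ≈⟨ interchange _ _ _ _ ⟩
      (Y z u +ᴹ - 1# *ₗ Y l u) +ᴹ (Y z v +ᴹ - 1# *ₗ Y l v) ∎)
    (λ c u → begin
      Y z (c *ₗ u) +ᴹ - 1# *ₗ Y l (c *ₗ u)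
        ≈⟨ +ᴹ-cong (Y.*ₗ-homo z c u) (≈ᴹ-trans (*ₗ-congˡ (Y.*ₗ-homo l c u)) (swap* (- 1#) c _)) ⟩
      c *ₗ Y z u +ᴹ c *ₗ (- 1# *ₗ Y l u) ≈⟨ *ₗ-distribˡ _ _ _ ⟨
      c *ₗ (Y z u +ᴹ - 1# *ₗ Y l u) ∎) where
    open CommutativeSemigroupProperties (CommutativeMonoid.commutativeSemigroup +ᴹ-commutativeMonoid) using (interchange)
    swap* : ∀ c d u → c *ₗ (d *ₗ u) ≈ᴹ d *ₗ (c *ₗ u)
    swap* c d u = ≈ᴹ-trans (≈ᴹ-sym (*ₗ-assoc c d u)) (≈ᴹ-trans (*ₗ-congʳ (*-comm c d)) (*ₗ-assoc d c u))

  aps-cong : ∀ z fs {u v} → u ≈ᴹ v → aps z fs u ≈ᴹ aps z fs v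
  aps-cong z [] e = e
  aps-cong z (f ∷ fs) e = aps-cong z fs (ap-cong z f e)

  ap-ap : ∀ z f w g u → ap z f (ap w g u) ≈ᴹ ap w g (ap z f u)
  ap-ap z nothing w g u = Y-ap z w g u
  ap-ap z (just l) w g u = begin
    Y z (ap w g u) +ᴹ - 1# *ₗ Y l (ap w g u)
      ≈⟨ +ᴹ-cong (Y-ap z w g u) (≈ᴹ-trans (*ₗ-congˡ (Y-ap l w g u)) (≈ᴹ-sym (A.*ₗ-homo (- 1#) _))) ⟩
    ap w g (Y z u) +ᴹ ap w g (- 1# *ₗ Y l u) ≈⟨ A.+ᴹ-homo _ _ ⟨
    ap w g (Y z u +ᴹ - 1# *ₗ Y l u) ∎
    where module A = IsModuleHomomorphism (ap-linear w g)

  aps-ap : ∀ z fs w g u → aps z fs (ap w g u) ≈ᴹ ap w g (aps z fs u)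
  aps-ap z [] w g u = ≈ᴹ-refl
  aps-ap z (f ∷ fs) w g u = ≈ᴹ-trans (aps-cong z fs (ap-ap z f w g u)) (aps-ap z fs w g (ap z f u))

  aps-linear : ∀ z fs → IsLinear V V (aps z fs)
  aps-linear z [] = mkLinear V V _ (λ e → e) (λ _ _ → ≈ᴹ-refl) (λ _ _ → ≈ᴹ-refl)
  aps-linear z (f ∷ fs) = mkLinear V V _ (aps-cong z (f ∷ fs))
    (λ u v → ≈ᴹ-trans (aps-cong z fs (A.+ᴹ-homo u v)) (B.+ᴹ-homo _ _))
    (λ c u → ≈ᴹ-trans (aps-cong z fs (A.*ₗ-homo c u)) (B.*ₗ-homo c _)) where
    module A = IsModuleHomomorphism (ap-linear z f)
    module B = IsModuleHomomorphism (aps-linear z fs)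

  pow : Fin n → ℕ → Carrierᴹ → Carrierᴹ
  pow z zero u = u
  pow z (suc a) u = pow z a (Y z u)

  up : ℕ → ℕ → ℕ
  up zero d = d
  up (suc a) d = up a (r ℕ.+ d)

  up-suc : ∀ a d → up a (r ℕ.+ d) ≡ r ℕ.+ up a d
  up-suc zero d = ≡.refl
  up-suc (suc a) d = up-suc a (r ℕ.+ d)

  pow-linear : ∀ z a → IsLinear V V (pow z a)
  pow-linear z zero = mkLinear V V _ (λ e → e) (λ _ _ → ≈ᴹ-refl) (λ _ _ → ≈ᴹ-refl)
  pow-linear z (suc a) = mkLinear V V _
    (λ e → B.⟦⟧-cong (Y.⟦⟧-cong z e))
    (λ u v → ≈ᴹ-trans (B.⟦⟧-cong (Y.+ᴹ-homo z u v)) (B.+ᴹ-homo _ _))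
    (λ c u → ≈ᴹ-trans (B.⟦⟧-cong (Y.*ₗ-homo z c u)) (B.*ₗ-homo c _))
    where module B = IsModuleHomomorphism (pow-linear z a)

  pow-ap : ∀ z a w g u → pow z a (ap w g u) ≈ᴹ ap w g (pow z a u)
  pow-ap z zero w g u = ≈ᴹ-refl
  pow-ap z (suc a) w g u = ≈ᴹ-trans (B.⟦⟧-cong (Y-ap z w g u)) (pow-ap z a w g (Y z u))
    where module B = IsModuleHomomorphism (pow-linear z a)

  act : List (Fin n) → Carrierᴹ → Carrierᴹ
  act [] u = u
  act (i ∷ α) u = act α (Y i u)

  act-linear : ∀ α → IsLinear V V (act α)
  act-linear [] = mkLinear V V _ (λ e → e) (λ _ _ → ≈ᴹ-refl) (λ _ _ → ≈ᴹ-refl)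
  act-linear (i ∷ α) = mkLinear V V _
    (λ e → B.⟦⟧-cong (Y.⟦⟧-cong i e))
    (λ u v → ≈ᴹ-trans (B.⟦⟧-cong (Y.+ᴹ-homo i u v)) (B.+ᴹ-homo _ _))
    (λ c u → ≈ᴹ-trans (B.⟦⟧-cong (Y.*ₗ-homo i c u)) (B.*ₗ-homo c _))
    where module B = IsModuleHomomorphism (act-linear α)

  module _ (W : ℕ → Submodule V) where

    -- The largest family of subspaces of the W d which is stable under all Y i.
    W° : ℕ → Submodule V
    W° d = record
      { _∈S = λ u → ∀ α → act α u ∈ W (ups α d)
      ; resp = λ e p α → Submodule.resp (W _) (A.⟦⟧-cong α e) (p α)
      ; 0∈ = λ α → Submodule.resp (W _) (≈ᴹ-sym (A.0ᴹ-homo α)) (Submodule.0∈ (W _))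
      ; +∈ = λ p q α → Submodule.resp (W _) (≈ᴹ-sym (A.+ᴹ-homo α _ _)) (Submodule.+∈ (W _) (p α) (q α))
      ; *∈ = λ c p α → Submodule.resp (W _) (≈ᴹ-sym (A.*ₗ-homo α c _)) (Submodule.*∈ (W _) c (p α))
      }
      where module A α = IsModuleHomomorphism (act-linear α)

    private module W° d = Submodule (W° d)

    Y∈ : ∀ {d u} i → u ∈ W° d → Y i u ∈ W° (r ℕ.+ d)
    Y∈ i p α = p (i ∷ α)

    ap∈ : ∀ {d u} z f → u ∈ W° d → ap z f u ∈ W° (r ℕ.+ d)
    ap∈ z nothing p = Y∈ z p
    ap∈ z (just l) p = W°.+∈ _ (Y∈ z p) (W°.*∈ _ (- 1#) (Y∈ l p))

    pow∈ : ∀ {d u} z a → u ∈ W° d → pow z a u ∈ W° (up a d)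
    pow∈ z zero p = p
    pow∈ z (suc a) p = pow∈ z a (Y∈ z p)

    aps∈ : ∀ {d u} z fs → u ∈ W° d → aps z fs u ∈ W° (ups fs d)
    aps∈ z [] p = p
    aps∈ z (f ∷ fs) p = aps∈ z fs (ap∈ z f p)

    cast∈ : ∀ {d e u} → d ≡ e → u ∈ W° d → u ∈ W° e
    cast∈ ≡.refl p = p

    -- The product over Λ is a polynomial in Y (z i) whose coefficients do not depend on i, so the
    -- sum is a combination of moments. The induction absorbs one factor into t at a time, which
    -- preserves the hypothesis on the moments.
    moments : ∀ (z : Fin k → Fin n) (t : Fin k → Carrierᴹ) d → (∀ a → sumᴹ (λ i → pow (z i) a (t i)) ∈ W° (up a d)) →
      ∀ Λ → sumᴹ (λ i → aps (z i) (justs Λ) (t i)) ∈ W° (ups (justs Λ) d)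
    moments z t d h [] = h 0
    moments z t d h (l ∷ Λ) = moments z (λ i → ap (z i) (just l) (t i)) (r ℕ.+ d) h′ Λ where
      h′ : ∀ a → sumᴹ (λ i → pow (z i) a (ap (z i) (just l) (t i))) ∈ W° (up a (r ℕ.+ d))
      h′ a = W°.resp _ (begin
        sumᴹ (λ i → pow (z i) (suc a) (t i)) +ᴹ - 1# *ₗ Y l (sumᴹ (λ i → pow (z i) a (t i)))
          ≈⟨ +ᴹ-congˡ (≈ᴹ-trans (*ₗ-congˡ (sumᴹ-linear (Y l) (Y-linear l) _))
               (sumᴹ-linear (- 1# *ₗ_) (mkLinear V V _ *ₗ-congˡ (*ₗ-distribˡ _)
                 (λ c u → ≈ᴹ-trans (≈ᴹ-sym (*ₗ-assoc _ c u)) (≈ᴹ-trans (*ₗ-congʳ (*-comm _ c)) (*ₗ-assoc c _ u)))) _)) ⟩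
        sumᴹ (λ i → pow (z i) (suc a) (t i)) +ᴹ sumᴹ (λ i → - 1# *ₗ Y l (pow (z i) a (t i))) ≈⟨ sumᴹ-+ _ _ ⟨
        sumᴹ (λ i → pow (z i) (suc a) (t i) +ᴹ - 1# *ₗ Y l (pow (z i) a (t i)))
          ≈⟨ sumᴹ-cong (λ i → ≈ᴹ-sym (≈ᴹ-trans (P.+ᴹ-homo (z i) a _ _)
               (+ᴹ-congˡ (≈ᴹ-trans (P.*ₗ-homo (z i) a _ _) (*ₗ-congˡ (pow-ap (z i) a l nothing (t i))))))) ⟩
        sumᴹ (λ i → pow (z i) a (ap (z i) (just l) (t i))) ∎)
        (W°.+∈ _ (h (suc a)) (W°.*∈ _ (- 1#) (cast∈ (≡.sym (up-suc a d)) (Y∈ l (h a)))))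
        where module P z a = IsModuleHomomorphism (pow-linear z a)

    Relations : (Fin k → Fin n) → Vec (Cell r′) k → ℕ → Carrierᴹ → Set
    Relations ι [] d v = ⊤
    Relations ι ((false , _) ∷ cs) d v = Relations (ι ∘ suc) cs d v
    Relations ι ((true , ρ) ∷ cs) d v =
      aps (ι zero) F v ∈ W° (ups F d) × Relations (ι ∘ suc) cs d v
      where F = factors (true , ρ) (roots (ι ∘ suc) cs)

    relations-ap : ∀ (ι : Fin k → Fin n) cs {d v} z f → Relations ι cs d v → Relations ι cs (r ℕ.+ d) (ap z f v)
    relations-ap ι [] z f rs = tt
    relations-ap ι ((false , _) ∷ cs) z f rs = relations-ap (ι ∘ suc) cs z f rs
    relations-ap ι ((true , ρ) ∷ cs) {d} {v} z f (p , rs) =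
      cast∈ (≡.sym (ups-suc F d)) (W°.resp _ (≈ᴹ-sym (aps-ap (ι zero) F z f v)) (ap∈ z f p)) ,
      relations-ap (ι ∘ suc) cs z f rs
      where F = factors (true , ρ) (roots (ι ∘ suc) cs)

    -- A root meets the factor Y l - Y l. Any other element is annihilated by its own relation,
    -- which involves the later roots only; the earlier roots contribute further factors.
    product∈ : ∀ (ι : Fin k → Fin n) cs {d v} → Relations ι cs d v → ∀ l →
      aps (ι l) (justs (roots ι cs)) (Y (ι l) v) ∈ W° (ups (justs (roots ι cs)) (r ℕ.+ d))
    product∈ ι ((false , _) ∷ cs) {d} {v} rs zero =
      W°.resp _ (≈ᴹ-sym (≈ᴹ-trans (A.⟦⟧-cong vanish) A.0ᴹ-homo)) (W°.0∈ _) where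
      module A = IsModuleHomomorphism
        (aps-linear (ι zero) (justs (roots (ι ∘ suc) cs)))
      vanish : ap (ι zero) (just (ι zero)) (Y (ι zero) v) ≈ᴹ 0ᴹ
      vanish = ≈ᴹ-trans (+ᴹ-congˡ (-‿*ₗ (W° 0) _)) (-ᴹ‿inverseʳ _)
    product∈ ι ((false , _) ∷ cs) {d} {v} rs (suc l) =
      cast∈ (≡.sym (ups-suc (justs Λ) _))
        (W°.resp _ (≈ᴹ-sym (aps-difference (justs Λ)))
          (W°.+∈ _ (Y∈ _ ih) (W°.*∈ _ (- 1#) (Y∈ _ ih)))) where
      Λ = roots (ι ∘ suc) cs
      z = ι (suc l)
      ih = product∈ (ι ∘ suc) cs rs l
      aps-difference : ∀ fs → aps z fs (ap z (just (ι zero)) (Y z v)) ≈ᴹ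
                       Y z (aps z fs (Y z v)) +ᴹ - 1# *ₗ Y (ι zero) (aps z fs (Y z v))
      aps-difference fs = aps-ap z fs z (just (ι zero)) (Y z v)
    product∈ ι ((true , zero) ∷ cs) {d} {v} (p , rs) zero =
      cast∈ (≡.sym (ups-suc (justs (roots (ι ∘ suc) cs)) d))
        (W°.resp _ (≈ᴹ-sym (aps-ap (ι zero) (justs (roots (ι ∘ suc) cs)) (ι zero) nothing v)) (Y∈ (ι zero) p))
    product∈ ι ((true , suc _) ∷ cs) (p , rs) zero = p
    product∈ ι ((true , zero) ∷ cs) (p , rs) (suc l) = product∈ (ι ∘ suc) cs rs l
    product∈ ι ((true , suc _) ∷ cs) (p , rs) (suc l) = product∈ (ι ∘ suc) cs rs l

    -- Telescoping: Y z agrees with Y l on u and hence on all multiples of u by the operators.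
    pow-link : ∀ {d u} z l a → Y z u +ᴹ - 1# *ₗ Y l u ∈ W° (r ℕ.+ d) →
      pow z a (Y z u) +ᴹ - 1# *ₗ pow l a (Y l u) ∈ W° (up a (r ℕ.+ d))
    pow-link z l zero p = p
    pow-link {d} {u} z l (suc a) p = W°.resp _ (begin
      pow z a (Y z (ap z (just l) u)) +ᴹ (pow z a (Y z (Y l u)) +ᴹ - 1# *ₗ pow l a (Y l (Y l u)))
        ≈⟨ +ᴹ-congʳ (≈ᴹ-trans (P.⟦⟧-cong (Y.+ᴹ-homo z _ _)) (P.+ᴹ-homo _ _)) ⟩
      (pow z a (Y z (Y z u)) +ᴹ pow z a (Y z (- 1# *ₗ Y l u))) +ᴹ (pow z a (Y z (Y l u)) +ᴹ _)
        ≈⟨ +ᴹ-congʳ (+ᴹ-congˡ (≈ᴹ-trans (P.⟦⟧-cong (Y.*ₗ-homo z _ _)) (P.*ₗ-homo _ _))) ⟩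
      (A +ᴹ - 1# *ₗ B) +ᴹ (B +ᴹ C) ≈⟨ +ᴹ-assoc _ _ _ ⟩
      A +ᴹ (- 1# *ₗ B +ᴹ (B +ᴹ C)) ≈⟨ +ᴹ-congˡ (≈ᴹ-sym (+ᴹ-assoc _ _ _)) ⟩
      A +ᴹ ((- 1# *ₗ B +ᴹ B) +ᴹ C) ≈⟨ +ᴹ-congˡ (+ᴹ-congʳ (≈ᴹ-trans (+ᴹ-congʳ (-‿*ₗ (W° 0) B)) (-ᴹ‿inverseˡ B))) ⟩
      A +ᴹ (0ᴹ +ᴹ C) ≈⟨ +ᴹ-congˡ (+ᴹ-identityˡ C) ⟩
      A +ᴹ C ∎)
      (W°.+∈ _ (pow∈ z a (Y∈ z p))
        (pow-link z l a (W°.resp _ (Y-ap l z (just l) u) (Y∈ l p)))) where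
      module P = IsModuleHomomorphism (pow-linear z a)
      A = pow z a (Y z (Y z u))
      B = pow z a (Y z (Y l u))
      C = - 1# *ₗ pow l a (Y l (Y l u))

    module _ (fromℕ-unit : ∀ m → Unit (fromℕ (suc m))) where

      -- Modulo W°, every Y i acts on v as 0 or as the operator of an element still to be processed.
      -- The number w l + 1 counts the elements identified with ι l so far, itself included; its
      -- invertibility is used in `product-head`.
      record State {k} (ι : Fin k → Fin n) (cs : Vec (Cell r′) k) (w : Fin k → ℕ) (d : ℕ) (v : Carrierᴹ) : Set where
        field
          linked : ∀ i → Y i v ∈ W° (r ℕ.+ d) ⊎ ∃ λ l → ap i (just (ι l)) v ∈ W° (r ℕ.+ d)
          powerSums : ∀ a → sumᴹ (λ l → fromℕ (suc (w l)) *ₗ pow (ι l) (suc a) v) ∈ W° (up (suc a) d)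
          relations : Relations ι cs d v

      open State

      state-ap : ∀ {ι : Fin k → Fin n} {cs w d v} z f → State ι cs w d v → State ι cs w (r ℕ.+ d) (ap z f v)
      state-ap {ι = ι} {cs} {w} {d} {v} z f st = record
        { linked = λ i → link i (linked st i)
        ; powerSums = λ a → cast∈ (≡.sym (up-suc (suc a) d)) (W°.resp _ (≈ᴹ-sym (sums a)) (ap∈ z f (powerSums st a)))
        ; relations = relations-ap ι cs z f (relations st)
        } where
        link : ∀ i → Y i v ∈ W° (r ℕ.+ d) ⊎ ∃ (λ l → ap i (just (ι l)) v ∈ W° (r ℕ.+ d)) →
          Y i (ap z f v) ∈ W° (r ℕ.+ (r ℕ.+ d)) ⊎ ∃ (λ l → ap i (just (ι l)) (ap z f v) ∈ W° (r ℕ.+ (r ℕ.+ d)))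
        link i (inj₁ p) = inj₁ (W°.resp _ (≈ᴹ-sym (Y-ap i z f v)) (ap∈ z f p))
        link i (inj₂ (l , p)) = inj₂ (l , W°.resp _ (ap-ap z f i (just (ι l)) v) (ap∈ z f p))
        module A = IsModuleHomomorphism (ap-linear z f)
        sums : ∀ a → sumᴹ (λ l → fromℕ (suc (w l)) *ₗ pow (ι l) (suc a) (ap z f v)) ≈ᴹ
                     ap z f (sumᴹ (λ l → fromℕ (suc (w l)) *ₗ pow (ι l) (suc a) v))
        sums a = ≈ᴹ-trans
          (sumᴹ-cong λ l → ≈ᴹ-trans (*ₗ-congˡ (pow-ap (ι l) (suc a) z f v)) (≈ᴹ-sym (A.*ₗ-homo _ _)))
          (≈ᴹ-sym (sumᴹ-linear (ap z f) (ap-linear z f) _))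

      Spanned : (Fin k → Fin n) → Vec (Cell r′) k → ℕ → Carrierᴹ → Set
      Spanned {k} ι cs d v = ∀ {q} (c : Code r′ k q) → shape c ≡ cs → selem ι c v ∈ W (sdeg ι c d)

      Target : (Fin (suc k) → Fin n) → Maybe (Fin n) → Set
      Target ι nothing = ⊤
      Target ι (just l) = ∃ λ l′ → l ≡ ι (suc l′)

      tails : ∀ {ι : Fin (suc k) → Fin n} {cs d v} p → Relations ι (p ∷ cs) d v → Relations (ι ∘ suc) cs d v
      tails (false , _) rs = rs
      tails (true , _) rs = proj₂ rs

      -- Once v is linked at its first element, that element may be dropped: its weight is
      -- carried over to the element it is linked to.
      drop : ∀ {ι : Fin (suc k) → Fin n} {p cs w d v} f → Target ι f → State ι (p ∷ cs) w d v → ap (ι zero) f v ∈ W° (r ℕ.+ d) →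
        ∃ λ w′ → State (ι ∘ suc) cs w′ d v
      drop {ι = ι} {p} {cs} {w} {d} {v} nothing _ st z∈ = w ∘ suc , record
        { linked = λ i → link i (linked st i)
        ; powerSums = λ a → difference∈ (W° _) (W°.resp _ (≈ᴹ-trans (sumᴹ-∷ _) (+ᴹ-comm _ _)) (powerSums st a))
            (W°.*∈ _ _ (pow∈ (ι zero) a z∈))
        ; relations = tails {ι = ι} p (relations st)
        } where
        link : ∀ i → Y i v ∈ W° (r ℕ.+ d) ⊎ ∃ (λ l → ap i (just (ι l)) v ∈ W° (r ℕ.+ d)) →
          Y i v ∈ W° (r ℕ.+ d) ⊎ ∃ (λ l → ap i (just (ι (suc l))) v ∈ W° (r ℕ.+ d))
        link i (inj₁ q) = inj₁ q
        link i (inj₂ (suc l , q)) = inj₂ (l , q)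
        link i (inj₂ (zero , q)) = inj₁ (difference∈ (W° _) q (W°.*∈ _ (- 1#) z∈))
      drop {k} {ι = ι} {p} {cs} {w} {d} {v} (just _) (l′ , ≡.refl) st z∈ = w′ , record
        { linked = λ i → link i (linked st i)
        ; powerSums = λ a → W°.resp _ (sums a)
            (W°.+∈ _ (W°.resp _ (sumᴹ-∷ _) (powerSums st a))
              (W°.*∈ _ (- 1# * fromℕ (suc (w zero))) (pow-link {d} {v} (ι zero) (ι (suc l′)) a z∈)))
        ; relations = tails {ι = ι} p (relations st)
        } where
        link : ∀ i → Y i v ∈ W° (r ℕ.+ d) ⊎ ∃ (λ l → ap i (just (ι l)) v ∈ W° (r ℕ.+ d)) →
          Y i v ∈ W° (r ℕ.+ d) ⊎ ∃ (λ l → ap i (just (ι (suc l))) v ∈ W° (r ℕ.+ d))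
        link i (inj₁ q) = inj₁ q
        link i (inj₂ (suc l , q)) = inj₂ (l , q)
        link i (inj₂ (zero , q)) = inj₂ (l′ , W°.resp _ (begin
          (Y i v +ᴹ - 1# *ₗ Y (ι zero) v) +ᴹ (Y (ι zero) v +ᴹ - 1# *ₗ Y (ι (suc l′)) v) ≈⟨ +ᴹ-assoc _ _ _ ⟩
          Y i v +ᴹ (- 1# *ₗ Y (ι zero) v +ᴹ (Y (ι zero) v +ᴹ - 1# *ₗ Y (ι (suc l′)) v)) ≈⟨ +ᴹ-congˡ (+ᴹ-assoc _ _ _) ⟨
          Y i v +ᴹ ((- 1# *ₗ Y (ι zero) v +ᴹ Y (ι zero) v) +ᴹ - 1# *ₗ Y (ι (suc l′)) v)
            ≈⟨ +ᴹ-congˡ (+ᴹ-congʳ (≈ᴹ-trans (+ᴹ-congʳ (-‿*ₗ (W° 0) _)) (-ᴹ‿inverseˡ _))) ⟩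
          Y i v +ᴹ (0ᴹ +ᴹ - 1# *ₗ Y (ι (suc l′)) v) ≈⟨ +ᴹ-congˡ (+ᴹ-identityˡ _) ⟩
          Y i v +ᴹ - 1# *ₗ Y (ι (suc l′)) v ∎) (W°.+∈ _ q z∈))
        extra : Fin k → ℕ
        extra l with l Fin.≟ l′
        ... | yes _ = suc (w zero)
        ... | no _ = 0
        extra-same : extra l′ ≡ suc (w zero)
        extra-same with l′ Fin.≟ l′
        ... | yes _ = ≡.refl
        ... | no ¬e = contradiction ≡.refl ¬e
        extra-other : ∀ l → l ≢ l′ → extra l ≡ 0
        extra-other l l≢ with l Fin.≟ l′
        ... | yes e = contradiction e l≢
        ... | no _ = ≡.refl
        w′ : Fin k → ℕ
        w′ l = w (suc l) ℕ.+ extra l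
        sums : ∀ a → (fromℕ (suc (w zero)) *ₗ pow (ι zero) (suc a) v +ᴹ
                       sumᴹ (λ l → fromℕ (suc (w (suc l))) *ₗ pow (ι (suc l)) (suc a) v)) +ᴹ
                     (- 1# * fromℕ (suc (w zero))) *ₗ
                       (pow (ι zero) (suc a) v +ᴹ - 1# *ₗ pow (ι (suc l′)) (suc a) v)
                     ≈ᴹ sumᴹ (λ l → fromℕ (suc (w′ l)) *ₗ pow (ι (suc l)) (suc a) v)
        sums a = begin
          (c *ₗ P +ᴹ Σ) +ᴹ (- 1# * c) *ₗ (P +ᴹ - 1# *ₗ Q) ≈⟨ +ᴹ-congˡ (*ₗ-distribˡ _ _ _) ⟩
          (c *ₗ P +ᴹ Σ) +ᴹ ((- 1# * c) *ₗ P +ᴹ (- 1# * c) *ₗ (- 1# *ₗ Q))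
            ≈⟨ +ᴹ-congˡ (+ᴹ-cong (*ₗ-assoc _ _ _) (≈ᴹ-trans (≈ᴹ-sym (*ₗ-assoc _ _ _)) (*ₗ-congʳ
                 (Solver.solve K 1 (λ c → (:- :1 :* c) :* (:- :1) := c) (CommutativeRing.refl K) c)))) ⟩
          (c *ₗ P +ᴹ Σ) +ᴹ (- 1# *ₗ (c *ₗ P) +ᴹ c *ₗ Q) ≈⟨ +ᴹ-congʳ (+ᴹ-comm _ _) ⟩
          (Σ +ᴹ c *ₗ P) +ᴹ (- 1# *ₗ (c *ₗ P) +ᴹ c *ₗ Q) ≈⟨ +ᴹ-assoc _ _ _ ⟩
          Σ +ᴹ (c *ₗ P +ᴹ (- 1# *ₗ (c *ₗ P) +ᴹ c *ₗ Q)) ≈⟨ +ᴹ-congˡ (+ᴹ-assoc _ _ _) ⟨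
          Σ +ᴹ ((c *ₗ P +ᴹ - 1# *ₗ (c *ₗ P)) +ᴹ c *ₗ Q)
            ≈⟨ +ᴹ-congˡ (+ᴹ-congʳ (≈ᴹ-trans (+ᴹ-congˡ (-‿*ₗ (W° 0) _)) (-ᴹ‿inverseʳ _))) ⟩
          Σ +ᴹ (0ᴹ +ᴹ c *ₗ Q) ≈⟨ +ᴹ-congˡ (+ᴹ-identityˡ _) ⟩
          Σ +ᴹ c *ₗ Q ≈⟨ +ᴹ-congˡ (*ₗ-congʳ (CommutativeRing.reflexive K (≡.cong fromℕ (≡.sym extra-same)))) ⟩
          Σ +ᴹ fromℕ (extra l′) *ₗ Q ≈⟨ +ᴹ-congˡ (sumᴹ-single l′ (λ l → fromℕ (extra l) *ₗ pow (ι (suc l)) (suc a) v)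
                 (λ l l≢ → ≈ᴹ-trans (*ₗ-congʳ (CommutativeRing.reflexive K (≡.cong fromℕ (extra-other l l≢)))) (*ₗ-zeroˡ _))) ⟨
          Σ +ᴹ sumᴹ (λ l → fromℕ (extra l) *ₗ pow (ι (suc l)) (suc a) v) ≈⟨ sumᴹ-+ _ _ ⟨
          sumᴹ (λ l → fromℕ (suc (w (suc l))) *ₗ pow (ι (suc l)) (suc a) v +ᴹ fromℕ (extra l) *ₗ pow (ι (suc l)) (suc a) v)
            ≈⟨ sumᴹ-cong (λ l → ≈ᴹ-trans (≈ᴹ-sym (*ₗ-distribʳ _ _ _))
                 (*ₗ-congʳ (CommutativeRing.sym K (fromℕ-+ (suc (w (suc l))) (extra l))))) ⟩
          sumᴹ (λ l → fromℕ (suc (w′ l)) *ₗ pow (ι (suc l)) (suc a) v) ∎ where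
          open Solver K using (:-_; :1; _:*_; _:=_)
          c = fromℕ (suc (w zero))
          P = pow (ι zero) (suc a) v
          Q = pow (ι (suc l′)) (suc a) v
          Σ = sumᴹ (λ l → fromℕ (suc (w (suc l))) *ₗ pow (ι (suc l)) (suc a) v)

      -- For an element that starts a block, `moments` turns the weighted power sums into a sum of
      -- products. By `product∈` all terms but the first lie in W°, and the weight of the first is
      -- invertible. For the other elements this is the relation.
      product-head : ∀ {ι : Fin (suc k) → Fin n} {p cs w d v} → State ι (p ∷ cs) w d v →
        aps (ι zero) (factors p (roots (ι ∘ suc) cs)) v ∈ W° (ups (factors p (roots (ι ∘ suc) cs)) d)
      product-head {p = true , _} st = proj₁ (relations st)
      product-head {ι = ι} {p = false , _} {cs} {w} {d} {v} st =
        W°.resp _ (≈ᴹ-trans (≈ᴹ-sym (*ₗ-assoc _ _ _)) (≈ᴹ-trans (*ₗ-congʳ (CommutativeRing.trans K (*-comm _ _) (proj₂ u))) (*ₗ-identityˡ _)))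
          (W°.*∈ _ (proj₁ u) (W°.resp _ (A.*ₗ-homo (ι zero) _ _) (summand∈ (W° _) zero _ total others))) where
        Λ = roots (ι ∘ suc) cs
        u = fromℕ-unit (w zero)
        t : Fin _ → Carrierᴹ
        t l = fromℕ (suc (w l)) *ₗ Y (ι l) v
        module A z = IsModuleHomomorphism (aps-linear z (justs Λ))
        module P z a = IsModuleHomomorphism (pow-linear z a)
        total : sumᴹ (λ l → aps (ι l) (justs Λ) (t l)) ∈ W° (ups (justs Λ) (r ℕ.+ d))
        total = moments ι t (r ℕ.+ d) (λ a → W°.resp _ (sumᴹ-cong λ l → ≈ᴹ-sym (P.*ₗ-homo (ι l) a _ _)) (powerSums st a)) Λ
        others : ∀ l → l ≢ zero → aps (ι l) (justs Λ) (t l) ∈ W° (ups (justs Λ) (r ℕ.+ d))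
        others zero l≢ = contradiction ≡.refl l≢
        others (suc l) _ = W°.resp _ (≈ᴹ-sym (A.*ₗ-homo (ι (suc l)) _ _)) (W°.*∈ _ _ (product∈ (ι ∘ suc) cs (relations st) l))

      targets : ∀ (ι : Fin (suc k) → Fin n) (p : Cell r′) (cs : Vec (Cell r′) k) → All (Target ι) (factors p (roots (ι ∘ suc) cs))
      targets ι (true , zero) cs = go (ι ∘ suc) cs (λ l → l , ≡.refl) where
        go : ∀ {j} (κ : Fin j → Fin n) (cs : Vec (Cell r′) j) → (∀ l → ∃ λ l′ → κ l ≡ ι (suc l′)) → All (Target ι) (justs (roots κ cs))
        go κ [] h = []
        go κ ((false , _) ∷ cs) h = h zero ∷ go (κ ∘ suc) cs (h ∘ suc)
        go κ ((true , _) ∷ cs) h = go (κ ∘ suc) cs (h ∘ suc)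
      targets ι (true , suc _) cs = tt ∷ targets ι (true , zero) cs
      targets ι (false , _) cs = tt ∷ targets ι (true , zero) cs

      -- Induction on the number of unprocessed elements. The condition on v is replaced by
      -- conditions on the products of v with initial segments of the factors of its first element,
      -- one for each way to extend a code of the rest.
      straight : ∀ (ι : Fin k → Fin n) cs w d v → State ι cs w d v → Spanned ι cs d v → v ∈ W° d
      -- Induction on the factors: the remaining factors send `ap (ι zero) f v` into W°, so this
      -- element itself lies in W°, and this says that v is linked at its first element, which can
      -- then be dropped.
      descend : ∀ (ι : Fin (suc k) → Fin n) p cs w d v → State ι (p ∷ cs) w d v →
        ∀ fs → All (Target ι) fs → aps (ι zero) fs v ∈ W° (ups fs d) →
        (∀ t → t ℕ.< length fs → Spanned (ι ∘ suc) cs (ups (take t fs) d) (aps (ι zero) (take t fs) v)) →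
        v ∈ W° d

      descend ι p cs w d v st [] tg full sp = full
      descend ι p cs w d v st (f ∷ fs) (tf ∷ tg) full sp =
        let w′ , st′ = drop f tf st v₁∈ in straight (ι ∘ suc) cs w′ d v st′ (sp 0 (s≤s z≤n)) where
        v₁∈ : ap (ι zero) f v ∈ W° (r ℕ.+ d)
        v₁∈ = descend ι p cs w (r ℕ.+ d) (ap (ι zero) f v) (state-ap (ι zero) f st) fs tg full
                (λ t t< → sp (suc t) (s≤s t<))

      straight {zero} ι [] w d v st sp [] = sp [] ≡.refl
      -- No element is left to be linked to, so every Y i sends v into W°; the spanning hypothesis
      -- is used for the empty word.
      straight {zero} ι [] w d v st sp (i ∷ α) with linked st i
      ... | inj₁ p = p α
      straight {suc k} ι (p ∷ cs) w d v st sp =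
        descend ι p cs w d v st (factors p Λ) (targets ι p cs) (product-head st) spans where
        Λ = roots (ι ∘ suc) cs
        spans : ∀ t → t ℕ.< length (factors p Λ) →
          Spanned (ι ∘ suc) cs (ups (take t (factors p Λ)) d) (aps (ι zero) (take t (factors p Λ)) v)
        spans t t< {q} c ≡.refl = pick p t t< sp where
          slot : ∀ {t} → t ℕ.< length (justs Λ) → t ℕ.< q
          slot {t} = ≡.subst (t ℕ.<_) (≡.trans (List.length-map just Λ) (roots-length (ι ∘ suc) c))
          slot⁺ : ∀ {t} → t ℕ.< suc (length (justs Λ)) → t ℕ.< suc q
          slot⁺ {t} = ≡.subst (λ l → t ℕ.< suc l) (≡.trans (List.length-map just Λ) (roots-length (ι ∘ suc) c))
          result : Cell r′ → ℕ → Set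
          result p t = selem (ι ∘ suc) c (aps (ι zero) (take t (factors p Λ)) v) ∈
                       W (sdeg (ι ∘ suc) c (ups (take t (factors p Λ)) d))
          -- The number t of factors applied names the extension of c: block t or gap t, but for a
          -- cell (true, suc ρ) the value 0 means the zero block and t + 1 means block t.
          pick : ∀ p t → t ℕ.< length (factors p Λ) → Spanned ι (p ∷ cs) d v → result p t
          pick (true , zero) t t< sp =
            ≡.subst (result (true , zero)) (Fin.toℕ-fromℕ< (slot t<)) (sp (joi (fromℕ< (slot t<)) zero c) ≡.refl)
          pick (true , suc ρ) zero t< sp = sp (zer ρ c) ≡.refl
          pick (true , suc ρ) (suc t) (s≤s t<) sp =
            ≡.subst (λ t → result (true , suc ρ) (suc t)) (Fin.toℕ-fromℕ< (slot t<)) (sp (joi (fromℕ< (slot t<)) (suc ρ) c) ≡.refl)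
          pick (false , ρ) t t< sp =
            ≡.subst (result (false , ρ)) (Fin.toℕ-fromℕ< (slot⁺ t<)) (sp (new (fromℕ< (slot⁺ t<)) ρ c) ≡.refl)

-- Bijection between codes and partitions

unique⇒lookup-injective : ∀ {A : Set} {xs : List A} → Unique xs → ∀ {i j} → List.lookup xs i ≡ List.lookup xs j → i ≡ j
unique⇒lookup-injective (_ ∷ _) {zero} {zero} e = ≡.refl
unique⇒lookup-injective (p ∷ _) {zero} {suc j} e = contradiction e (All.lookup p (∈.∈-lookup j))
unique⇒lookup-injective (p ∷ _) {suc i} {zero} e = contradiction (≡.sym e) (All.lookup p (∈.∈-lookup i))
unique⇒lookup-injective (_ ∷ ps) {suc i} {suc j} e = ≡.cong suc (unique⇒lookup-injective ps e)

module Codes (r′ : ℕ) where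
  open ≡ using (refl; sym; trans; cong; cong₂; subst)

  r : ℕ
  r = suc r′

  shift : Fin (suc q) → Place r q → Place r (suc q)
  shift e = Sum.map id λ (b , ρ) → punchIn e b , ρ

  shift-injective : ∀ (e : Fin (suc q)) {p p′} → shift e p ≡ shift e p′ → p ≡ p′
  shift-injective e {inj₁ _} {inj₁ _} refl = refl
  shift-injective e {inj₂ (b , ρ)} {inj₂ (b′ , ρ′)} eq =
    cong inj₂ (cong₂ _,_ (Fin.punchIn-injective e b b′ (cong proj₁ (Sum.inj₂-injective eq)))
                         (cong proj₂ (Sum.inj₂-injective eq)))

  enc : Code r′ k q → Vec (Place r q) k
  enc [] = []
  enc (zer c t) = inj₁ c ∷ enc t
  enc (joi b ρ t) = inj₂ (b , ρ) ∷ enc t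
  enc (new e ρ t) = inj₂ (e , ρ) ∷ Vec.map (shift e) (enc t)

  enc-nonempty : (c : Code r′ k q) → NoEmptyBlock (enc c)
  enc-nonempty (zer c t) j = let i , ρ′ , eq = enc-nonempty t j in suc i , ρ′ , eq
  enc-nonempty (joi b ρ t) j = let i , ρ′ , eq = enc-nonempty t j in suc i , ρ′ , eq
  enc-nonempty (new e ρ t) j with e Fin.≟ j
  ... | yes refl = zero , ρ , refl
  ... | no e≢j =
    let i , ρ′ , eq = enc-nonempty t (punchOut e≢j)
    in suc i , ρ′ , trans (Vec.lookup-map i (shift e) (enc t))
         (trans (cong (shift e) eq) (cong (λ b → inj₂ (b , ρ′)) (Fin.punchIn-punchOut e≢j)))

  private
    avoids : ∀ e (v : Vec (Place r q) k) i ρ → lookup (Vec.map (shift e) v) i ≢ inj₂ (e , ρ)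
    avoids e v i ρ eq with lookup v i | trans (sym (Vec.lookup-map i (shift e) v)) eq
    ... | inj₂ (b , _) | eq′ = Fin.punchInᵢ≢i e b (cong proj₁ (Sum.inj₂-injective eq′))

    map-shift-injective : ∀ e (v v′ : Vec (Place r q) k) → Vec.map (shift e) v ≡ Vec.map (shift e) v′ → v ≡ v′
    map-shift-injective e [] [] eq = refl
    map-shift-injective e (p ∷ v) (p′ ∷ v′) eq =
      cong₂ _∷_ (shift-injective e (Vec.∷-injectiveˡ eq)) (map-shift-injective e v v′ (Vec.∷-injectiveʳ eq))

    -- A joined block occurs again among the later elements, whereas `shift e` never produces the
    -- label e.
    joi≢new : ∀ b ρ (t : Code r′ k (suc q)) e (ρ′ : Fin r) (t′ : Code r′ k q) → enc (joi b ρ t) ≢ enc (new e ρ′ t′)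
    joi≢new b ρ t e ρ′ t′ eq with Vec.∷-injective eq
    ... | refl , eq′ = let i , ρ″ , at = enc-nonempty t e
                       in avoids e (enc t′) i ρ″ (trans (cong (λ v → lookup v i) (sym eq′)) at)

  enc-injective : (c c′ : Code r′ k q) → enc c ≡ enc c′ → c ≡ c′
  enc-injective [] [] eq = refl
  enc-injective (zer c t) (zer c′ t′) eq with Vec.∷-injective eq
  ... | refl , eq′ = cong (zer c) (enc-injective t t′ eq′)
  enc-injective (joi b ρ t) (joi b′ ρ′ t′) eq with Vec.∷-injective eq
  ... | refl , eq′ = cong (joi b ρ) (enc-injective t t′ eq′)
  enc-injective (new e ρ t) (new e′ ρ′ t′) eq with Vec.∷-injective eq
  ... | refl , eq′ = cong (new e ρ) (enc-injective t t′ (map-shift-injective e _ _ eq′))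
  enc-injective (joi b ρ t) (new e ρ′ t′) eq = contradiction eq (joi≢new b ρ t e ρ′ t′)
  enc-injective (new e ρ t) (joi b ρ′ t′) eq = contradiction (sym eq) (joi≢new b ρ′ t′ e ρ t)

  occurs? : (e : Fin (suc q)) (v : Vec (Place r (suc q)) k) →
    (∃ λ i → ∃ λ ρ → lookup v i ≡ inj₂ (e , ρ)) ⊎ (∃ λ v′ → v ≡ Vec.map (shift e) v′)
  occurs? e [] = inj₂ ([] , refl)
  occurs? e (p ∷ v) with occurs? e v
  occurs? e (p ∷ v) | inj₁ (i , ρ , eq) = inj₁ (suc i , ρ , eq)
  occurs? e (inj₁ c ∷ v) | inj₂ (v′ , eq) = inj₂ (inj₁ c ∷ v′ , cong (inj₁ c ∷_) eq)
  occurs? e (inj₂ (b , ρ) ∷ v) | inj₂ (v′ , eq) with e Fin.≟ b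
  ... | yes refl = inj₁ (zero , ρ , refl)
  ... | no e≢b = inj₂ (inj₂ (punchOut e≢b , ρ) ∷ v′ ,
                     cong₂ _∷_ (cong (λ b → inj₂ (b , ρ)) (sym (Fin.punchIn-punchOut e≢b))) eq)

  -- The first element joins its block or founds it according to whether the block meets the
  -- remaining elements, which `occurs?` decides. If it founds the block, the label is taken out of
  -- the labels of the rest.
  enc-surjective : (v : Vec (Place r q) k) → NoEmptyBlock v → ∃ λ c → enc c ≡ v
  enc-surjective {q = zero} [] ne = [] , refl
  enc-surjective {q = suc q} [] ne with ne zero
  ... | () , _
  enc-surjective (inj₁ c ∷ v) ne = let t , eq = enc-surjective v ne′ in zer c t , cong (inj₁ c ∷_) eq where
    ne′ : NoEmptyBlock v
    ne′ j with ne j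
    ... | suc i , ρ , eq = i , ρ , eq
  enc-surjective {q = suc q} (inj₂ (b , ρ) ∷ v) ne with occurs? b v
  ... | inj₁ (i₀ , ρ₀ , eq₀) = let t , eq = enc-surjective v ne′ in joi b ρ t , cong (inj₂ (b , ρ) ∷_) eq where
    ne′ : NoEmptyBlock v
    ne′ j with ne j
    ... | zero , ρ , refl = i₀ , ρ₀ , eq₀
    ... | suc i , ρ , eq = i , ρ , eq
  ... | inj₂ (v′ , refl) =
    let t , eq = enc-surjective v′ ne′ in new b ρ t , cong (λ v → inj₂ (b , ρ) ∷ Vec.map (shift b) v) eq where
    ne′ : NoEmptyBlock v′
    ne′ j with ne (punchIn b j)
    ... | zero , ρ , eq = contradiction (sym (cong proj₁ (Sum.inj₂-injective eq))) (Fin.punchInᵢ≢i b j)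
    ... | suc i , ρ , eq = i , ρ , shift-injective b (trans (sym (Vec.lookup-map i (shift b) v′)) eq)

  place-≟ : DecidableEquality (Place r q)
  place-≟ = Sum.≡-dec Fin._≟_ (Product.≡-dec Fin._≟_ Fin._≟_)

  noEmptyBlock? : (v : Vec (Place r q) k) → Dec (NoEmptyBlock v)
  noEmptyBlock? v = Fin.all? λ j → Fin.any? λ i → Fin.any? λ ρ → place-≟ (lookup v i) (inj₂ (j , ρ))

  module _ {n : ℕ} where

    -- The proof stored in `OP̃` is irrelevant; since the property is decidable, a usable proof can
    -- be recomputed.
    nonempty : (σ : OP̃ n r) → NoEmptyBlock (OP̃.place σ)
    nonempty (mkOP̃ _ v ne) = recompute (noEmptyBlock? v) ne

    op̃ : Code r′ n q → OP̃ n r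
    op̃ c = mkOP̃ _ (enc c) (enc-nonempty c)

    op̃-≡ : ∀ {v v′ : Vec (Place r q) n} .{ne} .{ne′} → v ≡ v′ → mkOP̃ q v ne ≡ mkOP̃ q v′ ne′
    op̃-≡ refl = refl

    code : (σ : OP̃ n r) → Code r′ n (OP̃.blocks σ)
    code σ = proj₁ (enc-surjective (OP̃.place σ) (nonempty σ))

    op̃-code : (σ : OP̃ n r) → op̃ (code σ) ≡ σ
    op̃-code σ = op̃-≡ (proj₂ (enc-surjective (OP̃.place σ) (nonempty σ)))

    code-op̃ : (c : Code r′ n q) → code (op̃ c) ≡ c
    code-op̃ c = enc-injective _ c (proj₂ (enc-surjective (enc c) (nonempty (op̃ c))))

    op̃-≟ : DecidableEquality (OP̃ n r)
    op̃-≟ (mkOP̃ k v _) (mkOP̃ k′ v′ _) with k ℕ.≟ k′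
    ... | no k≢k′ = no λ e → k≢k′ (cong OP̃.blocks e)
    ... | yes refl with Vec.≡-dec place-≟ v v′
    ... | yes refl = yes refl
    ... | no v≢v′ = no λ { refl → v≢v′ refl }

  extensions : ∃ (Code r′ k) → List (∃ (Code r′ (suc k)))
  extensions (q , t) =
    List.map (λ c → q , zer c t) (allFin r′) ++
    cartesianProductWith (λ b ρ → q , joi b ρ t) (allFin q) (allFin r) ++
    cartesianProductWith (λ e ρ → suc q , new e ρ t) (allFin (suc q)) (allFin r)

  codes : ∀ k → List (∃ (Code r′ k))
  codes zero = (0 , []) ∷ []
  codes (suc k) = concatMap extensions (codes k)

  codes-complete : (c : Code r′ k q) → (q , c) ∈ˡ codes k
  codes-complete [] = here refl
  codes-complete (zer c t) = ∈.∈-concatMap⁺ extensions (Any.map (λ { refl → ∈.∈-++⁺ˡ (∈.∈-map⁺ _ (∈.∈-allFin c)) }) (codes-complete t))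
  codes-complete (joi b ρ t) = ∈.∈-concatMap⁺ extensions (Any.map (λ { refl →
    ∈.∈-++⁺ʳ (List.map _ (allFin r′)) (∈.∈-++⁺ˡ (∈.∈-cartesianProductWith⁺ _ (∈.∈-allFin b) (∈.∈-allFin ρ))) }) (codes-complete t))
  codes-complete {q = suc q} (new e ρ t) = ∈.∈-concatMap⁺ extensions (Any.map (λ { refl →
    ∈.∈-++⁺ʳ (List.map _ (allFin r′)) (∈.∈-++⁺ʳ (cartesianProductWith (λ b ρ → q , joi b ρ t) (allFin q) (allFin r))
      (∈.∈-cartesianProductWith⁺ _ (∈.∈-allFin e) (∈.∈-allFin ρ))) }) (codes-complete t))

  module Enumeration (n : ℕ) where

    opaque
      all-op̃ : List (OP̃ n r)
      all-op̃ = deduplicate op̃-≟ (List.map (λ (_ , c) → op̃ c) (codes n))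

      all-op̃-unique : Unique all-op̃
      all-op̃-unique = deduplicate-! op̃-≟ _

      all-op̃-complete : ∀ σ → σ ∈ˡ all-op̃
      all-op̃-complete σ = ∈.∈-deduplicate⁺ op̃-≟
        (subst (_∈ˡ List.map (λ (_ , c) → op̃ c) (codes n)) (op̃-code σ) (∈.∈-map⁺ _ (codes-complete (code σ))))

    N : ℕ
    N = length all-op̃

    partition : Fin N → OP̃ n r
    partition = List.lookup all-op̃

    index : OP̃ n r → Fin N
    index σ = Any.index (all-op̃-complete σ)

    partition-index : ∀ σ → partition (index σ) ≡ σ
    partition-index σ = sym (Any.lookup-index (all-op̃-complete σ))

    partition-injective : ∀ {i j} → partition i ≡ partition j → i ≡ j
    partition-injective = unique⇒lookup-injective all-op̃-unique

    index-partition : ∀ i → index (partition i) ≡ i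
    index-partition i = partition-injective (partition-index (partition i))

-- Exponent vectors of superspace monomials

-- Exponents of the xᵢ together with the set of the θᵢ occurring.
Mon : ℕ → Set
Mon = Vec (ℕ × Bool)

bump mark : ℕ × Bool → ℕ × Bool
bump (a , j) = suc a , j
mark (a , _) = a , true

incr setθ : Fin k → Mon k → Mon k
incr i m = updateAt m i bump
setθ i m = updateAt m i mark

updateAt-comm : ∀ {A : Set} {f g : A → A} → (∀ c → f (g c) ≡ g (f c)) → ∀ (i j : Fin k) m →
  updateAt (updateAt m j g) i f ≡ updateAt (updateAt m i f) j g
updateAt-comm h zero zero (c ∷ m) = ≡.cong (_∷ m) (h c)
updateAt-comm h zero (suc j) (_ ∷ _) = ≡.refl
updateAt-comm h (suc i) zero (_ ∷ _) = ≡.refl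
updateAt-comm h (suc i) (suc j) (c ∷ m) = ≡.cong (c ∷_) (updateAt-comm h i j m)

unitMon : Mon k
unitMon = replicate _ (0 , false)

incrs : Fin k → ℕ → Mon k → Mon k
incrs i zero m = m
incrs i (suc a) m = incr i (incrs i a m)

incrs-zero : ∀ a b j (m : Mon k) → incrs zero a ((b , j) ∷ m) ≡ (a ℕ.+ b , j) ∷ m
incrs-zero zero b j m = ≡.refl
incrs-zero (suc a) b j m rewrite incrs-zero a b j m = ≡.refl

incrs-suc : ∀ (i : Fin k) a p (m : Mon k) → incrs (suc i) a (p ∷ m) ≡ p ∷ incrs i a m
incrs-suc i zero p m = ≡.refl
incrs-suc i (suc a) p m rewrite incrs-suc i a p m = ≡.refl

-- Weighted elementary symmetric polynomials and Newton's identities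

module Elementary (K : CommutativeRing 0ℓ 0ℓ) where
  open CommutativeRing K hiding (zero)
  open LinearAlgebra K
  open Solver K
  open SetoidReasoning setoid

  elem : (Fin q → Carrier) → ℕ → Carrier
  elem Y zero = 1#
  elem {zero} Y (suc a) = 0#
  elem {suc q} Y (suc a) = elem (Y ∘ suc) (suc a) + Y zero * elem (Y ∘ suc) a

  -- The sum over all B of size a of (Σ_{b ∈ B} w b) · ∏_{b ∈ B} Y b.
  welem : (w Y : Fin q → Carrier) → ℕ → Carrier
  welem w Y zero = 0#
  welem {zero} w Y (suc a) = 0#
  welem {suc q} w Y (suc a) = welem (w ∘ suc) (Y ∘ suc) (suc a) +
    Y zero * (welem (w ∘ suc) (Y ∘ suc) a + w zero * elem (Y ∘ suc) a)

  wpower : (w Y : Fin q → Carrier) → ℕ → Carrier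
  wpower w Y a = sum λ b → w b * Y b ^ suc a

  -- alternating P e a = Σ_{i ≤ a} (-1)ⁱ Pᵢ e_{a-i}
  alternating : (P e : ℕ → Carrier) → ℕ → Carrier
  alternating P e zero = P 0 * e 0
  alternating P e (suc a) = P 0 * e (suc a) + - alternating (P ∘ suc) e a

  alternating-cong : ∀ {P P′ e e′ : ℕ → Carrier} → (∀ i → P i ≈ P′ i) → (∀ i → e i ≈ e′ i) →
    ∀ a → alternating P e a ≈ alternating P′ e′ a
  alternating-cong p q zero = *-cong (p 0) (q 0)
  alternating-cong p q (suc a) = +-cong (*-cong (p 0) (q (suc a))) (-‿cong (alternating-cong (p ∘ suc) q a))

  alternating-+ : ∀ (P P′ e : ℕ → Carrier) a → alternating (λ i → P i + P′ i) e a ≈ alternating P e a + alternating P′ e a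
  alternating-+ P P′ e zero = distribʳ _ _ _
  alternating-+ P P′ e (suc a) = trans (+-congˡ (-‿cong (alternating-+ (P ∘ suc) (P′ ∘ suc) e a)))
    (solve 5 (λ p p′ e u v → (p :+ p′) :* e :+ :- (u :+ v) := (p :* e :+ :- u) :+ (p′ :* e :+ :- v)) refl _ _ _ _ _)

  alternating-zero : ∀ {P : ℕ → Carrier} e → (∀ i → P i ≈ 0#) → ∀ a → alternating P e a ≈ 0#
  alternating-zero e z zero = trans (*-congʳ (z 0)) (zeroˡ _)
  alternating-zero e z (suc a) = trans (+-cong (trans (*-congʳ (z 0)) (zeroˡ _)) (-‿cong (alternating-zero e (z ∘ suc) a)))
    (solve 0 (:0 :+ :- :0 := :0) refl)

  private
    -- Coefficients of the generating function of e multiplied by 1 + y t: the effect of a new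
    -- variable y on elementary symmetric polynomials.
    shifted : (ℕ → Carrier) → Carrier → ℕ → Carrier
    shifted e y zero = e 0
    shifted e y (suc a) = e (suc a) + y * e a

    alternating-shift : ∀ (P e : ℕ → Carrier) y a →
      alternating P (shifted e y) (suc a) ≈ alternating P e (suc a) + y * alternating P e a
    alternating-shift P e y zero = solve 5 (λ p p′ e e′ y →
        p :* (e′ :+ y :* e) :+ :- (p′ :* e) := (p :* e′ :+ :- (p′ :* e)) :+ y :* (p :* e)) refl (P 0) (P 1) (e 0) (e 1) y
    alternating-shift P e y (suc a) = trans (+-congˡ (-‿cong (alternating-shift (P ∘ suc) e y a)))
      (solve 6 (λ p e e′ y u v → p :* (e′ :+ y :* e) :+ :- (u :+ y :* v) := (p :* e′ :+ :- u) :+ y :* (p :* e :+ :- v))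
        refl (P 0) (e (suc a)) (e (suc (suc a))) y _ _)

    -- The terms coming from the power sums of the new variable telescope.
    alternating-powers : ∀ w y s e a → alternating (λ i → w * (s * y ^ suc i)) (shifted e y) a ≈ w * (s * (y * e a))
    alternating-powers w y s e zero = solve 4 (λ w s y e → (w :* (s :* (y :* :1))) :* e := w :* (s :* (y :* e))) refl w s y (e 0)
    alternating-powers w y s e (suc a) = trans
      (+-congˡ (-‿cong (trans (alternating-cong (λ i → *-congˡ (x∙yz≈xy∙z s y _)) (λ _ → refl) a)
        (alternating-powers w y (s * y) e a))))
      (solve 5 (λ w s y e e′ → (w :* (s :* (y :* :1))) :* (e′ :+ y :* e) :+ :- (w :* ((s :* y) :* (y :* e))) :=
                 w :* (s :* (y :* e′))) refl w s y (e a) (e (suc a)))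

  elem-shifted : ∀ (Y : Fin (suc q) → Carrier) i → elem Y i ≈ shifted (elem (Y ∘ suc)) (Y zero) i
  elem-shifted Y zero = refl
  elem-shifted Y (suc i) = refl

  -- Both sides are the coefficient of tᵃ in Σ_b w b Y b / (1 + Y b t) times the product of all 1 +
  -- Y b t. The induction adds one variable at a time.
  newton : ∀ (w Y : Fin q → Carrier) a → welem w Y (suc a) ≈ alternating (wpower w Y) (elem Y) a
  newton {zero} w Y a = sym (alternating-zero _ (λ i → sum-[] _) a)
  newton {suc q} w Y a = sym (begin
    alternating (wpower w Y) (elem Y) a ≈⟨ alternating-cong (λ i → sum-∷ _) (elem-shifted Y) a ⟩
    alternating (λ i → w zero * Y zero ^ suc i + wpower w′ Y′ i) (shifted e y) a ≈⟨ alternating-+ _ _ _ a ⟩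
    alternating (λ i → w zero * Y zero ^ suc i) (shifted e y) a + alternating (wpower w′ Y′) (shifted e y) a
      ≈⟨ +-cong (trans (alternating-cong (λ i → *-congˡ (sym (*-identityˡ _))) (λ _ → refl) a)
                  (trans (alternating-powers (w zero) y 1# e a) (*-congˡ (*-identityˡ _)))) (rest a) ⟩
    w zero * (y * e a) + (welem w′ Y′ (suc a) + y * welem w′ Y′ a)
      ≈⟨ solve 5 (λ w y e f g → w :* (y :* e) :+ (f :+ y :* g) := f :+ y :* (g :+ w :* e)) refl _ _ _ _ _ ⟩
    welem w Y (suc a) ∎) where
    w′ = w ∘ suc
    Y′ = Y ∘ suc
    y = Y zero
    e = elem Y′
    rest : ∀ a → alternating (wpower w′ Y′) (shifted e y) a ≈ welem w′ Y′ (suc a) + y * welem w′ Y′ a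
    rest zero = trans (sym (newton w′ Y′ 0)) (solve 2 (λ f y → f := f :+ y :* :0) refl _ y)
    rest (suc a) = trans (alternating-shift (wpower w′ Y′) e y a)
      (+-cong (sym (newton w′ Y′ (suc a))) (*-congˡ (sym (newton w′ Y′ a))))

-- Relabelled monomials and base monomials

lookup-incrs-same : ∀ (i : Fin k) a m → lookup (incrs i a m) i ≡ (a ℕ.+ proj₁ (lookup m i) , proj₂ (lookup m i))
lookup-incrs-same i zero m = ≡.refl
lookup-incrs-same i (suc a) m rewrite Vec.lookup∘updateAt i {bump} (incrs i a m) | lookup-incrs-same i a m = ≡.refl

lookup-incrs-other : ∀ (i j : Fin k) a m → j ≢ i → lookup (incrs i a m) j ≡ lookup m j
lookup-incrs-other i j zero m j≢i = ≡.refl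
lookup-incrs-other i j (suc a) m j≢i = ≡.trans (Vec.lookup∘updateAt′ j i {bump} j≢i (incrs i a m)) (lookup-incrs-other i j a m j≢i)

lookup-setθ-same : ∀ (i : Fin k) m → lookup (setθ i m) i ≡ (proj₁ (lookup m i) , true)
lookup-setθ-same i m = Vec.lookup∘updateAt i m

lookup-setθ-other : ∀ (i j : Fin k) m → j ≢ i → lookup (setθ i m) j ≡ lookup m j
lookup-setθ-other i j m j≢i = Vec.lookup∘updateAt′ j i j≢i m

injective⇒surjective : (u : Fin k → Fin k) → (∀ {i j} → u i ≡ u j → i ≡ j) → ∀ j → ∃ λ i → u i ≡ j
injective⇒surjective {suc k} u inj j with Fin.any? (λ i → u i Fin.≟ j)
... | yes hit = hit
... | no miss = contradiction
  (Fin.injective⇒≤ {f = λ i → punchOut (≢u i)} λ e → inj (Fin.punchOut-injective (≢u _) (≢u _) e)) (ℕ.<⇒≱ ℕ.≤-refl) where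
  ≢u : ∀ i → j ≢ u i
  ≢u i e = miss (i , ≡.sym e)

bits : Mon k → Vec Bool k
bits = Vec.map proj₂

bits-incrs : ∀ (i : Fin k) a m → bits (incrs i a m) ≡ bits m
bits-incrs i zero m = ≡.refl
bits-incrs i (suc a) m = ≡.trans (bits-incr i (incrs i a m)) (bits-incrs i a m) where
  bits-incr : ∀ (i : Fin k) m → bits (incr i m) ≡ bits m
  bits-incr zero (_ ∷ m) = ≡.refl
  bits-incr (suc i) (p ∷ m) = ≡.cong (proj₂ p ∷_) (bits-incr i m)

bits-setθ : ∀ (i : Fin k) {m m′} → bits m ≡ bits m′ → bits (setθ i m) ≡ bits (setθ i m′)
bits-setθ zero {_ ∷ m} {_ ∷ m′} e = ≡.cong (true ∷_) (Vec.∷-injectiveʳ e)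
bits-setθ (suc i) {_ ∷ m} {_ ∷ m′} e = ≡.cong₂ _∷_ (Vec.∷-injectiveˡ e) (bits-setθ i (Vec.∷-injectiveʳ e))

-- Exponents of the image of a monomial when each index i is replaced by ι i. The sign from
-- reordering the θ is kept apart in `relabelSign`.
relabel : (Fin k → Fin n) → Mon k → Mon n
relabel ι [] = unitMon
relabel ι ((a , true) ∷ m) = incrs (ι zero) a (setθ (ι zero) (relabel (ι ∘ suc) m))
relabel ι ((a , false) ∷ m) = incrs (ι zero) a (relabel (ι ∘ suc) m)

relabel-cong : ∀ {ι ι′ : Fin k → Fin n} → (∀ i → ι i ≡ ι′ i) → ∀ m → relabel ι m ≡ relabel ι′ m
relabel-cong e [] = ≡.refl
relabel-cong e ((a , true) ∷ m) rewrite e zero | relabel-cong (e ∘ suc) m = ≡.refl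
relabel-cong e ((a , false) ∷ m) rewrite e zero | relabel-cong (e ∘ suc) m = ≡.refl

lookup-unit : (i : Fin k) → lookup unitMon i ≡ (0 , false)
lookup-unit i = Vec.lookup-replicate i (0 , false)

lookup-relabel-other : ∀ (ι : Fin k → Fin n) m j → (∀ i → j ≢ ι i) → lookup (relabel ι m) j ≡ (0 , false)
lookup-relabel-other ι [] j h = lookup-unit j
lookup-relabel-other ι ((a , true) ∷ m) j h = ≡.trans (lookup-incrs-other (ι zero) j a _ (h zero))
  (≡.trans (lookup-setθ-other (ι zero) j (relabel (ι ∘ suc) m) (h zero)) (lookup-relabel-other (ι ∘ suc) m j (h ∘ suc)))
lookup-relabel-other ι ((a , false) ∷ m) j h = ≡.trans (lookup-incrs-other (ι zero) j a _ (h zero))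
  (lookup-relabel-other (ι ∘ suc) m j (h ∘ suc))

lookup-relabel : (ι : Fin k → Fin n) → (∀ {i j} → ι i ≡ ι j → i ≡ j) → ∀ m i → lookup (relabel ι m) (ι i) ≡ lookup m i
lookup-relabel ι inj ((a , true) ∷ m) zero
  rewrite lookup-incrs-same (ι zero) a (setθ (ι zero) (relabel (ι ∘ suc) m))
        | lookup-setθ-same (ι zero) (relabel (ι ∘ suc) m)
        | lookup-relabel-other (ι ∘ suc) m (ι zero) (λ i e → contradiction (inj e) λ ()) = ≡.cong (_, true) (ℕ.+-identityʳ a)
lookup-relabel ι inj ((a , false) ∷ m) zero
  rewrite lookup-incrs-same (ι zero) a (relabel (ι ∘ suc) m)
        | lookup-relabel-other (ι ∘ suc) m (ι zero) (λ i e → contradiction (inj e) λ ()) = ≡.cong (_, false) (ℕ.+-identityʳ a)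
lookup-relabel ι inj ((a , true) ∷ m) (suc i) =
  ≡.trans (lookup-incrs-other (ι zero) (ι (suc i)) a _ (λ e → contradiction (inj e) λ ()))
    (≡.trans (lookup-setθ-other (ι zero) (ι (suc i)) (relabel (ι ∘ suc) m) (λ e → contradiction (inj e) λ ()))
      (lookup-relabel (ι ∘ suc) (Fin.suc-injective ∘ inj) m i))
lookup-relabel ι inj ((a , false) ∷ m) (suc i) =
  ≡.trans (lookup-incrs-other (ι zero) (ι (suc i)) a _ (λ e → contradiction (inj e) λ ()))
    (lookup-relabel (ι ∘ suc) (Fin.suc-injective ∘ inj) m i)

bits-relabel : ∀ (ι : Fin k → Fin n) {m m′} → bits m ≡ bits m′ → bits (relabel ι m) ≡ bits (relabel ι m′)
bits-relabel ι {[]} {[]} e = ≡.refl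
bits-relabel ι {(a , j) ∷ m} {(a′ , j′) ∷ m′} e with Vec.∷-injectiveˡ e
bits-relabel ι {(a , true) ∷ m} {(a′ , true) ∷ m′} e | ≡.refl = ≡.trans (bits-incrs (ι zero) a _)
  (≡.trans (bits-setθ (ι zero) (bits-relabel (ι ∘ suc) (Vec.∷-injectiveʳ e))) (≡.sym (bits-incrs (ι zero) a′ _)))
bits-relabel ι {(a , false) ∷ m} {(a′ , false) ∷ m′} e | ≡.refl = ≡.trans (bits-incrs (ι zero) a _)
  (≡.trans (bits-relabel (ι ∘ suc) (Vec.∷-injectiveʳ e)) (≡.sym (bits-incrs (ι zero) a′ _)))

fullMon : Mon k
fullMon = replicate _ (0 , true)

updateAt-insertAt : ∀ {A : Set} {f : A → A} {c} (p : Fin (suc k)) i m →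
  updateAt (insertAt m p c) (punchIn p i) f ≡ insertAt (updateAt m i f) p c
updateAt-insertAt zero i m = ≡.refl
updateAt-insertAt (suc p) zero (_ ∷ m) = ≡.refl
updateAt-insertAt (suc p) (suc i) (a ∷ m) = ≡.cong (a ∷_) (updateAt-insertAt p i m)

incrs-insert : ∀ (p : Fin (suc k)) i a m → incrs (punchIn p i) a (insertAt m p (0 , false)) ≡ insertAt (incrs i a m) p (0 , false)
incrs-insert p i zero m = ≡.refl
incrs-insert p i (suc a) m = ≡.trans (≡.cong (incr (punchIn p i)) (incrs-insert p i a m)) (updateAt-insertAt p i _)

insert-unit : (p : Fin (suc k)) → insertAt (unitMon {k}) p (0 , false) ≡ unitMon
insert-unit zero = ≡.refl
insert-unit {suc k} (suc p) = ≡.cong ((0 , false) ∷_) (insert-unit p)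

relabel-punchIn : ∀ {j k} (p : Fin (suc k)) (ι : Fin j → Fin k) m →
  relabel (punchIn p ∘ ι) m ≡ insertAt (relabel ι m) p (0 , false)
relabel-punchIn p ι [] = ≡.sym (insert-unit p)
relabel-punchIn p ι ((a , true) ∷ m) = ≡.trans
  (≡.cong (λ m → incrs (punchIn p (ι zero)) a (setθ (punchIn p (ι zero)) m)) (relabel-punchIn p (ι ∘ suc) m))
  (≡.trans (≡.cong (incrs (punchIn p (ι zero)) a) (updateAt-insertAt p (ι zero) _)) (incrs-insert p (ι zero) a _))
relabel-punchIn p ι ((a , false) ∷ m) = ≡.trans
  (≡.cong (incrs (punchIn p (ι zero)) a) (relabel-punchIn p (ι ∘ suc) m)) (incrs-insert p (ι zero) a _)

weight₁ : Vec Bool k → ℕ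
weight₁ [] = 0
weight₁ (true ∷ b) = suc (weight₁ b)
weight₁ (false ∷ b) = weight₁ b

-- The sum of the positions of the entries true.
positions : Vec Bool k → ℕ
positions [] = 0
positions (_ ∷ b) = weight₁ b ℕ.+ positions b

weight₁-setθ : ∀ (i : Fin k) m → lookup (bits m) i ≡ false → weight₁ (bits (setθ i m)) ≡ suc (weight₁ (bits m))
weight₁-setθ zero ((_ , false) ∷ m) e = ≡.refl
weight₁-setθ (suc i) ((_ , true) ∷ m) e = ≡.cong suc (weight₁-setθ i m e)
weight₁-setθ (suc i) ((_ , false) ∷ m) e = weight₁-setθ i m e

positions-setθ : ∀ (i : Fin k) m → lookup (bits m) i ≡ false → positions (bits (setθ i m)) ≡ toℕ i ℕ.+ positions (bits m)
positions-setθ zero (_ ∷ m) e = ≡.refl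
positions-setθ (suc i) (_ ∷ m) e rewrite weight₁-setθ i m e | positions-setθ i m e =
  ≡.cong suc (≡.trans (≡.sym (ℕ.+-assoc (weight₁ (bits m)) (toℕ i) _))
    (≡.trans (≡.cong (ℕ._+ positions (bits m)) (ℕ.+-comm (weight₁ (bits m)) (toℕ i))) (ℕ.+-assoc (toℕ i) _ _)))

-- Exponents up to multiplication by yᵢ. With θ present, colour 0 stands for the exponent r - 1,
-- that is for dyᵢ, and colour c + 1 for the exponent c.
baseCell : Cell r′ → ℕ × Bool
baseCell (false , ρ) = toℕ ρ , false
baseCell {r′} (true , zero) = r′ , true
baseCell (true , suc c) = toℕ c , true

base : Vec (Cell r′) k → Mon k
base = Vec.map baseCell

-- For a cell j with θ this is the monomial u without θⱼ such that dyⱼ u is, up to sign, the base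
-- monomial if the colour is 0 and yⱼ times the base monomial otherwise.
lowered : Vec (Cell r′) k → Fin k → Mon k
lowered (p ∷ cs) zero = (toℕ (proj₂ p) , false) ∷ base cs
lowered (p ∷ cs) (suc j) = baseCell p ∷ lowered cs j

lowered-zero : ∀ (cs : Vec (Cell r′) k) j → lookup cs j ≡ (true , zero) → incrs j r′ (setθ j (lowered cs j)) ≡ base cs
lowered-zero {r′} ((true , zero) ∷ cs) zero ≡.refl = ≡.trans (incrs-zero r′ 0 true (base cs)) (≡.cong (λ a → (a , true) ∷ base cs) (ℕ.+-identityʳ r′))
lowered-zero {r′} (p ∷ cs) (suc j) e = ≡.trans (incrs-suc j r′ (baseCell p) _) (≡.cong (baseCell p ∷_) (lowered-zero cs j e))

lowered-suc : ∀ (cs : Vec (Cell r′) k) j c → lookup cs j ≡ (true , suc c) →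
  incrs j r′ (setθ j (lowered cs j)) ≡ incrs j (suc r′) (base cs)
lowered-suc {r′} ((true , suc c) ∷ cs) zero c ≡.refl = ≡.trans (incrs-zero r′ (suc (toℕ c)) true (base cs))
  (≡.trans (≡.cong (λ a → (a , true) ∷ base cs) (ℕ.+-suc r′ (toℕ c))) (≡.sym (incrs-zero (suc r′) (toℕ c) true (base cs))))
lowered-suc {r′} (p ∷ cs) (suc j) c e = ≡.trans (incrs-suc j r′ (baseCell p) _)
  (≡.trans (≡.cong (baseCell p ∷_) (lowered-suc cs j c e)) (≡.sym (incrs-suc j (suc r′) (baseCell p) _)))

lowered-bit : ∀ (cs : Vec (Cell r′) k) j → lookup (bits (lowered cs j)) j ≡ false
lowered-bit (_ ∷ cs) zero = ≡.refl
lowered-bit (_ ∷ cs) (suc j) = lowered-bit cs j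

base-bit : ∀ (cs : Vec (Cell r′) k) i → lookup (bits (base cs)) i ≡ proj₁ (lookup cs i)
base-bit ((false , _) ∷ cs) zero = ≡.refl
base-bit ((true , zero) ∷ cs) zero = ≡.refl
base-bit ((true , suc _) ∷ cs) zero = ≡.refl
base-bit (_ ∷ cs) (suc i) = base-bit cs i

lowered-other : ∀ (cs : Vec (Cell r′) k) j i → i ≢ j → lookup (bits (lowered cs j)) i ≡ proj₁ (lookup cs i)
lowered-other (_ ∷ cs) zero zero i≢j = contradiction ≡.refl i≢j
lowered-other (_ ∷ cs) zero (suc i) i≢j = base-bit cs i
lowered-other (p ∷ cs) (suc j) zero i≢j = base-bit (p ∷ cs) zero
lowered-other (_ ∷ cs) (suc j) (suc i) i≢j = lowered-other cs j i (i≢j ∘ ≡.cong suc)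

-- Every monomial is a product of powers of the yᵢ and a base monomial.
reduce : (P : Mon k → Set) → (∀ i m → P m → P (incrs i (suc r′) m)) →
  ∀ m → (∀ (cs : Vec (Cell r′) k) → bits (base cs) ≡ bits m → P (base cs)) → P m
reduce P step [] h = h [] ≡.refl
reduce {r′ = r′} P step ((a , j) ∷ m) h = reduce (λ m → P ((a , j) ∷ m))
  (λ i m p → ≡.subst P (incrs-suc i (suc r′) (a , j) m) (step (suc i) _ p)) m head where
  head : ∀ cs → bits (base cs) ≡ bits m → P ((a , j) ∷ base cs)
  head cs e = ≡.subst (λ a → P ((a , j) ∷ base cs)) (≡.trans (ℕ.+-comm ((a / suc r′) ℕ.* suc r′) (a % suc r′)) (≡.sym (ℕ.m≡m%n+[m/n]*n a (suc r′))))
    (iterate (a / suc r′) (a % suc r′) (≡.subst P (proj₂ canonical) (h (proj₁ canonical ∷ cs) (≡.trans (≡.cong bits (proj₂ canonical)) (≡.cong (j ∷_) e)))))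
    where
    canonical′ : ∀ j b → b ℕ.< suc r′ → ∃ λ (p : Cell r′) → base (p ∷ cs) ≡ (b , j) ∷ base cs
    canonical′ false b b< = (false , fromℕ< b<) , ≡.cong (λ b → (b , false) ∷ base cs) (Fin.toℕ-fromℕ< b<)
    canonical′ true b b< with b ℕ.≟ r′
    ... | yes ≡.refl = (true , zero) , ≡.refl
    ... | no b≢r′ = (true , suc (fromℕ< b<r′)) , ≡.cong (λ b → (b , true) ∷ base cs) (Fin.toℕ-fromℕ< b<r′)
      where b<r′ = ℕ.≤∧≢⇒< (ℕ.s≤s⁻¹ b<) b≢r′
    canonical = canonical′ j (a % suc r′) (ℕ.m%n<n a (suc r′))
    iterate : ∀ b a → P ((a , j) ∷ base cs) → P ((b ℕ.* suc r′ ℕ.+ a , j) ∷ base cs)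
    iterate zero a q = q
    iterate (suc b) a q = ≡.subst P (≡.trans (incrs-zero (suc r′) _ j (base cs)) (≡.cong (λ a → (a , j) ∷ base cs) (≡.sym (ℕ.+-assoc (suc r′) (b ℕ.* suc r′) a))))
      (step zero _ (iterate b a q))

-- Evaluation points, sums over vectors, and the properties of the ring

Bounded : ℕ → Vec ℕ q → Set
Bounded n w = ∀ b → 1 ℕ.≤ lookup w b × lookup w b ℕ.≤ n

-- For every sequence w of block sizes, a point at which the polynomials welem w take values
-- depending on the number of blocks only.
record Points (K : CommutativeRing 0ℓ 0ℓ) (n : ℕ) : Set where
  open CommutativeRing K
  open LinearAlgebra K using (Unit; fromℕ)
  open Elementary K using (welem)
  field
    point : ∀ {q} → Vec ℕ q → Fin q → Carrier
    level : ℕ → ℕ → Carrier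
    on-level : (w : Vec ℕ q) → Bounded n w → ∀ a → welem (fromℕ ∘ lookup w) (point w) (suc a) ≈ level q a
    nonzero : ∀ {q} (w : Vec ℕ q) → Bounded n w → ∀ b → Unit (point w b)
    separate : (w w′ : Vec ℕ q) → Bounded n w → Bounded n w′ → ∀ {b b′} → b ≢ b′ → Unit (point w b + - point w′ b′)

module VectorSums (K : CommutativeRing 0ℓ 0ℓ) where
  open CommutativeRing K hiding (zero)
  open LinearAlgebra K
  open SetoidReasoning setoid

  sumⱽ : ∀ {k m} → (Vec (Fin k) m → Carrier) → Carrier
  sumⱽ {m = zero} F = F []
  sumⱽ {m = suc m} F = sum λ a → sumⱽ λ u → F (a ∷ u)

  sumⱽ-cong : ∀ {k m} {F G : Vec (Fin k) m → Carrier} → (∀ u → F u ≈ G u) → sumⱽ F ≈ sumⱽ G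
  sumⱽ-cong {m = zero} e = e []
  sumⱽ-cong {m = suc m} e = sum-cong λ a → sumⱽ-cong λ u → e (a ∷ u)

  sumⱽ-*ˡ : ∀ {k m} c (F : Vec (Fin k) m → Carrier) → c * sumⱽ F ≈ sumⱽ (λ u → c * F u)
  sumⱽ-*ˡ {m = zero} c F = refl
  sumⱽ-*ˡ {m = suc m} c F = trans (sum-*ˡ c _) (sum-cong λ a → sumⱽ-*ˡ c λ u → F (a ∷ u))

  sumⱽ-zero : ∀ {k m} {F : Vec (Fin k) m → Carrier} → (∀ u → F u ≈ 0#) → sumⱽ F ≈ 0#
  sumⱽ-zero {m = zero} z = z []
  sumⱽ-zero {m = suc m} z = sum-zero λ a → sumⱽ-zero λ u → z (a ∷ u)

  sumⱽ-product : ∀ {k m} (g : Fin m → Fin k → Carrier) →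
    sumⱽ {k} {m} (λ u → product λ i → g i (lookup u i)) ≈ product λ i → sum (g i)
  sumⱽ-product {k} {zero} g = refl
  sumⱽ-product {k} {suc m} g = begin
    sum (λ a → sumⱽ λ u → g zero a * product (λ i → g (suc i) (lookup u i))) ≈⟨ sum-cong (λ a → sumⱽ-*ˡ {k} {m} (g zero a) (λ u → product (λ i → g (suc i) (lookup u i)))) ⟨
    sum (λ a → g zero a * sumⱽ (λ u → product (λ i → g (suc i) (lookup u i)))) ≈⟨ sum-cong (λ a → *-congˡ (sumⱽ-product (g ∘ suc))) ⟩
    sum (λ a → g zero a * product (λ i → sum (g (suc i)))) ≈⟨ sum-*ʳ _ _ ⟨
    sum (g zero) * product (λ i → sum (g (suc i))) ∎

  unit-product : ∀ {m} (f : Fin m → Carrier) → (∀ i → Unit (f i)) → Unit (product f)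
  unit-product {zero} f h = unit-1
  unit-product {suc m} f h = unit-* (h zero) (unit-product (f ∘ suc) (h ∘ suc))

  zero-product : ∀ {m} (f : Fin m → Carrier) i → f i ≈ 0# → product f ≈ 0#
  zero-product f zero z = trans (*-congʳ z) (zeroˡ _)
  zero-product f (suc i) z = trans (*-congˡ (zero-product (f ∘ suc) i z)) (zeroʳ _)

  sum-const : ∀ k c → sum {k} (λ _ → c) ≈ fromℕ k * c
  sum-const zero c = trans (sum-[] _) (sym (zeroˡ c))
  sum-const (suc k) c = trans (sum-∷ _) (trans (+-cong (sym (*-identityˡ c)) (sum-const k c)) (sym (distribʳ c _ _)))

record Setting (K : CommutativeRing 0ℓ 0ℓ) (n r′ : ℕ) (ζ : CommutativeRing.Carrier K) : Set where
  open CommutativeRing K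
  open LinearAlgebra K
  field
    local : IsLocal
    fromℕ-unit : ∀ m → Unit (fromℕ (suc m))
    ζʳ : ζ ^ suc r′ ≈ 1#
    root-unit : ∀ k → 0 ℕ.< k → k ℕ.< suc r′ → Unit (1# + - (ζ ^ k))
    points : Points K n

  half : Unit (1# + 1#)
  half = unit-cong (+-congˡ (+-identityʳ 1#)) (fromℕ-unit 1)

-- The coinvariant ring: linear functionals on superspace

module Coinvariants (K : CommutativeRing 0ℓ 0ℓ) (n r′ : ℕ) (ζ : CommutativeRing.Carrier K) (setting : Setting K n r′ ζ) where
  open CommutativeRing K hiding (zero)
  open LinearAlgebra K
  open Solver K
  open Elementary K
  open VectorSums K
  open Representations K
  open Superspace K n (suc r′) ζ
    renaming ( invariant to SI-invariant ; resp to SI-resp ; zero to SI-zero ; add to SI-add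
             ; mulˡ to SI-mulˡ ; mulʳ to SI-mulʳ )
  open ModuleSums K Ω-module
  open Exp semiring using (^-congˡ; ^-congʳ; ^-homo-*; ^-assocʳ)
  open CExp commutativeSemiring using (^-distrib-*)
  open OP̃ using (place)
  open Setting setting
  open Points points
  open Codes r′ hiding (r)
  open Enumeration n
  private
    module Sub = Submodule
    module ≈Ω = SetoidReasoning Ω-setoid
    module ≈K = SetoidReasoning setoid
    module Π = MonoidSum *-commutativeMonoid

  infix 4 _∈_
  _∈_ : {V : KModule} → Module.Carrierᴹ V → Submodule V → Set
  u ∈ S = Sub._∈S S u

  -- The sign from moving θᵢ past the θ of smaller index, and 0 if θᵢ already occurs, because θᵢ² =
  -- 0.
  sign : Fin k → Mon k → Carrier
  sign zero ((_ , false) ∷ _) = 1#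
  sign zero ((_ , true) ∷ _) = 0#
  sign (suc i) ((_ , false) ∷ m) = sign i m
  sign (suc i) ((_ , true) ∷ m) = - sign i m

  sign-incr : ∀ (i j : Fin k) m → sign i (incr j m) ≡ sign i m
  sign-incr zero zero ((_ , false) ∷ _) = ≡.refl
  sign-incr zero zero ((_ , true) ∷ _) = ≡.refl
  sign-incr zero (suc j) ((_ , false) ∷ _) = ≡.refl
  sign-incr zero (suc j) ((_ , true) ∷ _) = ≡.refl
  sign-incr (suc i) zero ((_ , false) ∷ _) = ≡.refl
  sign-incr (suc i) zero ((_ , true) ∷ _) = ≡.refl
  sign-incr (suc i) (suc j) ((_ , false) ∷ m) = sign-incr i j m
  sign-incr (suc i) (suc j) ((_ , true) ∷ m) = ≡.cong -_ (sign-incr i j m)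

  sign-anti : ∀ (i j : Fin k) m → sign j m * sign i (setθ j m) ≈ - (sign i m * sign j (setθ i m))
  sign-anti zero zero ((_ , false) ∷ _) = solve 0 (:1 :* :0 := :- (:1 :* :0)) refl
  sign-anti zero zero ((_ , true) ∷ _) = solve 0 (:0 :* :0 := :- (:0 :* :0)) refl
  sign-anti zero (suc j) ((_ , false) ∷ m) =
    solve 1 (λ s → s :* :1 := :- (:1 :* (:- s))) refl (sign j m)
  sign-anti zero (suc j) ((_ , true) ∷ m) =
    solve 1 (λ s → (:- s) :* :0 := :- (:0 :* (:- s))) refl (sign j m)
  sign-anti (suc i) zero ((_ , false) ∷ m) =
    solve 1 (λ s → :1 :* (:- s) := :- (s :* :1)) refl (sign i m)
  sign-anti (suc i) zero ((_ , true) ∷ m) =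
    solve 1 (λ s → :0 :* (:- s) := :- ((:- s) :* :0)) refl (sign i m)
  sign-anti (suc i) (suc j) ((_ , false) ∷ m) = sign-anti i j m
  sign-anti (suc i) (suc j) ((_ , true) ∷ m) =
    trans (neg-neg _ _) (trans (sign-anti i j m) (-‿cong (sym (neg-neg _ _)))) where
    neg-neg : ∀ a b → (- a) * (- b) ≈ a * b
    neg-neg = solve 2 (λ a b → (:- a) :* (:- b) := a :* b) refl

  -- (f ▷ φ) m is the value at f ∙ m of the linear functional with values φ on monomials.
  infixr 5 _▷_
  _▷_ : Ω → (Mon n → Carrier) → Mon n → Carrier
  (κ c ▷ φ) m = c * φ m
  (x i ▷ φ) m = φ (incr i m)
  (θ i ▷ φ) m = sign i m * φ (setθ i m)
  (f ∔ g ▷ φ) m = (f ▷ φ) m + (g ▷ φ) m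
  f ∙ g ▷ φ = g ▷ (f ▷ φ)

  ▷-cong : ∀ f {φ ψ : Mon n → Carrier} → (∀ m → φ m ≈ ψ m) → ∀ m → (f ▷ φ) m ≈ (f ▷ ψ) m
  ▷-cong (κ c) e m = *-congˡ (e m)
  ▷-cong (x i) e m = e (incr i m)
  ▷-cong (θ i) e m = *-congˡ (e (setθ i m))
  ▷-cong (f ∔ g) e m = +-cong (▷-cong f e m) (▷-cong g e m)
  ▷-cong (f ∙ g) e m = ▷-cong g (▷-cong f e) m

  ▷-+ : ∀ f (φ ψ : Mon n → Carrier) m → (f ▷ λ m → φ m + ψ m) m ≈ (f ▷ φ) m + (f ▷ ψ) m
  ▷-+ (κ c) φ ψ m = distribˡ c _ _
  ▷-+ (x i) φ ψ m = refl
  ▷-+ (θ i) φ ψ m = distribˡ _ _ _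
  ▷-+ (f ∔ g) φ ψ m = trans (+-cong (▷-+ f φ ψ m) (▷-+ g φ ψ m))
    (solve 4 (λ a b c d → (a :+ b) :+ (c :+ d) := (a :+ c) :+ (b :+ d)) refl _ _ _ _)
  ▷-+ (f ∙ g) φ ψ m = trans (▷-cong g (▷-+ f φ ψ) m) (▷-+ g _ _ m)

  ▷-* : ∀ f c (φ : Mon n → Carrier) m → (f ▷ λ m → c * φ m) m ≈ c * (f ▷ φ) m
  ▷-* (κ d) c φ m = x∙yz≈y∙xz d c _
  ▷-* (x i) c φ m = refl
  ▷-* (θ i) c φ m = x∙yz≈y∙xz _ c _
  ▷-* (f ∔ g) c φ m = trans (+-cong (▷-* f c φ m) (▷-* g c φ m)) (sym (distribˡ c _ _))
  ▷-* (f ∙ g) c φ m = trans (▷-cong g (▷-* f c φ) m) (▷-* g c _ m)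

  -- Checked relation by relation, this turns every function on monomials into a linear functional
  -- on Ω, which is given by generators and relations only.
  ▷-resp : ∀ {f g} → f ≈Ω g → ∀ φ m → (f ▷ φ) m ≈ (g ▷ φ) m
  ▷-resp reflΩ φ m = refl
  ▷-resp (symΩ p) φ m = sym (▷-resp p φ m)
  ▷-resp (transΩ p q) φ m = trans (▷-resp p φ m) (▷-resp q φ m)
  ▷-resp (∔-cong p q) φ m = +-cong (▷-resp p φ m) (▷-resp q φ m)
  ▷-resp (∔-assoc f g h) φ m = +-assoc _ _ _
  ▷-resp (∔-comm f g) φ m = +-comm _ _
  ▷-resp (∔-idˡ f) φ m = trans (+-congʳ (zeroˡ _)) (+-identityˡ _)
  ▷-resp (∙-cong {f} {f′} {g} p q) φ m = trans (▷-cong g (▷-resp p φ) m) (▷-resp q _ m)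
  ▷-resp (∙-assoc f g h) φ m = refl
  ▷-resp (∙-idˡ f) φ m = ▷-cong f (λ m → *-identityˡ _) m
  ▷-resp (∙-zeroˡ f) φ m = trans (▷-* f 0# φ m) (trans (zeroˡ _) (sym (zeroˡ _)))
  ▷-resp (∙-distribˡ f g h) φ m = refl
  ▷-resp (∙-distribʳ f g h) φ m = ▷-+ f (g ▷ φ) (h ▷ φ) m
  ▷-resp (κ-cong e) φ m = *-congʳ e
  ▷-resp (κ-+ c d) φ m = distribʳ _ c d
  ▷-resp (κ-* c d) φ m = xy∙z≈y∙xz c d _
  ▷-resp (κ-central c f) φ m = ▷-* f c φ m
  ▷-resp (xx-comm i j) φ m = reflexive (≡.cong φ (updateAt-comm (λ _ → ≡.refl) i j m))
  ▷-resp (xθ-comm i j) φ m =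
    *-cong (reflexive (≡.sym (sign-incr j i m))) (reflexive (≡.cong φ (updateAt-comm (λ _ → ≡.refl) i j m)))
  ▷-resp (θθ-anti i j) φ m = trans
    (trans (sym (*-assoc _ _ _)) (*-cong (sign-anti i j m) (reflexive (≡.cong φ (updateAt-comm (λ _ → ≡.refl) i j m)))))
    (solve 3 (λ a b c → (:- (a :* b)) :* c := a :* (b :* ((:- :1) :* c))) refl _ _ _)

  opaque
    T : (Mon n → Carrier) → Ω → Carrier
    T φ f = (f ▷ φ) unitMon

    T-def : ∀ φ f → T φ f ≈ (f ▷ φ) unitMon
    T-def φ f = refl

    T-∙ : ∀ φ f g → T φ (f ∙ g) ≈ T (f ▷ φ) g
    T-∙ φ f g = refl

    T-∔ : ∀ φ f g → T φ (f ∔ g) ≈ T φ f + T φ g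
    T-∔ φ f g = refl

    T-resp : ∀ φ {f g} → f ≈Ω g → T φ f ≈ T φ g
    T-resp φ p = ▷-resp p φ unitMon

    T-cong : ∀ {φ ψ : Mon n → Carrier} → (∀ m → φ m ≈ ψ m) → ∀ f → T φ f ≈ T ψ f
    T-cong e f = ▷-cong f e unitMon

    T-κ : ∀ φ c f → T φ (κ c ∙ f) ≈ c * T φ f
    T-κ φ c f = ▷-* f c φ unitMon

    T-* : ∀ φ c f → T (λ m → c * φ m) f ≈ c * T φ f
    T-* φ c f = ▷-* f c φ unitMon

    T-0 : ∀ φ → T φ (κ 0#) ≈ 0#
    T-0 φ = zeroˡ _

    T-1 : ∀ φ → T φ (κ 1#) ≈ φ unitMon
    T-1 φ = *-identityˡ _

  -- Commutation rules and the spanning monomials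

  module _ where
    open SetoidReasoning Ω-setoid

    Central : Ω → Set
    Central f = ∀ g → f ∙ g ≈Ω g ∙ f

    ∙-cong₁ : ∀ {f f′ g} → f ≈Ω f′ → f ∙ g ≈Ω f′ ∙ g
    ∙-cong₁ p = ∙-cong p reflΩ

    ∙-cong₂ : ∀ {f g g′} → g ≈Ω g′ → f ∙ g ≈Ω f ∙ g′
    ∙-cong₂ p = ∙-cong reflΩ p

    reflexiveΩ : ∀ {f g} → f ≡ g → f ≈Ω g
    reflexiveΩ ≡.refl = reflΩ

    ∙-central : ∀ {f g} → Central f → Central g → Central (f ∙ g)
    ∙-central {f} {g} cf cg h = begin
      (f ∙ g) ∙ h ≈⟨ ∙-assoc f g h ⟩
      f ∙ (g ∙ h) ≈⟨ ∙-cong₂ (cg h) ⟩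
      f ∙ (h ∙ g) ≈⟨ ∙-assoc f h g ⟨
      (f ∙ h) ∙ g ≈⟨ ∙-cong₁ (cf h) ⟩
      (h ∙ f) ∙ g ≈⟨ ∙-assoc h f g ⟩
      h ∙ (f ∙ g) ∎

    ∔-central : ∀ {f g} → Central f → Central g → Central (f ∔ g)
    ∔-central {f} {g} cf cg h = begin
      (f ∔ g) ∙ h ≈⟨ ∙-distribʳ h f g ⟩
      f ∙ h ∔ g ∙ h ≈⟨ ∔-cong (cf h) (cg h) ⟩
      h ∙ f ∔ h ∙ g ≈⟨ ∙-distribˡ h f g ⟨
      h ∙ (f ∔ g) ∎

    central : ∀ {f} → (∀ j → f ∙ x j ≈Ω x j ∙ f) → (∀ j → f ∙ θ j ≈Ω θ j ∙ f) → Central f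
    central {f} px pθ (κ c) = symΩ (κ-central c f)
    central {f} px pθ (x j) = px j
    central {f} px pθ (θ j) = pθ j
    central {f} px pθ (g ∔ h) = begin
      f ∙ (g ∔ h) ≈⟨ ∙-distribˡ f g h ⟩
      f ∙ g ∔ f ∙ h ≈⟨ ∔-cong (central px pθ g) (central px pθ h) ⟩
      g ∙ f ∔ h ∙ f ≈⟨ ∙-distribʳ f g h ⟨
      (g ∔ h) ∙ f ∎
    central {f} px pθ (g ∙ h) = begin
      f ∙ (g ∙ h) ≈⟨ ∙-assoc f g h ⟨
      (f ∙ g) ∙ h ≈⟨ ∙-cong₁ (central px pθ g) ⟩
      (g ∙ f) ∙ h ≈⟨ ∙-assoc g f h ⟩
      g ∙ (f ∙ h) ≈⟨ ∙-cong₂ (central px pθ h) ⟩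
      g ∙ (h ∙ f) ≈⟨ ∙-assoc g h f ⟨
      (g ∙ h) ∙ f ∎

    x-central : ∀ i → Central (x i)
    x-central i = central (xx-comm i) (xθ-comm i)

    pull : ∀ {c} → Central c → ∀ f g → f ∙ (c ∙ g) ≈Ω c ∙ (f ∙ g)
    pull {c} cc f g = begin
      f ∙ (c ∙ g) ≈⟨ ∙-assoc f c g ⟨
      (f ∙ c) ∙ g ≈⟨ ∙-cong₁ (cc f) ⟨
      (c ∙ f) ∙ g ≈⟨ ∙-assoc c f g ⟩
      c ∙ (f ∙ g) ∎

    pull-κ : ∀ c f g → f ∙ (κ c ∙ g) ≈Ω κ c ∙ (f ∙ g)
    pull-κ c = pull (κ-central c)

    κκ : ∀ a b f → κ a ∙ (κ b ∙ f) ≈Ω κ (a * b) ∙ f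
    κκ a b f = transΩ (symΩ (∙-assoc _ _ _)) (∙-cong₁ (symΩ (κ-* a b)))

    κ0-zero : ∀ {c} f → c ≈ 0# → κ c ∙ f ≈Ω κ 0#
    κ0-zero f e = transΩ (∙-cong₁ (κ-cong e)) (∙-zeroˡ f)

    ∙-zeroʳ : ∀ f → f ∙ κ 0# ≈Ω κ 0#
    ∙-zeroʳ f = transΩ (symΩ (κ-central 0# f)) (∙-zeroˡ f)

    ∔-idʳ : ∀ f → f ∔ κ 0# ≈Ω f
    ∔-idʳ f = transΩ (∔-comm _ _) (∔-idˡ f)

    ∙-idʳ : ∀ f → f ∙ κ 1# ≈Ω f
    ∙-idʳ f = transΩ (symΩ (κ-central 1# f)) (∙-idˡ f)

    Anti : Ω → Ω → Set
    Anti f g = f ∙ g ≈Ω κ (- 1#) ∙ (g ∙ f)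

    anti⇒exchange : ∀ {f g} → Anti f g → ∀ h → f ∙ (g ∙ h) ≈Ω κ (- 1#) ∙ (g ∙ (f ∙ h))
    anti⇒exchange {f} {g} p h = begin
      f ∙ (g ∙ h) ≈⟨ ∙-assoc _ _ _ ⟨
      (f ∙ g) ∙ h ≈⟨ ∙-cong₁ p ⟩
      (κ (- 1#) ∙ (g ∙ f)) ∙ h ≈⟨ ∙-assoc _ _ _ ⟩
      κ (- 1#) ∙ ((g ∙ f) ∙ h) ≈⟨ ∙-cong₂ (∙-assoc _ _ _) ⟩
      κ (- 1#) ∙ (g ∙ (f ∙ h)) ∎

    xpow : Fin n → ℕ → Ω
    xpow i zero = κ 1#
    xpow i (suc a) = x i ∙ xpow i a

    xpow-central : ∀ i a → Central (xpow i a)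
    xpow-central i zero = κ-central 1#
    xpow-central i (suc a) = ∙-central (x-central i) (xpow-central i a)

    θbit : Fin n → Bool → Ω
    θbit i false = κ 1#
    θbit i true = θ i

    monoAt : (Fin k → Fin n) → Mon k → Ω
    monoAt ι [] = κ 1#
    monoAt ι ((a , j) ∷ m) = xpow (ι zero) a ∙ (θbit (ι zero) j ∙ monoAt (ι ∘ suc) m)

    mono : Mon n → Ω
    mono = monoAt (λ i → i)

    x-monoAt : ∀ (ι : Fin k → Fin n) i m → x (ι i) ∙ monoAt ι m ≈Ω monoAt ι (incr i m)
    x-monoAt ι zero (_ ∷ m) = symΩ (∙-assoc _ _ _)
    x-monoAt ι (suc i) ((a , j) ∷ m) = begin
      x (ι (suc i)) ∙ (xpow (ι zero) a ∙ (θbit (ι zero) j ∙ monoAt (ι ∘ suc) m)) ≈⟨ pull (xpow-central (ι zero) a) _ _ ⟩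
      xpow (ι zero) a ∙ (x (ι (suc i)) ∙ (θbit (ι zero) j ∙ monoAt (ι ∘ suc) m)) ≈⟨ ∙-cong₂ (pull (x-central (ι (suc i))) _ _) ⟨
      xpow (ι zero) a ∙ (θbit (ι zero) j ∙ (x (ι (suc i)) ∙ monoAt (ι ∘ suc) m)) ≈⟨ ∙-cong₂ (∙-cong₂ (x-monoAt (ι ∘ suc) i m)) ⟩
      xpow (ι zero) a ∙ (θbit (ι zero) j ∙ monoAt (ι ∘ suc) (incr i m)) ∎

    x-mono : ∀ i m → x i ∙ mono m ≈Ω mono (incr i m)
    x-mono = x-monoAt (λ i → i)

    monoAt-unit : (ι : Fin k → Fin n) → monoAt ι unitMon ≈Ω κ 1#
    monoAt-unit {zero} ι = reflΩ
    monoAt-unit {suc k} ι = transΩ (∙-idˡ _) (transΩ (∙-idˡ _) (monoAt-unit (ι ∘ suc)))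

    -- Anticommutation of f with itself yields only 2 f² = 0, so 2 has to be inverted.
    anti-square : ∀ {f} → Anti f f → f ∙ f ≈Ω κ 0#
    anti-square {f} p = begin
      f ∙ f ≈⟨ ∙-idˡ _ ⟨
      κ 1# ∙ (f ∙ f) ≈⟨ ∙-cong₁ (κ-cong (trans (sym (proj₂ half)) (*-comm _ _))) ⟩
      κ (½ * (1# + 1#)) ∙ (f ∙ f) ≈⟨ κκ _ _ _ ⟨
      κ ½ ∙ (κ (1# + 1#) ∙ (f ∙ f)) ≈⟨ ∙-cong₂ (∙-cong₁ (κ-+ 1# 1#)) ⟩
      κ ½ ∙ ((κ 1# ∔ κ 1#) ∙ (f ∙ f)) ≈⟨ ∙-cong₂ (∙-distribʳ _ _ _) ⟩
      κ ½ ∙ (κ 1# ∙ (f ∙ f) ∔ κ 1# ∙ (f ∙ f)) ≈⟨ ∙-cong₂ (∔-cong reflΩ (transΩ (∙-idˡ _) p)) ⟩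
      κ ½ ∙ (κ 1# ∙ (f ∙ f) ∔ κ (- 1#) ∙ (f ∙ f)) ≈⟨ ∙-cong₂ (∙-distribʳ _ _ _) ⟨
      κ ½ ∙ ((κ 1# ∔ κ (- 1#)) ∙ (f ∙ f)) ≈⟨ ∙-cong₂ (∙-cong₁ (transΩ (symΩ (κ-+ _ _)) (κ-cong (-‿inverseʳ 1#)))) ⟩
      κ ½ ∙ (κ 0# ∙ (f ∙ f)) ≈⟨ ∙-cong₂ (∙-zeroˡ _) ⟩
      κ ½ ∙ κ 0# ≈⟨ ∙-zeroʳ _ ⟩
      κ 0# ∎
      where ½ = proj₁ half

    θ² : ∀ i → θ i ∙ θ i ≈Ω κ 0#
    θ² i = anti-square (θθ-anti i i)

    θ-monoAt : ∀ (ι : Fin k → Fin n) i m → θ (ι i) ∙ monoAt ι m ≈Ω κ (sign i m) ∙ monoAt ι (setθ i m)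
    θ-monoAt ι zero ((a , false) ∷ m) = begin
      θ (ι zero) ∙ (xpow (ι zero) a ∙ (κ 1# ∙ monoAt (ι ∘ suc) m)) ≈⟨ pull (xpow-central _ a) _ _ ⟩
      xpow (ι zero) a ∙ (θ (ι zero) ∙ (κ 1# ∙ monoAt (ι ∘ suc) m)) ≈⟨ ∙-cong₂ (∙-cong₂ (∙-idˡ _)) ⟩
      xpow (ι zero) a ∙ (θ (ι zero) ∙ monoAt (ι ∘ suc) m) ≈⟨ ∙-idˡ _ ⟨
      κ 1# ∙ (xpow (ι zero) a ∙ (θ (ι zero) ∙ monoAt (ι ∘ suc) m)) ∎
    θ-monoAt ι zero ((a , true) ∷ m) = begin
      θ (ι zero) ∙ (xpow (ι zero) a ∙ (θ (ι zero) ∙ monoAt (ι ∘ suc) m)) ≈⟨ pull (xpow-central _ a) _ _ ⟩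
      xpow (ι zero) a ∙ (θ (ι zero) ∙ (θ (ι zero) ∙ monoAt (ι ∘ suc) m)) ≈⟨ ∙-cong₂ (∙-assoc _ _ _) ⟨
      xpow (ι zero) a ∙ ((θ (ι zero) ∙ θ (ι zero)) ∙ monoAt (ι ∘ suc) m) ≈⟨ ∙-cong₂ (∙-cong₁ (θ² _)) ⟩
      xpow (ι zero) a ∙ (κ 0# ∙ monoAt (ι ∘ suc) m) ≈⟨ ∙-cong₂ (∙-zeroˡ _) ⟩
      xpow (ι zero) a ∙ κ 0# ≈⟨ ∙-zeroʳ _ ⟩
      κ 0# ≈⟨ ∙-zeroˡ _ ⟨
      κ 0# ∙ monoAt ι ((a , true) ∷ m) ∎
    θ-monoAt ι (suc i) ((a , false) ∷ m) = begin
      θ (ι (suc i)) ∙ (xpow (ι zero) a ∙ (κ 1# ∙ M)) ≈⟨ pull (xpow-central _ a) _ _ ⟩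
      xpow (ι zero) a ∙ (θ (ι (suc i)) ∙ (κ 1# ∙ M)) ≈⟨ ∙-cong₂ (pull-κ 1# _ _) ⟩
      xpow (ι zero) a ∙ (κ 1# ∙ (θ (ι (suc i)) ∙ M)) ≈⟨ ∙-cong₂ (∙-cong₂ (θ-monoAt (ι ∘ suc) i m)) ⟩
      xpow (ι zero) a ∙ (κ 1# ∙ (κ (sign i m) ∙ _)) ≈⟨ ∙-cong₂ (pull-κ _ _ _) ⟩
      xpow (ι zero) a ∙ (κ (sign i m) ∙ (κ 1# ∙ _)) ≈⟨ pull-κ _ _ _ ⟩
      κ (sign i m) ∙ (xpow (ι zero) a ∙ (κ 1# ∙ monoAt (ι ∘ suc) (setθ i m))) ∎
      where M = monoAt (ι ∘ suc) m
    θ-monoAt ι (suc i) ((a , true) ∷ m) = begin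
      θ (ι (suc i)) ∙ (xpow (ι zero) a ∙ (θ (ι zero) ∙ M)) ≈⟨ pull (xpow-central _ a) _ _ ⟩
      xpow (ι zero) a ∙ (θ (ι (suc i)) ∙ (θ (ι zero) ∙ M)) ≈⟨ ∙-cong₂ (anti⇒exchange (θθ-anti _ _) _) ⟩
      xpow (ι zero) a ∙ (κ (- 1#) ∙ (θ (ι zero) ∙ (θ (ι (suc i)) ∙ M))) ≈⟨ ∙-cong₂ (∙-cong₂ (∙-cong₂ (θ-monoAt (ι ∘ suc) i m))) ⟩
      xpow (ι zero) a ∙ (κ (- 1#) ∙ (θ (ι zero) ∙ (κ (sign i m) ∙ M′))) ≈⟨ ∙-cong₂ (∙-cong₂ (pull-κ _ _ _)) ⟩
      xpow (ι zero) a ∙ (κ (- 1#) ∙ (κ (sign i m) ∙ (θ (ι zero) ∙ M′))) ≈⟨ ∙-cong₂ (κκ _ _ _) ⟩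
      xpow (ι zero) a ∙ (κ (- 1# * sign i m) ∙ (θ (ι zero) ∙ M′)) ≈⟨ pull-κ _ _ _ ⟩
      κ (- 1# * sign i m) ∙ (xpow (ι zero) a ∙ (θ (ι zero) ∙ M′))
        ≈⟨ ∙-cong₁ (κ-cong (solve 1 (λ s → (:- :1) :* s := :- s) refl (sign i m))) ⟩
      κ (- sign i m) ∙ (xpow (ι zero) a ∙ (θ (ι zero) ∙ M′)) ∎ where
      M = monoAt (ι ∘ suc) m
      M′ = monoAt (ι ∘ suc) (setθ i m)

    θ-mono : ∀ i m → θ i ∙ mono m ≈Ω κ (sign i m) ∙ mono (setθ i m)
    θ-mono = θ-monoAt (λ i → i)

    shiftSubmodule : Ω → Submodule Ω-module → Submodule Ω-module
    shiftSubmodule f S = record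
      { _∈S = λ u → (f ∙ u) ∈S
      ; resp = λ e → resp (∙-cong₂ e)
      ; 0∈ = resp (symΩ (∙-zeroʳ f)) 0∈
      ; +∈ = λ p q → resp (symΩ (∙-distribˡ f _ _)) (+∈ p q)
      ; *∈ = λ c p → resp (symΩ (pull-κ c f _)) (*∈ c p)
      }
      where open Submodule S

    -- The induction on f varies the submodule: for a product f ∙ g, the element g ∙ m is sought in
    -- the submodule of all u with f ∙ u in S.
    mono-acts : (S : Submodule Ω-module) → ∀ f → (∀ m → mono m ∈ S) → ∀ m → f ∙ mono m ∈ S
    mono-acts S = go where
      open Submodule S using (resp; +∈; *∈)
      go : ∀ f → (∀ m → mono m ∈ S) → ∀ m → f ∙ mono m ∈ S
      go (κ c) h m = *∈ c (h m)
      go (x i) h m = resp (symΩ (x-mono i m)) (h _)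
      go (θ i) h m = resp (symΩ (θ-mono i m)) (*∈ _ (h _))
      go (f ∔ g) h m = resp (symΩ (∙-distribʳ _ f g)) (+∈ (go f h m) (go g h m))
      go (f ∙ g) h m = resp (symΩ (∙-assoc f g _)) (mono-acts (shiftSubmodule f S) g (go f h) m)

    mono-span : (S : Submodule Ω-module) → (∀ m → mono m ∈ S) → ∀ f → f ∈ S
    mono-span S h f = Sub.resp S
      (transΩ (∙-cong₂ (monoAt-unit _)) (∙-idʳ f)) (mono-acts S f h unitMon)

    r : ℕ
    r = suc r′

    anti-resp : ∀ {f f′ g} → f ≈Ω f′ → Anti f g → Anti f′ g
    anti-resp e p = transΩ (∙-cong₁ (symΩ e)) (transΩ p (∙-cong₂ (∙-cong₂ e)))

    anti-sym : ∀ {f g} → Anti f g → Anti g f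
    anti-sym {f} {g} p = begin
      g ∙ f ≈⟨ ∙-idˡ _ ⟨
      κ 1# ∙ (g ∙ f) ≈⟨ ∙-cong₁ (κ-cong (solve 0 (:1 := (:- :1) :* (:- :1)) refl)) ⟩
      κ (- 1# * - 1#) ∙ (g ∙ f) ≈⟨ κκ _ _ _ ⟨
      κ (- 1#) ∙ (κ (- 1#) ∙ (g ∙ f)) ≈⟨ ∙-cong₂ p ⟨
      κ (- 1#) ∙ (f ∙ g) ∎

    anti-∔ : ∀ {f f′ g} → Anti f g → Anti f′ g → Anti (f ∔ f′) g
    anti-∔ {f} {f′} {g} p q = begin
      (f ∔ f′) ∙ g ≈⟨ ∙-distribʳ _ _ _ ⟩
      f ∙ g ∔ f′ ∙ g ≈⟨ ∔-cong p q ⟩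
      κ (- 1#) ∙ (g ∙ f) ∔ κ (- 1#) ∙ (g ∙ f′) ≈⟨ ∙-distribˡ _ _ _ ⟨
      κ (- 1#) ∙ (g ∙ f ∔ g ∙ f′) ≈⟨ ∙-cong₂ (∙-distribˡ _ _ _) ⟨
      κ (- 1#) ∙ (g ∙ (f ∔ f′)) ∎

    anti-0 : ∀ {g} → Anti (κ 0#) g
    anti-0 {g} = transΩ (∙-zeroˡ _) (symΩ (transΩ (∙-cong₂ (∙-zeroʳ g)) (∙-zeroʳ _)))

    anti-central : ∀ {c f g} → Central c → Anti f g → Anti (c ∙ f) g
    anti-central {c} {f} {g} cc p = begin
      (c ∙ f) ∙ g ≈⟨ ∙-assoc _ _ _ ⟩
      c ∙ (f ∙ g) ≈⟨ ∙-cong₂ p ⟩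
      c ∙ (κ (- 1#) ∙ (g ∙ f)) ≈⟨ pull-κ _ _ _ ⟩
      κ (- 1#) ∙ (c ∙ (g ∙ f)) ≈⟨ ∙-cong₂ (pull cc g f) ⟨
      κ (- 1#) ∙ (g ∙ (c ∙ f)) ∎

    anti-sum : ∀ (f : Fin k → Ω) {g} → (∀ i → Anti (f i) g) → Anti (sumᴹ f) g
    anti-sum {zero} f h = anti-resp (symΩ (sumᴹ-[] f)) anti-0
    anti-sum {suc k} f h = anti-resp (symΩ (sumᴹ-∷ f)) (anti-∔ (h zero) (anti-sum (f ∘ suc) (h ∘ suc)))

    sum-∙ˡ : ∀ f (g : Fin k → Ω) → f ∙ sumᴹ g ≈Ω sumᴹ (λ i → f ∙ g i)
    sum-∙ˡ f g = sumᴹ-linear (f ∙_)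
      (mkLinear Ω-module Ω-module _ ∙-cong₂ (∙-distribˡ f) (λ c g → pull-κ c f g)) g

    sum-∙ʳ : ∀ (g : Fin k → Ω) f → sumᴹ g ∙ f ≈Ω sumᴹ (λ i → g i ∙ f)
    sum-∙ʳ g f = sumᴹ-linear (_∙ f)
      (mkLinear Ω-module Ω-module _ ∙-cong₁ (λ g h → ∙-distribʳ f g h) (λ c g → ∙-assoc _ _ _)) g

    central-sum : (f : Fin k → Ω) → (∀ i → Central (f i)) → Central (sumᴹ f)
    central-sum f h g = transΩ (sum-∙ʳ f g) (transΩ (sumᴹ-cong (λ i → h i g)) (symΩ (sum-∙ˡ g f)))

  -- The ideal of the basic invariants, and gradings

  y dy : Fin n → Ω
  y i = xpow i r
  dy i = xpow i r′ ∙ θ i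

  ypow : Fin n → ℕ → Ω
  ypow i zero = κ 1#
  ypow i (suc a) = y i ∙ ypow i a

  y-central : ∀ i → Central (y i)
  y-central i = xpow-central i r

  ypow-central : ∀ i a → Central (ypow i a)
  ypow-central i zero = κ-central 1#
  ypow-central i (suc a) = ∙-central (y-central i) (ypow-central i a)

  dy-anti : ∀ i j → Anti (dy i) (dy j)
  dy-anti i j = anti-central (xpow-central i r′) (anti-sym (anti-central (xpow-central j r′) (θθ-anti j i)))

  -- The invariants Σᵢ yᵢᵃ⁺¹ and Σᵢ yᵢᵃ dyᵢ, where yᵢ = xᵢʳ and dyᵢ = xᵢʳ⁻¹ θᵢ.
  p ξ : ℕ → Ω
  p a = sumᴹ λ i → ypow i (suc a)
  ξ a = sumᴹ λ i → ypow i a ∙ dy i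

  p-central : ∀ a → Central (p a)
  p-central a = central-sum _ λ i → ypow-central i (suc a)

  ξ-anti : ∀ a j → Anti (ξ a) (θ j)
  ξ-anti a j = anti-sum _ λ i → anti-central (ypow-central i a) (anti-central (xpow-central i r′) (θθ-anti i j))

  -- Right multiples suffice for a two-sided ideal: p a is central, and ξ a commutes with the xᵢ and
  -- anticommutes with the θᵢ.
  data Gen : Ω → Set where
    gen-p : ∀ a h → Gen (p a ∙ h)
    gen-ξ : ∀ a h → Gen (ξ a ∙ h)
    gen-0 : Gen (κ 0#)
    gen-∔ : ∀ {f g} → Gen f → Gen g → Gen (f ∔ g)
    gen-resp : ∀ {f g} → f ≈Ω g → Gen f → Gen g

  gen-by : ∀ f → (∀ a h → Gen (f ∙ (ξ a ∙ h))) → ∀ {g} → Gen g → Gen (f ∙ g)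
  gen-by f F (gen-p a h) = gen-resp (symΩ (pull (p-central a) f h)) (gen-p a (f ∙ h))
  gen-by f F (gen-ξ a h) = F a h
  gen-by f F gen-0 = gen-resp (symΩ (∙-zeroʳ f)) gen-0
  gen-by f F (gen-∔ p q) = gen-resp (symΩ (∙-distribˡ f _ _)) (gen-∔ (gen-by f F p) (gen-by f F q))
  gen-by f F (gen-resp e p) = gen-resp (∙-cong₂ e) (gen-by f F p)

  gen-κ : ∀ c {f} → Gen f → Gen (κ c ∙ f)
  gen-κ c = gen-by (κ c) λ a h → gen-resp (pull-κ c (ξ a) h) (gen-ξ a (κ c ∙ h))

  gen-∙ˡ : ∀ f {g} → Gen g → Gen (f ∙ g)
  gen-∙ˡ (κ c) q = gen-κ c q
  gen-∙ˡ (x i) q = gen-by (x i) (λ a h → gen-resp (pull (x-central i) (ξ a) h) (gen-ξ a (x i ∙ h))) q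
  gen-∙ˡ (θ i) q = gen-by (θ i) (λ a h →
    gen-resp (symΩ (anti⇒exchange (anti-sym (ξ-anti a i)) h)) (gen-κ (- 1#) (gen-ξ a (θ i ∙ h)))) q
  gen-∙ˡ (f ∔ g) q = gen-resp (symΩ (∙-distribʳ _ _ _)) (gen-∔ (gen-∙ˡ f q) (gen-∙ˡ g q))
  gen-∙ˡ (f ∙ g) q = gen-resp (symΩ (∙-assoc _ _ _)) (gen-∙ˡ f (gen-∙ˡ g q))

  gen-∙ʳ : ∀ f {g} → Gen g → Gen (g ∙ f)
  gen-∙ʳ f (gen-p a h) = gen-resp (symΩ (∙-assoc _ _ _)) (gen-p a (h ∙ f))
  gen-∙ʳ f (gen-ξ a h) = gen-resp (symΩ (∙-assoc _ _ _)) (gen-ξ a (h ∙ f))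
  gen-∙ʳ f gen-0 = gen-resp (symΩ (∙-zeroˡ _)) gen-0
  gen-∙ʳ f (gen-∔ p q) = gen-resp (symΩ (∙-distribʳ _ _ _)) (gen-∔ (gen-∙ʳ f p) (gen-∙ʳ f q))
  gen-∙ʳ f (gen-resp e p) = gen-resp (∙-cong₁ e) (gen-∙ʳ f p)

  -- The weights 1, 1 give the total degree that drives the filtration; the weights 0, 1 count the
  -- θᵢ.
  module Grading (wx wθ : ℕ) where

    deg : Mon k → ℕ
    deg [] = 0
    deg ((a , true) ∷ m) = (a ℕ.* wx ℕ.+ wθ) ℕ.+ deg m
    deg ((a , false) ∷ m) = a ℕ.* wx ℕ.+ deg m

    deg-incr : ∀ (i : Fin k) m → deg (incr i m) ≡ wx ℕ.+ deg m
    deg-incr zero ((a , true) ∷ m) =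
      ≡.trans (≡.cong (ℕ._+ deg m) (ℕ.+-assoc wx (a ℕ.* wx) wθ)) (ℕ.+-assoc wx _ (deg m))
    deg-incr zero ((a , false) ∷ m) = ℕ.+-assoc wx (a ℕ.* wx) (deg m)
    deg-incr (suc i) ((a , true) ∷ m) rewrite deg-incr i m =
      ≡.trans (≡.sym (ℕ.+-assoc (a ℕ.* wx ℕ.+ wθ) wx _))
        (≡.trans (≡.cong (ℕ._+ deg m) (ℕ.+-comm (a ℕ.* wx ℕ.+ wθ) wx)) (ℕ.+-assoc wx _ (deg m)))
    deg-incr (suc i) ((a , false) ∷ m) rewrite deg-incr i m =
      ≡.trans (≡.sym (ℕ.+-assoc (a ℕ.* wx) wx _))
        (≡.trans (≡.cong (ℕ._+ deg m) (ℕ.+-comm (a ℕ.* wx) wx)) (ℕ.+-assoc wx _ (deg m)))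

    deg-setθ : ∀ (i : Fin k) m → sign i m ≈ 0# ⊎ (deg (setθ i m) ≡ wθ ℕ.+ deg m)
    deg-setθ zero ((a , true) ∷ m) = inj₁ refl
    deg-setθ zero ((a , false) ∷ m) = inj₂
      (≡.trans (≡.cong (ℕ._+ deg m) (ℕ.+-comm (a ℕ.* wx) wθ)) (ℕ.+-assoc wθ _ (deg m)))
    deg-setθ (suc i) ((a , true) ∷ m) with deg-setθ i m
    ... | inj₁ s = inj₁ (trans (-‿cong s) (solve 0 (:- :0 := :0) refl))
    ... | inj₂ e rewrite e = inj₂
      (≡.trans (≡.sym (ℕ.+-assoc (a ℕ.* wx ℕ.+ wθ) wθ _))
        (≡.trans (≡.cong (ℕ._+ deg m) (ℕ.+-comm (a ℕ.* wx ℕ.+ wθ) wθ)) (ℕ.+-assoc wθ _ (deg m))))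
    deg-setθ (suc i) ((a , false) ∷ m) with deg-setθ i m
    ... | inj₁ s = inj₁ s
    ... | inj₂ e rewrite e = inj₂
      (≡.trans (≡.sym (ℕ.+-assoc (a ℕ.* wx) wθ _))
        (≡.trans (≡.cong (ℕ._+ deg m) (ℕ.+-comm (a ℕ.* wx) wθ)) (ℕ.+-assoc wθ _ (deg m))))

    deg-unit : deg (unitMon {k}) ≡ 0
    deg-unit {zero} = ≡.refl
    deg-unit {suc k} = deg-unit {k}

    data Hom : ℕ → Ω → Set where
      hom-κ : ∀ c → Hom 0 (κ c)
      hom-0 : ∀ d → Hom d (κ 0#)
      hom-x : ∀ i → Hom wx (x i)
      hom-θ : ∀ i → Hom wθ (θ i)
      hom-∔ : ∀ {d f g} → Hom d f → Hom d g → Hom d (f ∔ g)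
      hom-∙ : ∀ {d e f g} → Hom d f → Hom e g → Hom (d ℕ.+ e) (f ∙ g)
      hom-resp : ∀ {d f g} → f ≈Ω g → Hom d f → Hom d g

    hom-cast : ∀ {d e f} → d ≡ e → Hom d f → Hom e f
    hom-cast ≡.refl h = h

    hom-sum : ∀ {k d} (f : Fin k → Ω) → (∀ i → Hom d (f i)) → Hom d (sumᴹ f)
    hom-sum {zero} f h = hom-resp (symΩ (sumᴹ-[] f)) (hom-0 _)
    hom-sum {suc k} f h = hom-resp (symΩ (sumᴹ-∷ f)) (hom-∔ (h zero) (hom-sum (f ∘ suc) (h ∘ suc)))

    hom-xpow : ∀ i a → Hom (a ℕ.* wx) (xpow i a)
    hom-xpow i zero = hom-κ 1#
    hom-xpow i (suc a) = hom-∙ (hom-x i) (hom-xpow i a)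

    hom-monoAt : ∀ (ι : Fin k → Fin n) m → Hom (deg m) (monoAt ι m)
    hom-monoAt ι [] = hom-κ 1#
    hom-monoAt ι ((a , true) ∷ m) = hom-cast (≡.sym (ℕ.+-assoc (a ℕ.* wx) wθ _))
      (hom-∙ (hom-xpow _ a) (hom-∙ (hom-θ _) (hom-monoAt (ι ∘ suc) m)))
    hom-monoAt ι ((a , false) ∷ m) = hom-∙ (hom-xpow _ a) (hom-∙ (hom-κ 1#) (hom-monoAt (ι ∘ suc) m))

    hom-mono : ∀ m → Hom (deg m) (mono m)
    hom-mono = hom-monoAt id

    hom-vanishes : ∀ {d f} → Hom d f → ∀ (φ : Mon n → Carrier) D → (∀ m → deg m ≡ D → φ m ≈ 0#) →
      ∀ m → d ℕ.+ deg m ≡ D → (f ▷ φ) m ≈ 0#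
    hom-vanishes (hom-κ c) φ D z m e = trans (*-congˡ (z m e)) (zeroʳ c)
    hom-vanishes (hom-0 d) φ D z m e = zeroˡ _
    hom-vanishes (hom-x i) φ D z m e = z (incr i m) (≡.trans (deg-incr i m) e)
    hom-vanishes (hom-θ i) φ D z m e with deg-setθ i m
    ... | inj₁ s = trans (*-congʳ s) (zeroˡ _)
    ... | inj₂ e′ = trans (*-congˡ (z (setθ i m) (≡.trans e′ e))) (zeroʳ _)
    hom-vanishes (hom-∔ p q) φ D z m e =
      trans (+-cong (hom-vanishes p φ D z m e) (hom-vanishes q φ D z m e)) (+-identityˡ 0#)
    hom-vanishes (hom-∙ {d} {e} p q) φ D z m eq = hom-vanishes q _ (e ℕ.+ deg m)
      (λ m′ e′ → hom-vanishes p φ D z m′ (≡.trans (≡.cong (d ℕ.+_) e′) (≡.trans (≡.sym (ℕ.+-assoc d e _)) eq))) m ≡.refl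
    hom-vanishes (hom-resp e p) φ D z m eq = trans (sym (▷-resp e φ m)) (hom-vanishes p φ D z m eq)

    T-vanishes : ∀ {d f} → Hom d f → ∀ (φ : Mon n → Carrier) → (∀ m → deg m ≡ d → φ m ≈ 0#) → T φ f ≈ 0#
    T-vanishes {d} {f} h φ z = trans (T-def φ f) (hom-vanishes h φ d z unitMon (≡.trans (≡.cong (d ℕ.+_) (deg-unit {n})) (ℕ.+-identityʳ d)))

    hom-acts : (S : ℕ → Submodule Ω-module) → ∀ {d f} → Hom d f → (∀ m → mono m ∈ S (deg m)) → ∀ m → f ∙ mono m ∈ S (d ℕ.+ deg m)
    hom-acts S (hom-κ c) h m = Sub.*∈ (S _) c (h m)
    hom-acts S (hom-0 d) h m = Sub.resp (S _) (symΩ (∙-zeroˡ _)) (Sub.0∈ (S _))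
    hom-acts S (hom-x i) h m = Sub.resp (S _) (symΩ (x-mono i m))
      (≡.subst (λ d → mono (incr i m) ∈ S d) (deg-incr i m) (h _))
    hom-acts S (hom-θ i) h m with deg-setθ i m
    ... | inj₁ s = Sub.resp (S _) (symΩ (transΩ (θ-mono i m) (κ0-zero _ s))) (Sub.0∈ (S _))
    ... | inj₂ e = Sub.resp (S _) (symΩ (θ-mono i m))
      (Sub.*∈ (S _) _ (≡.subst (λ d → mono (setθ i m) ∈ S d) e (h _)))
    hom-acts S (hom-∔ p q) h m = Sub.resp (S _) (symΩ (∙-distribʳ _ _ _))
      (Sub.+∈ (S _) (hom-acts S p h m) (hom-acts S q h m))
    hom-acts S (hom-∙ {d} {e} {f} {g} p q) h m = Sub.resp (S _) (symΩ (∙-assoc _ _ _))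
      (≡.subst (λ j → f ∙ (g ∙ mono m) ∈ S j) (≡.sym (ℕ.+-assoc d e _))
        (hom-acts (λ j → shiftSubmodule f (S (d ℕ.+ j))) q (hom-acts S p h) m))
    hom-acts S (hom-resp e p) h m = Sub.resp (S _) (∙-cong₁ e) (hom-acts S p h m)

    hom-span : (S : ℕ → Submodule Ω-module) → (∀ m → mono m ∈ S (deg m)) → ∀ {d f} → Hom d f → f ∈ S d
    hom-span S h {d} {f} p = Sub.resp (S _) (transΩ (∙-cong₂ (monoAt-unit _)) (∙-idʳ f))
      (≡.subst (λ j → f ∙ mono unitMon ∈ S j)
        (≡.trans (≡.cong (d ℕ.+_) (deg-unit {n})) (ℕ.+-identityʳ d)) (hom-acts S p h unitMon))

  -- Every monomial arises from 1 by inserting first the θᵢ, from last to first, and then the xᵢ.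
  mon-induction : (P : Mon k → Set) → P unitMon → (∀ i m → P m → P (incr i m)) →
    (∀ i m → sign i m ≡ 1# → P m → P (setθ i m)) → ∀ m → P m
  mon-induction P p₁ px pθ [] = p₁
  mon-induction P p₁ px pθ ((a , j) ∷ m) = go a j where
    tail : P ((0 , false) ∷ m)
    tail = mon-induction (λ m → P ((0 , false) ∷ m)) p₁ (λ i m → px (suc i) ((0 , false) ∷ m))
             (λ i m → pθ (suc i) ((0 , false) ∷ m)) m
    go : ∀ a j → P ((a , j) ∷ m)
    go zero false = tail
    go zero true = pθ zero ((0 , false) ∷ m) ≡.refl tail
    go (suc a) j = px zero ((a , j) ∷ m) (go a j)

  T-sum : ∀ φ {k} (f : Fin k → Ω) → T φ (sumᴹ f) ≈ sum (λ i → T φ (f i))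
  T-sum φ {zero} f = trans (T-resp φ (sumᴹ-[] f)) (trans (T-0 φ) (sym (sum-[] _)))
  T-sum φ {suc k} f = trans (T-resp φ (sumᴹ-∷ f)) (trans (T-∔ φ _ _) (trans (+-congˡ (T-sum φ (f ∘ suc))) (sym (sum-∷ _))))

  T-scaled : ∀ {φ ψ : Mon n → Carrier} c → (∀ m → φ m ≈ c * ψ m) → ∀ f → T φ f ≈ c * T ψ f
  T-scaled {ψ = ψ} c e f = trans (T-cong e f) (T-* ψ c f)

  -- Hence the monomials are linearly independent: the values of a functional on them can be
  -- prescribed.
  T-mono : ∀ φ m → T φ (mono m) ≈ φ m
  T-mono φ m = mon-induction (λ m → ∀ φ → T φ (mono m) ≈ φ m) one step-x step-θ m φ where
    one : ∀ φ → T φ (mono unitMon) ≈ φ unitMon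
    one φ = trans (T-resp φ (monoAt-unit id)) (T-1 φ)
    step-x : ∀ i m → (∀ φ → T φ (mono m) ≈ φ m) → ∀ φ → T φ (mono (incr i m)) ≈ φ (incr i m)
    step-x i m ih φ = trans (T-resp φ (symΩ (x-mono i m))) (trans (T-∙ φ (x i) (mono m)) (ih _))
    step-θ : ∀ i m → sign i m ≡ 1# → (∀ φ → T φ (mono m) ≈ φ m) → ∀ φ → T φ (mono (setθ i m)) ≈ φ (setθ i m)
    step-θ i m s ih φ = begin
      T φ (mono (setθ i m)) ≈⟨ *-identityˡ _ ⟨
      1# * T φ (mono (setθ i m)) ≈⟨ T-κ φ 1# _ ⟨
      T φ (κ 1# ∙ mono (setθ i m)) ≈⟨ T-resp φ (∙-cong₁ (κ-cong (sym (reflexive s)))) ⟩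
      T φ (κ (sign i m) ∙ mono (setθ i m)) ≈⟨ T-resp φ (θ-mono i m) ⟨
      T φ (θ i ∙ mono m) ≈⟨ trans (T-∙ φ (θ i) (mono m)) (ih _) ⟩
      sign i m * φ (setθ i m) ≈⟨ *-congʳ (reflexive s) ⟩
      1# * φ (setθ i m) ≈⟨ *-identityˡ _ ⟩
      φ (setθ i m) ∎
      where open ≈K

  ▷-xpow : ∀ i a φ m → (xpow i a ▷ φ) m ≈ φ (incrs i a m)
  ▷-xpow i zero φ m = *-identityˡ _
  ▷-xpow i (suc a) φ m = ▷-xpow i a (x i ▷ φ) m

  xpow-mono : ∀ i a m → xpow i a ∙ mono m ≈Ω mono (incrs i a m)
  xpow-mono i zero m = ∙-idˡ _
  xpow-mono i (suc a) m = transΩ (∙-assoc _ _ _) (transΩ (∙-cong₂ (xpow-mono i a m)) (x-mono i _))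

  dy-mono : ∀ i m → dy i ∙ mono m ≈Ω κ (sign i m) ∙ mono (incrs i r′ (setθ i m))
  dy-mono i m = transΩ (∙-assoc _ _ _) (transΩ (∙-cong₂ (θ-mono i m))
    (transΩ (pull-κ _ _ _) (∙-cong₂ (xpow-mono i r′ _))))

  -- The functionals attached to partitions

  Z : Place r q → Set
  Z p = ∃ λ c → p ≡ inj₁ c

  -- The value of yᵢ at an element of the given place, when yᵢ = Y j on the j-th block.
  value : (Fin q → Carrier) → Place r q → Carrier
  value Y (inj₁ _) = 0#
  value Y (inj₂ (j , _)) = Y j

  -- The exponents are dictated by equivariance up to det. Under diag(ζᶜ) the monomial xᵃθ is
  -- multiplied by ζ^(-c(a+1)), while a change of colour by c multiplies the value by ζ^(c(a+2));
  -- what remains is ζᶜ, the contribution to det. On the zero block with colour k the only exponent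
  -- a = r - 2 - k leaves ζ^(c(1+k)), that is det times the scalar of the action on partitions.
  cell : (Fin q → Carrier) → Place r q → ℕ × Bool → Carrier
  cell Y p (_ , false) = 0#
  cell Y (inj₁ c) (a , true) = ⟦ suc a ℕ.≟ r′ ℕ.∸ toℕ c ⟧?
  cell Y (inj₂ (j , ρ)) (a , true) = ζ ^ (toℕ ρ ℕ.* suc (suc a)) * Y j ^ (suc a / r)

  top : (Fin q → Carrier) → Vec (Place r q) k → Mon k → Carrier
  top Y [] [] = 1#
  top Y (p ∷ v) (a ∷ m) = cell Y p a * top Y v m

  member : Fin q → Place r q → Carrier
  member j (inj₁ _) = 0#
  member j (inj₂ (b , _)) = δ j b

  dyB : Vec (Place r q) n → Fin q → Ω
  dyB v j = sumᴹ λ i → κ (member j (lookup v i)) ∙ dy i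

  dys : Vec (Place r q) n → (Fin k → Fin q) → Ω
  dys {k = zero} v β = κ 1#
  dys {k = suc k} v β = dys v (β ∘ suc) ∙ dyB v (β zero)

  -- The coefficient of θ₁⋯θₙ in dy_{B_q} ⋯ dy_{B_1} f, evaluated at the point with coordinates Y
  -- (with the exponent of x extracted on the zero block).
  ev : (Fin q → Carrier) → Vec (Place r q) n → Ω → Carrier
  ev Y v f = T (top Y v) (dys v id ∙ f)

  private
    κ≤r′ : ∀ (c : Fin r′) a → r ℕ.+ a ≢ r′ ℕ.∸ toℕ c
    κ≤r′ c a e = ℕ.<⇒≱ (s≤s (ℕ.m≤m+n r′ a)) (≡.subst (ℕ._≤ r′) (≡.sym e) (ℕ.m∸n≤m r′ (toℕ c)))

  module _ where
    open ≈K

    ζ-period : ∀ a b c → ζ ^ (a ℕ.* (r ℕ.* b ℕ.+ c)) ≈ ζ ^ (a ℕ.* c)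
    ζ-period a b c = begin
      ζ ^ (a ℕ.* (r ℕ.* b ℕ.+ c)) ≈⟨ ^-congʳ ζ (ℕ.*-distribˡ-+ a (r ℕ.* b) c) ⟩
      ζ ^ (a ℕ.* (r ℕ.* b) ℕ.+ a ℕ.* c) ≈⟨ ^-homo-* ζ (a ℕ.* (r ℕ.* b)) _ ⟩
      ζ ^ (a ℕ.* (r ℕ.* b)) * ζ ^ (a ℕ.* c) ≈⟨ *-congʳ trivial ⟩
      1# * ζ ^ (a ℕ.* c) ≈⟨ *-identityˡ _ ⟩
      ζ ^ (a ℕ.* c) ∎ where
      trivial : ζ ^ (a ℕ.* (r ℕ.* b)) ≈ 1#
      trivial = begin
        ζ ^ (a ℕ.* (r ℕ.* b)) ≈⟨ ^-congʳ ζ (≡.trans (≡.sym (ℕ.*-assoc a r b))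
                                    (≡.trans (≡.cong (ℕ._* b) (ℕ.*-comm a r)) (ℕ.*-assoc r a b))) ⟩
        ζ ^ (r ℕ.* (a ℕ.* b)) ≈⟨ ^-assocʳ ζ r (a ℕ.* b) ⟨
        (ζ ^ r) ^ (a ℕ.* b) ≈⟨ ^-congˡ (a ℕ.* b) ζʳ ⟩
        1# ^ (a ℕ.* b) ≈⟨ one^ (a ℕ.* b) ⟩
        1# ∎

    cell-y : ∀ (Y : Fin q → Carrier) p a j → cell Y p (r ℕ.+ a , j) ≈ value Y p * cell Y p (a , j)
    cell-y Y p a false = sym (zeroʳ _)
    cell-y Y (inj₁ c) a true = trans
      (⟦⟧?-no (suc (r ℕ.+ a) ℕ.≟ r′ ℕ.∸ toℕ c) (λ e → contradiction (≡.trans (ℕ.+-suc r a) e) (κ≤r′ c (suc a)))) (sym (zeroˡ _))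
    cell-y Y (inj₂ (j , ρ)) a true = begin
      ζ ^ (toℕ ρ ℕ.* suc (suc (r ℕ.+ a))) * Y j ^ (suc (r ℕ.+ a) / r) ≈⟨ *-cong (^-congʳ ζ (≡.cong (toℕ ρ ℕ.*_) exponent))
             (^-congʳ (Y j) (≡.trans (≡.cong (_/ r) (≡.sym (ℕ.+-suc r a)))
               (≡.trans (ℕ.+-distrib-/-∣ˡ {r} (suc a) {r} ℕ.∣-refl) (≡.cong (ℕ._+ suc a / r) (ℕ.n/n≡1 r))))) ⟩
      ζ ^ (toℕ ρ ℕ.* (r ℕ.* 1 ℕ.+ suc (suc a))) * (Y j * Y j ^ (suc a / r)) ≈⟨ *-congʳ (ζ-period (toℕ ρ) 1 (suc (suc a))) ⟩
      ζ ^ (toℕ ρ ℕ.* suc (suc a)) * (Y j * Y j ^ (suc a / r)) ≈⟨ x∙yz≈y∙xz _ _ _ ⟩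
      Y j * (ζ ^ (toℕ ρ ℕ.* suc (suc a)) * Y j ^ (suc a / r)) ∎ where
      exponent : suc (suc (r ℕ.+ a)) ≡ r ℕ.* 1 ℕ.+ suc (suc a)
      exponent = ≡.trans (≡.sym (≡.trans (ℕ.+-suc r (suc a)) (≡.cong suc (ℕ.+-suc r a))))
        (≡.cong (ℕ._+ suc (suc a)) (≡.sym (ℕ.*-identityʳ r)))

    top-y : ∀ (Y : Fin q → Carrier) (v : Vec (Place r q) k) i m → top Y v (incrs i r m) ≈ value Y (lookup v i) * top Y v m
    top-y Y (p ∷ v) zero ((a , j) ∷ m) = begin
      top Y (p ∷ v) (incrs zero r ((a , j) ∷ m)) ≡⟨ ≡.cong (top Y (p ∷ v)) (incrs-zero r a j m) ⟩
      cell Y p (r ℕ.+ a , j) * top Y v m ≈⟨ *-congʳ (cell-y Y p a j) ⟩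
      (value Y p * cell Y p (a , j)) * top Y v m ≈⟨ *-assoc _ _ _ ⟩
      value Y p * top Y (p ∷ v) ((a , j) ∷ m) ∎
    top-y Y (p ∷ v) (suc i) (a ∷ m) = begin
      top Y (p ∷ v) (incrs (suc i) r (a ∷ m)) ≡⟨ ≡.cong (top Y (p ∷ v)) (incrs-suc i r a m) ⟩
      cell Y p a * top Y v (incrs i r m) ≈⟨ *-congˡ (top-y Y v i m) ⟩
      cell Y p a * (value Y (lookup v i) * top Y v m) ≈⟨ x∙yz≈y∙xz _ _ _ ⟩
      value Y (lookup v i) * top Y (p ∷ v) (a ∷ m) ∎

    T-y : ∀ (Y : Fin q → Carrier) v i f → T (top Y v) (y i ∙ f) ≈ value Y (lookup v i) * T (top Y v) f
    T-y Y v i f = trans (T-∙ _ (y i) f) (T-scaled (value Y (lookup v i)) (λ m → trans (▷-xpow i r (top Y v) m) (top-y Y v i m)) f)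

  -- The zero block sees only exponents below r - 1, so xᵢʳ⁻¹, and with it dyᵢ, acts as 0.
  top-zero : ∀ (Y : Fin q → Carrier) (v : Vec (Place r q) k) i m → Z (lookup v i) → top Y v (incrs i r′ m) ≈ 0#
  top-zero Y (p ∷ v) zero ((a , j) ∷ m) z =
    trans (reflexive (≡.cong (top Y (p ∷ v)) (incrs-zero r′ a j m))) (trans (*-congʳ (vanish j z)) (zeroˡ _)) where
    vanish : ∀ j → Z p → cell Y p (r′ ℕ.+ a , j) ≈ 0#
    vanish false z = refl
    vanish true (c , ≡.refl) = ⟦⟧?-no (suc (r′ ℕ.+ a) ℕ.≟ r′ ℕ.∸ toℕ c) (λ e → contradiction e (κ≤r′ c a))
  top-zero Y (p ∷ v) (suc i) (a ∷ m) z =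
    trans (reflexive (≡.cong (top Y (p ∷ v)) (incrs-suc i r′ a m))) (trans (*-congˡ (top-zero Y v i m z)) (zeroʳ _))

  T-dy-zero : ∀ (Y : Fin q → Carrier) v i f g → Z (lookup v i) → T (top Y v) (f ∙ (dy i ∙ g)) ≈ 0#
  T-dy-zero Y v i f g z = begin
    T (top Y v) (f ∙ ((xpow i r′ ∙ θ i) ∙ g)) ≈⟨ T-resp _ (transΩ (∙-cong₂ (∙-assoc _ _ _)) (pull (xpow-central i r′) f _)) ⟩
    T (top Y v) (xpow i r′ ∙ (f ∙ (θ i ∙ g)))
      ≈⟨ trans (T-∙ _ (xpow i r′) _) (T-scaled {ψ = top Y v} 0# (λ m → trans (▷-xpow i r′ (top Y v) m) (trans (top-zero Y v i m z) (sym (zeroˡ _)))) _) ⟩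
    0# * T (top Y v) (f ∙ (θ i ∙ g)) ≈⟨ zeroˡ _ ⟩
    0# ∎
    where open ≈K

  dyB-anti : ∀ (v : Vec (Place r q) n) j l → Anti (dyB v j) (dyB v l)
  dyB-anti v j l = anti-sum _ λ i → anti-central (κ-central _) (anti-sym (anti-sum _ λ k →
    anti-central (κ-central _) (dy-anti k i)))

  dys-dyB : ∀ (v : Vec (Place r q) n) (β : Fin k → Fin q) i → dys v β ∙ dyB v (β i) ≈Ω κ 0#
  dys-dyB v β zero = transΩ (∙-assoc _ _ _) (transΩ (∙-cong₂ (anti-square (dyB-anti v (β zero) (β zero)))) (∙-zeroʳ _))
  dys-dyB v β (suc i) = begin
    (dys v (β ∘ suc) ∙ dyB v (β zero)) ∙ dyB v (β (suc i)) ≈⟨ ∙-assoc _ _ _ ⟩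
    dys v (β ∘ suc) ∙ (dyB v (β zero) ∙ dyB v (β (suc i))) ≈⟨ ∙-cong₂ (dyB-anti v (β zero) (β (suc i))) ⟩
    dys v (β ∘ suc) ∙ (κ (- 1#) ∙ (dyB v (β (suc i)) ∙ dyB v (β zero))) ≈⟨ pull-κ _ _ _ ⟩
    κ (- 1#) ∙ (dys v (β ∘ suc) ∙ (dyB v (β (suc i)) ∙ dyB v (β zero))) ≈⟨ ∙-cong₂ (∙-assoc _ _ _) ⟨
    κ (- 1#) ∙ ((dys v (β ∘ suc) ∙ dyB v (β (suc i))) ∙ dyB v (β zero)) ≈⟨ ∙-cong₂ (∙-cong₁ (dys-dyB v (β ∘ suc) i)) ⟩
    κ (- 1#) ∙ (κ 0# ∙ dyB v (β zero)) ≈⟨ ∙-cong₂ (∙-zeroˡ _) ⟩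
    κ (- 1#) ∙ κ 0# ≈⟨ ∙-zeroʳ _ ⟩
    κ 0# ∎
    where open SetoidReasoning Ω-setoid

  module _ {q} (Y : Fin q → Carrier) (v : Vec (Place r q) n) where
    open SetoidReasoning setoid

    val : Fin n → Carrier
    val i = value Y (lookup v i)

    ev-resp : ∀ {f g} → f ≈Ω g → ev Y v f ≈ ev Y v g
    ev-resp e = T-resp _ (∙-cong₂ e)

    ev-∔ : ∀ f g → ev Y v (f ∔ g) ≈ ev Y v f + ev Y v g
    ev-∔ f g = trans (T-resp _ (∙-distribˡ _ f g)) (T-∔ _ _ _)

    ev-κ : ∀ c f → ev Y v (κ c ∙ f) ≈ c * ev Y v f
    ev-κ c f = trans (T-resp _ (pull-κ c _ f)) (T-κ _ c _)

    ev-0 : ev Y v (κ 0#) ≈ 0#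
    ev-0 = trans (T-resp _ (∙-zeroʳ _)) (T-0 _)

    T-dys-sum : ∀ {k j} (β : Fin k → Fin q) (f : Fin j → Ω) →
      T (top Y v) (dys v β ∙ sumᴹ f) ≈ sum (λ i → T (top Y v) (dys v β ∙ f i))
    T-dys-sum β f = trans (T-resp _ (sum-∙ˡ _ f)) (T-sum _ _)

    T-ypow : ∀ i a f → T (top Y v) (ypow i a ∙ f) ≈ val i ^ a * T (top Y v) f
    T-ypow i zero f = trans (T-κ _ 1# f) refl
    T-ypow i (suc a) f = begin
      T (top Y v) ((y i ∙ ypow i a) ∙ f) ≈⟨ T-resp _ (∙-assoc _ _ _) ⟩
      T (top Y v) (y i ∙ (ypow i a ∙ f)) ≈⟨ T-y Y v i _ ⟩
      val i * T (top Y v) (ypow i a ∙ f) ≈⟨ *-congˡ (T-ypow i a f) ⟩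
      val i * (val i ^ a * T (top Y v) f) ≈⟨ *-assoc _ _ _ ⟨
      val i ^ suc a * T (top Y v) f ∎

    ev-ypow : ∀ i a f → ev Y v (ypow i a ∙ f) ≈ val i ^ a * ev Y v f
    ev-ypow i a f = trans (T-resp _ (pull (ypow-central i a) _ f)) (T-ypow i a _)

    ev-y : ∀ i f → ev Y v (y i ∙ f) ≈ val i * ev Y v f
    ev-y i f = trans (T-resp _ (pull (y-central i) _ f)) (T-y Y v i _)

    ev-p : ∀ a f → ev Y v (p a ∙ f) ≈ sum (λ i → val i ^ suc a) * ev Y v f
    ev-p a f = begin
      T (top Y v) (dys v id ∙ (p a ∙ f)) ≈⟨ T-resp _ (∙-cong₂ (sum-∙ʳ _ f)) ⟩
      T (top Y v) (dys v id ∙ sumᴹ (λ i → ypow i (suc a) ∙ f)) ≈⟨ T-dys-sum id _ ⟩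
      sum (λ i → ev Y v (ypow i (suc a) ∙ f)) ≈⟨ sum-cong (λ i → ev-ypow i (suc a) f) ⟩
      sum (λ i → val i ^ suc a * ev Y v f) ≈⟨ sum-*ʳ _ _ ⟨
      sum (λ i → val i ^ suc a) * ev Y v f ∎

    -- On this functional Σ yᵢᵃ dyᵢ acts as the sum over the blocks of Y jᵃ times the dy of block j,
    -- because dyᵢ acts as 0 for i in the zero block. The dy of each block is already a factor of
    -- `dys`, and its square is 0.
    ev-ξ : ∀ a f → ev Y v (ξ a ∙ f) ≈ 0#
    ev-ξ a f = begin
      T (top Y v) (dys v id ∙ (ξ a ∙ f)) ≈⟨ T-resp _ (∙-cong₂ (sum-∙ʳ _ f)) ⟩
      T (top Y v) (dys v id ∙ sumᴹ (λ i → (ypow i a ∙ dy i) ∙ f)) ≈⟨ T-dys-sum id _ ⟩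
      sum (λ i → ev Y v ((ypow i a ∙ dy i) ∙ f)) ≈⟨ sum-cong (λ i → trans (ev-resp (∙-assoc _ _ _)) (ev-ypow i a _)) ⟩
      sum (λ i → val i ^ a * t i) ≈⟨ sum-cong (λ i → split (lookup v i) (t i) (T-dy-zero Y v i _ f)) ⟩
      sum (λ i → sum (λ j → Y j ^ a * (member j (lookup v i) * t i))) ≈⟨ sum-swap _ ⟩
      sum (λ j → sum (λ i → Y j ^ a * (member j (lookup v i) * t i)))
        ≈⟨ sum-zero (λ j → trans (sym (sum-*ˡ _ _)) (trans (*-congˡ (vanish j)) (zeroʳ _))) ⟩
      0# ∎ where
      t : Fin n → Carrier
      t i = ev Y v (dy i ∙ f)
      split : ∀ p t → (Z p → t ≈ 0#) → value Y p ^ a * t ≈ sum (λ j → Y j ^ a * (member j p * t))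
      split (inj₁ c) t z = trans (*-congˡ (z (c , ≡.refl))) (trans (zeroʳ _)
        (sym (sum-zero λ j → solve 2 (λ a t → a :* (:0 :* t) := :0) refl _ t)))
      split (inj₂ (b , ρ)) t z = sym (trans (sum-cong λ j → x∙yz≈xz∙y _ (δ j b) t)
        (sum-δʳ b (λ j → Y j ^ a * t)))
      vanish : ∀ j → sum (λ i → member j (lookup v i) * t i) ≈ 0#
      vanish j = begin
        sum (λ i → member j (lookup v i) * t i) ≈⟨ sum-cong (λ i → ev-κ _ _) ⟨
        sum (λ i → ev Y v (κ (member j (lookup v i)) ∙ (dy i ∙ f))) ≈⟨ sum-cong (λ i → ev-resp (∙-assoc _ _ _)) ⟨
        sum (λ i → ev Y v ((κ (member j (lookup v i)) ∙ dy i) ∙ f)) ≈⟨ T-dys-sum id _ ⟨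
        T (top Y v) (dys v id ∙ sumᴹ (λ i → (κ (member j (lookup v i)) ∙ dy i) ∙ f)) ≈⟨ T-resp _ (∙-cong₂ (sum-∙ʳ _ f)) ⟨
        T (top Y v) (dys v id ∙ (dyB v j ∙ f)) ≈⟨ T-resp _ (∙-assoc _ _ _) ⟨
        T (top Y v) ((dys v id ∙ dyB v j) ∙ f) ≈⟨ T-resp _ (transΩ (∙-cong₁ (dys-dyB v id j)) (∙-zeroˡ _)) ⟩
        T (top Y v) (κ 0#) ≈⟨ T-0 _ ⟩
        0# ∎

  

  -- Elementary symmetric polynomials under the functionals

  -- Elementary symmetric polynomials in the yᵢ for which θᵢ does not occur in the monomial.
  es : (Fin k → Fin n) → Mon k → ℕ → Ω
  es ι [] zero = κ 1#
  es ι [] (suc a) = κ 0#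
  es ι ((_ , true) ∷ m) a = es (ι ∘ suc) m a
  es ι ((_ , false) ∷ m) zero = es (ι ∘ suc) m zero
  es ι ((_ , false) ∷ m) (suc a) = es (ι ∘ suc) m (suc a) ∔ y (ι zero) ∙ es (ι ∘ suc) m a

  es⁻ : (Fin k → Fin n) → Mon k → ℕ → Ω
  es⁻ ι m zero = κ 0#
  es⁻ ι m (suc a) = es ι m a

  es-central : ∀ (ι : Fin k → Fin n) m a → Central (es ι m a)
  es-central ι [] zero = κ-central 1#
  es-central ι [] (suc a) = κ-central 0#
  es-central ι ((_ , true) ∷ m) a = es-central (ι ∘ suc) m a
  es-central ι ((_ , false) ∷ m) zero = es-central (ι ∘ suc) m zero
  es-central ι ((_ , false) ∷ m) (suc a) =
    ∔-central (es-central (ι ∘ suc) m (suc a)) (∙-central (y-central (ι zero)) (es-central (ι ∘ suc) m a))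

  es-incr : ∀ (ι : Fin k → Fin n) i m a → es ι (incr i m) a ≡ es ι m a
  es-incr ι zero ((_ , true) ∷ m) a = ≡.refl
  es-incr ι zero ((_ , false) ∷ m) zero = ≡.refl
  es-incr ι zero ((_ , false) ∷ m) (suc a) = ≡.refl
  es-incr ι (suc i) ((_ , true) ∷ m) a = es-incr (ι ∘ suc) i m a
  es-incr ι (suc i) ((_ , false) ∷ m) zero = es-incr (ι ∘ suc) i m zero
  es-incr ι (suc i) ((_ , false) ∷ m) (suc a) =
    ≡.cong₂ (λ f g → f ∔ y (ι zero) ∙ g) (es-incr (ι ∘ suc) i m (suc a)) (es-incr (ι ∘ suc) i m a)

  es-incrs : ∀ (ι : Fin k → Fin n) i b m a → es ι (incrs i b m) a ≡ es ι m a
  es-incrs ι i zero m a = ≡.refl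
  es-incrs ι i (suc b) m a = ≡.trans (es-incr ι i (incrs i b m) a) (es-incrs ι i b m a)

  -- Adding θᵢ takes yᵢ out of the variables, hence the usual recursion at yᵢ. A vanishing sign
  -- covers the case that θᵢ was already there.
  es-setθ : ∀ (ι : Fin k → Fin n) i m → sign i m ≈ 0# ⊎ (∀ a → es ι m a ≈Ω es ι (setθ i m) a ∔ y (ι i) ∙ es⁻ ι (setθ i m) a)
  es-setθ ι zero ((_ , true) ∷ m) = inj₁ refl
  es-setθ ι zero ((_ , false) ∷ m) = inj₂ λ where
    zero → symΩ (transΩ (∔-cong reflΩ (∙-zeroʳ _)) (∔-idʳ _))
    (suc a) → reflΩ
  es-setθ ι (suc i) ((_ , true) ∷ m) with es-setθ (ι ∘ suc) i m
  ... | inj₁ s = inj₁ (trans (-‿cong s) (solve 0 (:- :0 := :0) refl))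
  ... | inj₂ h = inj₂ λ where
    zero → h zero
    (suc a) → h (suc a)
  es-setθ ι (suc i) ((b , false) ∷ m) with es-setθ (ι ∘ suc) i m
  ... | inj₁ s = inj₁ s
  ... | inj₂ h = inj₂ split where
    open ≈Ω
    2+ : ℕ → ℕ
    2+ a = suc (suc a)
    y₀ = y (ι zero)
    yᵢ = y (ι (suc i))
    E : ℕ → Ω
    E = es (ι ∘ suc) (setθ i m)
    ∔-interchange : ∀ a b c d → (a ∔ b) ∔ (c ∔ d) ≈Ω (a ∔ c) ∔ (b ∔ d)
    ∔-interchange a b c d = begin
      (a ∔ b) ∔ (c ∔ d) ≈⟨ ∔-assoc _ _ _ ⟩
      a ∔ (b ∔ (c ∔ d)) ≈⟨ ∔-cong reflΩ (∔-assoc _ _ _) ⟨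
      a ∔ ((b ∔ c) ∔ d) ≈⟨ ∔-cong reflΩ (∔-cong (∔-comm _ _) reflΩ) ⟩
      a ∔ ((c ∔ b) ∔ d) ≈⟨ ∔-cong reflΩ (∔-assoc _ _ _) ⟩
      a ∔ (c ∔ (b ∔ d)) ≈⟨ ∔-assoc _ _ _ ⟨
      (a ∔ c) ∔ (b ∔ d) ∎
    split : ∀ a → es ι ((b , false) ∷ m) a ≈Ω es ι (setθ (suc i) ((b , false) ∷ m)) a ∔ yᵢ ∙ es⁻ ι (setθ (suc i) ((b , false) ∷ m)) a
    split zero = h zero
    split (suc zero) = transΩ (∔-cong (h 1) (∙-cong₂ (transΩ (h 0) (transΩ (∔-cong reflΩ (∙-zeroʳ _)) (∔-idʳ _)))))
      (begin
        (E 1 ∔ yᵢ ∙ E 0) ∔ y₀ ∙ E 0 ≈⟨ ∔-assoc _ _ _ ⟩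
        E 1 ∔ (yᵢ ∙ E 0 ∔ y₀ ∙ E 0) ≈⟨ ∔-cong reflΩ (∔-comm _ _) ⟩
        E 1 ∔ (y₀ ∙ E 0 ∔ yᵢ ∙ E 0) ≈⟨ ∔-assoc _ _ _ ⟨
        (E 1 ∔ y₀ ∙ E 0) ∔ yᵢ ∙ E 0 ∎)
    split (suc (suc a)) = transΩ (∔-cong (h (suc (suc a))) (∙-cong₂ (h (suc a)))) (begin
        (E (2+ a) ∔ yᵢ ∙ E (suc a)) ∔ y₀ ∙ (E (suc a) ∔ yᵢ ∙ E a) ≈⟨ ∔-cong reflΩ (∙-distribˡ _ _ _) ⟩
        (E (2+ a) ∔ yᵢ ∙ E (suc a)) ∔ (y₀ ∙ E (suc a) ∔ y₀ ∙ (yᵢ ∙ E a)) ≈⟨ ∔-interchange _ _ _ _ ⟩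
        (E (2+ a) ∔ y₀ ∙ E (suc a)) ∔ (yᵢ ∙ E (suc a) ∔ y₀ ∙ (yᵢ ∙ E a)) ≈⟨ ∔-cong reflΩ (∔-cong reflΩ (pull (y-central _) _ _)) ⟩
        (E (2+ a) ∔ y₀ ∙ E (suc a)) ∔ (yᵢ ∙ E (suc a) ∔ yᵢ ∙ (y₀ ∙ E a)) ≈⟨ ∔-cong reflΩ (∙-distribˡ _ _ _) ⟨
        (E (2+ a) ∔ y₀ ∙ E (suc a)) ∔ yᵢ ∙ (E (suc a) ∔ y₀ ∙ E a) ∎)

  module _ {q} (Y : Fin q → Carrier) (v : Vec (Place r q) n) where
    open SetoidReasoning setoid

    esᴷ : (Fin k → Fin n) → Mon k → ℕ → Carrier
    esᴷ ι [] zero = 1#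
    esᴷ ι [] (suc a) = 0#
    esᴷ ι ((_ , true) ∷ m) a = esᴷ (ι ∘ suc) m a
    esᴷ ι ((_ , false) ∷ m) zero = esᴷ (ι ∘ suc) m zero
    esᴷ ι ((_ , false) ∷ m) (suc a) = esᴷ (ι ∘ suc) m (suc a) + val Y v (ι zero) * esᴷ (ι ∘ suc) m a

    T-es : ∀ (ι : Fin k → Fin n) m a f → T (top Y v) (es ι m a ∙ f) ≈ esᴷ ι m a * T (top Y v) f
    T-es ι [] zero f = T-κ _ 1# f
    T-es ι [] (suc a) f = T-κ _ 0# f
    T-es ι ((_ , true) ∷ m) a f = T-es (ι ∘ suc) m a f
    T-es ι ((_ , false) ∷ m) zero f = T-es (ι ∘ suc) m zero f
    T-es ι ((b , false) ∷ m) (suc a) f = begin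
      T (top Y v) ((es (ι ∘ suc) m (suc a) ∔ y (ι zero) ∙ es (ι ∘ suc) m a) ∙ f)
        ≈⟨ T-resp _ (transΩ (∙-distribʳ _ _ _) (∔-cong reflΩ (∙-assoc _ _ _))) ⟩
      T (top Y v) (es (ι ∘ suc) m (suc a) ∙ f ∔ y (ι zero) ∙ (es (ι ∘ suc) m a ∙ f)) ≈⟨ T-∔ _ _ _ ⟩
      T (top Y v) (es (ι ∘ suc) m (suc a) ∙ f) + T (top Y v) (y (ι zero) ∙ (es (ι ∘ suc) m a ∙ f))
        ≈⟨ +-cong (T-es (ι ∘ suc) m (suc a) f) (trans (T-y Y v (ι zero) _) (*-congˡ (T-es (ι ∘ suc) m a f))) ⟩
      _ * _ + val Y v (ι zero) * (esᴷ (ι ∘ suc) m a * T (top Y v) f)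
        ≈⟨ solve 4 (λ a y b t → a :* t :+ y :* (b :* t) := (a :+ y :* b) :* t) refl _ _ _ _ ⟩
      esᴷ ι ((b , false) ∷ m) (suc a) * T (top Y v) f ∎

    -- The value of `top` is 0 unless all θ occur, and then no variable is left.
    es-top : ∀ (ι : Fin k → Fin n) (v′ : Vec (Place r q) k) m a → esᴷ ι m a * top Y v′ m ≈ elem {0} (λ ()) a * top Y v′ m
    es-top ι [] [] zero = refl
    es-top ι [] [] (suc a) = refl
    es-top ι (p ∷ v′) ((b , false) ∷ m) a = trans (*-congˡ (zeroˡ _)) (trans (zeroʳ _) (sym (trans (*-congˡ (zeroˡ _)) (zeroʳ _))))
    es-top ι (p ∷ v′) ((b , true) ∷ m) a = begin
      esᴷ (ι ∘ suc) m a * (c * top Y v′ m) ≈⟨ x∙yz≈y∙xz _ _ _ ⟩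
      c * (esᴷ (ι ∘ suc) m a * top Y v′ m) ≈⟨ *-congˡ (es-top (ι ∘ suc) v′ m a) ⟩
      c * (elem {0} (λ ()) a * top Y v′ m) ≈⟨ x∙yz≈y∙xz _ _ _ ⟩
      elem {0} (λ ()) a * (c * top Y v′ m) ∎
      where c = cell Y p (b , true)

    elem-0 : (Z : Fin 0 → Carrier) → ∀ a → elem Z a ≡ elem {0} (λ ()) a
    elem-0 Z zero = ≡.refl
    elem-0 Z (suc a) = ≡.refl

    -- The dy of a block supplies one missing θᵢ with i in this block. At that moment `es` splits
    -- off yᵢ, which takes the value Y of the block, so `es` follows the recursion of `elem` at the
    -- block values.
    ev-es′ : ∀ (β : Fin k → Fin q) a m →
      T (top Y v) (dys v β ∙ (es id m a ∙ mono m)) ≈ elem (Y ∘ β) a * T (top Y v) (dys v β ∙ mono m)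
    ev-es′ {zero} β a m = begin
      T (top Y v) (κ 1# ∙ (es id m a ∙ mono m)) ≈⟨ T-resp _ (∙-idˡ _) ⟩
      T (top Y v) (es id m a ∙ mono m) ≈⟨ T-es id m a _ ⟩
      esᴷ id m a * T (top Y v) (mono m) ≈⟨ *-congˡ (T-mono _ m) ⟩
      esᴷ id m a * top Y v m ≈⟨ es-top id v m a ⟩
      elem {0} (λ ()) a * top Y v m ≈⟨ *-cong (reflexive (≡.sym (elem-0 (Y ∘ β) a))) (sym (trans (T-resp _ (∙-idˡ _)) (T-mono _ m))) ⟩
      elem (Y ∘ β) a * T (top Y v) (κ 1# ∙ mono m) ∎
    ev-es′ {suc k} β a m = begin
      T (top Y v) ((D ∙ dyB v b) ∙ (es id m a ∙ mono m)) ≈⟨ expand (es id m a ∙ mono m) ⟩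
      sum (λ i → member b (lookup v i) * T (top Y v) (D ∙ (dy i ∙ (es id m a ∙ mono m))))
        ≈⟨ sum-cong (λ i → term i (es-setθ id i m)) ⟩
      sum (λ i → elem (Y ∘ β) a * (member b (lookup v i) * T (top Y v) (D ∙ (dy i ∙ mono m)))) ≈⟨ sum-*ˡ _ _ ⟨
      elem (Y ∘ β) a * sum (λ i → member b (lookup v i) * T (top Y v) (D ∙ (dy i ∙ mono m))) ≈⟨ *-congˡ (expand (mono m)) ⟨
      elem (Y ∘ β) a * T (top Y v) ((D ∙ dyB v b) ∙ mono m) ∎ where
      b = β zero
      D = dys v (β ∘ suc)
      expand : ∀ f → T (top Y v) ((D ∙ dyB v b) ∙ f) ≈ sum (λ i → member b (lookup v i) * T (top Y v) (D ∙ (dy i ∙ f)))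
      expand f = begin
        T (top Y v) ((D ∙ dyB v b) ∙ f) ≈⟨ T-resp _ (transΩ (∙-assoc _ _ _) (∙-cong₂ (sum-∙ʳ _ f))) ⟩
        T (top Y v) (D ∙ sumᴹ (λ i → (κ (member b (lookup v i)) ∙ dy i) ∙ f)) ≈⟨ T-dys-sum Y v (β ∘ suc) _ ⟩
        sum (λ i → T (top Y v) (D ∙ ((κ (member b (lookup v i)) ∙ dy i) ∙ f)))
          ≈⟨ sum-cong (λ i → trans (T-resp _ (transΩ (∙-cong₂ (∙-assoc _ _ _)) (pull-κ _ _ _))) (T-κ _ _ _)) ⟩
        sum (λ i → member b (lookup v i) * T (top Y v) (D ∙ (dy i ∙ f))) ∎
      elem⁻ : ℕ → Carrier
      elem⁻ zero = 0#
      elem⁻ (suc a) = elem (Y ∘ β ∘ suc) a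
      elem-split : ∀ a → elem (Y ∘ β) a ≈ elem (Y ∘ β ∘ suc) a + Y b * elem⁻ a
      elem-split zero = solve 1 (λ y → :1 := :1 :+ y :* :0) refl (Y b)
      elem-split (suc a) = refl
      member-value : ∀ p → member b p * value Y p ≈ member b p * Y b
      member-value (inj₁ _) = trans (zeroˡ _) (sym (zeroˡ _))
      member-value (inj₂ (j , _)) with b Fin.≟ j
      ... | yes ≡.refl = refl
      ... | no _ = trans (zeroˡ _) (sym (zeroˡ _))
      term : ∀ i → sign i m ≈ 0# ⊎ (∀ a → es id m a ≈Ω es id (setθ i m) a ∔ y i ∙ es⁻ id (setθ i m) a) →
        member b (lookup v i) * T (top Y v) (D ∙ (dy i ∙ (es id m a ∙ mono m))) ≈
             elem (Y ∘ β) a * (member b (lookup v i) * T (top Y v) (D ∙ (dy i ∙ mono m)))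
      term i (inj₁ s) = trans (trans (*-congˡ (trans (T-resp _ (transΩ (∙-cong₂ (transΩ (pull (es-central id m a) _ _)
                          (transΩ (∙-cong₂ dy0) (∙-zeroʳ _)))) (∙-zeroʳ _))) (T-0 _))) (zeroʳ _))
                        (sym (trans (*-congˡ (trans (*-congˡ (trans (T-resp _ (transΩ (∙-cong₂ dy0) (∙-zeroʳ _))) (T-0 _))) (zeroʳ _))) (zeroʳ _)))
        where
        dy0 : dy i ∙ mono m ≈Ω κ 0#
        dy0 = transΩ (dy-mono i m) (κ0-zero _ s)
      term i (inj₂ h) = begin
        μ * T (top Y v) (D ∙ (dy i ∙ (es id m a ∙ mono m))) ≈⟨ *-congˡ (T-resp _ rewritten) ⟩
        μ * T (top Y v) (κ s ∙ (D ∙ (es id m′ a ∙ mono m′) ∔ y i ∙ (D ∙ (es⁻ id m′ a ∙ mono m′))))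
          ≈⟨ *-congˡ (trans (T-κ _ _ _) (*-congˡ (trans (T-∔ _ _ _) (+-congˡ (T-y Y v i _))))) ⟩
        μ * (s * (T (top Y v) (D ∙ (es id m′ a ∙ mono m′)) + val Y v i * T (top Y v) (D ∙ (es⁻ id m′ a ∙ mono m′))))
          ≈⟨ *-congˡ (*-congˡ (+-cong (ev-es′ (β ∘ suc) a m′) (*-congˡ (previous a)))) ⟩
        μ * (s * (elem (Y ∘ β ∘ suc) a * t + val Y v i * (elem⁻ a * t)))
          ≈⟨ solve 6 (λ μ s e t w e′ → μ :* (s :* (e :* t :+ w :* (e′ :* t))) := (μ :* e :+ (μ :* w) :* e′) :* (s :* t)) refl
               μ s _ t (val Y v i) (elem⁻ a) ⟩
        (μ * elem (Y ∘ β ∘ suc) a + (μ * val Y v i) * elem⁻ a) * (s * t)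
          ≈⟨ *-congʳ (+-congˡ (*-congʳ (member-value (lookup v i)))) ⟩
        (μ * elem (Y ∘ β ∘ suc) a + (μ * Y b) * elem⁻ a) * (s * t)
          ≈⟨ solve 6 (λ μ s e t w e′ → (μ :* e :+ (μ :* w) :* e′) :* (s :* t) := (e :+ w :* e′) :* (μ :* (s :* t))) refl
               μ s _ t (Y b) (elem⁻ a) ⟩
        (elem (Y ∘ β ∘ suc) a + Y b * elem⁻ a) * (μ * (s * t))
          ≈⟨ *-cong (sym (elem-split a)) (*-congˡ (sym (trans (T-resp _ (transΩ (∙-cong₂ (dy-mono i m)) (pull-κ _ _ _))) (T-κ _ _ _)))) ⟩
        elem (Y ∘ β) a * (μ * T (top Y v) (D ∙ (dy i ∙ mono m))) ∎ where
        μ = member b (lookup v i)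
        s = sign i m
        m′ = incrs i r′ (setθ i m)
        t = T (top Y v) (D ∙ mono m′)
        es-eq : ∀ a → es id (setθ i m) a ≡ es id m′ a
        es-eq a = ≡.sym (es-incrs id i r′ (setθ i m) a)
        es⁻-eq : ∀ a → es⁻ id (setθ i m) a ≡ es⁻ id m′ a
        es⁻-eq zero = ≡.refl
        es⁻-eq (suc a) = es-eq a
        previous : ∀ a → T (top Y v) (D ∙ (es⁻ id m′ a ∙ mono m′)) ≈ elem⁻ a * t
        previous zero = trans (T-resp _ (transΩ (∙-cong₂ (∙-zeroˡ _)) (∙-zeroʳ _))) (trans (T-0 _) (sym (zeroˡ _)))
        previous (suc a) = ev-es′ (β ∘ suc) a m′
        rewritten : D ∙ (dy i ∙ (es id m a ∙ mono m)) ≈Ω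
                    κ s ∙ (D ∙ (es id m′ a ∙ mono m′) ∔ y i ∙ (D ∙ (es⁻ id m′ a ∙ mono m′)))
        rewritten = ≈Ω.begin
          D ∙ (dy i ∙ (es id m a ∙ mono m)) ≈Ω.≈⟨ ∙-cong₂ (pull (es-central id m a) _ _) ⟩
          D ∙ (es id m a ∙ (dy i ∙ mono m)) ≈Ω.≈⟨ ∙-cong₂ (∙-cong (transΩ (h a) (∔-cong (reflexiveΩ (es-eq a)) (∙-cong₂ (reflexiveΩ (es⁻-eq a))))) (dy-mono i m)) ⟩
          D ∙ ((E ∔ y i ∙ E⁻) ∙ (κ s ∙ mono m′)) ≈Ω.≈⟨ transΩ (∙-cong₂ (pull-κ _ _ _)) (pull-κ _ _ _) ⟩
          κ s ∙ (D ∙ ((E ∔ y i ∙ E⁻) ∙ mono m′)) ≈Ω.≈⟨ ∙-cong₂ (∙-cong₂ (transΩ (∙-distribʳ _ _ _) (∔-cong reflΩ (∙-assoc _ _ _)))) ⟩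
          κ s ∙ (D ∙ (E ∙ mono m′ ∔ y i ∙ (E⁻ ∙ mono m′))) ≈Ω.≈⟨ ∙-cong₂ (transΩ (∙-distribˡ _ _ _) (∔-cong reflΩ (pull (y-central i) _ _))) ⟩
          κ s ∙ (D ∙ (E ∙ mono m′) ∔ y i ∙ (D ∙ (E⁻ ∙ mono m′))) ≈Ω.∎ where
          E = es id m′ a
          E⁻ = es⁻ id m′ a

    ev-es : ∀ a m → ev Y v (es id m a ∙ mono m) ≈ elem Y a * ev Y v (mono m)
    ev-es = ev-es′ id

  -- Signs of permutations and determinants of monomial matrices

  sign-bits : ∀ (i : Fin k) {m m′} → bits m ≡ bits m′ → sign i m ≡ sign i m′
  sign-bits zero {(_ , j) ∷ m} {(_ , j′) ∷ m′} e with Vec.∷-injectiveˡ e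
  sign-bits zero {(_ , true) ∷ m} {_ ∷ m′} e | ≡.refl = ≡.refl
  sign-bits zero {(_ , false) ∷ m} {_ ∷ m′} e | ≡.refl = ≡.refl
  sign-bits (suc i) {(_ , j) ∷ m} {(_ , j′) ∷ m′} e with Vec.∷-injectiveˡ e
  sign-bits (suc i) {(_ , true) ∷ m} {_ ∷ m′} e | ≡.refl = ≡.cong -_ (sign-bits i (Vec.∷-injectiveʳ e))
  sign-bits (suc i) {(_ , false) ∷ m} {_ ∷ m′} e | ≡.refl = sign-bits i (Vec.∷-injectiveʳ e)

  relabelSign : ∀ {j k} → (Fin j → Fin k) → Mon j → Carrier
  relabelSign ι [] = 1#
  relabelSign ι ((a , true) ∷ m) = relabelSign (ι ∘ suc) m * sign (ι zero) (relabel (ι ∘ suc) m)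
  relabelSign ι ((a , false) ∷ m) = relabelSign (ι ∘ suc) m

  relabelSign-cong : ∀ {j k} {ι ι′ : Fin j → Fin k} → (∀ i → ι i ≡ ι′ i) → ∀ m → relabelSign ι m ≡ relabelSign ι′ m
  relabelSign-cong e [] = ≡.refl
  relabelSign-cong e ((a , true) ∷ m) rewrite e zero | relabel-cong (e ∘ suc) m | relabelSign-cong (e ∘ suc) m = ≡.refl
  relabelSign-cong e ((a , false) ∷ m) = relabelSign-cong (e ∘ suc) m

  relabelSign-bits : ∀ {j k} (ι : Fin j → Fin k) {m m′} → bits m ≡ bits m′ → relabelSign ι m ≡ relabelSign ι m′
  relabelSign-bits ι {[]} {[]} e = ≡.refl
  relabelSign-bits ι {(a , j) ∷ m} {(a′ , j′) ∷ m′} e with Vec.∷-injectiveˡ e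
  relabelSign-bits ι {(a , true) ∷ m} {(a′ , true) ∷ m′} e | ≡.refl = ≡.cong₂ _*_ (relabelSign-bits (ι ∘ suc) (Vec.∷-injectiveʳ e))
    (sign-bits (ι zero) (bits-relabel (ι ∘ suc) (Vec.∷-injectiveʳ e)))
  relabelSign-bits ι {(a , false) ∷ m} {(a′ , false) ∷ m′} e | ≡.refl = relabelSign-bits (ι ∘ suc) (Vec.∷-injectiveʳ e)

  sign-insert : ∀ (p : Fin (suc k)) i m → sign (punchIn p i) (insertAt m p (0 , false)) ≡ sign i m
  sign-insert zero i m = ≡.refl
  sign-insert (suc p) zero ((_ , true) ∷ m) = ≡.refl
  sign-insert (suc p) zero ((_ , false) ∷ m) = ≡.refl
  sign-insert (suc p) (suc i) ((_ , true) ∷ m) = ≡.cong -_ (sign-insert p i m)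
  sign-insert (suc p) (suc i) ((_ , false) ∷ m) = sign-insert p i m

  relabelSign-punchIn : ∀ {j k} (p : Fin (suc k)) (ι : Fin j → Fin k) m → relabelSign (punchIn p ∘ ι) m ≡ relabelSign ι m
  relabelSign-punchIn p ι [] = ≡.refl
  relabelSign-punchIn p ι ((a , true) ∷ m) = ≡.cong₂ _*_ (relabelSign-punchIn p (ι ∘ suc) m)
    (≡.trans (≡.cong (sign (punchIn p (ι zero))) (relabel-punchIn p (ι ∘ suc) m)) (sign-insert p (ι zero) _))
  relabelSign-punchIn p ι ((a , false) ∷ m) = relabelSign-punchIn p (ι ∘ suc) m

  sign-last : ∀ (i : Fin k) m → lookup (bits m) i ≡ false → (∀ j → j ≢ i → lookup (bits m) j ≡ true) → sign i m ≈ (- 1#) ^ toℕ i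
  sign-last zero ((_ , false) ∷ m) e h = refl
  sign-last (suc i) ((_ , true) ∷ m) e h = trans (-‿cong (sign-last i m e (λ j j≢i → h (suc j) (j≢i ∘ Fin.suc-injective))))
    (solve 1 (λ x → :- x := (:- :1) :* x) refl _)
  sign-last (suc i) ((_ , false) ∷ m) e h with h zero (λ ())
  ... | ()

  permSign : (Fin k → Fin k) → Carrier
  permSign u = relabelSign u fullMon

  bits-full : (i : Fin k) → lookup (bits fullMon) i ≡ true
  bits-full zero = ≡.refl
  bits-full (suc i) = bits-full i

  module _ {k} (u : Fin (suc k) → Fin (suc k)) (inj : ∀ {i j} → u i ≡ u j → i ≡ j) where

    0≢suc : ∀ i → u zero ≢ u (suc i)
    0≢suc i e = contradiction (inj e) λ ()

    minorMap : Fin k → Fin k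
    minorMap i = punchOut (0≢suc i)

    minorMap-injective : ∀ {i j} → minorMap i ≡ minorMap j → i ≡ j
    minorMap-injective e = Fin.suc-injective (inj (Fin.punchOut-injective (0≢suc _) (0≢suc _) e))

    minorMap-punchIn : ∀ i → u (suc i) ≡ punchIn (u zero) (minorMap i)
    minorMap-punchIn i = ≡.sym (Fin.punchIn-punchOut (0≢suc i))

    -- The θ with index u 0 moves past those of smaller index, all of which are present since u is
    -- surjective. What remains belongs to the minor in the Laplace expansion.
    permSign-step : permSign u ≈ (- 1#) ^ toℕ (u zero) * permSign minorMap
    permSign-step = trans (*-comm _ _) (*-cong (sign-last (u zero) _ at-0 off-0) (reflexive
      (≡.trans (relabelSign-cong minorMap-punchIn fullMon) (relabelSign-punchIn (u zero) minorMap fullMon)))) where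
      rest = relabel (u ∘ suc) fullMon
      at-0 : lookup (bits rest) (u zero) ≡ false
      at-0 = ≡.trans (Vec.lookup-map (u zero) proj₂ rest) (≡.cong proj₂ (lookup-relabel-other (u ∘ suc) fullMon (u zero) 0≢suc))
      off-0 : ∀ j → j ≢ u zero → lookup (bits rest) j ≡ true
      off-0 j j≢ with injective⇒surjective u inj j
      ... | zero , ≡.refl = contradiction ≡.refl j≢
      ... | suc i , ≡.refl = ≡.trans (Vec.lookup-map (u (suc i)) proj₂ rest)
        (≡.trans (≡.cong proj₂ (lookup-relabel (u ∘ suc) (Fin.suc-injective ∘ inj) fullMon i))
          (≡.cong proj₂ (Vec.lookup-replicate i (0 , true))))

  permSign² : (u : Fin k → Fin k) → (∀ {i j} → u i ≡ u j → i ≡ j) → permSign u * permSign u ≈ 1#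
  permSign² {zero} u inj = *-identityˡ 1#
  permSign² {suc k} u inj = begin
    permSign u * permSign u ≈⟨ *-cong (permSign-step u inj) (permSign-step u inj) ⟩
    (s * permSign u′) * (s * permSign u′) ≈⟨ solve 2 (λ s t → (s :* t) :* (s :* t) := (s :* s) :* (t :* t)) refl s _ ⟩
    (s * s) * (permSign u′ * permSign u′) ≈⟨ *-cong (square (toℕ (u zero))) (permSign² u′ (minorMap-injective u inj)) ⟩
    1# * 1# ≈⟨ *-identityˡ 1# ⟩
    1# ∎ where
    open SetoidReasoning setoid
    u′ = minorMap u inj
    s = (- 1#) ^ toℕ (u zero)
    square : ∀ a → (- 1#) ^ a * (- 1#) ^ a ≈ 1#
    square zero = *-identityˡ 1#
    square (suc a) = trans (solve 1 (λ t → ((:- :1) :* t) :* ((:- :1) :* t) := t :* t) refl _) (square a)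

  det-monomial : (u : Fin k → Fin k) → (∀ {i j} → u i ≡ u j → i ≡ j) → ∀ (d : Fin k → Carrier) (A : Matrix k) →
    (∀ i j → A i j ≈ δ j (u i) * d i) → determinant A ≈ product d * permSign u
  det-monomial {zero} u inj d A h = sym (*-identityˡ 1#)
  det-monomial {suc k} u inj d A h = begin
    determinant A ≡⟨ sum-unfold (λ j → (- 1#) ^ toℕ j * (A zero j * determinant (minor j))) ⟨
    sum (λ j → (- 1#) ^ toℕ j * (A zero j * determinant (minor j)))
      ≈⟨ sum-single (u zero) _ (λ j j≢ → trans (*-congˡ (trans (*-congʳ (trans (h zero j) (trans (*-congʳ (δ-no j≢)) (zeroˡ _)))) (zeroˡ _))) (zeroʳ _)) ⟩
    s * (A zero (u zero) * determinant (minor (u zero)))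
      ≈⟨ *-congˡ (*-cong (trans (h zero (u zero)) (trans (*-congʳ (δ-yes (u zero))) (*-identityˡ _)))
           (det-monomial u′ (minorMap-injective u inj) (d ∘ suc) (minor (u zero)) minor-entries)) ⟩
    s * (d zero * (product (d ∘ suc) * permSign u′))
      ≈⟨ solve 4 (λ s d p t → s :* (d :* (p :* t)) := (d :* p) :* (s :* t)) refl s _ _ _ ⟩
    product d * (s * permSign u′) ≈⟨ *-congˡ (permSign-step u inj) ⟨
    product d * permSign u ∎ where
    open SetoidReasoning setoid
    u′ = minorMap u inj
    s = (- 1#) ^ toℕ (u zero)
    minor : Fin (suc k) → Matrix k
    minor j i l = A (suc i) (punchIn j l)
    minor-entries : ∀ i l → minor (u zero) i l ≈ δ l (u′ i) * d (suc i)
    minor-entries i l = trans (h (suc i) _) (*-congʳ (trans (reflexive (≡.cong (δ (punchIn (u zero) l)) (minorMap-punchIn u inj i)))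
      (δ-injective (punchIn (u zero)) (λ {a} {b} → Fin.punchIn-injective (u zero) a b) l (u′ i))))

  substitute-xpow : ∀ w i a → permAct w (xpow i a) ≡ xpow (w ⟨$⟩ʳ i) a
  substitute-xpow w i zero = ≡.refl
  substitute-xpow w i (suc a) = ≡.cong (x (w ⟨$⟩ʳ i) ∙_) (substitute-xpow w i a)

  permAct-monoAt : ∀ w (ι : Fin k → Fin n) m → permAct w (monoAt ι m) ≡ monoAt (λ i → w ⟨$⟩ʳ ι i) m
  permAct-monoAt w ι [] = ≡.refl
  permAct-monoAt w ι ((a , true) ∷ m) = ≡.cong₂ _∙_ (substitute-xpow w (ι zero) a)
    (≡.cong (θ (w ⟨$⟩ʳ ι zero) ∙_) (permAct-monoAt w (ι ∘ suc) m))
  permAct-monoAt w ι ((a , false) ∷ m) = ≡.cong₂ _∙_ (substitute-xpow w (ι zero) a)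
    (≡.cong (κ 1# ∙_) (permAct-monoAt w (ι ∘ suc) m))

  monoAt-relabel : ∀ (ι : Fin k → Fin n) m → monoAt ι m ≈Ω κ (relabelSign ι m) ∙ mono (relabel ι m)
  monoAt-relabel ι [] = symΩ (transΩ (∙-idˡ _) (monoAt-unit id))
  monoAt-relabel ι ((a , true) ∷ m) = begin
    xpow (ι zero) a ∙ (θ (ι zero) ∙ monoAt (ι ∘ suc) m) ≈⟨ ∙-cong₂ (∙-cong₂ (monoAt-relabel (ι ∘ suc) m)) ⟩
    xpow (ι zero) a ∙ (θ (ι zero) ∙ (κ s ∙ mono m′)) ≈⟨ ∙-cong₂ (pull-κ _ _ _) ⟩
    xpow (ι zero) a ∙ (κ s ∙ (θ (ι zero) ∙ mono m′)) ≈⟨ ∙-cong₂ (∙-cong₂ (θ-mono (ι zero) m′)) ⟩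
    xpow (ι zero) a ∙ (κ s ∙ (κ (sign (ι zero) m′) ∙ mono (setθ (ι zero) m′))) ≈⟨ ∙-cong₂ (κκ _ _ _) ⟩
    xpow (ι zero) a ∙ (κ (s * sign (ι zero) m′) ∙ mono (setθ (ι zero) m′)) ≈⟨ pull-κ _ _ _ ⟩
    κ (s * sign (ι zero) m′) ∙ (xpow (ι zero) a ∙ mono (setθ (ι zero) m′)) ≈⟨ ∙-cong₂ (xpow-mono (ι zero) a _) ⟩
    κ (s * sign (ι zero) m′) ∙ mono (relabel ι ((a , true) ∷ m)) ∎ where
    open ≈Ω
    s = relabelSign (ι ∘ suc) m
    m′ = relabel (ι ∘ suc) m
  monoAt-relabel ι ((a , false) ∷ m) = transΩ (∙-cong₂ (transΩ (∙-idˡ _) (monoAt-relabel (ι ∘ suc) m)))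
    (transΩ (pull-κ _ _ _) (∙-cong₂ (xpow-mono (ι zero) a _)))

  diagAct-trivial : ∀ f → diagAct (λ _ → zero) f ≈Ω f
  diagAct-trivial (κ c) = reflΩ
  diagAct-trivial (x i) = transΩ (∙-cong₁ (κ-cong ζʳ)) (∙-idˡ _)
  diagAct-trivial (θ i) = transΩ (∙-cong₁ (κ-cong ζʳ)) (∙-idˡ _)
  diagAct-trivial (f ∔ g) = ∔-cong (diagAct-trivial f) (diagAct-trivial g)
  diagAct-trivial (f ∙ g) = ∙-cong (diagAct-trivial f) (diagAct-trivial g)

  permAct-cong : ∀ w {f g} → f ≈Ω g → permAct w f ≈Ω permAct w g
  permAct-cong w {f} {g} e = transΩ (symΩ (diagAct-trivial (permAct w f)))
    (transΩ (act-cong ((λ _ → zero) ⋉ w) e) (diagAct-trivial (permAct w g)))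

  permAct-id : ∀ f → permAct Perm.id f ≡ f
  permAct-id (κ c) = ≡.refl
  permAct-id (x i) = ≡.refl
  permAct-id (θ i) = ≡.refl
  permAct-id (f ∔ g) = ≡.cong₂ _∔_ (permAct-id f) (permAct-id g)
  permAct-id (f ∙ g) = ≡.cong₂ _∙_ (permAct-id f) (permAct-id g)

  diagAct-cong : ∀ c {f g} → f ≈Ω g → diagAct c f ≈Ω diagAct c g
  diagAct-cong c {f} {g} e = ≡.subst₂ (λ f g → diagAct c f ≈Ω diagAct c g) (permAct-id f) (permAct-id g)
    (act-cong (c ⋉ Perm.id) e)

  permAct-∘ : ∀ w w′ f → permAct w (permAct w′ f) ≡ permAct (w′ ∘ₚ w) f
  permAct-∘ w w′ (κ c) = ≡.refl
  permAct-∘ w w′ (x i) = ≡.refl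
  permAct-∘ w w′ (θ i) = ≡.refl
  permAct-∘ w w′ (f ∔ g) = ≡.cong₂ _∔_ (permAct-∘ w w′ f) (permAct-∘ w w′ g)
  permAct-∘ w w′ (f ∙ g) = ≡.cong₂ _∙_ (permAct-∘ w w′ f) (permAct-∘ w w′ g)

  permAct-pointwise : ∀ {w w′ : Permutation′ n} → (∀ i → w ⟨$⟩ʳ i ≡ w′ ⟨$⟩ʳ i) → ∀ f → permAct w f ≡ permAct w′ f
  permAct-pointwise e (κ c) = ≡.refl
  permAct-pointwise e (x i) = ≡.cong x (e i)
  permAct-pointwise e (θ i) = ≡.cong θ (e i)
  permAct-pointwise {w} {w′} e (f ∔ g) = ≡.cong₂ _∔_ (permAct-pointwise {w} {w′} e f) (permAct-pointwise {w} {w′} e g)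
  permAct-pointwise {w} {w′} e (f ∙ g) = ≡.cong₂ _∙_ (permAct-pointwise {w} {w′} e f) (permAct-pointwise {w} {w′} e g)

  sgn : Permutation′ n → Carrier
  sgn w = permSign (w ⟨$⟩ʳ_)

  perm-injective : ∀ (w : Permutation′ n) {i j} → w ⟨$⟩ʳ i ≡ w ⟨$⟩ʳ j → i ≡ j
  perm-injective w {i} {j} e = ≡.trans (≡.sym (Perm.inverseˡ w)) (≡.trans (≡.cong (w ⟨$⟩ˡ_) e) (Perm.inverseˡ w))

  sgn² : ∀ w → sgn w * sgn w ≈ 1#
  sgn² w = permSign² (w ⟨$⟩ʳ_) (perm-injective w)

  vec-ext : ∀ {A : Set} {k} {v v′ : Vec A k} → (∀ i → lookup v i ≡ lookup v′ i) → v ≡ v′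
  vec-ext {v = []} {[]} h = ≡.refl
  vec-ext {v = a ∷ v} {b ∷ v′} h = ≡.cong₂ _∷_ (h zero) (vec-ext (h ∘ suc))

  relabel-full : ∀ (w : Permutation′ n) → relabel (w ⟨$⟩ʳ_) fullMon ≡ fullMon
  relabel-full w = vec-ext λ i → ≡.trans (≡.cong (lookup (relabel (w ⟨$⟩ʳ_) fullMon)) (≡.sym (Perm.inverseʳ w)))
    (≡.trans (lookup-relabel (w ⟨$⟩ʳ_) (perm-injective w) fullMon (w ⟨$⟩ˡ i))
      (≡.trans (Vec.lookup-replicate (w ⟨$⟩ˡ i) (0 , true)) (≡.sym (Vec.lookup-replicate i (0 , true)))))

  permAct-full : ∀ w → permAct w (mono fullMon) ≈Ω κ (sgn w) ∙ mono fullMon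
  permAct-full w = transΩ (reflexiveΩ (permAct-monoAt w id fullMon))
    (transΩ (monoAt-relabel (w ⟨$⟩ʳ_) fullMon) (∙-cong₂ (reflexiveΩ (≡.cong mono (relabel-full w)))))

  κ-full-injective : ∀ {c d} → κ c ∙ mono fullMon ≈Ω κ d ∙ mono fullMon → c ≈ d
  κ-full-injective e = trans (sym (coefficient _)) (trans (T-resp one e) (coefficient _)) where
    one : Mon n → Carrier
    one _ = 1#
    coefficient : ∀ c → T one (κ c ∙ mono fullMon) ≈ c
    coefficient c = trans (T-κ one c _) (trans (*-congˡ (T-mono one fullMon)) (*-identityʳ c))

  -- Both sides are the scalar by which the composite acts on θ₁⋯θₙ.
  sgn-∘ : ∀ w w′ → sgn (w′ ∘ₚ w) ≈ sgn w * sgn w′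
  sgn-∘ w w′ = κ-full-injective (≈Ω.begin
    κ (sgn (w′ ∘ₚ w)) ∙ mono fullMon ≈Ω.≈⟨ permAct-full (w′ ∘ₚ w) ⟨
    permAct (w′ ∘ₚ w) (mono fullMon) ≈Ω.≡⟨ permAct-∘ w w′ (mono fullMon) ⟨
    permAct w (permAct w′ (mono fullMon)) ≈Ω.≈⟨ permAct-cong w (permAct-full w′) ⟩
    κ (sgn w′) ∙ permAct w (mono fullMon) ≈Ω.≈⟨ ∙-cong₂ (permAct-full w) ⟩
    κ (sgn w′) ∙ (κ (sgn w) ∙ mono fullMon) ≈Ω.≈⟨ κκ _ _ _ ⟩
    κ (sgn w′ * sgn w) ∙ mono fullMon ≈Ω.≈⟨ ∙-cong₁ (κ-cong (*-comm _ _)) ⟩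
    κ (sgn w * sgn w′) ∙ mono fullMon ≈Ω.∎)

  sgn-pointwise : ∀ {w w′ : Permutation′ n} → (∀ i → w ⟨$⟩ʳ i ≡ w′ ⟨$⟩ʳ i) → sgn w ≈ sgn w′
  sgn-pointwise e = reflexive (relabelSign-cong e fullMon)

  sgn-id : sgn Perm.id ≈ 1#
  sgn-id = begin
    sgn Perm.id ≈⟨ *-identityʳ _ ⟨
    sgn Perm.id * 1# ≈⟨ *-congˡ (sgn² Perm.id) ⟨
    sgn Perm.id * (sgn Perm.id * sgn Perm.id) ≈⟨ *-congˡ (sgn-∘ Perm.id Perm.id) ⟨
    sgn Perm.id * sgn (Perm.id ∘ₚ Perm.id) ≈⟨ *-congˡ (sgn-pointwise {Perm.id ∘ₚ Perm.id} {Perm.id} (λ _ → ≡.refl)) ⟩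
    sgn Perm.id * sgn Perm.id ≈⟨ sgn² Perm.id ⟩
    1# ∎
    where open SetoidReasoning setoid

  sgn-flip : ∀ w → sgn (flip w) ≈ sgn w
  sgn-flip w = begin
    sgn (flip w) ≈⟨ *-identityˡ _ ⟨
    1# * sgn (flip w) ≈⟨ *-congʳ (sgn² w) ⟨
    (sgn w * sgn w) * sgn (flip w) ≈⟨ *-assoc _ _ _ ⟩
    sgn w * (sgn w * sgn (flip w)) ≈⟨ *-congˡ (sgn-∘ w (flip w)) ⟨
    sgn w * sgn (flip w ∘ₚ w) ≈⟨ *-congˡ (trans (sgn-pointwise {flip w ∘ₚ w} {Perm.id} (λ i → Perm.inverseʳ w)) sgn-id) ⟩
    sgn w * 1# ≈⟨ *-identityʳ _ ⟩
    sgn w ∎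
    where open SetoidReasoning setoid

  -- Row i has its nonzero entry in column w⁻¹(i), so the expansion along rows produces the sign of
  -- the inverse, which is that of w.
  det-matrix : ∀ c w → determinant (matrix (c ⋉ w)) ≈ product (λ i → ζ ^ toℕ (c i)) * sgn w
  det-matrix c w = trans
    (det-monomial (w ⟨$⟩ˡ_) (perm-injective (flip w)) (λ i → ζ ^ toℕ (c i)) (matrix (c ⋉ w)) entries)
    (*-congˡ (sgn-flip w)) where
    entries : ∀ i j → matrix (c ⋉ w) i j ≈ δ j (w ⟨$⟩ˡ i) * ζ ^ toℕ (c i)
    entries i j with i Fin.≟ (w ⟨$⟩ʳ j) | j Fin.≟ (w ⟨$⟩ˡ i)
    ... | yes p | yes q = sym (*-identityˡ _)
    ... | no ¬p | no ¬q = sym (zeroˡ _)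
    ... | yes p | no ¬q = contradiction (≡.sym (≡.trans (≡.cong (w ⟨$⟩ˡ_) p) (Perm.inverseˡ w))) ¬q
    ... | no ¬p | yes q = contradiction (≡.sym (≡.trans (≡.cong (w ⟨$⟩ʳ_) q) (Perm.inverseʳ w))) ¬p

  -- The functionals under the group

  permutePlaces : Permutation′ n → Vec (Place r q) n → Vec (Place r q) n
  permutePlaces w v = tabulate λ b → lookup v (w ⟨$⟩ˡ b)

  lookup-permutePlaces : ∀ w (v : Vec (Place r q) n) i → lookup (permutePlaces w v) (w ⟨$⟩ʳ i) ≡ lookup v i
  lookup-permutePlaces w v i = ≡.trans (Vec.lookup∘tabulate _ (w ⟨$⟩ʳ i)) (≡.cong (lookup v) (Perm.inverseˡ w))

  top-product : ∀ (Y : Fin q → Carrier) (v : Vec (Place r q) k) m → top Y v m ≈ product (λ i → cell Y (lookup v i) (lookup m i))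
  top-product Y [] [] = refl
  top-product Y (p ∷ v) (a ∷ m) = *-congˡ (top-product Y v m)

  top-relabel : ∀ (Y : Fin q → Carrier) w (v : Vec (Place r q) n) m → top Y (permutePlaces w v) (relabel (w ⟨$⟩ʳ_) m) ≈ top Y v m
  top-relabel Y w v m = begin
    top Y v′ m′ ≈⟨ top-product Y v′ m′ ⟩
    product (λ b → cell Y (lookup v′ b) (lookup m′ b)) ≈⟨ Π.sum-permute (λ b → cell Y (lookup v′ b) (lookup m′ b)) w ⟩
    product (λ i → cell Y (lookup v′ (w ⟨$⟩ʳ i)) (lookup m′ (w ⟨$⟩ʳ i)))
      ≈⟨ Π.sum-cong-≋ (λ i → reflexive (≡.cong₂ (cell Y) (lookup-permutePlaces w v i) (lookup-relabel (w ⟨$⟩ʳ_) (perm-injective w) m i))) ⟩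
    product (λ i → cell Y (lookup v i) (lookup m i)) ≈⟨ top-product Y v m ⟨
    top Y v m ∎ where
    open SetoidReasoning setoid
    v′ = permutePlaces w v
    m′ = relabel (w ⟨$⟩ʳ_) m

  permAct-linear : ∀ w → IsLinear Ω-module Ω-module (permAct w)
  permAct-linear w = mkLinear Ω-module Ω-module _ (permAct-cong w) (λ _ _ → reflΩ) (λ _ _ → reflΩ)

  permAct-dy : ∀ w i → permAct w (dy i) ≡ dy (w ⟨$⟩ʳ i)
  permAct-dy w i = ≡.cong (_∙ θ (w ⟨$⟩ʳ i)) (substitute-xpow w i r′)

  permAct-dyB : ∀ w (v : Vec (Place r q) n) j → permAct w (dyB v j) ≈Ω dyB (permutePlaces w v) j
  permAct-dyB w v j = begin
    permAct w (sumᴹ (λ i → κ (member j (lookup v i)) ∙ dy i)) ≈⟨ sumᴹ-linear (permAct w) (permAct-linear w) _ ⟩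
    sumᴹ (λ i → κ (member j (lookup v i)) ∙ permAct w (dy i))
      ≈⟨ sumᴹ-cong (λ i → reflexiveΩ (≡.cong₂ (λ p f → κ (member j p) ∙ f) (≡.sym (lookup-permutePlaces w v i)) (permAct-dy w i))) ⟩
    sumᴹ (λ i → κ (member j (lookup (permutePlaces w v) (w ⟨$⟩ʳ i))) ∙ dy (w ⟨$⟩ʳ i))
      ≈⟨ sumᴹ-permute (λ b → κ (member j (lookup (permutePlaces w v) b)) ∙ dy b) w ⟨
    dyB (permutePlaces w v) j ∎
    where open ≈Ω

  permAct-dys : ∀ w (v : Vec (Place r q) n) (β : Fin k → Fin q) → permAct w (dys v β) ≈Ω dys (permutePlaces w v) β
  permAct-dys {k = zero} w v β = reflΩ
  permAct-dys {k = suc k} w v β = ∙-cong (permAct-dys w v (β ∘ suc)) (permAct-dyB w v (β zero))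

  functional-ext : (L L′ : Ω → Carrier) →
    (∀ {f g} → f ≈Ω g → L f ≈ L g) → (∀ f g → L (f ∔ g) ≈ L f + L g) → (∀ c f → L (κ c ∙ f) ≈ c * L f) →
    (∀ {f g} → f ≈Ω g → L′ f ≈ L′ g) → (∀ f g → L′ (f ∔ g) ≈ L′ f + L′ g) → (∀ c f → L′ (κ c ∙ f) ≈ c * L′ f) →
    (∀ m → L (mono m) ≈ L′ (mono m)) → ∀ f → L f ≈ L′ f
  functional-ext L L′ r₁ a₁ s₁ r₂ a₂ s₂ h = mono-span S h where
    zero′ : ∀ (L : Ω → Carrier) → (∀ {f g} → f ≈Ω g → L f ≈ L g) → (∀ c f → L (κ c ∙ f) ≈ c * L f) → L (κ 0#) ≈ 0#
    zero′ L r s = trans (r (symΩ (∙-zeroˡ (κ 0#)))) (trans (s 0# (κ 0#)) (zeroˡ _))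
    S : Submodule Ω-module
    S = record
      { _∈S = λ f → L f ≈ L′ f
      ; resp = λ e p → trans (r₁ (symΩ e)) (trans p (r₂ e))
      ; 0∈ = trans (zero′ L r₁ s₁) (sym (zero′ L′ r₂ s₂))
      ; +∈ = λ p q → trans (a₁ _ _) (trans (+-cong p q) (sym (a₂ _ _)))
      ; *∈ = λ c p → trans (s₁ c _) (trans (*-congˡ p) (sym (s₂ c _)))
      }

  full⊎zero : ∀ (Y : Fin q → Carrier) (v : Vec (Place r q) k) m → top Y v m ≈ 0# ⊎ bits m ≡ bits fullMon
  full⊎zero Y [] [] = inj₂ ≡.refl
  full⊎zero Y (p ∷ v) ((a , false) ∷ m) = inj₁ (zeroˡ _)
  full⊎zero Y (p ∷ v) ((a , true) ∷ m) with full⊎zero Y v m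
  ... | inj₁ z = inj₁ (trans (*-congˡ z) (zeroʳ _))
  ... | inj₂ e = inj₂ (≡.cong (true ∷_) e)

  T-perm : ∀ (Y : Fin q → Carrier) w v f → T (top Y (permutePlaces w v)) (permAct w f) ≈ sgn w * T (top Y v) f
  T-perm Y w v = functional-ext _ _
    (λ e → T-resp _ (permAct-cong w e)) (λ _ _ → T-∔ _ _ _) (λ c f → T-κ _ c _)
    (λ e → *-congˡ (T-resp _ e)) (λ f g → trans (*-congˡ (T-∔ _ f g)) (distribˡ _ _ _))
    (λ c f → trans (*-congˡ (T-κ _ c f)) (x∙yz≈y∙xz _ _ _))
    λ m → begin
      T (top Y v′) (permAct w (mono m)) ≈⟨ T-resp _ (reflexiveΩ (permAct-monoAt w id m)) ⟩
      T (top Y v′) (monoAt (w ⟨$⟩ʳ_) m) ≈⟨ T-resp _ (monoAt-relabel (w ⟨$⟩ʳ_) m) ⟩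
      T (top Y v′) (κ (s m) ∙ mono (relabel (w ⟨$⟩ʳ_) m)) ≈⟨ trans (T-κ _ _ _) (*-congˡ (T-mono _ _)) ⟩
      s m * top Y v′ (relabel (w ⟨$⟩ʳ_) m) ≈⟨ *-congˡ (top-relabel Y w v m) ⟩
      s m * top Y v m ≈⟨ signs m ⟩
      sgn w * top Y v m ≈⟨ *-congˡ (T-mono _ m) ⟨
      sgn w * T (top Y v) (mono m) ∎ where
    open SetoidReasoning setoid
    v′ = permutePlaces w v
    s : Mon n → Carrier
    s = relabelSign (w ⟨$⟩ʳ_)
    -- Where `top` does not vanish all θ occur, and there the reordering sign is the sign of w.
    signs : ∀ m → s m * top Y v m ≈ sgn w * top Y v m
    signs m with full⊎zero Y v m
    ... | inj₁ z = trans (*-congˡ z) (trans (zeroʳ _) (sym (trans (*-congˡ z) (zeroʳ _))))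
    ... | inj₂ e = *-congʳ (reflexive (relabelSign-bits (w ⟨$⟩ʳ_) e))

  ev-perm : ∀ (Y : Fin q → Carrier) w v f → ev Y (permutePlaces w v) (permAct w f) ≈ sgn w * ev Y v f
  ev-perm Y w v f = trans (T-resp _ (∙-cong₁ (symΩ (permAct-dys w v id)))) (T-perm Y w v (dys v id ∙ f))

  open SetoidReasoning setoid

  ζ^^ : ∀ a b → (ζ ^ a) ^ b ≈ (ζ ^ b) ^ a
  ζ^^ a b = trans (^-assocʳ ζ a b) (trans (^-congʳ ζ (ℕ.*-comm a b)) (sym (^-assocʳ ζ b a)))

  ζ^r : ∀ a → (ζ ^ a) ^ r ≈ 1#
  ζ^r a = trans (ζ^^ a r) (trans (^-congˡ a ζʳ) (one^ a))

  ζ⁻-inverse : ∀ c → ζ⁻ c * ζ ^ toℕ c ≈ 1#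
  ζ⁻-inverse c = trans (sym (^-homo-* ζ (r ℕ.∸ toℕ c) (toℕ c)))
    (trans (^-congʳ ζ (ℕ.m∸n+n≡m (ℕ.<⇒≤ (Fin.toℕ<n c)))) ζʳ)

  ζ⁻^r : ∀ c → ζ⁻ c ^ r ≈ 1#
  ζ⁻^r c = ζ^r (r ℕ.∸ toℕ c)

  ζ-mod : ∀ a → ζ ^ (a % r) ≈ ζ ^ a
  ζ-mod a = begin
    ζ ^ (a % r) ≈⟨ *-identityʳ _ ⟨
    ζ ^ (a % r) * 1# ≈⟨ *-congˡ (ζ^r (a / r)) ⟨
    ζ ^ (a % r) * (ζ ^ (a / r)) ^ r ≈⟨ *-congˡ (^-assocʳ ζ (a / r) r) ⟩
    ζ ^ (a % r) * ζ ^ ((a / r) ℕ.* r) ≈⟨ ^-homo-* ζ (a % r) _ ⟨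
    ζ ^ (a % r ℕ.+ (a / r) ℕ.* r) ≈⟨ ^-congʳ ζ (≡.sym (ℕ.m≡m%n+[m/n]*n a r)) ⟩
    ζ ^ a ∎

  toℕ-mod : ∀ a → toℕ (a ℕ.mod r) ≡ a % r
  toℕ-mod a = Fin.toℕ-fromℕ< (ℕ.m%n<n a r)

  diagWeight : (Fin k → Fin r) → Mon k → Carrier
  diagWeight c [] = 1#
  diagWeight c ((a , false) ∷ m) = ζ⁻ (c zero) ^ a * diagWeight (c ∘ suc) m
  diagWeight c ((a , true) ∷ m) = ζ⁻ (c zero) ^ suc a * diagWeight (c ∘ suc) m

  diagAct-xpow : ∀ c i a → diagAct c (xpow i a) ≈Ω κ (ζ⁻ (c i) ^ a) ∙ xpow i a
  diagAct-xpow c i zero = symΩ (∙-idˡ _)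
  diagAct-xpow c i (suc a) = ≈Ω.begin
    (κ z ∙ x i) ∙ diagAct c (xpow i a) ≈Ω.≈⟨ ∙-cong₂ (diagAct-xpow c i a) ⟩
    (κ z ∙ x i) ∙ (κ (z ^ a) ∙ xpow i a) ≈Ω.≈⟨ transΩ (∙-assoc _ _ _) (∙-cong₂ (pull-κ _ _ _)) ⟩
    κ z ∙ (κ (z ^ a) ∙ (x i ∙ xpow i a)) ≈Ω.≈⟨ κκ _ _ _ ⟩
    κ (z * z ^ a) ∙ xpow i (suc a) ≈Ω.∎
    where z = ζ⁻ (c i)

  diagAct-monoAt : ∀ c (ι : Fin k → Fin n) m → diagAct c (monoAt ι m) ≈Ω κ (diagWeight (c ∘ ι) m) ∙ monoAt ι m
  diagAct-monoAt c ι [] = symΩ (∙-idˡ _)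
  diagAct-monoAt c ι ((a , false) ∷ m) = ≈Ω.begin
    diagAct c (xpow (ι zero) a) ∙ (κ 1# ∙ diagAct c M) ≈Ω.≈⟨ ∙-cong (diagAct-xpow c (ι zero) a) (∙-cong₂ (diagAct-monoAt c (ι ∘ suc) m)) ⟩
    (κ (z ^ a) ∙ X) ∙ (κ 1# ∙ (κ t ∙ M)) ≈Ω.≈⟨ transΩ (∙-assoc _ _ _) (∙-cong₂ (transΩ (∙-cong₂ (pull-κ _ _ _)) (pull-κ _ _ _))) ⟩
    κ (z ^ a) ∙ (κ t ∙ (X ∙ (κ 1# ∙ M))) ≈Ω.≈⟨ κκ _ _ _ ⟩
    κ (z ^ a * t) ∙ monoAt ι ((a , false) ∷ m) ≈Ω.∎ where
    z = ζ⁻ (c (ι zero))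
    t = diagWeight (c ∘ ι ∘ suc) m
    X = xpow (ι zero) a
    M = monoAt (ι ∘ suc) m
  diagAct-monoAt c ι ((a , true) ∷ m) = ≈Ω.begin
    diagAct c (xpow (ι zero) a) ∙ ((κ z ∙ Θ) ∙ diagAct c M) ≈Ω.≈⟨ ∙-cong (diagAct-xpow c (ι zero) a) (∙-cong₂ (diagAct-monoAt c (ι ∘ suc) m)) ⟩
    (κ (z ^ a) ∙ X) ∙ ((κ z ∙ Θ) ∙ (κ t ∙ M)) ≈Ω.≈⟨ transΩ (∙-assoc _ _ _) (∙-cong₂ (∙-cong₂ (transΩ (∙-assoc _ _ _) (∙-cong₂ (pull-κ _ _ _))))) ⟩
    κ (z ^ a) ∙ (X ∙ (κ z ∙ (κ t ∙ (Θ ∙ M)))) ≈Ω.≈⟨ ∙-cong₂ (transΩ (∙-cong₂ (κκ _ _ _)) (pull-κ _ _ _)) ⟩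
    κ (z ^ a) ∙ (κ (z * t) ∙ (X ∙ (Θ ∙ M))) ≈Ω.≈⟨ κκ _ _ _ ⟩
    κ (z ^ a * (z * t)) ∙ (X ∙ (Θ ∙ M)) ≈Ω.≈⟨ ∙-cong₁ (κ-cong (x∙yz≈yx∙z _ z t)) ⟩
    κ (z ^ suc a * t) ∙ monoAt ι ((a , true) ∷ m) ≈Ω.∎ where
    z = ζ⁻ (c (ι zero))
    t = diagWeight (c ∘ ι ∘ suc) m
    X = xpow (ι zero) a
    Θ = θ (ι zero)
    M = monoAt (ι ∘ suc) m

  cancel-powers : ∀ {z z⁻} → z⁻ * z ≈ 1# → ∀ a b → z ^ (a ℕ.+ b) * z⁻ ^ a ≈ z ^ b
  cancel-powers e zero b = *-identityʳ _
  cancel-powers {z} {z⁻} e (suc a) b = begin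
    (z * z ^ (a ℕ.+ b)) * (z⁻ * z⁻ ^ a) ≈⟨ solve 4 (λ a b c d → (a :* b) :* (c :* d) := (c :* a) :* (b :* d)) refl _ _ _ _ ⟩
    (z⁻ * z) * (z ^ (a ℕ.+ b) * z⁻ ^ a) ≈⟨ *-cong e (cancel-powers e a b) ⟩
    1# * z ^ b ≈⟨ *-identityˡ _ ⟩
    z ^ b ∎

  cell-recolour : ∀ (Y : Fin q → Carrier) c p a →
    ζ⁻ c ^ suc a * cell Y (recolourPlace c p) (a , true) ≈ (ζ ^ toℕ c * weight c p) * cell Y p (a , true)
  cell-recolour Y c (inj₁ k) a = on-diagonal (suc a ℕ.≟ r′ ℕ.∸ toℕ k) λ e → begin
    z⁻ ^ suc a ≈⟨ *-identityˡ _ ⟨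
    1# * z⁻ ^ suc a ≈⟨ *-congʳ (ζ^r (toℕ c)) ⟨
    z ^ r * z⁻ ^ suc a ≈⟨ *-congʳ (^-congʳ z (exponent e)) ⟩
    z ^ (suc a ℕ.+ suc (toℕ k)) * z⁻ ^ suc a ≈⟨ cancel-powers (ζ⁻-inverse c) (suc a) _ ⟩
    z * z ^ toℕ k ≈⟨ *-congˡ (trans (^-assocʳ ζ (toℕ c) (toℕ k)) (^-congʳ ζ (ℕ.*-comm (toℕ c) (toℕ k)))) ⟩
    z * ζ ^ (toℕ k ℕ.* toℕ c) ∎ where
    z = ζ ^ toℕ c
    z⁻ = ζ⁻ c
    on-diagonal : ∀ {A : Set} (d : Dec A) {b c} → (A → b ≈ c) → b * ⟦ d ⟧? ≈ c * ⟦ d ⟧?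
    on-diagonal (yes e) h = *-congʳ (h e)
    on-diagonal (no _) h = trans (zeroʳ _) (sym (zeroʳ _))
    exponent : suc a ≡ r′ ℕ.∸ toℕ k → r ≡ suc a ℕ.+ suc (toℕ k)
    exponent e = ≡.sym (≡.trans (ℕ.+-suc (suc a) (toℕ k)) (≡.cong suc (≡.trans (≡.cong (ℕ._+ toℕ k) e)
      (ℕ.m∸n+n≡m (ℕ.<⇒≤ (Fin.toℕ<n k))))))
  cell-recolour Y c (inj₂ (j , ρ)) a = begin
    z⁻ ^ suc a * (ζ ^ (toℕ ((toℕ ρ ℕ.+ toℕ c) ℕ.mod r) ℕ.* suc (suc a)) * Yᵃ) ≈⟨ *-congˡ (*-congʳ recoloured) ⟩
    z⁻ ^ suc a * ((ζ ^ (toℕ ρ ℕ.* suc (suc a)) * z ^ suc (suc a)) * Yᵃ)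
      ≈⟨ solve 4 (λ a b c d → a :* ((b :* c) :* d) := (c :* a) :* (b :* d)) refl _ _ _ _ ⟩
    (z ^ suc (suc a) * z⁻ ^ suc a) * (ζ ^ (toℕ ρ ℕ.* suc (suc a)) * Yᵃ)
      ≈⟨ *-congʳ (trans (*-congʳ (^-congʳ z (≡.sym (ℕ.+-comm (suc a) 1)))) (trans (cancel-powers (ζ⁻-inverse c) (suc a) 1) refl)) ⟩
    (z * 1#) * (ζ ^ (toℕ ρ ℕ.* suc (suc a)) * Yᵃ) ∎ where
    z = ζ ^ toℕ c
    z⁻ = ζ⁻ c
    Yᵃ = Y j ^ (suc a / r)
    recoloured : ζ ^ (toℕ ((toℕ ρ ℕ.+ toℕ c) ℕ.mod r) ℕ.* suc (suc a)) ≈ ζ ^ (toℕ ρ ℕ.* suc (suc a)) * z ^ suc (suc a)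
    recoloured = begin
      ζ ^ (toℕ ((toℕ ρ ℕ.+ toℕ c) ℕ.mod r) ℕ.* suc (suc a)) ≈⟨ ^-assocʳ ζ (toℕ ((toℕ ρ ℕ.+ toℕ c) ℕ.mod r)) (suc (suc a)) ⟨
      (ζ ^ toℕ ((toℕ ρ ℕ.+ toℕ c) ℕ.mod r)) ^ suc (suc a) ≈⟨ ^-congˡ (suc (suc a)) (trans (^-congʳ ζ (toℕ-mod (toℕ ρ ℕ.+ toℕ c))) (ζ-mod (toℕ ρ ℕ.+ toℕ c))) ⟩
      (ζ ^ (toℕ ρ ℕ.+ toℕ c)) ^ suc (suc a) ≈⟨ ^-congˡ (suc (suc a)) (^-homo-* ζ (toℕ ρ) (toℕ c)) ⟩
      (ζ ^ toℕ ρ * z) ^ suc (suc a) ≈⟨ ^-distrib-* (ζ ^ toℕ ρ) z (suc (suc a)) ⟩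
      (ζ ^ toℕ ρ) ^ suc (suc a) * z ^ suc (suc a) ≈⟨ *-congʳ (^-assocʳ ζ (toℕ ρ) (suc (suc a))) ⟩
      ζ ^ (toℕ ρ ℕ.* suc (suc a)) * z ^ suc (suc a) ∎

  recolourPlaces : (Fin k → Fin r) → Vec (Place r q) k → Vec (Place r q) k
  recolourPlaces c v = tabulate λ i → recolourPlace (c i) (lookup v i)

  factor : (Fin k → Fin r) → Vec (Place r q) k → Carrier
  factor c v = product λ i → ζ ^ toℕ (c i) * weight (c i) (lookup v i)

  top-recolour : ∀ (Y : Fin q → Carrier) (c : Fin k → Fin r) (v : Vec (Place r q) k) m →
    diagWeight c m * top Y (recolourPlaces c v) m ≈ factor c v * top Y v m
  top-recolour Y c [] [] = refl
  top-recolour Y c (p ∷ v) ((a , false) ∷ m) =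
    trans (trans (*-congˡ (zeroˡ _)) (zeroʳ _)) (sym (trans (*-congˡ (zeroˡ _)) (zeroʳ _)))
  top-recolour Y c (p ∷ v) ((a , true) ∷ m) = begin
    (ζ⁻ (c zero) ^ suc a * diagWeight (c ∘ suc) m) * (cell Y (recolourPlace (c zero) p) (a , true) * top Y (recolourPlaces (c ∘ suc) v) m)
      ≈⟨ interchange _ _ _ _ ⟩
    (ζ⁻ (c zero) ^ suc a * cell Y (recolourPlace (c zero) p) (a , true)) * (diagWeight (c ∘ suc) m * top Y (recolourPlaces (c ∘ suc) v) m)
      ≈⟨ *-cong (cell-recolour Y (c zero) p a) (top-recolour Y (c ∘ suc) v m) ⟩
    ((ζ ^ toℕ (c zero) * weight (c zero) p) * cell Y p (a , true)) * (factor (c ∘ suc) v * top Y v m) ≈⟨ interchange _ _ _ _ ⟩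
    factor c (p ∷ v) * top Y (p ∷ v) ((a , true) ∷ m) ∎

  diagAct-linear : ∀ c → IsLinear Ω-module Ω-module (diagAct c)
  diagAct-linear c = mkLinear Ω-module Ω-module _ (diagAct-cong c) (λ _ _ → reflΩ) (λ _ _ → reflΩ)

  diagAct-dy : ∀ c i → diagAct c (dy i) ≈Ω dy i
  diagAct-dy c i = ≈Ω.begin
    diagAct c (xpow i r′) ∙ (κ z ∙ θ i) ≈Ω.≈⟨ ∙-cong₁ (diagAct-xpow c i r′) ⟩
    (κ (z ^ r′) ∙ xpow i r′) ∙ (κ z ∙ θ i) ≈Ω.≈⟨ transΩ (∙-assoc _ _ _) (∙-cong₂ (pull-κ _ _ _)) ⟩
    κ (z ^ r′) ∙ (κ z ∙ dy i) ≈Ω.≈⟨ κκ _ _ _ ⟩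
    κ (z ^ r′ * z) ∙ dy i ≈Ω.≈⟨ ∙-cong₁ (κ-cong (trans (*-comm _ _) (ζ⁻^r (c i)))) ⟩
    κ 1# ∙ dy i ≈Ω.≈⟨ ∙-idˡ _ ⟩
    dy i ≈Ω.∎
    where z = ζ⁻ (c i)

  diagAct-dyB : ∀ c (v : Vec (Place r q) n) j → diagAct c (dyB v j) ≈Ω dyB (recolourPlaces c v) j
  diagAct-dyB c v j = transΩ (sumᴹ-linear (diagAct c) (diagAct-linear c) _)
    (sumᴹ-cong λ i → ∙-cong (κ-cong (reflexive (member-recolour i))) (diagAct-dy c i)) where
    member-recolourPlace : ∀ d p → member j p ≡ member j (recolourPlace d p)
    member-recolourPlace d (inj₁ _) = ≡.refl
    member-recolourPlace d (inj₂ _) = ≡.refl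
    member-recolour : ∀ i → member j (lookup v i) ≡ member j (lookup (recolourPlaces c v) i)
    member-recolour i = ≡.trans (member-recolourPlace (c i) (lookup v i)) (≡.cong (member j) (≡.sym (Vec.lookup∘tabulate _ i)))

  diagAct-dys : ∀ c (v : Vec (Place r q) n) (β : Fin k → Fin q) → diagAct c (dys v β) ≈Ω dys (recolourPlaces c v) β
  diagAct-dys {k = zero} c v β = reflΩ
  diagAct-dys {k = suc k} c v β = ∙-cong (diagAct-dys c v (β ∘ suc)) (diagAct-dyB c v (β zero))

  T-diag : ∀ (Y : Fin q → Carrier) c v f → T (top Y (recolourPlaces c v)) (diagAct c f) ≈ factor c v * T (top Y v) f
  T-diag Y c v = functional-ext _ _
    (λ e → T-resp _ (diagAct-cong c e)) (λ _ _ → T-∔ _ _ _) (λ a f → T-κ _ a _)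
    (λ e → *-congˡ (T-resp _ e)) (λ f g → trans (*-congˡ (T-∔ _ f g)) (distribˡ _ _ _))
    (λ a f → trans (*-congˡ (T-κ _ a f)) (x∙yz≈y∙xz _ _ _))
    λ m → begin
      T (top Y v′) (diagAct c (mono m)) ≈⟨ T-resp _ (diagAct-monoAt c id m) ⟩
      T (top Y v′) (κ (diagWeight c m) ∙ mono m) ≈⟨ trans (T-κ _ _ _) (*-congˡ (T-mono _ m)) ⟩
      diagWeight c m * top Y v′ m ≈⟨ top-recolour Y c v m ⟩
      factor c v * top Y v m ≈⟨ *-congˡ (T-mono _ m) ⟨
      factor c v * T (top Y v) (mono m) ∎
    where v′ = recolourPlaces c v

  ev-diag : ∀ (Y : Fin q → Carrier) c v f → ev Y (recolourPlaces c v) (diagAct c f) ≈ factor c v * ev Y v f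
  ev-diag Y c v f = trans (T-resp _ (∙-cong₁ (symΩ (diagAct-dys c v id)))) (T-diag Y c v (dys v id ∙ f))

  -- Straightening in superspace

  open Grading 1 1
  y∙ : Fin n → Ω → Ω
  y∙ i f = y i ∙ f

  y∙-linear : ∀ i → IsLinear Ω-module Ω-module (y∙ i)
  y∙-linear i = mkLinear Ω-module Ω-module _ ∙-cong₂ (∙-distribˡ _) (λ c f → pull-κ c _ f)

  y∙-comm : ∀ i j f → y i ∙ (y j ∙ f) ≈Ω y j ∙ (y i ∙ f)
  y∙-comm i j f = pull (y-central j) (y i) f

  private module S = Straightening K Ω-module n r′ r y∙ y∙-linear y∙-comm
  open S using (ap; aps; pow; up; ups)

  spanner : Code r′ n q → Ω
  spanner c = S.selem id c (mono (base (shape c)))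

  spannerDeg : Code r′ n q → ℕ
  spannerDeg c = S.sdeg id c (deg (base (shape c)))

  hom-y : ∀ i → Hom r (y i)
  hom-y i = hom-cast (ℕ.*-identityʳ r) (hom-xpow i r)

  hom-aps : ∀ z fs {d f} → Hom d f → Hom (ups fs d) (aps z fs f)
  hom-aps z [] h = h
  hom-aps z (nothing ∷ fs) h = hom-aps z fs (hom-∙ (hom-y z) h)
  hom-aps z (just l ∷ fs) h = hom-aps z fs (hom-∔ (hom-∙ (hom-y z) h) (hom-∙ (hom-κ (- 1#)) (hom-∙ (hom-y l) h)))

  hom-spanner : (c : Code r′ n q) → Hom (spannerDeg c) (spanner c)
  hom-spanner c = go id c (hom-mono _) where
    go : ∀ (ι : Fin k → Fin n) (c : Code r′ k q) {d f} → Hom d f → Hom (S.sdeg ι c d) (S.selem ι c f)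
    go ι [] h = h
    go ι (zer _ c) h = go (ι ∘ suc) c h
    go ι (joi b ρ c) h = go (ι ∘ suc) c (hom-aps (ι zero) (List.take (S.taken (joi b ρ c)) (factors (true , ρ) (roots (ι ∘ suc) (shape c)))) h)
    go ι (new e ρ c) h = go (ι ∘ suc) c (hom-aps (ι zero) (List.take (toℕ e) (factors (false , ρ) (roots (ι ∘ suc) (shape c)))) h)

  hom-act* : ∀ α {d f} → Hom d f → Hom (ups α d) (S.act α f)
  hom-act* [] h = h
  hom-act* (i ∷ α) h = hom-act* α (hom-∙ (hom-y i) h)

  act*-∙ : ∀ α g f → S.act α (g ∙ f) ≈Ω g ∙ S.act α f
  act*-∙ [] g f = reflΩ
  act*-∙ (i ∷ α) g f = transΩ (A.⟦⟧-cong (symΩ (pull (y-central i) g f))) (act*-∙ α g (y i ∙ f))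
    where module A = IsModuleHomomorphism (S.act-linear α)

  ups-+ : ∀ (α : List (Fin n)) k e → ups α (k ℕ.+ e) ≡ k ℕ.+ ups α e
  ups-+ [] k e = ≡.refl
  ups-+ (_ ∷ α) k e = ≡.trans (≡.cong (ups α) (solve′ 3 (λ r k e → r :+′ (k :+′ e) :=′ k :+′ (r :+′ e)) ≡.refl r k e)) (ups-+ α k (r ℕ.+ e))
    where open +-*-Solver renaming (solve to solve′; _:+_ to _:+′_; _:=_ to _:=′_)

  up-* : ∀ a e → up a e ≡ a ℕ.* r ℕ.+ e
  up-* zero e = ≡.refl
  up-* (suc a) e = ≡.trans (up-* a (r ℕ.+ e)) (≡.trans (≡.sym (ℕ.+-assoc (a ℕ.* r) r e)) (≡.cong (ℕ._+ e) (ℕ.+-comm (a ℕ.* r) r)))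

  pow-ypow : ∀ z a f → pow z a f ≈Ω ypow z a ∙ f
  pow-ypow z zero f = symΩ (∙-idˡ f)
  pow-ypow z (suc a) f = transΩ (pow-ypow z a (y z ∙ f)) (transΩ (pull (y-central z) _ _) (symΩ (∙-assoc _ _ _)))

  deg-incrs : ∀ i a m → deg (incrs {n} i a m) ≡ a ℕ.+ deg m
  deg-incrs i zero m = ≡.refl
  deg-incrs i (suc a) m = ≡.trans (deg-incr i (incrs i a m)) (≡.cong suc (deg-incrs i a m))

  deg-setθ-false : ∀ (i : Fin k) m → lookup (bits m) i ≡ false → deg (setθ i m) ≡ suc (deg m)
  deg-setθ-false zero ((a , false) ∷ m) e = ≡.cong (ℕ._+ deg m) (ℕ.+-comm (a ℕ.* 1) 1)
  deg-setθ-false (suc i) ((a , true) ∷ m) e = ≡.trans (≡.cong ((a ℕ.* 1 ℕ.+ 1) ℕ.+_) (deg-setθ-false i m e)) (ℕ.+-suc _ _)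
  deg-setθ-false (suc i) ((a , false) ∷ m) e = ≡.trans (≡.cong (a ℕ.* 1 ℕ.+_) (deg-setθ-false i m e)) (ℕ.+-suc _ _)

  sign-true : ∀ (i : Fin k) m → lookup (bits m) i ≡ true → sign i m ≈ 0#
  sign-true zero ((a , true) ∷ m) e = refl
  sign-true (suc i) ((a , true) ∷ m) e = trans (-‿cong (sign-true i m e)) (solve 0 (:- :0 := :0) refl)
  sign-true (suc i) ((a , false) ∷ m) e = sign-true i m e

  sign-false : ∀ (i : Fin k) m → lookup (bits m) i ≡ false → sign i m * sign i m ≈ 1#
  sign-false zero ((a , false) ∷ m) e = *-identityˡ 1#
  sign-false (suc i) ((a , true) ∷ m) e = trans (solve 1 (λ s → :- s :* :- s := s :* s) refl _) (sign-false i m e)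
  sign-false (suc i) ((a , false) ∷ m) e = sign-false i m e

  module _ (W : ℕ → Submodule Ω-module)
    (p∈ : ∀ a {e f} → Hom e f → p a ∙ f ∈ W (suc a ℕ.* r ℕ.+ e))
    (ξ∈ : ∀ a {e f} → Hom e f → ξ a ∙ f ∈ W (suc a ℕ.* r ℕ.+ e))
    (s∈ : ∀ {q} (c : Code r′ n q) → spanner c ∈ W (spannerDeg c)) where
    W° : ℕ → Submodule Ω-module
    W° = S.W° W
    infix 4 _∈°_
    _∈°_ : Ω → ℕ → Set
    f ∈° d = f ∈ W° d
    resp° : ∀ {d f g} → f ≈Ω g → f ∈° d → g ∈° d
    resp° {d} = Sub.resp (W° d)
    cast° : ∀ {d e f} → d ≡ e → f ∈° d → f ∈° e
    cast° = S.cast∈ W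

    -- Membership in W° asks for all multiples by the yᵢ; those of g ∙ f are again g times a
    -- homogeneous element.
    absorb : ∀ {g a} → (∀ {e f} → Hom e f → g ∙ f ∈ W (suc a ℕ.* r ℕ.+ e)) → ∀ {e f} → Hom e f → g ∙ f ∈° suc a ℕ.* r ℕ.+ e
    absorb {g} {a} g∈ {e} {f} h α = ≡.subst (λ d → S.act α (g ∙ f) ∈ W d) (≡.sym (ups-+ α (suc a ℕ.* r) e))
      (Sub.resp (W _) (symΩ (act*-∙ α g f)) (g∈ (hom-act* α h)))

    In : Mon n → Set
    In m = mono m ∈° deg m

    In-y : ∀ i m → In m → In (incrs i r m)
    In-y i m q = cast° (≡.sym (deg-incrs i r m)) (resp° (xpow-mono i r m) (S.Y∈ W {deg m} {mono m} i q))

    aps° : ∀ {d u} z fs → u ∈° d → aps z fs u ∈° ups fs d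
    aps° {d} {u} = S.aps∈ W {d} {u}

    module Aps z fs = IsModuleHomomorphism (S.aps-linear z fs)

    cancel : ∀ f → f ∔ κ (- 1#) ∙ f ≈Ω κ 0#
    cancel f = transΩ (∔-cong (symΩ (∙-idˡ f)) reflΩ) (transΩ (symΩ (∙-distribʳ f _ _))
      (transΩ (∙-cong₁ (transΩ (symΩ (κ-+ _ _)) (κ-cong (-‿inverseʳ 1#)))) (∙-zeroˡ f)))

    aps-vanish : ∀ {i Λ} → i ∈ˡ Λ → ∀ u → aps i (justs Λ) u ≈Ω κ 0#
    aps-vanish {i} {Λ = _ ∷ Λ} (here ≡.refl) u = transΩ (Aps.⟦⟧-cong i (justs Λ) (cancel (y i ∙ u))) (Aps.0ᴹ-homo i (justs Λ))
    aps-vanish (there i∈) u = aps-vanish i∈ _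

    module _ (cs : Vec (Cell r′) n) (smaller : ∀ m → positions (bits m) ℕ.< positions (bits (base cs)) → In m) where

      -- Apply `moments` to the products ξ a ∙ u with u = `lowered` cs j: the sum over i of dyᵢ u
      -- times all yᵢ - y_l with l in Λ lies in W°. The term i vanishes if θᵢ occurs in u. For the
      -- other i > j it vanishes because i is in Λ, and for i < j the monomial has a smaller sum of
      -- θ-positions. The term i = j remains.
      relation : ∀ j ρ → lookup cs j ≡ (true , ρ) → ∀ Λ → (∀ l ρ′ → toℕ j ℕ.< toℕ l → lookup cs l ≡ (false , ρ′) → l ∈ˡ Λ) →
        aps j (factors (true , ρ) Λ) (mono (base cs)) ∈° ups (factors (true , ρ) Λ) (deg (base cs))
      relation j ρ at-j Λ later = finish ρ at-j where
        u = lowered cs j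
        D = r ℕ.+ deg u
        t : Fin n → Ω
        t i = dy i ∙ mono u
        m₁ : Fin n → Mon n
        m₁ i = incrs i r′ (setθ i u)
        deg-m₁ : ∀ i → lookup (bits u) i ≡ false → deg (m₁ i) ≡ D
        deg-m₁ i e = ≡.trans (deg-incrs i r′ _) (≡.trans (≡.cong (r′ ℕ.+_) (deg-setθ-false i u e)) (ℕ.+-suc r′ _))
        bits-m₁ : bits (m₁ j) ≡ bits (base cs)
        bits-m₁ = go ρ at-j where
          go : ∀ ρ → lookup cs j ≡ (true , ρ) → bits (m₁ j) ≡ bits (base cs)
          go zero e = ≡.cong bits (lowered-zero cs j e)
          go (suc c) e = ≡.trans (≡.cong bits (lowered-suc cs j c e)) (bits-incrs j r (base cs))
        moment : ∀ a → sumᴹ (λ i → pow i a (t i)) ∈° up a D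
        moment a = cast° degrees (resp° (≈Ω.begin
          ξ a ∙ mono u ≈Ω.≈⟨ sum-∙ʳ _ _ ⟩
          sumᴹ (λ i → (ypow i a ∙ dy i) ∙ mono u) ≈Ω.≈⟨ sumᴹ-cong (λ i → transΩ (∙-assoc _ _ _) (symΩ (pow-ypow i a (t i)))) ⟩
          sumᴹ (λ i → pow i a (t i)) ≈Ω.∎) (absorb {ξ a} {a} (ξ∈ a) (hom-mono u))) where
          degrees : suc a ℕ.* r ℕ.+ deg u ≡ up a D
          degrees = ≡.sym (≡.trans (up-* a D) (≡.trans (≡.sym (ℕ.+-assoc (a ℕ.* r) r _)) (≡.cong (ℕ._+ deg u) (ℕ.+-comm (a ℕ.* r) r))))
        others : ∀ i → i ≢ j → aps i (justs Λ) (t i) ∈° ups (justs Λ) D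
        others i i≢j = go (lookup (bits u) i) ≡.refl where
          go : ∀ b → lookup (bits u) i ≡ b → aps i (justs Λ) (t i) ∈° ups (justs Λ) D
          go true e = resp° (symΩ (transΩ (Aps.⟦⟧-cong i (justs Λ) (transΩ (dy-mono i u) (κ0-zero _ (sign-true i u e)))) (Aps.0ᴹ-homo i (justs Λ))))
            (Sub.0∈ (W° _))
          go false e with ℕ.<-cmp (toℕ i) (toℕ j)
          ... | tri≈ _ i≡j _ = contradiction (Fin.toℕ-injective i≡j) i≢j
          ... | tri> _ _ j<i = resp° (symΩ (aps-vanish (later i _ j<i (≡.cong₂ _,_ (≡.trans (≡.sym (lowered-other cs j i i≢j)) e) ≡.refl)) (t i)))
              (Sub.0∈ (W° _))
          ... | tri< i<j _ _ = aps° {D} {t i} i (justs Λ) (resp° (symΩ (dy-mono i u)) (Sub.*∈ (W° _) _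
              (cast° (deg-m₁ i e) (smaller (m₁ i) (≡.subst₂ ℕ._<_ (≡.sym shifted) (≡.trans (≡.sym unshifted) (≡.cong positions bits-m₁)) (ℕ.+-monoˡ-< _ i<j))))))
            where
            shifted : positions (bits (m₁ i)) ≡ toℕ i ℕ.+ positions (bits u)
            shifted = ≡.trans (≡.cong positions (bits-incrs i r′ (setθ i u))) (positions-setθ i u e)
            unshifted : positions (bits (m₁ j)) ≡ toℕ j ℕ.+ positions (bits u)
            unshifted = ≡.trans (≡.cong positions (bits-incrs j r′ (setθ j u))) (positions-setθ j u (lowered-bit cs j))
        scaled : aps j (justs Λ) (t j) ∈° ups (justs Λ) D
        scaled = summand∈ (W° _) j (λ i → aps i (justs Λ) (t i)) (S.moments W id t D moment Λ) others
        result : aps j (justs Λ) (mono (m₁ j)) ∈° ups (justs Λ) D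
        result = resp° (≈Ω.begin
          κ s ∙ aps j (justs Λ) (t j) ≈Ω.≈⟨ ∙-cong₂ (Aps.⟦⟧-cong j (justs Λ) (dy-mono j u)) ⟩
          κ s ∙ aps j (justs Λ) (κ s ∙ mono (m₁ j)) ≈Ω.≈⟨ ∙-cong₂ (Aps.*ₗ-homo j (justs Λ) s _) ⟩
          κ s ∙ (κ s ∙ aps j (justs Λ) (mono (m₁ j))) ≈Ω.≈⟨ κκ _ _ _ ⟩
          κ (s * s) ∙ aps j (justs Λ) (mono (m₁ j)) ≈Ω.≈⟨ ∙-cong₁ (κ-cong (sign-false j u (lowered-bit cs j))) ⟩
          κ 1# ∙ aps j (justs Λ) (mono (m₁ j)) ≈Ω.≈⟨ ∙-idˡ _ ⟩
          aps j (justs Λ) (mono (m₁ j)) ≈Ω.∎) (Sub.*∈ (W° _) s scaled)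
          where s = sign j u
        deg-m₁j = deg-m₁ j (lowered-bit cs j)
        finish : ∀ ρ → lookup cs j ≡ (true , ρ) →
          aps j (factors (true , ρ) Λ) (mono (base cs)) ∈° ups (factors (true , ρ) Λ) (deg (base cs))
        finish zero e = cast° (≡.cong (ups (justs Λ)) (≡.trans (≡.sym deg-m₁j) (≡.cong deg (lowered-zero cs j e))))
          (resp° (Aps.⟦⟧-cong j (justs Λ) (reflexiveΩ (≡.cong mono (lowered-zero cs j e)))) result)
        finish (suc c) e = cast° (≡.cong (ups (justs Λ)) (≡.trans (≡.sym deg-m₁j) (≡.trans (≡.cong deg (lowered-suc cs j c e)) (deg-incrs j r (base cs)))))
          (resp° (Aps.⟦⟧-cong j (justs Λ) (transΩ (reflexiveΩ (≡.cong mono (lowered-suc cs j c e))) (symΩ (xpow-mono j r (base cs))))) result)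

      root∈ : ∀ (ι : Fin k → Fin n) (ds : Vec (Cell r′) k) l ρ → lookup ds l ≡ (false , ρ) → ι l ∈ˡ roots ι ds
      root∈ ι ((false , _) ∷ ds) zero ρ e = here ≡.refl
      root∈ ι ((false , _) ∷ ds) (suc l) ρ e = there (root∈ (ι ∘ suc) ds l ρ e)
      root∈ ι ((true , _) ∷ ds) (suc l) ρ e = root∈ (ι ∘ suc) ds l ρ e

      all-relations : S.Relations W id cs (deg (base cs)) (mono (base cs))
      all-relations = go id cs relation where
        v = mono (base cs)
        d = deg (base cs)
        go : (ι : Fin k → Fin n) (ds : Vec (Cell r′) k) →
          (∀ j ρ → lookup ds j ≡ (true , ρ) → ∀ Λ → (∀ l ρ′ → toℕ j ℕ.< toℕ l → lookup ds l ≡ (false , ρ′) → ι l ∈ˡ Λ) →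
          aps (ι j) (factors (true , ρ) Λ) v ∈° ups (factors (true , ρ) Λ) d) →
          S.Relations W ι ds d v
        tails : (ι : Fin (suc k) → Fin n) (p : Cell r′) (ds : Vec (Cell r′) k) →
          (∀ j ρ → lookup (p ∷ ds) j ≡ (true , ρ) → ∀ Λ → (∀ l ρ′ → toℕ j ℕ.< toℕ l → lookup (p ∷ ds) l ≡ (false , ρ′) → ι l ∈ˡ Λ) →
          aps (ι j) (factors (true , ρ) Λ) v ∈° ups (factors (true , ρ) Λ) d) →
          S.Relations W (ι ∘ suc) ds d v
        tails ι p ds h = go (ι ∘ suc) ds λ j ρ e Λ later → h (suc j) ρ e Λ λ where
          (suc l) ρ′ lt e′ → later l ρ′ (ℕ.s≤s⁻¹ lt) e′
        go ι [] h = tt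
        go ι ((false , ρ) ∷ ds) h = tails ι (false , ρ) ds h
        go ι ((true , ρ) ∷ ds) h = h zero ρ ≡.refl (roots (ι ∘ suc) ds)
            (λ where (suc l) ρ′ lt e′ → root∈ (ι ∘ suc) ds l ρ′ e′) , tails ι (true , ρ) ds h

      base∈ : In (base cs)
      base∈ = S.straight W fromℕ-unit id cs (λ _ → 0) (deg (base cs)) v
        (record { linked = linked ; powerSums = powerSums ; relations = all-relations })
        (λ where c ≡.refl → s∈ c) where
        v = mono (base cs)
        d = deg (base cs)
        linked : ∀ i → y i ∙ v ∈° r ℕ.+ d ⊎ ∃ λ l → ap i (just l) v ∈° r ℕ.+ d
        linked i = inj₂ (i , resp° (symΩ (cancel (y i ∙ v))) (Sub.0∈ (W° _)))
        powerSums : ∀ a → sumᴹ (λ l → κ (fromℕ 1) ∙ pow l (suc a) v) ∈° up (suc a) d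
        powerSums a = cast° (≡.sym (up-* (suc a) d)) (resp° (transΩ (sum-∙ʳ _ v) (sumᴹ-cong λ l → symΩ
          (transΩ (∙-cong₁ (κ-cong (+-identityʳ 1#))) (transΩ (∙-idˡ _) (pow-ypow l (suc a) v)))))
          (absorb {p a} {a} (p∈ a) (hom-mono (base cs))))

    -- Induction on the sum of the θ-positions, the quantity that decreases in `relation`; factors
    -- yᵢ leave it unchanged and are stripped off by `reduce`.
    all-in : ∀ m → In m
    all-in m = <-rec (λ b → ∀ m → positions (bits m) ≡ b → In m)
      (λ b ih m e → reduce In In-y m λ cs e′ → base∈ cs λ m′ lt →
        ih (≡.subst (positions (bits m′) ℕ.<_) (≡.trans (≡.cong positions e′) e) lt) m′ ≡.refl)
      (positions (bits m)) m ≡.refl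

    mono∈ : ∀ m → mono m ∈ W (deg m)
    mono∈ m = all-in m []

  -- The filtration by degree on functions of partitions

  private module Gθ = Grading 0 1

  Fun : KModule
  Fun = mkModule {M = OP̃ n r → Carrier} {_≈ᴹ_ = λ F G → ∀ σ → F σ ≈ G σ}
    {_+ᴹ_ = λ F G σ → F σ + G σ} {0ᴹ = λ _ → 0#} {_•_ = λ c F σ → c * F σ}
    (record { refl = λ _ → refl ; sym = λ e σ → sym (e σ) ; trans = λ e e′ σ → trans (e σ) (e′ σ) })
    (λ e e′ σ → +-cong (e σ) (e′ σ)) (λ _ _ _ _ → +-assoc _ _ _) (λ _ _ _ → +-comm _ _) (λ _ _ → +-identityˡ _)
    (λ e e′ σ → *-cong e (e′ σ)) (λ _ _ _ _ → distribʳ _ _ _) (λ _ _ _ _ → distribˡ _ _ _) (λ _ _ _ _ → *-assoc _ _ _)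
    (λ _ _ → *-identityˡ _) (λ _ _ → zeroˡ _)

  occupies : Fin q → Place r q → ℕ
  occupies b (inj₁ _) = 0
  occupies b (inj₂ (j , _)) = if does (b Fin.≟ j) then 1 else 0

  size : Vec (Place r q) k → Fin q → ℕ
  size v b = ℕΣ.sum λ i → occupies b (lookup v i)

  sizes : Vec (Place r q) k → Vec ℕ q
  sizes v = tabulate (size v)

  occupies≤1 : ∀ (b : Fin q) p → occupies b p ℕ.≤ 1
  occupies≤1 b (inj₁ _) = z≤n
  occupies≤1 b (inj₂ (j , _)) with does (b Fin.≟ j)
  ... | true = ℕ.≤-refl
  ... | false = z≤n

  occupies-own : ∀ (b : Fin q) ρ → occupies b (inj₂ (b , ρ)) ≡ 1
  occupies-own b ρ with b Fin.≟ b
  ... | yes _ = ≡.refl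
  ... | no b≢b = contradiction ≡.refl b≢b

  size-≤ : ∀ (v : Vec (Place r q) k) b → size v b ℕ.≤ k
  size-≤ [] b = z≤n
  size-≤ (p ∷ v) b = ℕ.+-mono-≤ (occupies≤1 b p) (size-≤ v b)

  size-≥ : ∀ (v : Vec (Place r q) k) b i ρ → lookup v i ≡ inj₂ (b , ρ) → 1 ℕ.≤ size v b
  size-≥ (p ∷ v) b zero ρ ≡.refl = ≡.subst (λ a → 1 ℕ.≤ a ℕ.+ size v b) (≡.sym (occupies-own b ρ)) (s≤s z≤n)
  size-≥ (p ∷ v) b (suc i) ρ e = ℕ.≤-trans (size-≥ v b i ρ e) (ℕ.m≤n+m _ _)

  sizes-bounded : ∀ (σ : OP̃ n r) → Bounded n (sizes (place σ))
  sizes-bounded σ b rewrite Vec.lookup∘tabulate (size (place σ)) b =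
    let i , ρ , e = nonempty σ b in size-≥ (place σ) b i ρ e , size-≤ (place σ) b

  coords : Vec (Place r q) n → Fin q → Carrier
  coords v = point (sizes v)

  evaluate : OP̃ n r → Ω → Carrier
  evaluate σ = ev (coords (place σ)) (place σ)

  fromℕ-occupies : ∀ (b : Fin q) p → fromℕ (occupies b p) ≈ member b p
  fromℕ-occupies b (inj₁ _) = refl
  fromℕ-occupies b (inj₂ (j , _)) with does (b Fin.≟ j)
  ... | true = +-identityʳ 1#
  ... | false = refl

  fromℕ-sum : (f : Fin k → ℕ) → fromℕ (ℕΣ.sum f) ≈ sum (fromℕ ∘ f)
  fromℕ-sum {zero} f = sym (sum-[] _)
  fromℕ-sum {suc k} f = trans (fromℕ-+ (f zero) _) (trans (+-congˡ (fromℕ-sum (f ∘ suc))) (sym (sum-∷ _)))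

  power-sums : ∀ (Y : Fin q → Carrier) (v : Vec (Place r q) n) a →
    sum (λ i → val Y v i ^ suc a) ≈ wpower (fromℕ ∘ lookup (sizes v)) Y a
  power-sums Y v a = begin
    sum (λ i → val Y v i ^ suc a) ≈⟨ sum-cong (λ i → split (lookup v i)) ⟩
    sum (λ i → sum (λ b → member b (lookup v i) * Y b ^ suc a)) ≈⟨ sum-swap _ ⟩
    sum (λ b → sum (λ i → member b (lookup v i) * Y b ^ suc a)) ≈⟨ sum-cong (λ b → sum-*ʳ (Y b ^ suc a) _) ⟨
    sum (λ b → sum (λ i → member b (lookup v i)) * Y b ^ suc a)
      ≈⟨ sum-cong (λ b → *-congʳ (trans (sum-cong λ i → sym (fromℕ-occupies b (lookup v i)))
           (trans (sym (fromℕ-sum _)) (reflexive (≡.cong fromℕ (≡.sym (Vec.lookup∘tabulate (size v) b))))))) ⟩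
    sum (λ b → fromℕ (lookup (sizes v) b) * Y b ^ suc a) ∎ where
    split : ∀ p → value Y p ^ suc a ≈ sum (λ b → member b p * Y b ^ suc a)
    split (inj₁ _) = trans (zeroˡ _) (sym (sum-zero λ b → zeroˡ _))
    split (inj₂ (j , _)) = trans (sym (sum-δʳ j (λ b → Y b ^ suc a))) (sum-cong λ b → *-comm _ _)

  -- By Newton's identities the alternating sum is a weighted elementary polynomial in the block
  -- values, with the block sizes as weights. The point was chosen so that its value depends on the
  -- number of blocks only.
  evaluate-alternating : ∀ σ a t →
    alternating (λ i → sum (λ j → val (coords (place σ)) (place σ) j ^ suc i)) (elem (coords (place σ))) a * t ≈
    level (OP̃.blocks σ) a * t
  evaluate-alternating σ@(mkOP̃ q v _) a t = *-congʳ (trans (alternating-cong (power-sums (coords v) v) (λ _ → refl) a)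
    (trans (sym (newton _ (coords v) a)) (on-level (sizes v) (sizes-bounded σ) a)))

  -- All terms of the alternating sum but the last lie in S, and the last is P a with coefficient ±
  -- e 0 = ± 1.
  alternating∈ : (S : Submodule Fun) (t : OP̃ n r → Carrier) (e : OP̃ n r → ℕ → Carrier) → (∀ σ → e σ 0 ≈ 1#) →
    ∀ a (P : OP̃ n r → ℕ → Carrier) →
    (∀ i j → i ℕ.+ suc j ≡ a → (λ σ → P σ i * (e σ (suc j) * t σ)) ∈ S) →
    (λ σ → alternating (P σ) (e σ) a * t σ) ∈ S → (λ σ → P σ a * t σ) ∈ S
  alternating∈ S t e e₀ zero P terms total = resp (λ σ → *-congʳ (trans (*-congˡ (e₀ σ)) (*-identityʳ _))) total
    where open Submodule S
  alternating∈ S t e e₀ (suc a) P terms total = alternating∈ S t e e₀ a (λ σ → P σ ∘ suc)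
    (λ i j eq → terms (suc i) j (≡.cong suc eq))
    (resp (λ σ → solve 5 (λ p e t s w → p :* (e :* t) :+ (:- :1) :* ((p :* e :+ :- s) :* t) := s :* t) refl (P σ 0) (e σ (suc a)) (t σ) _ (t σ))
      (+∈ (terms 0 a ≡.refl) (*∈ (- 1#) total)))
    where open Submodule S

  hom-es : ∀ (ι : Fin k → Fin n) m a → Hom (a ℕ.* r) (es ι m a)
  hom-es ι [] zero = hom-κ 1#
  hom-es ι [] (suc a) = hom-0 _
  hom-es ι ((_ , true) ∷ m) a = hom-es (ι ∘ suc) m a
  hom-es ι ((_ , false) ∷ m) zero = hom-es (ι ∘ suc) m zero
  hom-es ι ((_ , false) ∷ m) (suc a) = hom-∔ (hom-es (ι ∘ suc) m (suc a)) (hom-∙ (hom-y (ι zero)) (hom-es (ι ∘ suc) m a))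

  θ-count : (m : Mon k) → Gθ.deg m ≡ weight₁ (bits m)
  θ-count [] = ≡.refl
  θ-count ((a , true) ∷ m) = ≡.cong₂ ℕ._+_ (≡.cong (ℕ._+ 1) (ℕ.*-zeroʳ a)) (θ-count m)
  θ-count ((a , false) ∷ m) = ≡.cong₂ ℕ._+_ (ℕ.*-zeroʳ a) (θ-count m)

  weight₁-full : weight₁ (bits (fullMon {k})) ≡ k
  weight₁-full {zero} = ≡.refl
  weight₁-full {suc k} = ≡.cong suc weight₁-full

  θ-dys : (v : Vec (Place r q) n) (β : Fin k → Fin q) → Gθ.Hom k (dys v β)
  θ-dys {k = zero} v β = Gθ.hom-κ 1#
  θ-dys {k = suc k} v β = Gθ.hom-cast (ℕ.+-comm k 1) (Gθ.hom-∙ (θ-dys v (β ∘ suc)) (Gθ.hom-sum _ λ i →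
    Gθ.hom-∙ (Gθ.hom-κ _) (Gθ.hom-cast (≡.cong (ℕ._+ 1) (ℕ.*-zeroʳ r′)) (Gθ.hom-∙ (Gθ.hom-xpow i r′) (Gθ.hom-θ i)))))

  -- The functional of a partition with q blocks sees only the terms with n - q of the θᵢ.
  ev-θ-count : ∀ (Y : Fin q → Carrier) v {d f} → Gθ.Hom d f → q ℕ.+ d ≢ n → ev Y v f ≈ 0#
  ev-θ-count {q} Y v {d} h q+d≢n = Gθ.T-vanishes (Gθ.hom-∙ (θ-dys v id) h) (top Y v) vanish where
    vanish : ∀ m → Gθ.deg m ≡ q ℕ.+ d → top Y v m ≈ 0#
    vanish m e with full⊎zero Y v m
    ... | inj₁ z = z
    ... | inj₂ b = contradiction (≡.trans (≡.sym e) (≡.trans (θ-count m) (≡.trans (≡.cong weight₁ b) weight₁-full))) q+d≢n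

  -- Since the values of welem depend on the number of blocks only, multiplication by p lowers the filtration.
  lowers : (S : Submodule Fun) (d : ℕ) → (∀ {e h} → Hom e h → e ℕ.< d → (λ σ → evaluate σ h) ∈ S) →
    ∀ a {e f} → Hom e f → suc a ℕ.* r ℕ.+ e ≡ d → (λ σ → evaluate σ (p a ∙ f)) ∈ S
  lowers S d below = <-rec (λ a → ∀ {e f} → Hom e f → suc a ℕ.* r ℕ.+ e ≡ d → (λ σ → evaluate σ (p a ∙ f)) ∈S) step where
    open Submodule S
    step : ∀ a → (∀ {i} → i ℕ.< a → ∀ {e f} → Hom e f → suc i ℕ.* r ℕ.+ e ≡ d → (λ σ → evaluate σ (p i ∙ f)) ∈S) →
      ∀ {e f} → Hom e f → suc a ℕ.* r ℕ.+ e ≡ d → (λ σ → evaluate σ (p a ∙ f)) ∈S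
    -- Reduction to monomials, because the elementary symmetric factor in `ev-es` depends on the θ
    -- of the monomial.
    step a ih = hom-span family on-mono where
      family : ℕ → Submodule Ω-module
      family e = record
        { _∈S = λ f → suc a ℕ.* r ℕ.+ e ≡ d → (λ σ → evaluate σ (p a ∙ f)) ∈S
        ; resp = λ eq q eq′ → resp (λ σ → ev-resp _ _ (∙-cong₂ eq)) (q eq′)
        ; 0∈ = λ _ → resp (λ σ → sym (trans (ev-resp _ _ (∙-zeroʳ _)) (ev-0 _ _))) 0∈
        ; +∈ = λ q q′ eq → resp (λ σ → sym (trans (ev-resp _ _ (∙-distribˡ _ _ _)) (ev-∔ _ _ _ _))) (+∈ (q eq) (q′ eq))
        ; *∈ = λ c q eq → resp (λ σ → sym (trans (ev-resp _ _ (pull-κ c _ _)) (ev-κ _ _ _ _))) (*∈ c (q eq))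
        }
      on-mono : ∀ m → suc a ℕ.* r ℕ.+ deg m ≡ d → (λ σ → evaluate σ (p a ∙ mono m)) ∈S
      on-mono m eq = resp (λ σ → sym (ev-p _ _ a (mono m)))
        (alternating∈ S (λ σ → evaluate σ (mono m)) (λ σ → elem (coords (place σ))) (λ σ → refl) a _ terms total) where
        -- The elementary symmetric factor is absorbed into the argument by `ev-es`. The total
        -- degree stays d while the index of the power sum drops to i < a.
        terms : ∀ i j → i ℕ.+ suc j ≡ a →
          (λ σ → sum (λ l → val (coords (place σ)) (place σ) l ^ suc i) * (elem (coords (place σ)) (suc j) * evaluate σ (mono m))) ∈S
        terms i j ij = resp (λ σ → trans (ev-p _ _ i _) (*-congˡ (ev-es _ _ (suc j) m)))
          (ih (≡.subst (i ℕ.<_) ij (ℕ.m<m+n i (s≤s z≤n))) (hom-∙ (hom-es id m (suc j)) (hom-mono m))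
            (≡.trans (≡.trans (≡.sym (ℕ.+-assoc (suc i ℕ.* r) (suc j ℕ.* r) _)) (≡.cong (ℕ._+ deg m)
              (≡.trans (≡.sym (ℕ.*-distribʳ-+ r (suc i) (suc j))) (≡.cong (λ a → suc a ℕ.* r) ij)))) eq))
        J : ℕ
        J = Gθ.deg m
        total : (λ σ → alternating (λ i → sum (λ l → val (coords (place σ)) (place σ) l ^ suc i)) (elem (coords (place σ))) a * evaluate σ (mono m)) ∈S
        total = resp (λ σ → sym (trans (evaluate-alternating σ a _) (constant σ)))
          (*∈ (level (n ℕ.∸ J) a) (below (hom-mono m) (≡.subst (deg m ℕ.<_) eq (ℕ.m<n+m (deg m) (s≤s z≤n))))) where
          -- The functional sees a monomial with J of the θ only if q = n - J, so the level, which
          -- depends on q, may be replaced by one constant.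
          constant : ∀ σ → level (OP̃.blocks σ) a * evaluate σ (mono m) ≈ level (n ℕ.∸ J) a * evaluate σ (mono m)
          constant σ with OP̃.blocks σ ℕ.+ J ℕ.≟ n
          ... | yes q+J≡n = *-congʳ (reflexive (≡.cong (λ q → level q a) (≡.trans (≡.sym (ℕ.m+n∸n≡m (OP̃.blocks σ) J)) (≡.cong (ℕ._∸ J) q+J≡n))))
          ... | no q+J≢n = trans (trans (*-congˡ z) (zeroʳ _)) (sym (trans (*-congˡ z) (zeroʳ _)))
            where z = ev-θ-count _ (place σ) (Gθ.hom-mono m) q+J≢n

  s : Fin N → Ω
  s c = spanner (code (partition c))

  s-deg : Fin N → ℕ
  s-deg c = spannerDeg (code (partition c))

  hom-s : ∀ c → Hom (s-deg c) (s c)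
  hom-s c = hom-spanner (code (partition c))

  s-index : (c : Code r′ n q) → s (index (op̃ c)) ≡ spanner c × s-deg (index (op̃ c)) ≡ spannerDeg c
  s-index c rewrite partition-index (op̃ c) | code-op̃ c = ≡.refl , ≡.refl

  SpanBelow : ℕ → Submodule Fun
  SpanBelow D = record
    { _∈S = λ F → ∃ λ (u : Fin N → Carrier) → (∀ c → D ℕ.≤ s-deg c → u c ≈ 0#) ×
                     (∀ σ → F σ ≈ sum λ c → u c * evaluate σ (s c))
    ; resp = λ { e (u , z , f) → u , z , λ σ → trans (sym (e σ)) (f σ) }
    ; 0∈ = (λ _ → 0#) , (λ _ _ → refl) , λ σ → sym (sum-zero λ c → zeroˡ _)
    ; +∈ = λ { (u , z , f) (u′ , z′ , f′) → (λ c → u c + u′ c) ,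
               (λ c le → trans (+-cong (z c le) (z′ c le)) (+-identityˡ 0#)) ,
               λ σ → trans (+-cong (f σ) (f′ σ)) (trans (sym (sum-+ _ _)) (sum-cong λ c → sym (distribʳ _ _ _))) }
    ; *∈ = λ { a (u , z , f) → (λ c → a * u c) , (λ c le → trans (*-congˡ (z c le)) (zeroʳ a)) ,
               λ σ → trans (*-congˡ (f σ)) (trans (sum-*ˡ a _) (sum-cong λ c → sym (*-assoc _ _ _))) }
    }

  below-mono : ∀ {D E} → D ℕ.≤ E → ∀ {F} → F ∈ SpanBelow D → F ∈ SpanBelow E
  below-mono D≤E (u , z , f) = u , (λ c le → z c (ℕ.≤-trans D≤E le)) , f

  s∈below : ∀ {D} c → s-deg c ℕ.< D → (λ σ → evaluate σ (s c)) ∈ SpanBelow D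
  s∈below {D} c lt = δ c , (λ c′ le → δ-no {i = c} {c′} λ { ≡.refl → ℕ.<⇒≱ lt le }) , λ σ → sym (sum-δˡ c (λ c′ → evaluate σ (s c′)))

  -- Straightening for the submodules of all f whose function σ ↦ evaluate σ f is in the span:
  -- multiples of p a fall into lower degree by `lowers`, multiples of ξ a evaluate to 0, and the
  -- `s` c are in the span by definition.
  evaluate∈ : ∀ {e f} → Hom e f → (λ σ → evaluate σ f) ∈ SpanBelow (suc e)
  evaluate∈ {e} = <-rec (λ e → ∀ {f} → Hom e f → (λ σ → evaluate σ f) ∈ SpanBelow (suc e))
    (λ e ih h → hom-span W (mono∈ W p∈ ξ∈ s∈) h λ {e′} {h} hom lt → below-mono lt (ih lt hom)) e where
    W : ℕ → Submodule Ω-module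
    W e = record
      { _∈S = λ f → (∀ {e′ h} → Hom e′ h → e′ ℕ.< e → (λ σ → evaluate σ h) ∈ SpanBelow e) →
                     (λ σ → evaluate σ f) ∈ SpanBelow (suc e)
      ; resp = λ eq q ih → Sub.resp (SpanBelow _) (λ σ → ev-resp _ _ eq) (q ih)
      ; 0∈ = λ ih → Sub.resp (SpanBelow _) (λ σ → sym (ev-0 _ _)) (Sub.0∈ (SpanBelow _))
      ; +∈ = λ q q′ ih → Sub.resp (SpanBelow _) (λ σ → sym (ev-∔ _ _ _ _)) (Sub.+∈ (SpanBelow _) (q ih) (q′ ih))
      ; *∈ = λ c q ih → Sub.resp (SpanBelow _) (λ σ → sym (ev-κ _ _ c _)) (Sub.*∈ (SpanBelow _) c (q ih))
      }
    p∈ : ∀ a {e f} → Hom e f → p a ∙ f ∈ W (suc a ℕ.* r ℕ.+ e)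
    p∈ a h ih = below-mono (ℕ.n≤1+n _) (lowers (SpanBelow _) _ (λ h → ih h) a h ≡.refl)
    ξ∈ : ∀ a {e f} → Hom e f → ξ a ∙ f ∈ W (suc a ℕ.* r ℕ.+ e)
    ξ∈ a h ih = Sub.resp (SpanBelow _) (λ σ → sym (ev-ξ _ _ a _)) (Sub.0∈ (SpanBelow _))
    s∈ : (c : Code r′ n q) → spanner c ∈ W (spannerDeg c)
    s∈ c ih = ≡.subst₂ (λ d f → (λ σ → evaluate σ f) ∈ SpanBelow (suc d)) (proj₂ (s-index c)) (proj₁ (s-index c))
      (s∈below (index (op̃ c)) ℕ.≤-refl)

  -- The same straightening, now with one submodule for all degrees: the combinations of the `s` c
  -- plus elements of the ideal.
  straighten : ∀ f → ∃ λ (u : Fin N → Carrier) → ∃ λ g → Gen g × f ≈Ω sumᴹ (λ c → κ (u c) ∙ s c) ∔ g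
  straighten = mono-span S (mono∈ (λ _ → S) p∈ ξ∈ s∈) where
    combination : (Fin N → Carrier) → Ω
    combination u = sumᴹ λ c → κ (u c) ∙ s c
    open CommutativeSemigroupProperties (CommutativeMonoid.commutativeSemigroup (Module.+ᴹ-commutativeMonoid Ω-module))
      using () renaming (interchange to ∔-interchange)
    S : Submodule Ω-module
    S = record
      { _∈S = λ f → ∃ λ u → ∃ λ g → Gen g × f ≈Ω combination u ∔ g
      ; resp = λ { e (u , g , q , e′) → u , g , q , transΩ (symΩ e) e′ }
      ; 0∈ = (λ _ → 0#) , κ 0# , gen-0 , symΩ (transΩ (∔-idʳ _) (sumᴹ-zero λ c → ∙-zeroˡ _))
      ; +∈ = λ { (u , g , q , e) (u′ , g′ , q′ , e′) → (λ c → u c + u′ c) , g ∔ g′ , gen-∔ q q′ ,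
                 transΩ (∔-cong e e′) (transΩ (∔-interchange _ _ _ _) (∔-cong (transΩ (symΩ (sumᴹ-+ _ _))
                   (sumᴹ-cong λ c → transΩ (symΩ (∙-distribʳ _ _ _)) (∙-cong₁ (symΩ (κ-+ _ _))))) reflΩ)) }
      ; *∈ = λ { a (u , g , q , e) → (λ c → a * u c) , κ a ∙ g , gen-κ a q ,
                 transΩ (∙-cong₂ e) (transΩ (∙-distribˡ _ _ _) (∔-cong (transΩ (sum-∙ˡ _ _) (sumᴹ-cong λ c → κκ _ _ _)) reflΩ)) }
      }
    gen⇒S : ∀ {f} → Gen f → f ∈ S
    gen⇒S {f} q = (λ _ → 0#) , f , q , symΩ (transΩ (∔-cong (sumᴹ-zero λ c → ∙-zeroˡ _) reflΩ) (∔-idˡ f))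
    p∈ : ∀ a {e f} → Hom e f → p a ∙ f ∈ S
    p∈ a h = gen⇒S (gen-p a _)
    ξ∈ : ∀ a {e f} → Hom e f → ξ a ∙ f ∈ S
    ξ∈ a h = gen⇒S (gen-ξ a _)
    s∈ : (c : Code r′ n q) → spanner c ∈ S
    s∈ c = ≡.subst (Sub._∈S S) (proj₁ (s-index c))
      ((λ c′ → δ c′ i) , κ 0# , gen-0 , symΩ (transΩ (∔-idʳ _) (sumᴹ-δ i s)))
      where i = index (op̃ c)

  -- Fourier transform in the colours and separation of partitions

  geometric : ∀ z c k → (1# + - z) * sum {k} (λ b → c * z ^ suc (toℕ b)) ≈ c * z * (1# + - z ^ k)
  geometric z c zero = trans (*-congˡ (sum-[] _)) (solve 2 (λ z c → (:1 :- z) :* :0 := c :* z :* (:1 :- :1)) refl z c)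
  geometric z c (suc k) = begin
    (1# + - z) * sum (λ b → c * z ^ suc (toℕ b)) ≈⟨ *-congˡ (trans (sum-∷ _) (+-congˡ (sum-cong λ b → sym (*-assoc c z _)))) ⟩
    (1# + - z) * (c * (z * 1#) + sum {k} (λ b → (c * z) * z ^ suc (toℕ b)))
      ≈⟨ trans (distribˡ _ _ _) (+-congˡ (geometric z (c * z) k)) ⟩
    (1# + - z) * (c * (z * 1#)) + c * z * z * (1# + - z ^ k)
      ≈⟨ solve 3 (λ p c z → (:1 :- z) :* (c :* (z :* :1)) :+ c :* z :* z :* (:1 :- p) := c :* z :* (:1 :- z :* p)) refl (z ^ k) c z ⟩
    c * z * (1# + - z ^ suc k) ∎

  block : Place r q → Maybe (Fin q)
  block (inj₁ _) = nothing
  block (inj₂ (b , _)) = just b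

  -- The product is ζ to the difference of the colours, and modulo r this lies strictly between 0
  -- and r.
  colour-difference : ∀ (ρ ρ′ : Fin r) → ρ ≢ ρ′ → Unit (1# + - (ζ⁻ ρ * ζ ^ toℕ ρ′))
  colour-difference ρ ρ′ ρ≢ρ′ with ℕ.<-cmp (toℕ ρ) (toℕ ρ′)
  ... | tri≈ _ e _ = contradiction (Fin.toℕ-injective e) ρ≢ρ′
  ... | tri< lt _ _ = unit-cong (+-congˡ (-‿cong (sym (begin
      ζ⁻ ρ * ζ ^ toℕ ρ′ ≈⟨ *-congˡ (trans (^-congʳ ζ (≡.sym (ℕ.m+[n∸m]≡n (ℕ.<⇒≤ lt)))) (^-homo-* ζ (toℕ ρ) _)) ⟩
      ζ⁻ ρ * (ζ ^ toℕ ρ * ζ ^ (toℕ ρ′ ℕ.∸ toℕ ρ)) ≈⟨ *-assoc _ _ _ ⟨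
      (ζ⁻ ρ * ζ ^ toℕ ρ) * ζ ^ (toℕ ρ′ ℕ.∸ toℕ ρ) ≈⟨ trans (*-congʳ (ζ⁻-inverse ρ)) (*-identityˡ _) ⟩
      ζ ^ (toℕ ρ′ ℕ.∸ toℕ ρ) ∎))))
      (root-unit (toℕ ρ′ ℕ.∸ toℕ ρ) (ℕ.m<n⇒0<n∸m lt) (ℕ.≤-<-trans (ℕ.m∸n≤m (toℕ ρ′) (toℕ ρ)) (Fin.toℕ<n ρ′)))
  ... | tri> _ _ gt = unit-cong (+-congˡ (-‿cong (^-homo-* ζ (r ℕ.∸ toℕ ρ) (toℕ ρ′))))
      (root-unit (r ℕ.∸ toℕ ρ ℕ.+ toℕ ρ′) (ℕ.≤-trans (ℕ.m<n⇒0<n∸m (Fin.toℕ<n ρ)) (ℕ.m≤m+n _ _))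
        (≡.subst (r ℕ.∸ toℕ ρ ℕ.+ toℕ ρ′ ℕ.<_) (ℕ.m∸n+n≡m (ℕ.<⇒≤ (Fin.toℕ<n ρ))) (ℕ.+-monoʳ-< (r ℕ.∸ toℕ ρ) gt)))

  -- The discrete Fourier transform in the colour of an element of a nonzero block.
  dft-exponent : Place r q → Fin r → ℕ
  dft-exponent (inj₁ k) b = r′ ℕ.∸ suc (toℕ k)
  dft-exponent (inj₂ _) b = r′ ℕ.+ toℕ b

  dft-coefficient : Place r q → Fin r → Carrier
  dft-coefficient (inj₁ _) b = 1#
  dft-coefficient (inj₂ (_ , ρ)) b = ζ⁻ ρ ^ suc (toℕ b)

  dft : (Fin q → Carrier) → Place r q → Place r q → Carrier
  dft Y p p′ = sum λ b → dft-coefficient p b * cell Y p′ (dft-exponent p b , true)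

  -- The exponents r - 1 + b lie in a single period, so the power of Y j is 1 throughout and only
  -- the characters of the colours vary.
  dft-inj₂ : ∀ (Y : Fin q → Carrier) j ρ ρ′ →
    dft Y (inj₂ (j , ρ)) (inj₂ (j , ρ′)) ≈ sum {r} (λ b → Y j * (ζ⁻ ρ * ζ ^ toℕ ρ′) ^ suc (toℕ b))
  dft-inj₂ Y j ρ ρ′ = sum-cong λ b → begin
    ζ⁻ ρ ^ suc (toℕ b) * (ζ ^ (toℕ ρ′ ℕ.* suc (suc (r′ ℕ.+ toℕ b))) * Y j ^ (suc (r′ ℕ.+ toℕ b) / r))
      ≈⟨ *-congˡ (*-cong (trans (^-congʳ ζ (≡.cong (toℕ ρ′ ℕ.*_) (exponent b))) (trans (ζ-period (toℕ ρ′) 1 (suc (toℕ b))) (sym (^-assocʳ ζ (toℕ ρ′) _))))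
           (trans (^-congʳ (Y j) (quotient b)) (*-identityʳ _))) ⟩
    ζ⁻ ρ ^ suc (toℕ b) * ((ζ ^ toℕ ρ′) ^ suc (toℕ b) * Y j) ≈⟨ x∙yz≈z∙xy _ _ _ ⟩
    Y j * (ζ⁻ ρ ^ suc (toℕ b) * (ζ ^ toℕ ρ′) ^ suc (toℕ b)) ≈⟨ *-congˡ (^-distrib-* (ζ⁻ ρ) (ζ ^ toℕ ρ′) (suc (toℕ b))) ⟨
    Y j * (ζ⁻ ρ * ζ ^ toℕ ρ′) ^ suc (toℕ b) ∎ where
    exponent : ∀ (b : Fin r) → suc (suc (r′ ℕ.+ toℕ b)) ≡ r ℕ.* 1 ℕ.+ suc (toℕ b)
    exponent b = ≡.sym (≡.trans (≡.cong (ℕ._+ suc (toℕ b)) (ℕ.*-identityʳ r)) (ℕ.+-suc r (toℕ b)))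
    quotient : ∀ (b : Fin r) → (r ℕ.+ toℕ b) / r ≡ 1
    quotient b = ≡.trans (ℕ.+-distrib-/-∣ˡ {r} (toℕ b) {r} ℕ.∣-refl) (≡.cong₂ ℕ._+_ (ℕ.n/n≡1 r) (ℕ.m<n⇒m/n≡0 (Fin.toℕ<n b)))

  private
    k-exponent : ∀ (k : Fin r′) → suc (r′ ℕ.∸ suc (toℕ k)) ≡ r′ ℕ.∸ toℕ k
    k-exponent k = ≡.sym (ℕ.+-∸-assoc 1 (Fin.toℕ<n k))

  dft-same : (Y : Fin q → Carrier) → (∀ b → Unit (Y b)) → ∀ p → Unit (dft Y p p)
  dft-same Y Y-unit (inj₁ k) = unit-cong (sym (trans (sum-const r _) (*-congˡ (trans (*-identityˡ _) (⟦⟧?-yes (_ ℕ.≟ _) (k-exponent k))))))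
    (unit-* (fromℕ-unit r′) unit-1)
  dft-same Y Y-unit (inj₂ (j , ρ)) = unit-cong (sym (trans (dft-inj₂ Y j ρ ρ) (trans (sum-cong λ b → trans (*-congˡ
      (trans (^-congˡ (suc (toℕ b)) (ζ⁻-inverse ρ)) (one^ (suc (toℕ b))))) (*-identityʳ _)) (sum-const r (Y j)))))
    (unit-* (fromℕ-unit r′) (Y-unit j))

  dft-different : ∀ (Y : Fin q → Carrier) p p′ → block p ≡ block p′ → p ≢ p′ → dft Y p p′ ≈ 0#
  dft-different Y (inj₁ k) (inj₁ k′) e p≢p′ = sum-zero λ b → trans (*-identityˡ _) (⟦⟧?-no (_ ℕ.≟ _) λ eq →
    contradiction (≡.cong inj₁ (Fin.toℕ-injective (ℕ.∸-cancelˡ-≡ (ℕ.<⇒≤ (Fin.toℕ<n k)) (ℕ.<⇒≤ (Fin.toℕ<n k′)) (≡.trans (≡.sym (k-exponent k)) eq)))) p≢p′)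
  dft-different Y (inj₂ (j , ρ)) (inj₂ (.j , ρ′)) ≡.refl p≢p′ = trans (dft-inj₂ Y j ρ ρ′)
    (unit-cancel (colour-difference ρ ρ′ (λ { ≡.refl → p≢p′ ≡.refl })) (trans (geometric z (Y j) r) (trans (*-congˡ
      (trans (+-congˡ (-‿cong z^r)) (-‿inverseʳ 1#))) (zeroʳ _)))) where
    z = ζ⁻ ρ * ζ ^ toℕ ρ′
    z^r : z ^ r ≈ 1#
    z^r = trans (^-distrib-* (ζ⁻ ρ) _ r) (trans (*-cong (ζ⁻^r ρ) (ζ^r (toℕ ρ′))) (*-identityˡ 1#))

  module Transversal {q} (v : Vec (Place r q) n) (tr : Fin q → Fin n) (tr-block : ∀ b → block (lookup v (tr b)) ≡ just b) where

    tr-injective : ∀ {b b′} → tr b ≡ tr b′ → b ≡ b′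
    tr-injective {b} {b′} e = Maybe.just-injective (≡.trans (≡.sym (tr-block b)) (≡.trans (≡.cong (block ∘ lookup v) e) (tr-block b′)))

    raise : Fin q → Mon n → Mon n
    raise b m = incrs (tr b) r′ (setθ (tr b) m)

    fill : (Fin k → Fin q) → Mon n → Mon n
    fill {zero} β m = m
    fill {suc k} β m = fill (β ∘ suc) (raise (β zero) m)

    fillSign : (Fin k → Fin q) → Mon n → Carrier
    fillSign {zero} β m = 1#
    fillSign {suc k} β m = sign (tr (β zero)) m * fillSign (β ∘ suc) (raise (β zero) m)

    lookup-raise-other : ∀ b j m → j ≢ tr b → lookup (raise b m) j ≡ lookup m j
    lookup-raise-other b j m j≢ = ≡.trans (lookup-incrs-other (tr b) j r′ _ j≢) (lookup-setθ-other (tr b) j m j≢)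

    lookup-raise-same : ∀ b m → lookup (raise b m) (tr b) ≡ (r′ ℕ.+ proj₁ (lookup m (tr b)) , true)
    lookup-raise-same b m = ≡.trans (lookup-incrs-same (tr b) r′ (setθ (tr b) m))
      (≡.cong (λ p → r′ ℕ.+ proj₁ p , proj₂ p) (lookup-setθ-same (tr b) m))

    lookup-fill-other : ∀ (β : Fin k → Fin q) j m → (∀ a → j ≢ tr (β a)) → lookup (fill β m) j ≡ lookup m j
    lookup-fill-other {zero} β j m h = ≡.refl
    lookup-fill-other {suc k} β j m h = ≡.trans (lookup-fill-other (β ∘ suc) j _ (h ∘ suc)) (lookup-raise-other (β zero) j m (h zero))

    lookup-fill : (β : Fin k → Fin q) → (∀ {a a′} → β a ≡ β a′ → a ≡ a′) → ∀ a m →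
      lookup (fill β m) (tr (β a)) ≡ (r′ ℕ.+ proj₁ (lookup m (tr (β a))) , true)
    lookup-fill β inj zero m = ≡.trans (lookup-fill-other (β ∘ suc) _ _ λ a e → contradiction (inj (tr-injective e)) λ ()) (lookup-raise-same (β zero) m)
    lookup-fill β inj (suc a) m = ≡.trans (lookup-fill (β ∘ suc) (Fin.suc-injective ∘ inj) a _)
      (≡.cong (λ p → r′ ℕ.+ proj₁ p , true) (lookup-raise-other (β zero) _ m λ e → contradiction (inj (tr-injective e)) λ ()))

    bits-raise : ∀ b {m m′} → bits m ≡ bits m′ → bits (raise b m) ≡ bits (raise b m′)
    bits-raise b e = ≡.trans (bits-incrs (tr b) r′ _) (≡.trans (bits-setθ (tr b) e) (≡.sym (bits-incrs (tr b) r′ _)))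

    fillSign-bits : ∀ (β : Fin k → Fin q) {m m′} → bits m ≡ bits m′ → fillSign β m ≡ fillSign β m′
    fillSign-bits {zero} β e = ≡.refl
    fillSign-bits {suc k} β e = ≡.cong₂ _*_ (sign-bits (tr (β zero)) e) (fillSign-bits (β ∘ suc) (bits-raise (β zero) e))

    -- In the blocks chosen by β exactly the transversal elements lack their θ.
    Open : (Fin k → Fin q) → Mon n → Set
    Open β m = (∀ a → lookup (bits m) (tr (β a)) ≡ false) ×
               (∀ a i → block (lookup v i) ≡ just (β a) → i ≢ tr (β a) → lookup (bits m) i ≡ true)

    open-raise : (β : Fin (suc k) → Fin q) → (∀ {a a′} → β a ≡ β a′ → a ≡ a′) → ∀ {m} → Open β m → Open (β ∘ suc) (raise (β zero) m)
    open-raise β inj {m} (f , t) =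
      (λ a → ≡.trans (same (tr (β (suc a))) (λ e → contradiction (inj (tr-injective e)) λ ())) (f (suc a))) ,
      (λ a i e i≢ → ≡.trans (same i λ { ≡.refl → contradiction (inj (Maybe.just-injective (≡.trans (≡.sym e) (tr-block (β zero))))) λ () }) (t (suc a) i e i≢))
      where
      same : ∀ j → j ≢ tr (β zero) → lookup (bits (raise (β zero) m)) j ≡ lookup (bits m) j
      same j j≢ = ≡.trans (Vec.lookup-map j proj₂ (raise (β zero) m)) (≡.trans (≡.cong proj₂ (lookup-raise-other (β zero) j m j≢)) (≡.sym (Vec.lookup-map j proj₂ m)))

    fillSign² : (β : Fin k → Fin q) → (∀ {a a′} → β a ≡ β a′ → a ≡ a′) → ∀ {m} → Open β m → fillSign β m * fillSign β m ≈ 1#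
    fillSign² {zero} β inj o = *-identityˡ 1#
    fillSign² {suc k} β inj {m} o = trans (solve 2 (λ a b → (a :* b) :* (a :* b) := (a :* a) :* (b :* b)) refl _ _)
      (trans (*-cong (sign-false (tr (β zero)) m (proj₁ o zero)) (fillSign² (β ∘ suc) (Fin.suc-injective ∘ inj) (open-raise β inj o))) (*-identityˡ 1#))

    weight-fill : (β : Fin k → Fin q) → (∀ {a a′} → β a ≡ β a′ → a ≡ a′) → ∀ {m} → Open β m →
      weight₁ (bits (fill β m)) ≡ k ℕ.+ weight₁ (bits m)
    weight-fill {zero} β inj o = ≡.refl
    weight-fill {suc k} β inj {m} o = ≡.trans (weight-fill (β ∘ suc) (Fin.suc-injective ∘ inj) (open-raise β inj o))
      (≡.trans (≡.cong (k ℕ.+_) (≡.trans (≡.cong weight₁ (bits-incrs (tr (β zero)) r′ _)) (weight₁-setθ (tr (β zero)) m (proj₁ o zero)))) (ℕ.+-suc k _))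

    -- All other elements of the block carry their θ, so only the transversal element contributes.
    dyB-mono : ∀ b m → (∀ i → block (lookup v i) ≡ just b → i ≢ tr b → lookup (bits m) i ≡ true) →
      dyB v b ∙ mono m ≈Ω κ (sign (tr b) m) ∙ mono (raise b m)
    dyB-mono b m t = ≈Ω.begin
      dyB v b ∙ mono m ≈Ω.≈⟨ sum-∙ʳ _ _ ⟩
      sumᴹ (λ i → (κ (member b (lookup v i)) ∙ dy i) ∙ mono m) ≈Ω.≈⟨ sumᴹ-cong (λ i → ∙-assoc _ _ _) ⟩
      sumᴹ (λ i → κ (member b (lookup v i)) ∙ (dy i ∙ mono m)) ≈Ω.≈⟨ sumᴹ-single (tr b) _ others ⟩
      κ (member b (lookup v (tr b))) ∙ (dy (tr b) ∙ mono m) ≈Ω.≈⟨ ∙-cong₁ (κ-cong (own (lookup v (tr b)) (tr-block b))) ⟩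
      κ 1# ∙ (dy (tr b) ∙ mono m) ≈Ω.≈⟨ transΩ (∙-idˡ _) (dy-mono (tr b) m) ⟩
      κ (sign (tr b) m) ∙ mono (raise b m) ≈Ω.∎ where
      own : ∀ p → block p ≡ just b → member b p ≈ 1#
      own (inj₂ (.b , _)) ≡.refl = δ-yes b
      others : ∀ i → i ≢ tr b → κ (member b (lookup v i)) ∙ (dy i ∙ mono m) ≈Ω κ 0#
      others i i≢ = go (lookup v i) ≡.refl where
        go : ∀ p → lookup v i ≡ p → κ (member b p) ∙ (dy i ∙ mono m) ≈Ω κ 0#
        go (inj₁ _) e = ∙-zeroˡ _
        go (inj₂ (j , _)) e with b Fin.≟ j
        ... | no _ = ∙-zeroˡ _
        ... | yes ≡.refl = transΩ (∙-cong₂ (transΩ (dy-mono i m) (κ0-zero _ (sign-true i m (t i (≡.cong block e) i≢))))) (∙-zeroʳ _)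

    dys-mono : (β : Fin k → Fin q) → (∀ {a a′} → β a ≡ β a′ → a ≡ a′) → ∀ m → Open β m →
      dys v β ∙ mono m ≈Ω κ (fillSign β m) ∙ mono (fill β m)
    dys-mono {zero} β inj m o = reflΩ
    dys-mono {suc k} β inj m o = ≈Ω.begin
      (dys v (β ∘ suc) ∙ dyB v (β zero)) ∙ mono m ≈Ω.≈⟨ ∙-assoc _ _ _ ⟩
      dys v (β ∘ suc) ∙ (dyB v (β zero) ∙ mono m) ≈Ω.≈⟨ ∙-cong₂ (dyB-mono (β zero) m (proj₂ o zero)) ⟩
      dys v (β ∘ suc) ∙ (κ (sign (tr (β zero)) m) ∙ mono (raise (β zero) m)) ≈Ω.≈⟨ pull-κ _ _ _ ⟩
      κ (sign (tr (β zero)) m) ∙ (dys v (β ∘ suc) ∙ mono (raise (β zero) m))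
        ≈Ω.≈⟨ ∙-cong₂ (dys-mono (β ∘ suc) (Fin.suc-injective ∘ inj) _ (open-raise β inj o)) ⟩
      κ (sign (tr (β zero)) m) ∙ (κ (fillSign (β ∘ suc) (raise (β zero) m)) ∙ mono (fill (β ∘ suc) (raise (β zero) m))) ≈Ω.≈⟨ κκ _ _ _ ⟩
      κ (fillSign β m) ∙ mono (fill β m) ≈Ω.∎

    ev-mono : ∀ (Y : Fin q → Carrier) m → Open id m → ev Y v (mono m) ≈ fillSign id m * top Y v (fill id m)
    ev-mono Y m o = trans (T-resp _ (dys-mono id id m o)) (trans (T-κ _ _ _) (*-congˡ (T-mono _ _)))

  Ev : Submodule Fun
  Ev = record
    { _∈S = λ F → ∃ λ f → ∀ σ → F σ ≈ evaluate σ f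
    ; resp = λ { e (f , h) → f , λ σ → trans (sym (e σ)) (h σ) }
    ; 0∈ = κ 0# , λ σ → sym (ev-0 _ _)
    ; +∈ = λ { (f , h) (g , k) → f ∔ g , λ σ → trans (+-cong (h σ) (k σ)) (sym (ev-∔ _ _ f g)) }
    ; *∈ = λ { c (f , h) → κ c ∙ f , λ σ → trans (*-congˡ (h σ)) (sym (ev-κ _ _ c f)) }
    }

  sum∈Fun : (S : Submodule Fun) → ∀ {k} (F : Fin k → OP̃ n r → Carrier) → (∀ a → F a ∈ S) → (λ σ → sum λ a → F a σ) ∈ S
  sum∈Fun S {zero} F h = Sub.resp S (λ σ → sym (sum-[] _)) (Sub.0∈ S)
  sum∈Fun S {suc k} F h = Sub.resp S (λ σ → sym (sum-∷ _)) (Sub.+∈ S (h zero) (sum∈Fun S (F ∘ suc) (h ∘ suc)))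

  sumⱽ∈Fun : (S : Submodule Fun) → ∀ {k m} (F : Vec (Fin k) m → OP̃ n r → Carrier) → (∀ u → F u ∈ S) →
    (λ σ → sumⱽ λ u → F u σ) ∈ S
  sumⱽ∈Fun S {m = zero} F h = h []
  sumⱽ∈Fun S {m = suc m} F h = sum∈Fun S _ λ a → sumⱽ∈Fun S _ λ u → h (a ∷ u)

  SameBlocks : Vec (Place r q) n → Vec (Place r q) n → Set
  SameBlocks v v′ = ∀ i → block (lookup v i) ≡ block (lookup v′ i)

  module Fourier {q} (v : Vec (Place r q) n) (ne : NoEmptyBlock v) where

    tr : Fin q → Fin n
    tr b = proj₁ (ne b)

    tr-place : ∀ b → block (lookup v (tr b)) ≡ just b
    tr-place b = ≡.cong block (proj₂ (proj₂ (ne b)))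

    fourierCell : Place r q → Fin n → Fin r → ℕ × Bool
    fourierCell (inj₁ k) i b = dft-exponent {q} (inj₁ k) b , true
    fourierCell (inj₂ (j , ρ)) i b = if does (i Fin.≟ tr j) then (toℕ b , false) else (dft-exponent (inj₂ (j , ρ)) b , true)

    -- A transversal element gets the exponent b without θ. Then `dys` raises it to r - 1 + b with
    -- θ, the exponent of the transform, so that all elements of nonzero blocks are treated alike.
    fourierMon : Vec (Fin r) n → Mon n
    fourierMon u = tabulate λ i → fourierCell (lookup v i) i (lookup u i)

    fourierCoefficient : Vec (Fin r) n → Carrier
    fourierCoefficient u = product λ i → dft-coefficient (lookup v i) (lookup u i)

    fourier : OP̃ n r → Carrier
    fourier σ = sumⱽ λ u → fourierCoefficient u * evaluate σ (mono (fourierMon u))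

    fourier∈ : fourier ∈ Ev
    fourier∈ = sumⱽ∈Fun Ev _ λ u → Sub.*∈ Ev _ (mono (fourierMon u) , λ σ → refl)

    module _ (v′ : Vec (Place r q) n) (same : SameBlocks v v′) where
      open Transversal v′ tr (λ b → ≡.trans (≡.sym (same (tr b))) (tr-place b))

      bit : ∀ u i → lookup (bits (fourierMon u)) i ≡ proj₂ (fourierCell (lookup v i) i (lookup u i))
      bit u i = ≡.trans (Vec.lookup-map i proj₂ (fourierMon u)) (≡.cong proj₂ (Vec.lookup∘tabulate _ i))

      cell-tr : ∀ p b i c → block p ≡ just b → i ≡ tr b → fourierCell p i c ≡ (toℕ c , false)
      cell-tr (inj₂ (b , ρ)) .b i c ≡.refl e with i Fin.≟ tr b
      ... | yes _ = ≡.refl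
      ... | no i≢ = contradiction e i≢

      cell-other : ∀ p i c → (∀ b → block p ≡ just b → i ≢ tr b) → fourierCell p i c ≡ (dft-exponent p c , true)
      cell-other (inj₁ k) i c h = ≡.refl
      cell-other (inj₂ (b , ρ)) i c h with i Fin.≟ tr b
      ... | yes e = contradiction e (h b ≡.refl)
      ... | no _ = ≡.refl

      bit-free : ∀ p i c c′ → proj₂ (fourierCell p i c) ≡ proj₂ (fourierCell p i c′)
      bit-free (inj₁ k) i c c′ = ≡.refl
      bit-free (inj₂ (b , ρ)) i c c′ with does (i Fin.≟ tr b)
      ... | true = ≡.refl
      ... | false = ≡.refl

      opened : ∀ u → Open id (fourierMon u)
      opened u = (λ b → ≡.trans (bit u (tr b)) (≡.cong proj₂ (cell-tr (lookup v (tr b)) b (tr b) _ (tr-place b) ≡.refl))) ,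
        (λ b i e i≢ → ≡.trans (bit u i) (≡.cong proj₂ (cell-other (lookup v i) i _ λ b′ e′ →
          ≡.subst (λ b → i ≢ tr b) (Maybe.just-injective (≡.trans (≡.sym e) (≡.trans (≡.sym (same i)) e′))) i≢)))

      filled : ∀ u i → lookup (fill id (fourierMon u)) i ≡ (dft-exponent (lookup v i) (lookup u i) , true)
      filled u i = go (lookup v i) ≡.refl where
        other : ∀ p → lookup v i ≡ p → (∀ b → block p ≡ just b → i ≢ tr b) → lookup (fill id (fourierMon u)) i ≡ (dft-exponent p (lookup u i) , true)
        other p e h = ≡.trans (lookup-fill-other id i (fourierMon u) λ b e′ → h b (≡.trans (≡.cong block (≡.sym e)) (≡.trans (≡.cong (block ∘ lookup v) e′) (tr-place b))) e′)
          (≡.trans (Vec.lookup∘tabulate _ i) (≡.trans (≡.cong (λ p → fourierCell p i (lookup u i)) e) (cell-other p i _ h)))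
        go : ∀ p → lookup v i ≡ p → lookup (fill id (fourierMon u)) i ≡ (dft-exponent p (lookup u i) , true)
        go (inj₁ k) e = other (inj₁ k) e λ _ ()
        go (inj₂ (b , ρ)) e with i Fin.≟ tr b
        ... | no i≢ = other (inj₂ (b , ρ)) e λ { .b ≡.refl → i≢ }
        ... | yes ≡.refl = ≡.trans (lookup-fill id id b (fourierMon u)) (≡.cong (λ a → r′ ℕ.+ proj₁ a , true)
          (≡.trans (Vec.lookup∘tabulate _ i) (cell-tr (lookup v i) b i _ (tr-place b) ≡.refl)))

      u₀ : Vec (Fin r) n
      u₀ = Vec.replicate n zero

      ε : Carrier
      ε = fillSign id (fourierMon u₀)

      weight-fourier : ∀ u → q ℕ.+ weight₁ (bits (fourierMon u)) ≡ n
      weight-fourier u = ≡.trans (≡.sym (weight-fill id id (opened u))) (≡.trans (≡.cong weight₁ full) weight₁-full) where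
        full : bits (fill id (fourierMon u)) ≡ bits (fullMon {n})
        full = vec-ext λ i → ≡.trans (Vec.lookup-map i proj₂ (fill id (fourierMon u)))
          (≡.trans (≡.cong proj₂ (filled u i)) (≡.sym (bits-full i)))

      ε-free : ∀ u → fillSign id (fourierMon u) ≡ ε
      ε-free u = fillSign-bits id (vec-ext λ i → ≡.trans (bit u i) (≡.trans (bit-free (lookup v i) i _ _) (≡.sym (bit u₀ i))))

      -- The functional is a product over the elements, so the sum over all u splits into one
      -- transform per element; the sign does not depend on u.
      fourier-product : ∀ (Y : Fin q → Carrier) →
        sumⱽ (λ u → fourierCoefficient u * ev Y v′ (mono (fourierMon u))) ≈ ε * product (λ i → dft Y (lookup v i) (lookup v′ i))
      fourier-product Y = begin
        sumⱽ (λ u → fourierCoefficient u * ev Y v′ (mono (fourierMon u)))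
          ≈⟨ sumⱽ-cong (λ u → trans (*-congˡ (trans (ev-mono Y (fourierMon u) (opened u)) (*-cong (reflexive (ε-free u)) (trans (top-product Y v′ _)
               (Π.sum-cong-≋ λ i → reflexive (≡.cong (cell Y (lookup v′ i)) (filled u i)))))))
               (trans (x∙yz≈y∙xz _ ε _) (*-congˡ (sym (Π.∑-distrib-+ (λ i → dft-coefficient (lookup v i) (lookup u i)) _))))) ⟩
        sumⱽ (λ u → ε * product (λ i → dft-coefficient (lookup v i) (lookup u i) * cell Y (lookup v′ i) (dft-exponent (lookup v i) (lookup u i) , true)))
          ≈⟨ sumⱽ-*ˡ ε (λ u → product λ i → dft-coefficient (lookup v i) (lookup u i) * cell Y (lookup v′ i) (dft-exponent (lookup v i) (lookup u i) , true)) ⟨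
        ε * sumⱽ {r} {n} (λ u → product (λ i → dft-coefficient (lookup v i) (lookup u i) * cell Y (lookup v′ i) (dft-exponent (lookup v i) (lookup u i) , true)))
          ≈⟨ *-congˡ (sumⱽ-product (λ i b → dft-coefficient (lookup v i) b * cell Y (lookup v′ i) (dft-exponent (lookup v i) b , true))) ⟩
        ε * product (λ i → dft Y (lookup v i) (lookup v′ i)) ∎

      ε-unit : Unit ε
      ε-unit = ε , fillSign² id id (opened u₀)

    fourier-self : ∀ .(ne : NoEmptyBlock v) → Unit (fourier (mkOP̃ q v ne))
    fourier-self ne′ = unit-cong (sym (fourier-product v (λ _ → ≡.refl) (coords v)))
      (unit-* (ε-unit v (λ _ → ≡.refl)) (unit-product _ λ i → dft-same (coords v) (nonzero (sizes v) (sizes-bounded (mkOP̃ q v ne′))) (lookup v i)))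

    fourier-same-blocks : ∀ v′ .(ne : NoEmptyBlock v′) → SameBlocks v v′ → v′ ≢ v → fourier (mkOP̃ q v′ ne) ≈ 0#
    fourier-same-blocks v′ ne′ same v′≢v with Fin.all? (λ i → place-≟ (lookup v i) (lookup v′ i))
    ... | yes e = contradiction (vec-ext (≡.sym ∘ e)) v′≢v
    ... | no ¬e = let i , v≢ = Fin.¬∀⟶∃¬ n _ (λ i → place-≟ (lookup v i) (lookup v′ i)) ¬e in
      trans (fourier-product v′ same (coords v′)) (trans (*-congˡ (zero-product _ i (dft-different (coords v′) _ _ (same i) v≢))) (zeroʳ _))

    fourier-blocks : ∀ σ → OP̃.blocks σ ≢ q → fourier σ ≈ 0#
    fourier-blocks σ blocks≢q = sumⱽ-zero λ u → trans (*-congˡ (zero′ u)) (zeroʳ _) where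
      zero′ : ∀ u → evaluate σ (mono (fourierMon u)) ≈ 0#
      zero′ u = ev-θ-count _ (place σ) (Gθ.hom-mono (fourierMon u)) λ e → blocks≢q (ℕ.+-cancelʳ-≡ _ _ _
        (≡.trans e (≡.sym (≡.trans (≡.cong (q ℕ.+_) (θ-count (fourierMon u))) (weight-fourier v (λ _ → ≡.refl) u)))))

  value-difference : (v v′ : Vec (Place r q) n) → NoEmptyBlock v → NoEmptyBlock v′ → ∀ p p′ → block p ≢ block p′ →
    Unit (value (coords v) p + - value (coords v′) p′)
  value-difference v v′ ne ne′ (inj₁ _) (inj₁ _) b≢ = contradiction ≡.refl b≢
  value-difference v v′ ne ne′ (inj₁ _) (inj₂ (b , _)) b≢ =
    unit-cong (sym (+-identityˡ _)) (unit-neg (nonzero (sizes v′) (sizes-bounded (mkOP̃ _ v′ ne′)) b))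
  value-difference v v′ ne ne′ (inj₂ (b , _)) (inj₁ _) b≢ =
    unit-cong (solve 1 (λ a → a := a :- :0) refl (coords v b)) (nonzero (sizes v) (sizes-bounded (mkOP̃ _ v ne)) b)
  value-difference v v′ ne ne′ (inj₂ (b , _)) (inj₂ (b′ , _)) b≢ =
    separate (sizes v) (sizes v′) (sizes-bounded (mkOP̃ _ v ne)) (sizes-bounded (mkOP̃ _ v′ ne′)) (b≢ ∘ ≡.cong just)

  opaque
    -- Multiplication by yᵢ - c, with c a value of yᵢ, removes one partition after the other.
    separating : ∀ τ → ∃ λ f → Unit (evaluate τ f) × (∀ σ → σ ≢ τ → evaluate σ f ≈ 0#)
    separating τ@(mkOP̃ q v ne) = result where
      open Fourier v (nonempty τ)

      -- The last condition ensures that no later factor revives a partition which the Fourier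
      -- transform has already killed.
      Separated : (OP̃ n r → Carrier) → Set
      Separated F = F ∈ Ev × Unit (F τ) × (∀ σ → fourier σ ≈ 0# → F σ ≈ 0#)

      Killed : OP̃ n r → (OP̃ n r → Carrier) → Set
      Killed σ F = ∃ λ G → Separated G × G σ ≈ 0# × (∀ σ′ → F σ′ ≈ 0# → G σ′ ≈ 0#)

      kill-at : ∀ σ F → Separated F → ∀ i → Unit (val (coords v) v i + - val (coords (place σ)) (place σ) i) → Killed σ F
      kill-at σ F ((f , f≈) , F-unit , F-zero) i u =
        (λ σ′ → (at σ′ + - c) * F σ′) ,
        ((y i ∙ f ∔ κ (- c) ∙ f , λ σ′ → trans (distribʳ _ _ _) (sym (trans (ev-∔ _ _ _ _)
            (+-cong (trans (ev-y _ _ i f) (*-congˡ (sym (f≈ σ′)))) (trans (ev-κ _ _ _ f) (*-congˡ (sym (f≈ σ′)))))))) ,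
         unit-* u F-unit ,
         λ σ′ z → trans (*-congˡ (F-zero σ′ z)) (zeroʳ _)) ,
        trans (*-congʳ (-‿inverseʳ _)) (zeroˡ _) ,
        λ σ′ z → trans (*-congˡ z) (zeroʳ _) where
        at : OP̃ n r → Carrier
        at σ′ = val (coords (place σ′)) (place σ′) i
        c : Carrier
        c = at σ

      kill-zero : ∀ σ F → Separated F → fourier σ ≈ 0# → Killed σ F
      kill-zero σ F S z = F , S , proj₂ (proj₂ S) σ z , λ _ z → z

      kill-same-size : ∀ v′ (ne′ : NoEmptyBlock v′) → v′ ≢ v → ∀ F → Separated F →
        Dec (∀ i → block (lookup v i) ≡ block (lookup v′ i)) → Killed (mkOP̃ q v′ ne′) F
      kill-same-size v′ ne′ v′≢v F S (yes same) = kill-zero _ F S (fourier-same-blocks v′ ne′ same v′≢v)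
      kill-same-size v′ ne′ v′≢v F S (no ¬same) =
        let i , differ = Fin.¬∀⟶∃¬ n _ (λ i → Maybe.≡-dec Fin._≟_ (block (lookup v i)) (block (lookup v′ i))) ¬same
        in kill-at (mkOP̃ q v′ ne′) F S i (value-difference v v′ (nonempty τ) ne′ (lookup v i) (lookup v′ i) differ)

      kill : ∀ q′ (v′ : Vec (Place r q′) n) (ne′ : NoEmptyBlock v′) → mkOP̃ q′ v′ ne′ ≢ τ → ∀ F → Separated F →
        Dec (q′ ≡ q) → Killed (mkOP̃ q′ v′ ne′) F
      kill q′ v′ ne′ σ≢τ F S (no q′≢q) = kill-zero _ F S (fourier-blocks (mkOP̃ q′ v′ ne′) q′≢q)
      kill q′ v′ ne′ σ≢τ F S (yes ≡.refl) = kill-same-size v′ ne′ (λ { ≡.refl → σ≢τ ≡.refl }) F S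
        (Fin.all? λ i → Maybe.≡-dec Fin._≟_ (block (lookup v i)) (block (lookup v′ i)))

      Cleared : (Fin k → OP̃ n r) → Set
      Cleared t = ∃ λ F → Separated F × (∀ a → t a ≢ τ → F (t a) ≈ 0#)

      clear : (t : Fin (suc k) → OP̃ n r) → Cleared (t ∘ suc) → Dec (t zero ≡ τ) → Cleared t
      clear t (F , S , z) (yes e) = F , S , λ { zero ≢τ → contradiction e ≢τ ; (suc a) → z a }
      clear t (F , S , z) (no ≢τ) = let G , S′ , z₀ , keep = kill _ (place (t zero)) (nonempty (t zero)) ≢τ F S (_ ℕ.≟ q) in
        G , S′ , λ { zero _ → z₀ ; (suc a) ≢τ′ → keep _ (z a ≢τ′) }

      kill-all : (t : Fin k → OP̃ n r) → Cleared t
      kill-all {zero} t = fourier , (fourier∈ , fourier-self ne , λ _ z → z) , λ ()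
      kill-all {suc k} t = clear t (kill-all (t ∘ suc)) (op̃-≟ (t zero) τ)

      result : ∃ λ f → Unit (evaluate τ f) × (∀ σ → σ ≢ τ → evaluate σ f ≈ 0#)
      result = let F , ((f , f≈) , u , _) , z = kill-all partition in
        f , unit-cong (f≈ τ) u , λ σ σ≢τ → trans (sym (f≈ σ)) (≡.subst (λ σ → F σ ≈ 0#) (partition-index σ)
          (z (index σ) λ e → σ≢τ (≡.trans (≡.sym (partition-index σ)) e)))

  -- Indicator functions and leading coordinates

  Span : Submodule Fun
  Span = record
    { _∈S = λ F → ∃ λ D → F ∈ SpanBelow D
    ; resp = λ { e (D , q) → D , Sub.resp (SpanBelow D) e q }
    ; 0∈ = 0 , Sub.0∈ (SpanBelow 0)
    ; +∈ = λ { (D , q) (D′ , q′) → D ℕ.⊔ D′ , Sub.+∈ (SpanBelow _) (below-mono (ℕ.m≤m⊔n D D′) q) (below-mono (ℕ.m≤n⊔m D D′) q′) }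
    ; *∈ = λ { c (D , q) → D , Sub.*∈ (SpanBelow D) c q }
    }

  opaque
    evaluate∈Span : ∀ f → (λ σ → evaluate σ f) ∈ Span
    evaluate∈Span = mono-span S λ m → suc (deg m) , evaluate∈ (hom-mono m) where
      S : Submodule Ω-module
      S = record
        { _∈S = λ f → (λ σ → evaluate σ f) ∈ Span
        ; resp = λ e → Sub.resp Span (λ σ → ev-resp _ _ e)
        ; 0∈ = Sub.resp Span (λ σ → sym (ev-0 _ _)) (Sub.0∈ Span)
        ; +∈ = λ q q′ → Sub.resp Span (λ σ → sym (ev-∔ _ _ _ _)) (Sub.+∈ Span q q′)
        ; *∈ = λ c q → Sub.resp Span (λ σ → sym (ev-κ _ _ c _)) (Sub.*∈ Span c q)
        }

  indicator-coefficients : ∀ τ f → Unit (evaluate τ f) → (∀ σ → σ ≢ τ → evaluate σ f ≈ 0#) → (λ σ → evaluate σ f) ∈ Span →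
    ∃ λ (u : Fin N → Carrier) → ∀ i → sum (λ c → u c * evaluate (partition i) (s c)) ≈ δ i (index τ)
  indicator-coefficients τ f (b , fb) off (_ , u , _ , u≈) = (λ c → b * u c) , λ i → indicator i (i Fin.≟ index τ) where
    scaled : ∀ i → sum (λ c → (b * u c) * evaluate (partition i) (s c)) ≈ b * evaluate (partition i) f
    scaled i = trans (sum-cong λ c → *-assoc _ _ _) (trans (sym (sum-*ˡ _ _)) (*-congˡ (sym (u≈ (partition i)))))
    indicator : ∀ i (d : Dec (i ≡ index τ)) → sum (λ c → (b * u c) * evaluate (partition i) (s c)) ≈ ⟦ d ⟧?
    indicator i (yes ≡.refl) = trans (scaled (index τ)) (trans (*-comm _ _) (trans (*-congʳ (reflexive (≡.cong (λ σ → evaluate σ f) (partition-index τ)))) fb))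
    indicator i (no i≢) = trans (scaled i) (trans (*-congˡ (off (partition i) λ e →
        i≢ (≡.trans (≡.sym (index-partition i)) (≡.cong index e)))) (zeroʳ _))

  opaque
    indicator∈Span : ∀ τ → ∃ λ (u : Fin N → Carrier) → ∀ i → sum (λ c → u c * evaluate (partition i) (s c)) ≈ δ i (index τ)
    indicator∈Span τ = let f , unit , off = separating τ in indicator-coefficients τ f unit off (evaluate∈Span f)

  evaluate-resp : ∀ σ {f g} → f ≈Ω g → evaluate σ f ≈ evaluate σ g
  evaluate-resp σ = ev-resp (coords (place σ)) (place σ)

  evaluate-∔ : ∀ σ f g → evaluate σ (f ∔ g) ≈ evaluate σ f + evaluate σ g
  evaluate-∔ σ = ev-∔ (coords (place σ)) (place σ)

  evaluate-κ : ∀ σ c f → evaluate σ (κ c ∙ f) ≈ c * evaluate σ f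
  evaluate-κ σ = ev-κ (coords (place σ)) (place σ)

  evaluate-0 : ∀ σ → evaluate σ (κ 0#) ≈ 0#
  evaluate-0 σ = ev-0 (coords (place σ)) (place σ)

  evaluate-ξ : ∀ σ a f → evaluate σ (ξ a ∙ f) ≈ 0#
  evaluate-ξ σ = ev-ξ (coords (place σ)) (place σ)

  dual : Fin N → Fin N → Carrier
  dual c l = proj₁ (indicator∈Span (partition l)) c

  evaluate-dual : ∀ i l → sum (λ c → evaluate (partition i) (s c) * dual c l) ≈ δ i l
  evaluate-dual i l = trans (sum-cong λ c → *-comm _ _)
    (trans (proj₂ (indicator∈Span (partition l)) i) (reflexive (≡.cong (δ i) (index-partition l))))

  -- The matrix of values is square because the `s` c are indexed by the partitions. Its right
  -- inverse is therefore two-sided, and the functions of the `s` c form a basis.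
  dual-evaluate : ∀ c c′ → sum (λ i → dual c i * evaluate (partition i) (s c′)) ≈ δ c c′
  dual-evaluate = right-inverse⇒left-inverse local (λ i c → evaluate (partition i) (s c)) dual evaluate-dual

  opaque
    -- Coordinate of a function with respect to the functions σ ↦ evaluate σ (s c).
    coord : Fin N → (OP̃ n r → Carrier) → Carrier
    coord c F = sum λ i → dual c i * F (partition i)

    coord-cong : ∀ c {F G : OP̃ n r → Carrier} → (∀ σ → F σ ≈ G σ) → coord c F ≈ coord c G
    coord-cong c e = sum-cong λ i → *-congˡ (e (partition i))

    coord-+ : ∀ c (F G : OP̃ n r → Carrier) → coord c (λ σ → F σ + G σ) ≈ coord c F + coord c G
    coord-+ c F G = trans (sum-cong λ i → distribˡ _ _ _) (sum-+ _ _)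

    coord-* : ∀ c a (F : OP̃ n r → Carrier) → coord c (λ σ → a * F σ) ≈ a * coord c F
    coord-* c a F = trans (sum-cong λ i → x∙yz≈y∙xz _ a _) (sym (sum-*ˡ a _))

    coord-zero : ∀ c {F : OP̃ n r → Carrier} → (∀ σ → F σ ≈ 0#) → coord c F ≈ 0#
    coord-zero c z = sum-zero λ i → trans (*-congˡ (z (partition i))) (zeroʳ _)

    sum-coord : ∀ F σ → sum (λ c → coord c F * evaluate σ (s c)) ≈ F σ
    sum-coord F σ = begin
      sum (λ c → coord c F * evaluate σ (s c)) ≈⟨ sum-cong (λ c → trans (sum-*ʳ _ _) (sum-cong λ i → xy∙z≈zx∙y _ _ _)) ⟩
      sum (λ c → sum λ i → (evaluate σ (s c) * dual c i) * F (partition i)) ≈⟨ sum-swap _ ⟩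
      sum (λ i → sum λ c → (evaluate σ (s c) * dual c i) * F (partition i)) ≈⟨ sum-cong (λ i → sum-*ʳ (F (partition i)) _) ⟨
      sum (λ i → sum (λ c → evaluate σ (s c) * dual c i) * F (partition i))
        ≈⟨ sum-cong (λ i → *-congʳ (trans (reflexive (≡.cong (λ σ → sum λ c → evaluate σ (s c) * dual c i) (≡.sym (partition-index σ)))) (evaluate-dual (index σ) i))) ⟩
      sum (λ i → δ (index σ) i * F (partition i)) ≈⟨ sum-δˡ (index σ) (F ∘ partition) ⟩
      F (partition (index σ)) ≡⟨ ≡.cong F (partition-index σ) ⟩
      F σ ∎

    coord-combination : ∀ (u : Fin N → Carrier) c → coord c (λ σ → sum λ c′ → u c′ * evaluate σ (s c′)) ≈ u c
    coord-combination u c = begin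
      sum (λ i → dual c i * sum λ c′ → u c′ * evaluate (partition i) (s c′))
        ≈⟨ sum-cong (λ i → trans (sum-*ˡ _ _) (sum-cong λ c′ → x∙yz≈xz∙y _ _ _)) ⟩
      sum (λ i → sum λ c′ → (dual c i * evaluate (partition i) (s c′)) * u c′) ≈⟨ sum-swap _ ⟩
      sum (λ c′ → sum λ i → (dual c i * evaluate (partition i) (s c′)) * u c′) ≈⟨ sum-cong (λ c′ → trans (sym (sum-*ʳ (u c′) _)) (*-congʳ (dual-evaluate c c′))) ⟩
      sum (λ c′ → δ c c′ * u c′) ≈⟨ sum-δˡ c u ⟩
      u c ∎

  coord-below : ∀ {D F} c → D ℕ.≤ s-deg c → F ∈ SpanBelow D → coord c F ≈ 0#
  coord-below c le (u , z , f) = trans (coord-cong c f) (trans (coord-combination u c) (z c le))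

  -- The coordinates of the part of degree s-deg c.
  leading : Fin N → Ω → Carrier
  leading c = T λ m → ⟦ deg m ℕ.≟ s-deg c ⟧? * coord c (λ σ → evaluate σ (mono m))

  leading-hom : ∀ c {e f} → Hom e f → leading c f ≈ ⟦ e ℕ.≟ s-deg c ⟧? * coord c (λ σ → evaluate σ f)
  leading-hom c = hom-span S λ m → T-mono _ m where
    S : ℕ → Submodule Ω-module
    S e = record
      { _∈S = λ f → leading c f ≈ ⟦ e ℕ.≟ s-deg c ⟧? * coord c (λ σ → evaluate σ f)
      ; resp = λ eq q → trans (T-resp _ (symΩ eq)) (trans q (*-congˡ (coord-cong c λ σ → evaluate-resp σ eq)))
      ; 0∈ = trans (T-0 _) (sym (trans (*-congˡ (coord-zero c evaluate-0)) (zeroʳ _)))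
      ; +∈ = λ q q′ → trans (T-∔ _ _ _) (trans (+-cong q q′) (trans (sym (distribˡ _ _ _))
                 (*-congˡ (trans (sym (coord-+ c _ _)) (coord-cong c λ σ → sym (evaluate-∔ σ _ _))))))
      ; *∈ = λ a q → trans (T-κ _ a _) (trans (*-congˡ q) (trans (x∙yz≈y∙xz a _ _)
                 (*-congˡ (trans (sym (coord-* c a _)) (coord-cong c λ σ → sym (evaluate-κ σ a _))))))
      }

  hom-ypow : ∀ i a → Hom (a ℕ.* r) (ypow i a)
  hom-ypow i zero = hom-κ 1#
  hom-ypow i (suc a) = hom-∙ (hom-y i) (hom-ypow i a)

  leading-multiple : ∀ c g → (∀ m → leading c (g ∙ mono m) ≈ 0#) → ∀ h → leading c (g ∙ h) ≈ 0#
  leading-multiple c g = mono-span record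
    { _∈S = λ h → leading c (g ∙ h) ≈ 0#
    ; resp = λ e q → trans (T-resp _ (∙-cong₂ (symΩ e))) q
    ; 0∈ = trans (T-resp _ (∙-zeroʳ _)) (T-0 _)
    ; +∈ = λ q q′ → trans (T-resp _ (∙-distribˡ _ _ _)) (trans (T-∔ _ _ _) (trans (+-cong q q′) (+-identityˡ 0#)))
    ; *∈ = λ b q → trans (T-resp _ (pull-κ b _ _)) (trans (T-κ _ b _) (trans (*-congˡ q) (zeroʳ b)))
    }

  -- For a multiple of p a of degree e, `lowers` puts the evaluation into the span below e, where
  -- the coordinates with `s-deg` c = e vanish. Multiples of ξ a evaluate to 0.
  leading-gen : ∀ c {f} → Gen f → leading c f ≈ 0#
  leading-gen c (gen-p a h) = leading-multiple c (p a) on-mono h where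
    on-mono : ∀ m → leading c (p a ∙ mono m) ≈ 0#
    on-mono m = trans (leading-hom c (hom-∙ (hom-sum _ λ i → hom-ypow i (suc a)) (hom-mono m))) (cut (_ ℕ.≟ s-deg c)) where
      cut : (d : Dec (suc a ℕ.* r ℕ.+ deg m ≡ s-deg c)) → ⟦ d ⟧? * coord c (λ σ → evaluate σ (p a ∙ mono m)) ≈ 0#
      cut (no _) = zeroˡ _
      cut (yes e) = trans (*-congˡ (coord-below c (ℕ.≤-reflexive e)
        (lowers (SpanBelow _) _ (λ h lt → below-mono lt (evaluate∈ h)) a (hom-mono m) ≡.refl))) (zeroʳ _)
  leading-gen c (gen-ξ a h) = leading-multiple c (ξ a) on-mono h where
    hom-ξ : Hom (a ℕ.* r ℕ.+ (r′ ℕ.* 1 ℕ.+ 1)) (ξ a)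
    hom-ξ = hom-sum _ λ i → hom-∙ (hom-ypow i a) (hom-∙ (hom-xpow i r′) (hom-θ i))
    on-mono : ∀ m → leading c (ξ a ∙ mono m) ≈ 0#
    on-mono m = trans (leading-hom c (hom-∙ hom-ξ (hom-mono m))) (trans (*-congˡ (coord-zero c λ σ → evaluate-ξ σ a (mono m))) (zeroʳ _))
  leading-gen c gen-0 = T-0 _
  leading-gen c (gen-∔ q q′) = trans (T-∔ _ _ _) (trans (+-cong (leading-gen c q) (leading-gen c q′)) (+-identityˡ 0#))
  leading-gen c (gen-resp e q) = trans (T-resp _ (symΩ e)) (leading-gen c q)

  -- Averaging over the group

  -- A family of functionals which vanish on the generators and agree with ν · evaluate
  -- up to functionals of lower degree.
  record Reduction (ν : Carrier) (Φ : OP̃ n r → Ω → Carrier) : Set where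
    field
      Φ-resp : ∀ σ {f g} → f ≈Ω g → Φ σ f ≈ Φ σ g
      Φ-∔ : ∀ σ f g → Φ σ (f ∔ g) ≈ Φ σ f + Φ σ g
      Φ-κ : ∀ σ c f → Φ σ (κ c ∙ f) ≈ c * Φ σ f
      Φ-gen : ∀ σ {f} → Gen f → Φ σ f ≈ 0#
      Φ-top : ∀ {e f} → Hom e f → (λ σ → Φ σ f + - (ν * evaluate σ f)) ∈ SpanBelow e

  open Reduction

  opaque
    -- A multiple of p a has an evaluation of lower degree but not 0. Keeping the leading
    -- coordinates alone removes this defect.
    reduced : OP̃ n r → Ω → Carrier
    reduced σ f = sum λ c → leading c f * evaluate σ (s c)

    reduced-reduction : Reduction 1# reduced
    reduced-reduction = record
      { Φ-resp = λ σ e → sum-cong λ c → *-congʳ (T-resp _ e)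
      ; Φ-∔ = λ σ f g → trans (sum-cong λ c → trans (*-congʳ (T-∔ _ f g)) (distribʳ _ _ _)) (sum-+ _ _)
      ; Φ-κ = λ σ a f → trans (sum-cong λ c → trans (*-congʳ (T-κ _ a f)) (*-assoc _ _ _)) (sym (sum-*ˡ a _))
      ; Φ-gen = λ σ q → sum-zero λ c → trans (*-congʳ (leading-gen c q)) (zeroˡ _)
      ; Φ-top = λ {e} {f} h → (λ c → leading c f + - 1# * coord c (λ σ → evaluate σ f)) ,
          (λ c le → trans (+-congʳ (leading-hom c h)) (cut c le h (e ℕ.≟ s-deg c))) ,
          λ σ → trans (+-congˡ (trans (-‿cong (trans (*-identityˡ _) (sym (sum-coord (λ σ → evaluate σ f) σ))))
            (trans (solve 1 (λ x → :- x := (:- :1) :* x) refl _) (trans (sum-*ˡ _ _) (sum-cong λ c → sym (*-assoc _ _ _))))))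
            (trans (sym (sum-+ _ _)) (sum-cong λ c → sym (distribʳ _ _ _)))
      } where
      cut : ∀ c {e f} → e ℕ.≤ s-deg c → Hom e f → (d : Dec (e ≡ s-deg c)) →
        ⟦ d ⟧? * coord c (λ σ → evaluate σ f) + - 1# * coord c (λ σ → evaluate σ f) ≈ 0#
      cut c le h (yes _) = solve 1 (λ x → :1 :* x :+ (:- :1) :* x := :0) refl _
      cut c le h (no ≢) = trans (+-cong (zeroˡ _) (*-congˡ (coord-below c (ℕ.≤∧≢⇒< le ≢) (evaluate∈ h))))
        (solve 0 (:0 :+ (:- :1) :* :0 := :0) refl)

  zero-reduction : Reduction 0# (λ _ _ → 0#)
  zero-reduction = record
    { Φ-resp = λ _ _ → refl
    ; Φ-∔ = λ _ _ _ → sym (+-identityˡ 0#)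
    ; Φ-κ = λ _ c _ → sym (zeroʳ c)
    ; Φ-gen = λ _ _ → refl
    ; Φ-top = λ h → Sub.resp (SpanBelow _) (λ σ → solve 1 (λ x → :0 := :0 :+ :- (:0 :* x)) refl _) (Sub.0∈ (SpanBelow _))
    }

  sum-reduction : (ν : Fin k → Carrier) (Φ : Fin k → OP̃ n r → Ω → Carrier) → (∀ a → Reduction (ν a) (Φ a)) →
    Reduction (sum ν) (λ σ f → sum λ a → Φ a σ f)
  sum-reduction ν Φ R = record
    { Φ-resp = λ σ e → sum-cong λ a → Φ-resp (R a) σ e
    ; Φ-∔ = λ σ f g → trans (sum-cong λ a → Φ-∔ (R a) σ f g) (sum-+ _ _)
    ; Φ-κ = λ σ c f → trans (sum-cong λ a → Φ-κ (R a) σ c f) (sym (sum-*ˡ c _))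
    ; Φ-gen = λ σ q → sum-zero λ a → Φ-gen (R a) σ q
    ; Φ-top = λ {e} {f} h → Sub.resp (SpanBelow e)
        (λ σ → trans (sum-+ _ _) (+-congˡ (trans (sum-cong λ a → solve 2 (λ ν x → :- (ν :* x) := (:- :1) :* (ν :* x)) refl (ν a) (evaluate σ f))
          (trans (sym (sum-*ˡ _ _)) (trans (*-congˡ (sym (sum-*ʳ (evaluate σ f) ν))) (solve 1 (λ x → (:- :1) :* x := :- x) refl _))))))
        (sum∈Fun (SpanBelow e) _ λ a → Φ-top (R a) h)
    }

  sumⱽ-reduction : ∀ {k m} (ν : Vec (Fin k) m → Carrier) (Φ : Vec (Fin k) m → OP̃ n r → Ω → Carrier) →
    (∀ u → Reduction (ν u) (Φ u)) → Reduction (sumⱽ ν) (λ σ f → sumⱽ λ u → Φ u σ f)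
  sumⱽ-reduction {m = zero} ν Φ R = R []
  sumⱽ-reduction {m = suc m} ν Φ R = sum-reduction _ (λ a σ f → sumⱽ λ u → Φ (a ∷ u) σ f)
    λ a → sumⱽ-reduction (λ u → ν (a ∷ u)) (λ u → Φ (a ∷ u)) λ u → R (a ∷ u)

  -- A group element acting on the partitions by τ and on Ω by α. The factor by which it changes
  -- `evaluate` depends on the partition, and θ⁻¹ is its inverse.
  record Symmetry (τ : OP̃ n r → OP̃ n r) (α α⁻¹ : Ω → Ω) (θ⁻¹ : OP̃ n r → Carrier) : Set where
    field
      α-resp : ∀ {f g} → f ≈Ω g → α f ≈Ω α g
      α-∔ : ∀ f g → α (f ∔ g) ≈Ω α f ∔ α g
      α-κ : ∀ c f → α (κ c ∙ f) ≈Ω κ c ∙ α f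
      α-gen : ∀ {f} → Gen f → Gen (α f)
      α-hom : ∀ {d f} → Hom d f → Hom d (α f)
      α-inv : ∀ f → α (α⁻¹ f) ≈Ω f
      α⁻¹-hom : ∀ {d f} → Hom d f → Hom d (α⁻¹ f)
      α-evaluate : ∀ σ f → θ⁻¹ σ * evaluate (τ σ) (α f) ≈ evaluate σ f

  -- A symmetry preserves degrees and the ideal. It also preserves the spans below each degree: α⁻¹
  -- (s c) has the degree of s c, so `evaluate∈` applies to it.
  translate : ∀ {τ α α⁻¹ θ⁻¹} → Symmetry τ α α⁻¹ θ⁻¹ → ∀ {ν Φ} → Reduction ν Φ → Reduction ν (λ σ f → θ⁻¹ σ * Φ (τ σ) (α f))
  translate {τ} {α} {α⁻¹} {θ⁻¹} S {ν} {Φ} R = record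
    { Φ-resp = λ σ e → *-congˡ (Φ-resp R (τ σ) (α-resp e))
    ; Φ-∔ = λ σ f g → trans (*-congˡ (trans (Φ-resp R (τ σ) (α-∔ f g)) (Φ-∔ R (τ σ) _ _))) (distribˡ _ _ _)
    ; Φ-κ = λ σ c f → trans (*-congˡ (trans (Φ-resp R (τ σ) (α-κ c f)) (Φ-κ R (τ σ) c _)))
                 (x∙yz≈y∙xz _ c _)
    ; Φ-gen = λ σ q → trans (*-congˡ (Φ-gen R (τ σ) (α-gen q))) (zeroʳ _)
    ; Φ-top = λ {e} {f} h → Sub.resp (SpanBelow e)
        (λ σ → trans (solve 4 (λ t φ ν x → t :* (φ :+ :- (ν :* x)) := t :* φ :+ :- (ν :* (t :* x))) refl (θ⁻¹ σ) _ ν (evaluate (τ σ) (α f)))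
          (+-congˡ (-‿cong (*-congˡ (α-evaluate σ f)))))
        (stable e (Φ-top R (α-hom h)))
    } where
    open Symmetry S
    stable : ∀ e {F} → F ∈ SpanBelow e → (λ σ → θ⁻¹ σ * F (τ σ)) ∈ SpanBelow e
    stable e {F} (u , z , f) = Sub.resp (SpanBelow e) (λ σ → sym (begin
      θ⁻¹ σ * F (τ σ) ≈⟨ *-congˡ (f (τ σ)) ⟩
      θ⁻¹ σ * sum (λ c → u c * evaluate (τ σ) (s c)) ≈⟨ trans (sum-*ˡ _ _) (sum-cong λ c → x∙yz≈y∙xz (θ⁻¹ σ) (u c) _) ⟩
      sum (λ c → u c * (θ⁻¹ σ * evaluate (τ σ) (s c))) ≈⟨ sum-cong (λ c → *-congˡ (trans (*-congˡ (evaluate-resp (τ σ) (symΩ (α-inv (s c))))) (α-evaluate σ (α⁻¹ (s c))))) ⟩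
      sum (λ c → u c * evaluate σ (α⁻¹ (s c))) ∎))
      (sum∈Fun (SpanBelow e) (λ c σ → u c * evaluate σ (α⁻¹ (s c))) λ c → term c (s-deg c ℕ.<? e)) where
      term : ∀ c → Dec (s-deg c ℕ.< e) → (λ σ → u c * evaluate σ (α⁻¹ (s c))) ∈ SpanBelow e
      term c (yes lt) = Sub.*∈ (SpanBelow e) (u c) (below-mono lt (evaluate∈ (α⁻¹-hom (hom-s c))))
      term c (no ≮) = Sub.resp (SpanBelow e) (λ σ → sym (trans (*-congʳ (z c (ℕ.≮⇒≥ ≮))) (zeroˡ _))) (Sub.0∈ (SpanBelow e))

  permAct-ypow : ∀ w i a → permAct w (ypow i a) ≡ ypow (w ⟨$⟩ʳ i) a
  permAct-ypow w i zero = ≡.refl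
  permAct-ypow w i (suc a) = ≡.cong₂ _∙_ (substitute-xpow w i r) (permAct-ypow w i a)

  permAct-p : ∀ w a → permAct w (p a) ≈Ω p a
  permAct-p w a = transΩ (sumᴹ-linear (permAct w) (permAct-linear w) _)
    (transΩ (sumᴹ-cong λ i → reflexiveΩ (permAct-ypow w i (suc a))) (symΩ (sumᴹ-permute (λ i → ypow i (suc a)) w)))

  permAct-ξ : ∀ w a → permAct w (ξ a) ≈Ω ξ a
  permAct-ξ w a = transΩ (sumᴹ-linear (permAct w) (permAct-linear w) _)
    (transΩ (sumᴹ-cong λ i → reflexiveΩ (≡.cong₂ _∙_ (permAct-ypow w i a) (permAct-dy w i))) (symΩ (sumᴹ-permute (λ i → ypow i a ∙ dy i) w)))

  diagAct-ypow : ∀ c i a → diagAct c (ypow i a) ≈Ω ypow i a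
  diagAct-ypow c i zero = reflΩ
  diagAct-ypow c i (suc a) = ∙-cong (transΩ (diagAct-xpow c i r) (transΩ (∙-cong₁ (κ-cong (ζ⁻^r (c i)))) (∙-idˡ _))) (diagAct-ypow c i a)

  diagAct-p : ∀ c a → diagAct c (p a) ≈Ω p a
  diagAct-p c a = transΩ (sumᴹ-linear (diagAct c) (diagAct-linear c) _) (sumᴹ-cong λ i → diagAct-ypow c i (suc a))

  diagAct-ξ : ∀ c a → diagAct c (ξ a) ≈Ω ξ a
  diagAct-ξ c a = transΩ (sumᴹ-linear (diagAct c) (diagAct-linear c) _) (sumᴹ-cong λ i → ∙-cong (diagAct-ypow c i a) (diagAct-dy c i))

  permAct-gen : ∀ w {f} → Gen f → Gen (permAct w f)
  permAct-gen w (gen-p a h) = gen-resp (∙-cong₁ (symΩ (permAct-p w a))) (gen-p a _)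
  permAct-gen w (gen-ξ a h) = gen-resp (∙-cong₁ (symΩ (permAct-ξ w a))) (gen-ξ a _)
  permAct-gen w gen-0 = gen-0
  permAct-gen w (gen-∔ q q′) = gen-∔ (permAct-gen w q) (permAct-gen w q′)
  permAct-gen w (gen-resp e q) = gen-resp (permAct-cong w e) (permAct-gen w q)

  diagAct-gen : ∀ c {f} → Gen f → Gen (diagAct c f)
  diagAct-gen c (gen-p a h) = gen-resp (∙-cong₁ (symΩ (diagAct-p c a))) (gen-p a _)
  diagAct-gen c (gen-ξ a h) = gen-resp (∙-cong₁ (symΩ (diagAct-ξ c a))) (gen-ξ a _)
  diagAct-gen c gen-0 = gen-0
  diagAct-gen c (gen-∔ q q′) = gen-∔ (diagAct-gen c q) (diagAct-gen c q′)
  diagAct-gen c (gen-resp e q) = gen-resp (diagAct-cong c e) (diagAct-gen c q)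

  permAct-hom : ∀ w {d f} → Hom d f → Hom d (permAct w f)
  permAct-hom w (hom-κ c) = hom-κ c
  permAct-hom w (hom-0 d) = hom-0 d
  permAct-hom w (hom-x i) = hom-x _
  permAct-hom w (hom-θ i) = hom-θ _
  permAct-hom w (hom-∔ h h′) = hom-∔ (permAct-hom w h) (permAct-hom w h′)
  permAct-hom w (hom-∙ h h′) = hom-∙ (permAct-hom w h) (permAct-hom w h′)
  permAct-hom w (hom-resp e h) = hom-resp (permAct-cong w e) (permAct-hom w h)

  diagAct-hom : ∀ c {d f} → Hom d f → Hom d (diagAct c f)
  diagAct-hom c (hom-κ a) = hom-κ a
  diagAct-hom c (hom-0 d) = hom-0 d
  diagAct-hom c (hom-x i) = hom-∙ (hom-κ _) (hom-x i)
  diagAct-hom c (hom-θ i) = hom-∙ (hom-κ _) (hom-θ i)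
  diagAct-hom c (hom-∔ h h′) = hom-∔ (diagAct-hom c h) (diagAct-hom c h′)
  diagAct-hom c (hom-∙ h h′) = hom-∙ (diagAct-hom c h) (diagAct-hom c h′)
  diagAct-hom c (hom-resp e h) = hom-resp (diagAct-cong c e) (diagAct-hom c h)

  infixl 6 _⊕_
  _⊕_ : Fin r → Fin r → Fin r
  a ⊕ b = (toℕ a ℕ.+ toℕ b) ℕ.mod r

  ⊖_ : Fin r → Fin r
  ⊖ a = (r ℕ.∸ toℕ a) ℕ.mod r

  mod-≡ : ∀ a b → a % r ≡ b % r → a ℕ.mod r ≡ b ℕ.mod r
  mod-≡ a b e = Fin.toℕ-injective (≡.trans (toℕ-mod a) (≡.trans e (≡.sym (toℕ-mod b))))

  %-+ˡ : ∀ a b → (a % r ℕ.+ b) % r ≡ (a ℕ.+ b) % r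
  %-+ˡ a b = ≡.trans (ℕ.%-distribˡ-+ (a % r) b r) (≡.trans (≡.cong (λ a → (a ℕ.+ b % r) % r) (ℕ.m%n%n≡m%n a r)) (≡.sym (ℕ.%-distribˡ-+ a b r)))

  %-+ʳ : ∀ a b → (a ℕ.+ b % r) % r ≡ (a ℕ.+ b) % r
  %-+ʳ a b = ≡.trans (≡.cong (_% r) (ℕ.+-comm a (b % r))) (≡.trans (%-+ˡ b a) (≡.cong (_% r) (ℕ.+-comm b a)))

  ⊕-assoc : ∀ a b c → a ⊕ b ⊕ c ≡ a ⊕ (b ⊕ c)
  ⊕-assoc a b c = mod-≡ (toℕ (a ⊕ b) ℕ.+ toℕ c) (toℕ a ℕ.+ toℕ (b ⊕ c)) (≡.trans (≡.cong (λ m → (m ℕ.+ toℕ c) % r) (toℕ-mod (toℕ a ℕ.+ toℕ b)))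
    (≡.trans (%-+ˡ (toℕ a ℕ.+ toℕ b) (toℕ c)) (≡.trans (≡.cong (_% r) (ℕ.+-assoc (toℕ a) (toℕ b) (toℕ c)))
      (≡.sym (≡.trans (≡.cong (λ m → (toℕ a ℕ.+ m) % r) (toℕ-mod (toℕ b ℕ.+ toℕ c))) (%-+ʳ (toℕ a) (toℕ b ℕ.+ toℕ c)))))))

  ⊕-comm : ∀ a b → a ⊕ b ≡ b ⊕ a
  ⊕-comm a b = ≡.cong (ℕ._mod r) (ℕ.+-comm (toℕ a) (toℕ b))

  ⊕-identityʳ : ∀ a → a ⊕ zero ≡ a
  ⊕-identityʳ a = Fin.toℕ-injective (≡.trans (toℕ-mod (toℕ a ℕ.+ 0)) (≡.trans (≡.cong (_% r) (ℕ.+-identityʳ (toℕ a))) (ℕ.m<n⇒m%n≡m (Fin.toℕ<n a))))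

  ⊖-inverse : ∀ a → a ⊕ ⊖ a ≡ zero
  ⊖-inverse a = Fin.toℕ-injective (≡.trans (toℕ-mod (toℕ a ℕ.+ toℕ (⊖ a))) (≡.trans (≡.cong (λ m → (toℕ a ℕ.+ m) % r) (toℕ-mod (r ℕ.∸ toℕ a)))
    (≡.trans (%-+ʳ (toℕ a) (r ℕ.∸ toℕ a)) (≡.trans (≡.cong (_% r) (ℕ.m+[n∸m]≡n (ℕ.<⇒≤ (Fin.toℕ<n a)))) (ℕ.n%n≡0 r)))))

  translation : Fin r → Permutation′ r
  translation d = permutation (_⊕ d) (_⊕ ⊖ d)
    (λ a → ≡.trans (⊕-assoc a (⊖ d) d) (≡.trans (≡.cong (a ⊕_) (≡.trans (⊕-comm (⊖ d) d) (⊖-inverse d))) (⊕-identityʳ a)))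
    (λ a → ≡.trans (⊕-assoc a d (⊖ d)) (≡.trans (≡.cong (a ⊕_) (⊖-inverse d)) (⊕-identityʳ a)))

  ζ-⊕ : ∀ a b → ζ ^ toℕ (a ⊕ b) ≈ ζ ^ toℕ a * ζ ^ toℕ b
  ζ-⊕ a b = trans (^-congʳ ζ (toℕ-mod (toℕ a ℕ.+ toℕ b))) (trans (ζ-mod (toℕ a ℕ.+ toℕ b)) (^-homo-* ζ (toℕ a) (toℕ b)))

  inverse-product : ∀ {a b e a⁻ e⁻} → a * b ≈ e → a * a⁻ ≈ 1# → e * e⁻ ≈ 1# → a⁻ ≈ b * e⁻
  inverse-product {a} {b} {e} {a⁻} {e⁻} ab aa ee = begin
    a⁻ ≈⟨ trans (sym (*-identityʳ _)) (*-congˡ (sym ee)) ⟩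
    a⁻ * (e * e⁻) ≈⟨ *-congˡ (*-congʳ ab) ⟨
    a⁻ * ((a * b) * e⁻) ≈⟨ solve 4 (λ a⁻ a b e⁻ → a⁻ :* ((a :* b) :* e⁻) := (a :* a⁻) :* (b :* e⁻)) refl a⁻ a b e⁻ ⟩
    (a * a⁻) * (b * e⁻) ≈⟨ trans (*-congʳ aa) (*-identityˡ _) ⟩
    b * e⁻ ∎

  ζ⁻-⊕ : ∀ a b → ζ⁻ a * ζ⁻ b ≈ ζ⁻ (a ⊕ b)
  ζ⁻-⊕ a b = sym (trans (sym (*-identityʳ _)) (trans (*-congˡ (sym (trans (*-cong (ζ⁻-inverse a) (ζ⁻-inverse b)) (*-identityˡ 1#))))
    (trans (solve 5 (λ e a a′ b b′ → e :* ((a :* a′) :* (b :* b′)) := (a :* b) :* (e :* (a′ :* b′))) refl (ζ⁻ (a ⊕ b)) (ζ⁻ a) (ζ ^ toℕ a) (ζ⁻ b) (ζ ^ toℕ b))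
      (trans (*-congˡ (trans (*-congˡ (sym (ζ-⊕ a b))) (ζ⁻-inverse (a ⊕ b)))) (*-identityʳ _)))))

  diagAct-∘ : ∀ c d f → diagAct c (diagAct d f) ≈Ω diagAct (λ i → c i ⊕ d i) f
  diagAct-∘ c d (κ a) = reflΩ
  diagAct-∘ c d (x i) = transΩ (κκ _ _ _) (∙-cong₁ (κ-cong (trans (*-comm _ _) (ζ⁻-⊕ (c i) (d i)))))
  diagAct-∘ c d (θ i) = transΩ (κκ _ _ _) (∙-cong₁ (κ-cong (trans (*-comm _ _) (ζ⁻-⊕ (c i) (d i)))))
  diagAct-∘ c d (f ∔ g) = ∔-cong (diagAct-∘ c d f) (diagAct-∘ c d g)
  diagAct-∘ c d (f ∙ g) = ∙-cong (diagAct-∘ c d f) (diagAct-∘ c d g)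

  diagAct-pointwise : ∀ {c d : Fin n → Fin r} → (∀ i → c i ≡ d i) → ∀ f → diagAct c f ≡ diagAct d f
  diagAct-pointwise e (κ a) = ≡.refl
  diagAct-pointwise e (x i) = ≡.cong (λ c → κ (ζ⁻ c) ∙ x i) (e i)
  diagAct-pointwise e (θ i) = ≡.cong (λ c → κ (ζ⁻ c) ∙ θ i) (e i)
  diagAct-pointwise e (f ∔ g) = ≡.cong₂ _∔_ (diagAct-pointwise e f) (diagAct-pointwise e g)
  diagAct-pointwise e (f ∙ g) = ≡.cong₂ _∙_ (diagAct-pointwise e f) (diagAct-pointwise e g)

  diagAct-inverse : ∀ c f → diagAct c (diagAct (λ i → ⊖ c i) f) ≈Ω f
  diagAct-inverse c f = transΩ (diagAct-∘ c _ f) (transΩ (reflexiveΩ (diagAct-pointwise (λ i → ⊖-inverse (c i)) f)) (diagAct-trivial f))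

  permAct-inverse : ∀ w f → permAct w (permAct (flip w) f) ≡ f
  permAct-inverse w f = ≡.trans (permAct-∘ w (flip w) f) (≡.trans (permAct-pointwise {flip w ∘ₚ w} {Perm.id} (λ i → Perm.inverseʳ w) f) (permAct-id f))

  unit-^ : ∀ a → Unit (ζ ^ a)
  unit-^ a = (ζ ^ a) ^ r′ , ζ^r a

  weight-unit : ∀ c (p : Place r q) → Unit (weight c p)
  weight-unit c (inj₁ k) = unit-^ (toℕ k ℕ.* toℕ c)
  weight-unit c (inj₂ _) = unit-1

  opaque
    factor-unit : (c : Fin k → Fin r) (v : Vec (Place r q) k) → Unit (factor c v)
    factor-unit c v = unit-product _ λ i → unit-* (unit-^ (toℕ (c i))) (weight-unit (c i) (lookup v i))

  weight-⊕ : ∀ c d (p : Place r q) → weight c (recolourPlace d p) * weight d p ≈ weight (c ⊕ d) p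
  weight-⊕ c d (inj₂ _) = *-identityˡ 1#
  weight-⊕ c d (inj₁ k) = begin
    ζ ^ (toℕ k ℕ.* toℕ c) * ζ ^ (toℕ k ℕ.* toℕ d) ≈⟨ *-cong (power c) (power d) ⟩
    (ζ ^ toℕ c) ^ toℕ k * (ζ ^ toℕ d) ^ toℕ k ≈⟨ ^-distrib-* (ζ ^ toℕ c) (ζ ^ toℕ d) (toℕ k) ⟨
    (ζ ^ toℕ c * ζ ^ toℕ d) ^ toℕ k ≈⟨ ^-congˡ (toℕ k) (ζ-⊕ c d) ⟨
    (ζ ^ toℕ (c ⊕ d)) ^ toℕ k ≈⟨ power (c ⊕ d) ⟨
    ζ ^ (toℕ k ℕ.* toℕ (c ⊕ d)) ∎ where
    power : ∀ c → ζ ^ (toℕ k ℕ.* toℕ c) ≈ (ζ ^ toℕ c) ^ toℕ k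
    power c = trans (^-congʳ ζ (ℕ.*-comm (toℕ k) (toℕ c))) (sym (^-assocʳ ζ (toℕ c) (toℕ k)))

  factor-⊕ : (c d : Fin k → Fin r) (v : Vec (Place r q) k) →
    factor c (recolourPlaces d v) * factor d v ≈ factor (λ i → c i ⊕ d i) v
  factor-⊕ c d v = trans (sym (Π.∑-distrib-+ (λ i → ζ ^ toℕ (c i) * weight (c i) (lookup (recolourPlaces d v) i)) (λ i → ζ ^ toℕ (d i) * weight (d i) (lookup v i))))
    (Π.sum-cong-≋ λ i → begin
      (ζ ^ toℕ (c i) * weight (c i) (lookup (recolourPlaces d v) i)) * (ζ ^ toℕ (d i) * weight (d i) (lookup v i))
        ≡⟨ ≡.cong (λ p → (ζ ^ toℕ (c i) * weight (c i) p) * (ζ ^ toℕ (d i) * weight (d i) (lookup v i))) (Vec.lookup∘tabulate _ i) ⟩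
      (ζ ^ toℕ (c i) * weight (c i) (recolourPlace (d i) (lookup v i))) * (ζ ^ toℕ (d i) * weight (d i) (lookup v i))
        ≈⟨ interchange _ _ _ _ ⟩
      (ζ ^ toℕ (c i) * ζ ^ toℕ (d i)) * (weight (c i) (recolourPlace (d i) (lookup v i)) * weight (d i) (lookup v i))
        ≈⟨ *-cong (sym (ζ-⊕ (c i) (d i))) (weight-⊕ (c i) (d i) (lookup v i)) ⟩
      ζ ^ toℕ (c i ⊕ d i) * weight (c i ⊕ d i) (lookup v i) ∎)

  factor-permute : ∀ w c (v : Vec (Place r q) n) → factor (λ i → c (w ⟨$⟩ˡ i)) (permutePlaces w v) ≈ factor c v
  factor-permute w c v = trans (Π.sum-cong-≋ λ i → reflexive (≡.cong (λ p → ζ ^ toℕ (c (w ⟨$⟩ˡ i)) * weight (c (w ⟨$⟩ˡ i)) p) (Vec.lookup∘tabulate _ i)))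
    (sym (Π.sum-permute (λ i → ζ ^ toℕ (c i) * weight (c i) (lookup v i)) (flip w)))

  recolourPlace-⊕ : ∀ c d (p : Place r q) → recolourPlace c (recolourPlace d p) ≡ recolourPlace (c ⊕ d) p
  recolourPlace-⊕ c d (inj₁ k) = ≡.refl
  recolourPlace-⊕ c d (inj₂ (j , k)) = ≡.cong (λ k → inj₂ (j , k)) (≡.trans (⊕-assoc k d c) (≡.cong (k ⊕_) (⊕-comm d c)))

  recolourPlaces-⊕ : ∀ c d (v : Vec (Place r q) n) → recolourPlaces c (recolourPlaces d v) ≡ recolourPlaces (λ i → c i ⊕ d i) v
  recolourPlaces-⊕ c d v = Vec.tabulate-cong λ i → ≡.trans (≡.cong (recolourPlace (c i)) (Vec.lookup∘tabulate _ i)) (recolourPlace-⊕ (c i) (d i) (lookup v i))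

  sizes-recolour : ∀ c (v : Vec (Place r q) n) → sizes (recolourPlaces c v) ≡ sizes v
  sizes-recolour c v = Vec.tabulate-cong λ b → ℕΣ.sum-cong-≋ λ i → ≡.trans (≡.cong (occupies b) (Vec.lookup∘tabulate _ i)) (occupies-recolour b (c i) (lookup v i))
    where
    occupies-recolour : ∀ (b : Fin q) d p → occupies b (recolourPlace d p) ≡ occupies b p
    occupies-recolour b d (inj₁ _) = ≡.refl
    occupies-recolour b d (inj₂ _) = ≡.refl

  sizes-permute : ∀ w (v : Vec (Place r q) n) → sizes (permutePlaces w v) ≡ sizes v
  sizes-permute w v = Vec.tabulate-cong λ b → ≡.trans (ℕΣ.sum-cong-≋ λ i → ≡.cong (occupies b) (Vec.lookup∘tabulate (λ b → lookup v (w ⟨$⟩ˡ b)) i))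
    (≡.sym (ℕΣ.sum-permute (λ i → occupies b (lookup v i)) (flip w)))

  evaluate-recolour : ∀ c σ f → evaluate (recolour c σ) (diagAct c f) ≈ factor c (place σ) * evaluate σ f
  evaluate-recolour c (mkOP̃ q v ne) f = trans (reflexive (≡.cong (λ w → ev (point w) (recolourPlaces c v) (diagAct c f)) (sizes-recolour c v)))
    (ev-diag (coords v) c v f)

  evaluate-permute : ∀ w σ f → evaluate (permute w σ) (permAct w f) ≈ sgn w * evaluate σ f
  evaluate-permute w (mkOP̃ q v ne) f = trans (reflexive (≡.cong (λ s → ev (point s) (permutePlaces w v) (permAct w f)) (sizes-permute w v)))
    (ev-perm (coords v) w v f)

  diagonal-symmetry : ∀ c → Symmetry (recolour c) (diagAct c) (diagAct (λ i → ⊖ c i)) (λ σ → proj₁ (factor-unit c (place σ)))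
  diagonal-symmetry c = record
    { α-resp = diagAct-cong c ; α-∔ = λ _ _ → reflΩ ; α-κ = λ _ _ → reflΩ ; α-gen = diagAct-gen c ; α-hom = diagAct-hom c
    ; α-inv = diagAct-inverse c ; α⁻¹-hom = diagAct-hom (λ i → ⊖ c i)
    ; α-evaluate = λ σ f → trans (*-congˡ (evaluate-recolour c σ f)) (trans (sym (*-assoc _ _ _))
        (trans (*-congʳ (trans (*-comm _ _) (proj₂ (factor-unit c (place σ))))) (*-identityˡ _)))
    }

  permutation-symmetry : ∀ w → Symmetry (permute w) (permAct w) (permAct (flip w)) (λ σ → sgn w)
  permutation-symmetry w = record
    { α-resp = permAct-cong w ; α-∔ = λ _ _ → reflΩ ; α-κ = λ _ _ → reflΩ ; α-gen = permAct-gen w ; α-hom = permAct-hom w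
    ; α-inv = λ f → reflexiveΩ (permAct-inverse w f) ; α⁻¹-hom = permAct-hom (flip w)
    ; α-evaluate = λ σ f → trans (*-congˡ (evaluate-permute w σ f)) (trans (sym (*-assoc _ _ _)) (trans (*-congʳ (sgn² w)) (*-identityˡ _)))
    }

  permuteAll : ∀ {k m} → (Fin m → Permutation′ k) → Vec (Fin k) m → Vec (Fin k) m
  permuteAll π [] = []
  permuteAll π (a ∷ u) = (π zero ⟨$⟩ʳ a) ∷ permuteAll (π ∘ suc) u

  lookup-permuteAll : ∀ {k m} (π : Fin m → Permutation′ k) u i → lookup (permuteAll π u) i ≡ π i ⟨$⟩ʳ lookup u i
  lookup-permuteAll π (a ∷ u) zero = ≡.refl
  lookup-permuteAll π (a ∷ u) (suc i) = lookup-permuteAll (π ∘ suc) u i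

  sumⱽ-permute : ∀ {k m} (π : Fin m → Permutation′ k) (F : Vec (Fin k) m → Carrier) → sumⱽ (λ u → F (permuteAll π u)) ≈ sumⱽ F
  sumⱽ-permute {m = zero} π F = refl
  sumⱽ-permute {m = suc m} π F = trans (sum-cong λ a → sumⱽ-permute (π ∘ suc) λ u → F ((π zero ⟨$⟩ʳ a) ∷ u))
    (sym (sum-permute (λ a → sumⱽ λ u → F (a ∷ u)) (π zero)))

  diagonalTerm : (Fin n → Fin r) → OP̃ n r → Ω → Carrier
  diagonalTerm c σ f = proj₁ (factor-unit c (place σ)) * reduced (recolour c σ) (diagAct c f)

  averaged₁ : OP̃ n r → Ω → Carrier
  averaged₁ σ f = sumⱽ λ u → diagonalTerm (lookup u) σ f

  ν₁ : Carrier
  ν₁ = sumⱽ {r} {n} λ _ → 1#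

  averaged₁-reduction : Reduction ν₁ averaged₁
  averaged₁-reduction = sumⱽ-reduction (λ _ → 1#) (λ u → diagonalTerm (lookup u)) λ u → translate (diagonal-symmetry (lookup u)) reduced-reduction

  diagonalTerm-recolour : ∀ c d e σ f → (∀ i → e i ≡ c i ⊕ d i) →
    diagonalTerm c (recolour d σ) (diagAct d f) ≈ factor d (place σ) * diagonalTerm e σ f
  diagonalTerm-recolour c d e σ@(mkOP̃ q v ne) f e≡ = trans (*-cong
      (inverse-product (trans (factor-⊕ c d v) (Π.sum-cong-≋ λ i → reflexive (≡.cong (λ c → ζ ^ toℕ c * weight c (lookup v i)) (≡.sym (e≡ i)))))
        (proj₂ (factor-unit c (recolourPlaces d v))) (proj₂ (factor-unit e v)))
      (trans (Φ-resp reduced-reduction (recolour c (recolour d σ)) (transΩ (diagAct-∘ c d f) (reflexiveΩ (diagAct-pointwise (≡.sym ∘ e≡) f))))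
        (reflexive (≡.cong (λ σ → reduced σ (diagAct e f)) (op̃-≡ (≡.trans (recolourPlaces-⊕ c d v)
          (Vec.tabulate-cong λ i → ≡.cong (λ c → recolourPlace c (lookup v i)) (≡.sym (e≡ i)))))))))
    (*-assoc _ _ _)

  -- The summation variable is shifted by d, and `factor-⊕` accounts for the change of the factors.
  averaged₁-recolour : ∀ d σ f → averaged₁ (recolour d σ) (diagAct d f) ≈ factor d (place σ) * averaged₁ σ f
  averaged₁-recolour d σ f = begin
    sumⱽ (λ u → diagonalTerm (lookup u) (recolour d σ) (diagAct d f))
      ≈⟨ sumⱽ-cong (λ u → diagonalTerm-recolour (lookup u) d (lookup (permuteAll (translation ∘ d) u)) σ f (lookup-permuteAll (translation ∘ d) u)) ⟩
    sumⱽ (λ u → factor d (place σ) * diagonalTerm (lookup (permuteAll (translation ∘ d) u)) σ f)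
      ≈⟨ sumⱽ-*ˡ (factor d (place σ)) (λ u → diagonalTerm (lookup (permuteAll (translation ∘ d) u)) σ f) ⟨
    factor d (place σ) * sumⱽ (λ u → diagonalTerm (lookup (permuteAll (translation ∘ d) u)) σ f)
      ≈⟨ *-congˡ (sumⱽ-permute (translation ∘ d) (λ u → diagonalTerm (lookup u) σ f)) ⟩
    factor d (place σ) * averaged₁ σ f ∎

  Injective : Vec (Fin n) n → Set
  Injective v = ∀ i j → lookup v i ≡ lookup v j → i ≡ j

  injective? : ∀ v → Dec (Injective v)
  injective? v = Fin.all? λ i → Fin.all? λ j → (lookup v i Fin.≟ lookup v j) →-dec (i Fin.≟ j)

  opaque
    -- The vector lists the inverse of the permutation, so that replacing w by w preceded by h
    -- amounts to applying h⁻¹ to every entry.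
    fromInjective : ∀ v → Injective v → Permutation′ n
    fromInjective v inj = permutation (λ j → proj₁ (hit j)) (lookup v)
      (λ i → inj _ _ (proj₂ (hit (lookup v i)))) (λ j → proj₂ (hit j)) where
      hit : ∀ j → ∃ λ i → lookup v i ≡ j
      hit = injective⇒surjective (lookup v) (λ {i} {j} → inj i j)

    fromInjective-inverse : ∀ v inj i → fromInjective v inj ⟨$⟩ˡ i ≡ lookup v i
    fromInjective-inverse v inj i = ≡.refl

  permutationTerm : Permutation′ n → OP̃ n r → Ω → Carrier
  permutationTerm w σ f = sgn w * averaged₁ (permute w σ) (permAct w f)

  vectorTerm : ∀ v → Dec (Injective v) → OP̃ n r → Ω → Carrier
  vectorTerm v (yes inj) = permutationTerm (fromInjective v inj)
  -- The average over permutations is a sum over all vectors, in which those that are not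
  -- permutations contribute 0.
  vectorTerm v (no _) = λ _ _ → 0#

  averaged : OP̃ n r → Ω → Carrier
  averaged σ f = sumⱽ λ v → vectorTerm v (injective? v) σ f

  rescale : ∀ {ν ν′ Φ} → ν ≈ ν′ → Reduction ν Φ → Reduction ν′ Φ
  rescale e R = record
    { Φ-resp = Φ-resp R ; Φ-∔ = Φ-∔ R ; Φ-κ = Φ-κ R ; Φ-gen = Φ-gen R
    ; Φ-top = λ h → Sub.resp (SpanBelow _) (λ σ → +-congˡ (-‿cong (*-congʳ e))) (Φ-top R h)
    }

  ν : Carrier
  ν = sumⱽ λ v → ν₁ * ⟦ injective? v ⟧?

  vectorTerm-reduction : ∀ v d → Reduction (ν₁ * ⟦ d ⟧?) (vectorTerm v d)
  vectorTerm-reduction v (yes inj) = rescale (sym (*-identityʳ ν₁)) (translate (permutation-symmetry (fromInjective v inj)) averaged₁-reduction)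
  vectorTerm-reduction v (no _) = rescale (sym (zeroʳ ν₁)) zero-reduction

  averaged-reduction : Reduction ν averaged
  averaged-reduction = sumⱽ-reduction (λ v → ν₁ * ⟦ injective? v ⟧?) (λ v → vectorTerm v (injective? v)) λ v → vectorTerm-reduction v (injective? v)

  -- For the invertibility of ν, the order of the group, it is enough that a number of solutions is
  -- a positive natural number.
  sumⱽ-count : ∀ {k m} {P : Vec (Fin k) m → Set} (P? : ∀ u → Dec (P u)) →
    ∃ λ c → sumⱽ (λ u → ⟦ P? u ⟧?) ≈ fromℕ c × (∀ u → P u → 0 ℕ.< c)
  sumⱽ-count {m = zero} P? with P? []
  ... | yes p = 1 , sym (+-identityʳ 1#) , λ { [] _ → s≤s z≤n }
  ... | no ¬p = 0 , refl , λ { [] p → contradiction p ¬p }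
  sumⱽ-count {k} {suc m} {P} P? = ℕΣ.sum count ,
    trans (sum-cong λ a → proj₁ (proj₂ (ih a))) (sym (fromℕ-sum count)) ,
    λ { (a ∷ u) p → ℕ.<-≤-trans (proj₂ (proj₂ (ih a)) u p) (term≤sum count a) } where
    ih : ∀ a → ∃ λ c → sumⱽ (λ u → ⟦ P? (a ∷ u) ⟧?) ≈ fromℕ c × (∀ u → P (a ∷ u) → 0 ℕ.< c)
    ih a = sumⱽ-count λ u → P? (a ∷ u)
    count : Fin k → ℕ
    count a = proj₁ (ih a)
    term≤sum : ∀ {k} (f : Fin k → ℕ) a → f a ℕ.≤ ℕΣ.sum f
    term≤sum f zero = ℕ.m≤m+n _ _
    term≤sum f (suc a) = ℕ.≤-trans (term≤sum (f ∘ suc) a) (ℕ.m≤n+m _ _)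

  count-unit : ∀ {k m} {P : Vec (Fin k) m → Set} (P? : ∀ u → Dec (P u)) u → P u → Unit (sumⱽ λ u → ⟦ P? u ⟧?)
  count-unit P? u p with sumⱽ-count P?
  ... | zero , e , pos = contradiction (pos u p) λ ()
  ... | suc c , e , _ = unit-cong (sym e) (fromℕ-unit c)

  ν-unit : Unit ν
  ν-unit = unit-cong (sumⱽ-*ˡ ν₁ λ v → ⟦ injective? v ⟧?)
    (unit-* (count-unit {r} {n} (λ _ → yes tt) (Vec.replicate n zero) tt)
      (count-unit injective? (tabulate id) λ i j e → ≡.trans (≡.sym (Vec.lookup∘tabulate id i)) (≡.trans e (Vec.lookup∘tabulate id j))))

  permute-∘ : ∀ w h w′ (σ : OP̃ n r) → (∀ i → w′ ⟨$⟩ˡ i ≡ h ⟨$⟩ˡ (w ⟨$⟩ˡ i)) → permute w (permute h σ) ≡ permute w′ σ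
  permute-∘ w h w′ (mkOP̃ q v ne) e = op̃-≡ (Vec.tabulate-cong λ b → ≡.trans (Vec.lookup∘tabulate _ (w ⟨$⟩ˡ b)) (≡.cong (lookup v) (≡.sym (e b))))

  permutationTerm-∘ : ∀ w h w′ σ f → (∀ i → w′ ⟨$⟩ˡ i ≡ h ⟨$⟩ˡ (w ⟨$⟩ˡ i)) →
    permutationTerm w (permute h σ) (permAct h f) ≈ sgn h * permutationTerm w′ σ f
  permutationTerm-∘ w h w′ σ f e = begin
    sgn w * averaged₁ (permute w (permute h σ)) (permAct w (permAct h f))
      ≈⟨ *-cong sgn-w (reflexive (≡.cong₂ averaged₁ (permute-∘ w h w′ σ e) (≡.trans (permAct-∘ w h f) (permAct-pointwise {h ∘ₚ w} {w′} forward f)))) ⟩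
    (sgn h * sgn w′) * averaged₁ (permute w′ σ) (permAct w′ f) ≈⟨ *-assoc _ _ _ ⟩
    sgn h * permutationTerm w′ σ f ∎ where
    forward : ∀ i → (h ∘ₚ w) ⟨$⟩ʳ i ≡ w′ ⟨$⟩ʳ i
    forward i = ≡.trans (≡.sym (Perm.inverseʳ w′)) (≡.cong (w′ ⟨$⟩ʳ_)
      (≡.trans (e _) (≡.trans (≡.cong (h ⟨$⟩ˡ_) (Perm.inverseˡ w)) (Perm.inverseˡ h))))
    sgn-w : sgn w ≈ sgn h * sgn w′
    sgn-w = begin
      sgn w ≈⟨ *-identityʳ _ ⟨
      sgn w * 1# ≈⟨ *-congˡ (sgn² h) ⟨
      sgn w * (sgn h * sgn h) ≈⟨ solve 2 (λ w h → w :* (h :* h) := h :* (w :* h)) refl (sgn w) (sgn h) ⟩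
      sgn h * (sgn w * sgn h) ≈⟨ *-congˡ (sgn-∘ w h) ⟨
      sgn h * sgn (h ∘ₚ w) ≈⟨ *-congˡ (sgn-pointwise {h ∘ₚ w} {w′} forward) ⟩
      sgn h * sgn w′ ∎

  averaged-permute : ∀ h σ f → averaged (permute h σ) (permAct h f) ≈ sgn h * averaged σ f
  averaged-permute h σ f = begin
    sumⱽ (λ v → vectorTerm v (injective? v) (permute h σ) (permAct h f))
      ≈⟨ sumⱽ-cong (λ v → term v (injective? v) (injective? (π v))) ⟩
    sumⱽ (λ v → sgn h * vectorTerm (π v) (injective? (π v)) σ f)
      ≈⟨ sumⱽ-*ˡ (sgn h) (λ v → vectorTerm (π v) (injective? (π v)) σ f) ⟨
    sgn h * sumⱽ (λ v → vectorTerm (π v) (injective? (π v)) σ f)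
      ≈⟨ *-congˡ (sumⱽ-permute (λ _ → flip h) (λ v → vectorTerm v (injective? v) σ f)) ⟩
    sgn h * averaged σ f ∎ where
    π : Vec (Fin n) n → Vec (Fin n) n
    π = permuteAll (λ _ → flip h)
    lookup-π : ∀ v i → lookup (π v) i ≡ h ⟨$⟩ˡ lookup v i
    lookup-π = lookup-permuteAll (λ _ → flip h)
    term : ∀ v (d : Dec (Injective v)) (d′ : Dec (Injective (π v))) →
      vectorTerm v d (permute h σ) (permAct h f) ≈ sgn h * vectorTerm (π v) d′ σ f
    term v (yes inj) (yes inj′) = permutationTerm-∘ (fromInjective v inj) h (fromInjective (π v) inj′) σ f λ i →
      ≡.trans (fromInjective-inverse (π v) inj′ i) (≡.trans (lookup-π v i) (≡.cong (h ⟨$⟩ˡ_) (≡.sym (fromInjective-inverse v inj i))))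
    term v (no _) (no _) = sym (zeroʳ _)
    term v (yes inj) (no ¬inj′) = contradiction (λ i j e → inj i j (perm-injective (flip h)
      (≡.trans (≡.sym (lookup-π v i)) (≡.trans e (lookup-π v j))))) ¬inj′
    term v (no ¬inj) (yes inj′) = contradiction (λ i j e → inj′ i j
      (≡.trans (lookup-π v i) (≡.trans (≡.cong (h ⟨$⟩ˡ_) e) (≡.sym (lookup-π v j))))) ¬inj

  permAct-diagAct : ∀ w c f → permAct w (diagAct c f) ≡ diagAct (λ i → c (w ⟨$⟩ˡ i)) (permAct w f)
  permAct-diagAct w c (κ a) = ≡.refl
  permAct-diagAct w c (x i) = ≡.cong (λ j → κ (ζ⁻ (c j)) ∙ x (w ⟨$⟩ʳ i)) (≡.sym (Perm.inverseˡ w))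
  permAct-diagAct w c (θ i) = ≡.cong (λ j → κ (ζ⁻ (c j)) ∙ θ (w ⟨$⟩ʳ i)) (≡.sym (Perm.inverseˡ w))
  permAct-diagAct w c (f ∔ g) = ≡.cong₂ _∔_ (permAct-diagAct w c f) (permAct-diagAct w c g)
  permAct-diagAct w c (f ∙ g) = ≡.cong₂ _∙_ (permAct-diagAct w c f) (permAct-diagAct w c g)

  permute-recolour : ∀ w c (σ : OP̃ n r) → permute w (recolour c σ) ≡ recolour (λ i → c (w ⟨$⟩ˡ i)) (permute w σ)
  permute-recolour w c (mkOP̃ q v ne) = op̃-≡ (Vec.tabulate-cong λ b → ≡.trans (Vec.lookup∘tabulate _ (w ⟨$⟩ˡ b))
    (≡.cong (recolourPlace (c (w ⟨$⟩ˡ b))) (≡.sym (Vec.lookup∘tabulate _ b))))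

  permutationTerm-recolour : ∀ w c σ f → permutationTerm w (recolour c σ) (diagAct c f) ≈ factor c (place σ) * permutationTerm w σ f
  permutationTerm-recolour w c σ f = begin
    sgn w * averaged₁ (permute w (recolour c σ)) (permAct w (diagAct c f))
      ≈⟨ *-congˡ (reflexive (≡.cong₂ averaged₁ (permute-recolour w c σ) (permAct-diagAct w c f))) ⟩
    sgn w * averaged₁ (recolour (λ i → c (w ⟨$⟩ˡ i)) (permute w σ)) (diagAct (λ i → c (w ⟨$⟩ˡ i)) (permAct w f))
      ≈⟨ *-congˡ (trans (averaged₁-recolour (λ i → c (w ⟨$⟩ˡ i)) (permute w σ) (permAct w f)) (*-congʳ (factor-permute w c (place σ)))) ⟩
    sgn w * (factor c (place σ) * averaged₁ (permute w σ) (permAct w f)) ≈⟨ x∙yz≈y∙xz _ _ _ ⟩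
    factor c (place σ) * permutationTerm w σ f ∎

  averaged-recolour : ∀ c σ f → averaged (recolour c σ) (diagAct c f) ≈ factor c (place σ) * averaged σ f
  averaged-recolour c σ f = trans (sumⱽ-cong λ v → term v (injective? v))
    (sym (sumⱽ-*ˡ (factor c (place σ)) λ v → vectorTerm v (injective? v) σ f)) where
    term : ∀ v d → vectorTerm v d (recolour c σ) (diagAct c f) ≈ factor c (place σ) * vectorTerm v d σ f
    term v (yes inj) = permutationTerm-recolour (fromInjective v inj) c σ f
    term v (no _) = sym (zeroʳ _)

  translateσ : ℤ r ≀𝔖 n → OP̃ n r → OP̃ n r
  translateσ (c ⋉ w) σ = recolour c (permute w σ)

  character-value : ∀ c w σ → factor c (place (permute w σ)) * sgn w ≈ determinant (matrix (c ⋉ w)) * scalar c (permute w σ)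
  character-value c w σ = trans (*-congʳ (Π.∑-distrib-+ (λ i → ζ ^ toℕ (c i)) (λ i → weight (c i) (lookup (place (permute w σ)) i))))
    (trans (xy∙z≈xz∙y _ _ _) (*-congʳ (sym (det-matrix c w))))

  averaged-act : ∀ c w σ f → averaged (recolour c (permute w σ)) (act (c ⋉ w) f) ≈
                 (determinant (matrix (c ⋉ w)) * scalar c (permute w σ)) * averaged σ f
  averaged-act c w σ f = trans (averaged-recolour c (permute w σ) (permAct w f)) (trans (*-congˡ (averaged-permute w σ f))
    (trans (sym (*-assoc _ _ _)) (*-congʳ (character-value c w σ))))

  -- Image and kernel of the averaged functionals

  open Reduction averaged-reduction using ()
    renaming (Φ-resp to averaged-resp; Φ-∔ to averaged-∔; Φ-κ to averaged-κ; Φ-gen to averaged-gen; Φ-top to averaged-top)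

  averaged-sum : ∀ σ {k} (f : Fin k → Ω) → averaged σ (sumᴹ f) ≈ sum (λ a → averaged σ (f a))
  averaged-sum σ {zero} f = trans (averaged-resp σ (sumᴹ-[] f)) (trans (averaged-gen σ gen-0) (sym (sum-[] _)))
  averaged-sum σ {suc k} f = trans (averaged-resp σ (sumᴹ-∷ f)) (trans (averaged-∔ σ _ _) (trans (+-congˡ (averaged-sum σ (f ∘ suc))) (sym (sum-∷ _))))

  AveragedSpan : Submodule Fun
  AveragedSpan = record
    { _∈S = λ F → ∃ λ (u : Fin N → Carrier) → ∀ σ → F σ ≈ sum λ c → averaged σ (s c) * u c
    ; resp = λ { e (u , f) → u , λ σ → trans (sym (e σ)) (f σ) }
    ; 0∈ = (λ _ → 0#) , λ σ → sym (sum-zero λ c → zeroʳ _)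
    ; +∈ = λ { (u , f) (u′ , f′) → (λ c → u c + u′ c) ,
               λ σ → trans (+-cong (f σ) (f′ σ)) (trans (sym (sum-+ _ _)) (sum-cong λ c → sym (distribˡ _ _ _))) }
    ; *∈ = λ { a (u , f) → (λ c → a * u c) ,
               λ σ → trans (*-congˡ (f σ)) (trans (sum-*ˡ a _) (sum-cong λ c → x∙yz≈y∙xz _ _ _)) }
    }
  private module A = Submodule AveragedSpan

  below⊆averaged : ∀ e → (∀ c → s-deg c ℕ.< e → (λ σ → evaluate σ (s c)) A.∈S) →
    ∀ {F} → F ∈ SpanBelow e → F A.∈S
  below⊆averaged e h (u , z , f) = A.resp (λ σ → sym (f σ)) (sum∈Fun AveragedSpan (λ c σ → u c * evaluate σ (s c)) λ c → term c (s-deg c ℕ.<? e))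
    where
    term : ∀ c → Dec (s-deg c ℕ.< e) → (λ σ → u c * evaluate σ (s c)) A.∈S
    term c (yes lt) = A.*∈ (u c) (h c lt)
    term c (no ≮) = A.resp (λ σ → sym (trans (*-congʳ (z c (ℕ.≮⇒≥ ≮))) (zeroˡ _))) A.0∈

  -- By `averaged-top` the values averaged σ (s c) and ν evaluate σ (s c) agree up to lower degree.
  -- As ν is invertible, this triangular system is solved by induction on the degree.
  s∈averaged : ∀ c → (λ σ → evaluate σ (s c)) A.∈S
  s∈averaged c = <-rec (λ e → ∀ c → s-deg c ≡ e → (λ σ → evaluate σ (s c)) A.∈S) step (s-deg c) c ≡.refl where
    step : ∀ e → (∀ {d} → d ℕ.< e → ∀ c → s-deg c ≡ d → (λ σ → evaluate σ (s c)) A.∈S) →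
      ∀ c → s-deg c ≡ e → (λ σ → evaluate σ (s c)) A.∈S
    step e ih c ≡.refl = A.resp (λ σ → trans (solve 4 (λ b a v x → b :* (a :+ (:- :1) :* (a :+ :- (v :* x))) := (v :* b) :* x) refl (proj₁ ν-unit) (averaged σ (s c)) ν (evaluate σ (s c)))
        (trans (*-congʳ (proj₂ ν-unit)) (*-identityˡ _)))
      (A.*∈ (proj₁ ν-unit) (A.+∈ own (A.*∈ (- 1#) (below⊆averaged e (λ c lt → ih lt c ≡.refl) (averaged-top (hom-s c)))))) where
      own : (λ σ → averaged σ (s c)) A.∈S
      own = (λ c′ → δ c′ c) , λ σ → sym (sum-δʳ c (λ c → averaged σ (s c)))

  opaque
    averaged-onto : ∀ F → F A.∈S
    averaged-onto F = A.resp (sum-coord F) (sum∈Fun AveragedSpan (λ c σ → coord c F * evaluate σ (s c)) λ c → A.*∈ _ (s∈averaged c))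

  averaged-surjective : ∀ F → ∃ λ f → ∀ σ → averaged σ f ≈ F σ
  averaged-surjective F = let u , e = averaged-onto F in sumᴹ (λ c → κ (u c) ∙ s c) ,
    λ σ → trans (averaged-sum σ _) (trans (sum-cong λ c → trans (averaged-κ σ (u c) (s c)) (*-comm _ _)) (sym (e σ)))

  -- Straighten f. The square matrix of the averaged functionals at the `s` c has a right inverse by
  -- `averaged-onto`, hence trivial kernel, so all coefficients vanish and only the part in the
  -- ideal is left.
  kernel⊆Gen : ∀ f → (∀ σ → averaged σ f ≈ 0#) → Gen f
  kernel⊆Gen f z = let u , g , q , e = straighten f in gen-resp (symΩ e) (gen-∔ (gen-resp (symΩ (sumᴹ-zero λ c → κ0-zero (s c)
      (kernel-trivial local (λ i c → averaged (partition i) (s c)) (λ c l → proj₁ (averaged-onto (λ σ → δ (index σ) l)) c)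
        (λ i l → trans (sym (proj₂ (averaged-onto (λ σ → δ (index σ) l)) (partition i))) (reflexive (≡.cong (λ i → δ i l) (index-partition i))))
        u (λ i → vanish u g q e (partition i)) c))) gen-0) q) where
    vanish : ∀ u g → Gen g → f ≈Ω sumᴹ (λ c → κ (u c) ∙ s c) ∔ g → ∀ σ → sum (λ c → averaged σ (s c) * u c) ≈ 0#
    vanish u g q e σ = begin
      sum (λ c → averaged σ (s c) * u c) ≈⟨ sum-cong (λ c → trans (*-comm _ _) (sym (averaged-κ σ (u c) (s c)))) ⟩
      sum (λ c → averaged σ (κ (u c) ∙ s c)) ≈⟨ averaged-sum σ _ ⟨
      averaged σ (sumᴹ λ c → κ (u c) ∙ s c) ≈⟨ trans (+-congˡ (averaged-gen σ q)) (+-identityʳ _) ⟨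
      averaged σ (sumᴹ λ c → κ (u c) ∙ s c) + averaged σ g ≈⟨ trans (averaged-resp σ e) (averaged-∔ σ _ _) ⟨
      averaged σ f ≈⟨ z σ ⟩
      0# ∎

  -- All invariants without constant term lie in the ideal

  constantTerm-resp : ∀ {f g} → f ≈Ω g → constantTerm f ≈ constantTerm g
  constantTerm-resp reflΩ = refl
  constantTerm-resp (symΩ e) = sym (constantTerm-resp e)
  constantTerm-resp (transΩ e e′) = trans (constantTerm-resp e) (constantTerm-resp e′)
  constantTerm-resp (∔-cong e e′) = +-cong (constantTerm-resp e) (constantTerm-resp e′)
  constantTerm-resp (∔-assoc f g h) = +-assoc _ _ _
  constantTerm-resp (∔-comm f g) = +-comm _ _
  constantTerm-resp (∔-idˡ f) = +-identityˡ _
  constantTerm-resp (∙-cong e e′) = *-cong (constantTerm-resp e) (constantTerm-resp e′)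
  constantTerm-resp (∙-assoc f g h) = *-assoc _ _ _
  constantTerm-resp (∙-idˡ f) = *-identityˡ _
  constantTerm-resp (∙-zeroˡ f) = zeroˡ _
  constantTerm-resp (∙-distribˡ f g h) = distribˡ _ _ _
  constantTerm-resp (∙-distribʳ f g h) = distribʳ _ _ _
  constantTerm-resp (κ-cong e) = e
  constantTerm-resp (κ-+ c d) = refl
  constantTerm-resp (κ-* c d) = refl
  constantTerm-resp (κ-central c f) = *-comm _ _
  constantTerm-resp (xx-comm i j) = refl
  constantTerm-resp (xθ-comm i j) = refl
  constantTerm-resp (θθ-anti i j) = solve 0 (:0 :* :0 := (:- :1) :* (:0 :* :0)) refl

  constantTerm-sum : (f : Fin k → Ω) → (∀ i → constantTerm (f i) ≈ 0#) → constantTerm (sumᴹ f) ≈ 0#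
  constantTerm-sum {zero} f z = constantTerm-resp (sumᴹ-[] f)
  constantTerm-sum {suc k} f z = trans (constantTerm-resp (sumᴹ-∷ f)) (trans (+-cong (z zero) (constantTerm-sum (f ∘ suc) (z ∘ suc))) (+-identityˡ 0#))

  constantTerm-p : ∀ a → constantTerm (p a) ≈ 0#
  constantTerm-p a = constantTerm-sum _ λ i → trans (*-congʳ (zeroˡ _)) (zeroˡ _)

  constantTerm-ξ : ∀ a → constantTerm (ξ a) ≈ 0#
  constantTerm-ξ a = constantTerm-sum _ λ i → trans (*-congˡ (zeroʳ _)) (zeroʳ _)

  constantTerm-gen : ∀ {f} → Gen f → constantTerm f ≈ 0#
  constantTerm-gen (gen-p a h) = trans (*-congʳ (constantTerm-p a)) (zeroˡ _)
  constantTerm-gen (gen-ξ a h) = trans (*-congʳ (constantTerm-ξ a)) (zeroˡ _)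
  constantTerm-gen gen-0 = refl
  constantTerm-gen (gen-∔ q q′) = trans (+-cong (constantTerm-gen q) (constantTerm-gen q′)) (+-identityˡ 0#)
  constantTerm-gen (gen-resp e q) = trans (constantTerm-resp (symΩ e)) (constantTerm-gen q)

  Gen⊆SI : ∀ {f} → Gen f → SI f
  Gen⊆SI (gen-p a h) = SI-mulʳ h (SI-invariant (λ (c ⋉ w) → transΩ (diagAct-cong c (permAct-p w a)) (diagAct-p c a)) (constantTerm-p a))
  Gen⊆SI (gen-ξ a h) = SI-mulʳ h (SI-invariant (λ (c ⋉ w) → transΩ (diagAct-cong c (permAct-ξ w a)) (diagAct-ξ c a)) (constantTerm-ξ a))
  Gen⊆SI gen-0 = SI-zero
  Gen⊆SI (gen-∔ q q′) = SI-add (Gen⊆SI q) (Gen⊆SI q′)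
  Gen⊆SI (gen-resp e q) = SI-resp e (Gen⊆SI q)

  wedge : (Fin k → Fin n) → Ω
  wedge ι = monoAt ι fullMon

  wedge-cong : {ι ι′ : Fin k → Fin n} → (∀ l → ι l ≡ ι′ l) → wedge ι ≡ wedge ι′
  wedge-cong {zero} h = ≡.refl
  wedge-cong {suc k} h = ≡.cong₂ (λ i f → κ 1# ∙ (θ i ∙ f)) (h zero) (wedge-cong (h ∘ suc))

  -- Both exchanged factors pass the ones in front of position j. These signs cancel in pairs, and
  -- the sign of the exchange itself remains.
  wedge-exchange : ∀ (ι ι′ : Fin k → Fin n) j → (∀ l → l ≢ j → ι l ≡ ι′ l) → θ (ι′ j) ∙ wedge ι ≈Ω κ (- 1#) ∙ (θ (ι j) ∙ wedge ι′)
  wedge-exchange ι ι′ zero h = transΩ (∙-cong₂ (∙-idˡ _)) (transΩ (anti⇒exchange (θθ-anti _ _) _)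
    (∙-cong₂ (∙-cong₂ (transΩ (∙-cong₂ (reflexiveΩ (wedge-cong λ l → h (suc l) λ ()))) (symΩ (∙-idˡ _))))))
  wedge-exchange ι ι′ (suc j) h = ≈Ω.begin
    θ a ∙ (κ 1# ∙ (θ (ι zero) ∙ wedge (ι ∘ suc))) ≈Ω.≈⟨ ∙-cong₂ (∙-idˡ _) ⟩
    θ a ∙ (θ (ι zero) ∙ wedge (ι ∘ suc)) ≈Ω.≈⟨ anti⇒exchange (θθ-anti _ _) _ ⟩
    κ (- 1#) ∙ (θ (ι zero) ∙ (θ a ∙ wedge (ι ∘ suc)))
      ≈Ω.≈⟨ ∙-cong₂ (∙-cong₂ (wedge-exchange (ι ∘ suc) (ι′ ∘ suc) j λ l l≢j → h (suc l) (l≢j ∘ Fin.suc-injective))) ⟩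
    κ (- 1#) ∙ (θ (ι zero) ∙ (κ (- 1#) ∙ (θ b ∙ wedge (ι′ ∘ suc)))) ≈Ω.≈⟨ ∙-cong₂ (pull-κ _ _ _) ⟩
    κ (- 1#) ∙ (κ (- 1#) ∙ (θ (ι zero) ∙ (θ b ∙ wedge (ι′ ∘ suc)))) ≈Ω.≈⟨ ∙-cong₂ (anti⇒exchange (θθ-anti _ _) _) ⟨
    κ (- 1#) ∙ (θ b ∙ (θ (ι zero) ∙ wedge (ι′ ∘ suc)))
      ≈Ω.≈⟨ ∙-cong₂ (∙-cong₂ (transΩ (∙-cong₁ (reflexiveΩ (≡.cong θ (h zero λ ())))) (symΩ (∙-idˡ _)))) ⟩
    κ (- 1#) ∙ (θ b ∙ wedge ι′) ≈Ω.∎ where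
    a = ι′ (suc j)
    b = ι (suc j)

  wedge-transpose : ∀ (ι ι′ : Fin k → Fin n) i j → i ≢ j → ι i ≡ ι′ j → ι j ≡ ι′ i → (∀ l → l ≢ i → l ≢ j → ι l ≡ ι′ l) →
    wedge ι ≈Ω κ (- 1#) ∙ wedge ι′
  wedge-transpose {suc k} ι ι′ = go where
    first : ∀ j → ι zero ≡ ι′ (suc j) → ι (suc j) ≡ ι′ zero → (∀ l → l ≢ zero → l ≢ suc j → ι l ≡ ι′ l) →
      wedge ι ≈Ω κ (- 1#) ∙ wedge ι′
    first j e e′ h = transΩ (∙-cong₂ (transΩ (∙-cong₁ (reflexiveΩ (≡.cong θ e)))
      (transΩ (wedge-exchange (ι ∘ suc) (ι′ ∘ suc) j λ l l≢j → h (suc l) (λ ()) (l≢j ∘ Fin.suc-injective))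
        (∙-cong₂ (∙-cong₁ (reflexiveΩ (≡.cong θ e′))))))) (pull-κ _ _ _)
    go : ∀ i j → i ≢ j → ι i ≡ ι′ j → ι j ≡ ι′ i → (∀ l → l ≢ i → l ≢ j → ι l ≡ ι′ l) → wedge ι ≈Ω κ (- 1#) ∙ wedge ι′
    go zero zero i≢j = contradiction ≡.refl i≢j
    go zero (suc j) _ e e′ h = first j e e′ h
    go (suc i) zero _ e e′ h = first i e′ e λ l l≢0 l≢i → h l l≢i l≢0
    go (suc i) (suc j) i≢j e e′ h = transΩ (∙-cong₂ (transΩ (∙-cong (reflexiveΩ (≡.cong θ (h zero (λ ()) λ ())))
      (wedge-transpose (ι ∘ suc) (ι′ ∘ suc) i j (i≢j ∘ ≡.cong suc) e e′
        λ l l≢i l≢j → h (suc l) (l≢i ∘ Fin.suc-injective) (l≢j ∘ Fin.suc-injective))) (pull-κ _ _ _))) (pull-κ _ _ _)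

  sgn-transpose : ∀ i j → i ≢ j → sgn (Perm.transpose i j) ≈ - 1#
  sgn-transpose i j i≢j = κ-full-injective (transΩ (symΩ (permAct-full w)) (transΩ (reflexiveΩ (permAct-monoAt w id fullMon))
    (wedge-transpose (w ⟨$⟩ʳ_) id i j i≢j w-i w-j w-other))) where
    w = Perm.transpose i j
    w-i : w ⟨$⟩ʳ i ≡ j
    w-i with i Fin.≟ i
    ... | yes _ = ≡.refl
    ... | no i≢i = contradiction ≡.refl i≢i
    w-j : w ⟨$⟩ʳ j ≡ i
    w-j with j Fin.≟ i
    ... | yes e = contradiction (≡.sym e) i≢j
    ... | no _ with j Fin.≟ j
    ... | yes _ = ≡.refl
    ... | no j≢j = contradiction ≡.refl j≢j
    w-other : ∀ l → l ≢ i → l ≢ j → w ⟨$⟩ʳ l ≡ l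
    w-other l l≢i l≢j with l Fin.≟ i
    ... | yes e = contradiction e l≢i
    ... | no _ with l Fin.≟ j
    ... | yes e = contradiction e l≢j
    ... | no _ = ≡.refl

  product-single : (i : Fin k) (f : Fin k → Carrier) → (∀ j → j ≢ i → f j ≈ 1#) → product f ≈ f i
  product-single zero f h = trans (*-congˡ (ones (f ∘ suc) λ j → h (suc j) λ ())) (*-identityʳ _) where
    ones : (f : Fin k → Carrier) → (∀ j → f j ≈ 1#) → product f ≈ 1#
    ones {zero} f h = refl
    ones {suc k} f h = trans (*-cong (h zero) (ones (f ∘ suc) (h ∘ suc))) (*-identityˡ 1#)
  product-single (suc i) f h = trans (*-cong (h zero λ ()) (product-single i (f ∘ suc) λ j j≢ → h (suc j) (j≢ ∘ Fin.suc-injective))) (*-identityˡ _)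

  recolourPlace-zero : (p : Place r q) → recolourPlace zero p ≡ p
  recolourPlace-zero (inj₁ k) = ≡.refl
  recolourPlace-zero (inj₂ (j , k)) = ≡.cong (λ k → inj₂ (j , k)) (⊕-identityʳ k)

  module Invariants {f : Ω} (invariant : Invariant f) where

    diagonal-invariant : ∀ c → diagAct c f ≈Ω f
    diagonal-invariant c = transΩ (reflexiveΩ (≡.cong (diagAct c) (≡.sym (permAct-id f)))) (invariant (c ⋉ Perm.id))

    permutation-invariant : ∀ w → permAct w f ≈Ω f
    permutation-invariant w = transΩ (symΩ (diagAct-trivial _)) (invariant ((λ _ → zero) ⋉ w))

    value-recolour : ∀ c σ → averaged (recolour c σ) f ≈ factor c (place σ) * averaged σ f
    value-recolour c σ = trans (averaged-resp (recolour c σ) (symΩ (diagonal-invariant c))) (averaged-recolour c σ f)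

    value-permute : ∀ w σ → averaged (permute w σ) f ≈ sgn w * averaged σ f
    value-permute w σ = trans (averaged-resp (permute w σ) (symΩ (permutation-invariant w))) (averaged-permute w σ f)

    -- A colour change at an element of the zero block multiplies by a nontrivial root of unity.
    value-zero-block : ∀ σ i k → lookup (place σ) i ≡ inj₁ k → averaged σ f ≈ 0#
    value-zero-block σ@(mkOP̃ q v ne) i k e = unit-cancel (root-unit (suc (toℕ k)) (s≤s z≤n) (s≤s (Fin.toℕ<n k)))
      (trans (solve 2 (λ z a → (:1 :- z) :* a := a :- z :* a) refl (ζ ^ suc (toℕ k)) _)
        (trans (+-congˡ (-‿cong (sym scaled))) (-‿inverseʳ _))) where
      first : ∀ {m} → Fin m → Fin m
      first {suc _} _ = zero
      toℕ-first : ∀ {m} (k : Fin m) → toℕ (first k) ≡ 0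
      toℕ-first {suc _} _ = ≡.refl
      one : Fin r
      one = suc (first k)
      c : Fin n → Fin r
      c j = if does (j Fin.≟ i) then one else zero
      c-i : c i ≡ one
      c-i with i Fin.≟ i
      ... | yes _ = ≡.refl
      ... | no i≢i = contradiction ≡.refl i≢i
      c-other : ∀ j → j ≢ i → c j ≡ zero
      c-other j j≢i with j Fin.≟ i
      ... | yes j≡i = contradiction j≡i j≢i
      ... | no _ = ≡.refl
      unchanged : ∀ j → recolourPlace (c j) (lookup v j) ≡ lookup v j
      unchanged j = go (j Fin.≟ i) where
        go : Dec (j ≡ i) → recolourPlace (c j) (lookup v j) ≡ lookup v j
        go (yes ≡.refl) = ≡.trans (≡.cong (recolourPlace (c j)) e) (≡.sym e)
        go (no j≢i) = ≡.trans (≡.cong (λ c → recolourPlace c (lookup v j)) (c-other j j≢i)) (recolourPlace-zero _)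
      same : recolour c σ ≡ σ
      same = op̃-≡ (vec-ext λ j → ≡.trans (Vec.lookup∘tabulate _ j) (unchanged j))
      weight-zero : ∀ (p : Place r q) → ζ ^ 0 * weight zero p ≈ 1#
      weight-zero (inj₁ k) = trans (*-identityˡ _) (^-congʳ ζ (ℕ.*-zeroʳ (toℕ k)))
      weight-zero (inj₂ _) = *-identityˡ 1#
      factor-c : factor c v ≈ ζ ^ suc (toℕ k)
      factor-c = begin
        factor c v
          ≈⟨ product-single i _ (λ j j≢i → trans (reflexive (≡.cong (λ c → ζ ^ toℕ c * weight c (lookup v j)) (c-other j j≢i))) (weight-zero (lookup v j))) ⟩
        ζ ^ toℕ (c i) * weight (c i) (lookup v i) ≡⟨ ≡.cong₂ (λ c p → ζ ^ toℕ c * weight c p) c-i e ⟩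
        ζ ^ toℕ one * ζ ^ (toℕ k ℕ.* toℕ one) ≡⟨ ≡.cong (λ a → ζ ^ a * ζ ^ (toℕ k ℕ.* a)) (≡.cong suc (toℕ-first k)) ⟩
        ζ ^ 1 * ζ ^ (toℕ k ℕ.* 1) ≈⟨ *-cong (*-identityʳ ζ) (^-congʳ ζ (ℕ.*-identityʳ (toℕ k))) ⟩
        ζ ^ suc (toℕ k) ∎
      scaled : averaged σ f ≈ ζ ^ suc (toℕ k) * averaged σ f
      scaled = trans (reflexive (≡.cong (λ σ → averaged σ f) (≡.sym same))) (trans (value-recolour c σ) (*-congʳ factor-c))

    -- The exchange of two elements in the same place is a reflection of determinant -1.
    value-repeated : ∀ σ i j → i ≢ j → lookup (place σ) i ≡ lookup (place σ) j → averaged σ f ≈ 0#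
    value-repeated σ@(mkOP̃ q v ne) i j i≢j e = unit-cancel half (trans (solve 1 (λ a → (:1 :+ :1) :* a := a :- (:- :1) :* a) refl _)
      (trans (+-congˡ (-‿cong (sym negated))) (-‿inverseʳ _))) where
      w = Perm.transpose i j
      unchanged : ∀ b → lookup v (w ⟨$⟩ˡ b) ≡ lookup v b
      unchanged b with b Fin.≟ j
      ... | yes ≡.refl = e
      ... | no _ with b Fin.≟ i
      ... | yes ≡.refl = ≡.sym e
      ... | no _ = ≡.refl
      same : permute w σ ≡ σ
      same = op̃-≡ (vec-ext λ b → ≡.trans (Vec.lookup∘tabulate _ b) (unchanged b))
      negated : averaged σ f ≈ - 1# * averaged σ f
      negated = trans (reflexive (≡.cong (λ σ → averaged σ f) (≡.sym same))) (trans (value-permute w σ) (*-congʳ (sgn-transpose i j i≢j)))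

  neutralPlace : Place r q → Place r q
  neutralPlace (inj₁ k) = inj₁ k
  neutralPlace (inj₂ (b , _)) = inj₂ (b , zero)

  colourOf : Place r q → Fin r
  colourOf (inj₁ _) = zero
  colourOf (inj₂ (_ , k)) = k

  neutral : OP̃ n r → OP̃ n r
  neutral (mkOP̃ q v ne) = mkOP̃ q (Vec.map neutralPlace v) λ j →
    let i , _ , e = ne j in i , zero , ≡.trans (Vec.lookup-map i neutralPlace v) (≡.cong neutralPlace e)

  recolour-neutral : ∀ σ → recolour (λ i → colourOf (lookup (place σ) i)) (neutral σ) ≡ σ
  recolour-neutral (mkOP̃ q v ne) = op̃-≡ (vec-ext λ i → ≡.trans (Vec.lookup∘tabulate _ i)
    (≡.trans (≡.cong (recolourPlace (colourOf (lookup v i))) (Vec.lookup-map i neutralPlace v)) (restore (lookup v i)))) where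
    restore : (p : Place r q) → recolourPlace (colourOf p) (neutralPlace p) ≡ p
    restore (inj₁ k) = ≡.refl
    restore (inj₂ (b , k)) = ≡.cong (λ k → inj₂ (b , k)) (≡.trans (⊕-comm zero k) (⊕-identityʳ k))

  singletons : OP̃ n r
  singletons = mkOP̃ n (tabulate λ i → inj₂ (i , zero)) λ j → j , zero , Vec.lookup∘tabulate _ j

  Vanishing : OP̃ n r → Set
  Vanishing σ = ∀ {f} → Invariant f → averaged σ f ≈ 0#

  -- When all nonzero blocks have colour 0, two elements of one block are in the same place. If
  -- neither this nor a zero block occurs, elements and blocks correspond bijectively, and the
  -- partition is an arrangement of singletons.
  classify : ∀ σ → Vanishing (neutral σ) ⊎ ∃ λ w → neutral σ ≡ permute w singletons
  classify σ = by-zero-block (Fin.any? λ i → Fin.any? λ k → place-≟ (lookup v i) (inj₁ k)) where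
    blocks = OP̃.blocks σ
    v = place (neutral σ)

    block-of : (p : Place r blocks) → (∀ k → p ≢ inj₁ k) → Fin blocks
    block-of (inj₁ k) h = contradiction ≡.refl (h k)
    block-of (inj₂ (b , _)) h = b

    neutral-block : ∀ p h → neutralPlace p ≡ inj₂ (block-of (neutralPlace p) h , zero)
    neutral-block (inj₁ k) h = contradiction ≡.refl (h k)
    neutral-block (inj₂ (b , _)) h = ≡.refl

    module _ (noZ : ∀ i k → lookup v i ≢ inj₁ k) (noRepeat : ∀ i j → i ≢ j → lookup v i ≢ lookup v j) where
      u : Fin n → Fin blocks
      u i = block-of (lookup v i) (noZ i)
      place-u : ∀ i → lookup v i ≡ inj₂ (u i , zero)
      place-u i = go (lookup v i) (noZ i) (Vec.lookup-map i neutralPlace (place σ)) where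
        go : ∀ p h → p ≡ neutralPlace (lookup (place σ) i) → p ≡ inj₂ (block-of p h , zero)
        go _ h ≡.refl = neutral-block (lookup (place σ) i) h
      u-injective : ∀ {i j} → u i ≡ u j → i ≡ j
      u-injective {i} {j} e with i Fin.≟ j
      ... | yes i≡j = i≡j
      ... | no i≢j = contradiction (≡.trans (place-u i) (≡.trans (≡.cong (λ b → inj₂ (b , zero)) e) (≡.sym (place-u j)))) (noRepeat i j i≢j)
      tr : Fin blocks → Fin n
      tr b = proj₁ (nonempty (neutral σ) b)
      tr-injective : ∀ {b b′} → tr b ≡ tr b′ → b ≡ b′
      tr-injective {b} {b′} e = Maybe.just-injective (≡.trans (≡.sym (at b)) (≡.trans (≡.cong (block ∘ lookup v) e) (at b′)))
        where
        at : ∀ b → block (lookup v (tr b)) ≡ just b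
        at b = ≡.cong block (proj₂ (proj₂ (nonempty (neutral σ) b)))
      q≡n : blocks ≡ n
      q≡n = ℕ.≤-antisym (Fin.injective⇒≤ tr-injective) (Fin.injective⇒≤ u-injective)

    arrange : ∀ τ (u : Fin n → Fin (OP̃.blocks τ)) → (∀ {i j} → u i ≡ u j → i ≡ j) →
      (∀ i → lookup (place τ) i ≡ inj₂ (u i , zero)) → OP̃.blocks τ ≡ n → ∃ λ w → τ ≡ permute w singletons
    arrange (mkOP̃ _ v ne) u inj place ≡.refl = fromInjective (tabulate u) inj′ , op̃-≡ (vec-ext λ b → ≡.trans (place b)
        (≡.sym (≡.trans (Vec.lookup∘tabulate _ b) (≡.trans (Vec.lookup∘tabulate _ (fromInjective (tabulate u) inj′ ⟨$⟩ˡ b))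
          (≡.cong (λ b → inj₂ (b , zero)) (≡.trans (fromInjective-inverse (tabulate u) inj′ b) (Vec.lookup∘tabulate u b)))))))
      where
      inj′ : Injective (tabulate u)
      inj′ i j e = inj (≡.trans (≡.sym (Vec.lookup∘tabulate u i)) (≡.trans e (Vec.lookup∘tabulate u j)))

    by-repetition : (∀ i k → lookup v i ≢ inj₁ k) → Dec (∃ λ i → ∃ λ j → i ≢ j × lookup v i ≡ lookup v j) →
      Vanishing (neutral σ) ⊎ ∃ λ w → neutral σ ≡ permute w singletons
    by-repetition noZ (yes (i , j , i≢j , e)) = inj₁ λ inv → Invariants.value-repeated inv (neutral σ) i j i≢j e
    by-repetition noZ (no none) = inj₂ (arrange (neutral σ) (u noZ noRepeat) (u-injective noZ noRepeat) (place-u noZ noRepeat) (q≡n noZ noRepeat))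
      where
      noRepeat : ∀ i j → i ≢ j → lookup v i ≢ lookup v j
      noRepeat i j i≢j e = none (i , j , i≢j , e)

    by-zero-block : Dec (∃ λ i → ∃ λ k → lookup v i ≡ inj₁ k) → Vanishing (neutral σ) ⊎ ∃ λ w → neutral σ ≡ permute w singletons
    by-zero-block (yes (i , k , e)) = inj₁ λ inv → Invariants.value-zero-block inv (neutral σ) i k e
    by-zero-block (no none) = by-repetition (λ i k e → none (i , k , e))
      (Fin.any? λ i → Fin.any? λ j → ¬? (i Fin.≟ j) ×-dec place-≟ (lookup v i) (lookup v j))

  value-neutral : ∀ σ {f} → Invariant f → averaged σ f ≈ factor (λ i → colourOf (lookup (place σ) i)) (place (neutral σ)) * averaged (neutral σ) f
  value-neutral σ {f} inv = trans (reflexive (≡.cong (λ σ → averaged σ f) (≡.sym (recolour-neutral σ))))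
    (Invariants.value-recolour inv (λ i → colourOf (lookup (place σ) i)) (neutral σ))

  -- The invariants have proportional values, since the partitions at which they need not vanish form one orbit.
  proportional : ∀ {f h} → Invariant f → Invariant h → ∀ σ →
    averaged σ f * averaged singletons h ≈ averaged σ h * averaged singletons f
  proportional {f} {h} inv inv′ σ = trans (*-congʳ (value-neutral σ inv)) (trans (*-assoc _ _ _)
    (trans (*-congˡ (at-neutral (classify σ))) (sym (trans (*-congʳ (value-neutral σ inv′)) (*-assoc _ _ _))))) where
    at-neutral : Vanishing (neutral σ) ⊎ (∃ λ w → neutral σ ≡ permute w singletons) →
      averaged (neutral σ) f * averaged singletons h ≈ averaged (neutral σ) h * averaged singletons f
    at-neutral (inj₁ z) = trans (*-congʳ (z inv)) (trans (zeroˡ _) (sym (trans (*-congʳ (z inv′)) (zeroˡ _))))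
    at-neutral (inj₂ (w , e)) = trans (*-congʳ (orbit-value inv)) (trans (xy∙z≈xz∙y _ _ _)
      (*-congʳ (sym (orbit-value inv′)))) where
      orbit-value : ∀ {f} → Invariant f → averaged (neutral σ) f ≈ sgn w * averaged singletons f
      orbit-value {f} inv = trans (reflexive (≡.cong (λ σ → averaged σ f) e)) (Invariants.value-permute inv w singletons)

  unit-pow : ∀ {a} k → Unit a → Unit (a ^ k)
  unit-pow zero u = unit-1
  unit-pow (suc k) u = unit-* u (unit-pow k u)

  -- No degree is lower than 0, so on constants `averaged` is exactly ν times `evaluate`. The
  -- functional of the singletons supplies every θ, and its value at 1 is a product of units.
  singletons-unit : Unit (averaged singletons (κ 1#))
  singletons-unit = unit-cong (sym leading-value) (unit-* ν-unit (unit-cong (sym one-value) (unit-* (fillSign id unitMon , fillSign² id id opened)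
    (unit-cong (sym (top-product Y v _)) (unit-product _ λ i → cell-unit (lookup v i) (lookup (fill id unitMon) i) i (Vec.lookup∘tabulate _ i) (filled i))))))
    where
    v = place singletons
    Y = coords v
    block-v : ∀ i → block (lookup v i) ≡ just i
    block-v i = ≡.cong block (Vec.lookup∘tabulate (λ i → inj₂ (i , zero)) i)
    open Transversal v id block-v
    leading-value : averaged singletons (κ 1#) ≈ ν * evaluate singletons (κ 1#)
    leading-value = let u , z , f = averaged-top (hom-κ 1#) in
      trans (solve 2 (λ a b → a := (a :- b) :+ b) refl _ _) (trans (+-congʳ (trans (f singletons) (sum-zero λ c → trans (*-congʳ (z c z≤n)) (zeroˡ _)))) (+-identityˡ _))
    opened : Open id unitMon
    opened = (λ i → ≡.trans (Vec.lookup-map i proj₂ unitMon) (≡.cong proj₂ (lookup-unit i))) ,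
      λ a i e i≢a → contradiction (Maybe.just-injective (≡.trans (≡.sym (block-v i)) e)) i≢a
    filled : ∀ i → lookup (fill id unitMon) i ≡ (r′ ℕ.+ 0 , true)
    filled i = ≡.trans (lookup-fill id id i unitMon) (≡.cong (λ a → r′ ℕ.+ proj₁ a , true) (lookup-unit i))
    one-value : evaluate singletons (κ 1#) ≈ fillSign id unitMon * top Y v (fill id unitMon)
    one-value = trans (evaluate-resp singletons (symΩ (monoAt-unit id))) (ev-mono Y unitMon opened)
    cell-unit : ∀ p m i → p ≡ inj₂ (i , zero) → m ≡ (r′ ℕ.+ 0 , true) → Unit (cell Y p m)
    cell-unit _ _ i ≡.refl ≡.refl = unit-* (unit-^ 0) (unit-pow (suc (r′ ℕ.+ 0) / r) (nonzero (sizes v) (sizes-bounded singletons) i))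

  -- Subtract from f the constant c with the same value at the singletons. By `proportional` the
  -- difference lies in the kernel, hence in the ideal. Elements of the ideal have constant term 0,
  -- and so has f, whence c = 0.
  invariant⊆Gen : ∀ {f} → Invariant f → constantTerm f ≈ 0# → Gen f
  invariant⊆Gen {f} inv f₀ = gen-resp (transΩ (∔-cong reflΩ (κ0-zero _ (trans (-‿cong λ≈0) (solve 0 (:- :0 := :0) refl)))) (∔-idʳ f)) difference
    where
    inv₁ : Invariant (κ 1#)
    inv₁ g = reflΩ
    u = proj₁ singletons-unit
    c = averaged singletons f * u
    difference : Gen (f ∔ κ (- c) ∙ κ 1#)
    difference = kernel⊆Gen _ λ σ → begin
      averaged σ (f ∔ κ (- c) ∙ κ 1#) ≈⟨ trans (averaged-∔ σ _ _) (+-congˡ (averaged-κ σ _ _)) ⟩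
      averaged σ f + - c * averaged σ (κ 1#) ≈⟨ +-congʳ (trans (sym (*-identityʳ _)) (*-congˡ (sym (proj₂ singletons-unit)))) ⟩
      averaged σ f * (averaged singletons (κ 1#) * u) + - c * averaged σ (κ 1#)
        ≈⟨ +-congʳ (trans (sym (*-assoc _ _ _)) (*-congʳ (proportional inv inv₁ σ))) ⟩
      (averaged σ (κ 1#) * averaged singletons f) * u + - c * averaged σ (κ 1#)
        ≈⟨ solve 3 (λ a b u → (a :* b) :* u :+ (:- (b :* u)) :* a := :0) refl _ _ u ⟩
      0# ∎
    λ≈0 : c ≈ 0#
    λ≈0 = begin
      c ≈⟨ solve 1 (λ c → c := :- (:0 :+ (:- c) :* :1)) refl c ⟩
      - (0# + - c * 1#) ≈⟨ -‿cong (+-congʳ (sym f₀)) ⟩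
      - constantTerm (f ∔ κ (- c) ∙ κ 1#) ≈⟨ -‿cong (constantTerm-gen difference) ⟩
      - 0# ≈⟨ solve 0 (:- :0 := :0) refl ⟩
      0# ∎

  SI⊆Gen : ∀ {f} → SI f → Gen f
  SI⊆Gen (SI-invariant inv e) = invariant⊆Gen inv e
  SI⊆Gen (SI-resp e q) = gen-resp e (SI⊆Gen q)
  SI⊆Gen SI-zero = gen-0
  SI⊆Gen (SI-add q q′) = gen-∔ (SI⊆Gen q) (SI⊆Gen q′)
  SI⊆Gen (SI-mulˡ h q) = gen-∙ˡ h (SI⊆Gen q)
  SI⊆Gen (SI-mulʳ h q) = gen-∙ʳ h (SI⊆Gen q)

  -- The equivariant isomorphism

  Target : KModule
  Target = Rep.space (K[OP̃] ⊗ det)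

  private
    module V = Module (Free (OP̃ n r))
    module T = Module Target
    module ⊕ = ModuleSums K Target
    infix 4 _≈T_
    _≈T_ : T.Carrierᴹ → T.Carrierᴹ → Set
    _≈T_ = T._≈ᴹ_

  functional : {A : Set} → (A → Carrier) → Combination A → Carrier
  functional φ (gen a) = φ a
  functional φ 0̇ = 0#
  functional φ (u +̇ v) = functional φ u + functional φ v
  functional φ (c • u) = c * functional φ u

  functional-cong : {A : Set} {R : Combination A → Combination A → Set} (φ : A → Carrier) →
    (∀ {u v} → R u v → functional φ u ≈ functional φ v) → ∀ {u v} → _≈ᴾ_ R u v → functional φ u ≈ functional φ v
  functional-cong φ h (rel p) = h p
  functional-cong φ h reflᴾ = refl
  functional-cong φ h (symᴾ p) = sym (functional-cong φ h p)
  functional-cong φ h (transᴾ p q) = trans (functional-cong φ h p) (functional-cong φ h q)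
  functional-cong φ h (+̇-cong p q) = +-cong (functional-cong φ h p) (functional-cong φ h q)
  functional-cong φ h (+̇-assoc _ _ _) = +-assoc _ _ _
  functional-cong φ h (+̇-comm _ _) = +-comm _ _
  functional-cong φ h (+̇-idˡ _) = +-identityˡ _
  functional-cong φ h (•-cong e p) = *-cong e (functional-cong φ h p)
  functional-cong φ h (•-+ˡ _ _ _) = distribʳ _ _ _
  functional-cong φ h (•-+ʳ _ _ _) = distribˡ _ _ _
  functional-cong φ h (•-assoc _ _ _) = *-assoc _ _ _
  functional-cong φ h (•-one _) = *-identityˡ _
  functional-cong φ h (•-zero _) = zeroˡ _

  coefficient : OP̃ n r → Combination (OP̃ n r) → Carrier
  coefficient σ = functional λ τ → ⟦ op̃-≟ τ σ ⟧?

  coordinate : OP̃ n r → T.Carrierᴹ → Carrier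
  coordinate σ = functional λ (v , c) → coefficient σ v * c

  coordinate-cong : ∀ σ {t t′} → t ≈T t′ → coordinate σ t ≈ coordinate σ t′
  coordinate-cong σ = functional-cong _ λ where
    (⊗-cong p e) → *-cong (functional-cong _ (λ ()) p) e
    (+-⊗ v v′ c) → distribʳ _ _ _
    (⊗-+ v c c′) → distribˡ _ _ _
    (*-⊗ a v c) → *-assoc _ _ _
    (⊗-* a v c) → x∙yz≈y∙xz _ a c

  basis : Fin N → T.Carrierᴹ
  basis i = gen (gen (partition i) , 1#)

  coordinate-sum : ∀ σ {k} (t : Fin k → T.Carrierᴹ) → coordinate σ (⊕.sumᴹ t) ≈ sum λ i → coordinate σ (t i)
  coordinate-sum σ {zero} t = trans (coordinate-cong σ (⊕.sumᴹ-[] t)) (sym (sum-[] _))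
  coordinate-sum σ {suc k} t = trans (coordinate-cong σ (⊕.sumᴹ-∷ t)) (trans (+-congˡ (coordinate-sum σ (t ∘ suc))) (sym (sum-∷ _)))

  opaque
    combine : (OP̃ n r → Carrier) → T.Carrierᴹ
    combine F = ⊕.sumᴹ λ i → F (partition i) • basis i

    combine-def : ∀ F → combine F ≈T ⊕.sumᴹ λ i → F (partition i) • basis i
    combine-def F = reflᴾ

    combine-cong : ∀ {F G : OP̃ n r → Carrier} → (∀ σ → F σ ≈ G σ) → combine F ≈T combine G
    combine-cong e = ⊕.sumᴹ-cong λ i → •-cong (e (partition i)) reflᴾ

    combine-+ : ∀ (F G : OP̃ n r → Carrier) → combine (λ σ → F σ + G σ) ≈T combine F +̇ combine G
    combine-+ F G = transᴾ (⊕.sumᴹ-cong λ i → •-+ˡ _ _ _) (⊕.sumᴹ-+ _ _)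

    combine-* : ∀ c (F : OP̃ n r → Carrier) → combine (λ σ → c * F σ) ≈T c • combine F
    combine-* c F = transᴾ (⊕.sumᴹ-cong λ i → •-assoc _ _ _)
      (symᴾ (⊕.sumᴹ-linear (c •_) (mkLinear Target Target _ (•-cong refl) (•-+ʳ c) (λ a t → transᴾ (symᴾ (•-assoc _ _ _)) (transᴾ (•-cong (*-comm _ _) reflᴾ) (•-assoc _ _ _)))) _))

    coordinate-combine : ∀ σ F → coordinate σ (combine F) ≈ F σ
    coordinate-combine σ F = begin
      coordinate σ (combine F) ≈⟨ coordinate-sum σ _ ⟩
      sum (λ i → F (partition i) * (⟦ op̃-≟ (partition i) σ ⟧? * 1#)) ≈⟨ sum-single (index σ) _ (λ j j≢ → trans (*-congˡ (trans (*-identityʳ _)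
          (⟦⟧?-no (op̃-≟ (partition j) σ) λ e → contradiction (≡.trans (≡.sym (index-partition j)) (≡.cong index e)) j≢))) (zeroʳ _)) ⟩
      F (partition (index σ)) * (⟦ op̃-≟ (partition (index σ)) σ ⟧? * 1#)
        ≈⟨ *-cong (reflexive (≡.cong F (partition-index σ))) (trans (*-identityʳ _) (⟦⟧?-yes (op̃-≟ (partition (index σ)) σ) (partition-index σ))) ⟩
      F σ * 1# ≈⟨ *-identityʳ _ ⟩
      F σ ∎

    combine-0 : combine (λ _ → 0#) ≈T 0̇
    combine-0 = ⊕.sumᴹ-zero λ i → •-zero _

  -- As det is one-dimensional, moving all scalars out of the second factor shows that the `basis`
  -- spans the tensor product.
  expand : ∀ t → t ≈T combine λ σ → coordinate σ t
  expand (gen (v , c)) = transᴾ (rel (⊗-cong V.≈ᴹ-refl (sym (*-identityʳ c)))) (transᴾ (rel (⊗-* c v 1#))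
    (transᴾ (•-cong refl (pure v)) (transᴾ (symᴾ (combine-* c (λ σ → coefficient σ v))) (combine-cong λ σ → *-comm _ _)))) where
    pure : ∀ v → gen (v , 1#) ≈T combine λ σ → coefficient σ v
    pure (gen τ) = symᴾ (transᴾ (combine-def _) (transᴾ (⊕.sumᴹ-single (index τ) _ λ j j≢ → transᴾ (•-cong
        (⟦⟧?-no (op̃-≟ τ (partition j)) λ e → contradiction (≡.trans (≡.sym (index-partition j)) (≡.cong index (≡.sym e))) j≢) reflᴾ) (•-zero _))
      (transᴾ (•-cong (⟦⟧?-yes (op̃-≟ τ (partition (index τ))) (≡.sym (partition-index τ))) (T.≈ᴹ-reflexive (≡.cong (λ σ → gen (gen σ , 1#)) (partition-index τ))))
        (•-one _))))
    pure 0̇ = transᴾ (rel (⊗-cong (symᴾ (•-zero 0̇)) refl)) (transᴾ (rel (*-⊗ 0# 0̇ 1#)) (transᴾ (•-zero _)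
      (symᴾ combine-0)))
    pure (u +̇ v) = transᴾ (rel (+-⊗ u v 1#)) (transᴾ (+̇-cong (pure u) (pure v)) (symᴾ (combine-+ _ _)))
    pure (c • v) = transᴾ (rel (*-⊗ c v 1#)) (transᴾ (•-cong refl (pure v)) (symᴾ (combine-* c _)))
  expand 0̇ = symᴾ combine-0
  expand (t +̇ u) = transᴾ (+̇-cong (expand t) (expand u)) (symᴾ (combine-+ _ _))
  expand (c • t) = transᴾ (•-cong refl (expand t)) (symᴾ (combine-* c _))

  coordinates-determine : ∀ {t u} → (∀ σ → coordinate σ t ≈ coordinate σ u) → t ≈T u
  coordinates-determine {t} {u} e = transᴾ (expand t) (transᴾ (combine-cong e) (symᴾ (expand u)))

  permute-inverse : ∀ w (σ : OP̃ n r) → permute w (permute (flip w) σ) ≡ σ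
  permute-inverse w σ = ≡.trans (permute-∘ w (flip w) Perm.id σ (λ i → ≡.sym (Perm.inverseʳ w))) (op̃-≡ (Vec.tabulate∘lookup (place σ)))

  recolour-inverse : ∀ c d (σ : OP̃ n r) → (∀ i → c i ⊕ d i ≡ zero) → recolour c (recolour d σ) ≡ σ
  recolour-inverse c d (mkOP̃ q v ne) e = op̃-≡ (≡.trans (recolourPlaces-⊕ c d v) (vec-ext λ i → ≡.trans (Vec.lookup∘tabulate _ i)
    (≡.trans (≡.cong (λ c → recolourPlace c (lookup v i)) (e i)) (recolourPlace-zero (lookup v i)))))

  untranslate : ℤ r ≀𝔖 n → OP̃ n r → OP̃ n r
  untranslate (c ⋉ w) τ = permute (flip w) (recolour (λ i → ⊖ c i) τ)

  translate-untranslate : ∀ g τ → translateσ g (untranslate g τ) ≡ τ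
  translate-untranslate (c ⋉ w) τ = ≡.trans (≡.cong (recolour c) (permute-inverse w (recolour (λ i → ⊖ c i) τ))) (recolour-inverse c (λ i → ⊖ c i) τ (λ i → ⊖-inverse (c i)))

  untranslate-translate : ∀ g σ → untranslate g (translateσ g σ) ≡ σ
  untranslate-translate (c ⋉ w) σ = ≡.trans (≡.cong (permute (flip w)) (recolour-inverse (λ i → ⊖ c i) c (permute w σ) (λ i → ≡.trans (⊕-comm (⊖ c i) (c i)) (⊖-inverse (c i)))))
    (≡.trans (permute-∘ (flip w) w Perm.id σ (λ i → ≡.sym (Perm.inverseˡ w))) (op̃-≡ (Vec.tabulate∘lookup (place σ))))

  to : Ω → T.Carrierᴹ
  to f = combine λ σ → averaged σ f

  private
    module Q = Module (Rep.space SR)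
    ρT = Rep.ρ (K[OP̃] ⊗ det)
    module ρT g = IsModuleHomomorphism (Rep.linear (K[OP̃] ⊗ det) g)

  to-cong : ∀ {f g} → f Q.≈ᴹ g → to f ≈T to g
  to-cong {f} {g} q = combine-cong λ σ → trans (solve 2 (λ a b → a := (a :+ (:- :1) :* b) :+ b) refl (averaged σ f) (averaged σ g))
    (trans (+-congʳ (trans (+-congˡ (sym (averaged-κ σ (- 1#) g))) (trans (sym (averaged-∔ σ f _)) (averaged-gen σ (SI⊆Gen q))))) (+-identityˡ _))

  to-linear : IsLinear (Rep.space SR) Target to
  to-linear = mkLinear (Rep.space SR) Target to (λ {f} {g} → to-cong {f} {g})
    (λ f g → transᴾ (combine-cong λ σ → averaged-∔ σ f g) (combine-+ _ _))
    (λ c f → transᴾ (combine-cong λ σ → averaged-κ σ c f) (combine-* c _))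

  to-injective : ∀ {f g} → to f ≈T to g → f Q.≈ᴹ g
  to-injective {f} {g} e = Gen⊆SI (kernel⊆Gen _ λ σ → trans (averaged-∔ σ f _) (trans (+-congˡ (averaged-κ σ (- 1#) g))
    (trans (+-congʳ (trans (sym (coordinate-combine σ λ σ → averaged σ f)) (trans (coordinate-cong σ e) (coordinate-combine σ λ σ → averaged σ g))))
      (solve 1 (λ a → a :+ (:- :1) :* a := :0) refl _))))

  to-surjective : ∀ t → ∃ λ f → ∀ {g} → g Q.≈ᴹ f → to g ≈T t
  to-surjective t = let f , e = averaged-surjective (λ σ → coordinate σ t) in
    f , λ {g} q → transᴾ (to-cong {g} {f} q) (coordinates-determine λ σ → trans (coordinate-combine σ _) (e σ))

  -- Compare coordinates at τ: on the side of the target only the partition that g maps to τ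
  -- contributes, and `averaged-act` supplies its factor.
  to-equivariant : ∀ g f → to (act g f) ≈T ρT g (to f)
  to-equivariant g@(c ⋉ w) f = coordinates-determine λ τ → trans (coordinate-combine τ _) (sym (at τ)) where
    sum-ρ : ∀ (t : Fin N → T.Carrierᴹ) → ρT g (⊕.sumᴹ t) ≈T ⊕.sumᴹ λ i → ρT g (t i)
    sum-ρ = ⊕.sumᴹ-linear (ρT g) (Rep.linear (K[OP̃] ⊗ det) g)
    at : ∀ τ → coordinate τ (ρT g (to f)) ≈ averaged τ (act g f)
    at τ = begin
      coordinate τ (ρT g (to f)) ≈⟨ coordinate-cong τ (transᴾ (ρT.⟦⟧-cong g (combine-def _)) (sum-ρ _)) ⟩
      coordinate τ (⊕.sumᴹ λ i → ρT g (averaged (partition i) f • basis i)) ≈⟨ coordinate-sum τ _ ⟩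
      sum (λ i → averaged (partition i) f * ((scalar c (permute w (partition i)) * ⟦ op̃-≟ (translateσ g (partition i)) τ ⟧?) * (determinant (matrix g) * 1#)))
        ≈⟨ sum-cong (λ i → trans (solve 4 (λ a s d D → a :* ((s :* d) :* (D :* :1)) := ((D :* s) :* a) :* d) refl _ _ _ _)
             (*-congʳ (sym (averaged-act c w (partition i) f)))) ⟩
      sum (λ i → averaged (translateσ g (partition i)) (act g f) * ⟦ op̃-≟ (translateσ g (partition i)) τ ⟧?)
        ≈⟨ sum-single (index σ) _ (λ j j≢ → trans (*-congˡ (⟦⟧?-no (op̃-≟ (translateσ g (partition j)) τ) λ e → contradiction
             (≡.trans (≡.sym (index-partition j)) (≡.cong index (≡.trans (≡.sym (untranslate-translate g (partition j))) (≡.cong (untranslate g) e)))) j≢)) (zeroʳ _)) ⟩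
      averaged (translateσ g (partition (index σ))) (act g f) * ⟦ op̃-≟ (translateσ g (partition (index σ))) τ ⟧?
        ≈⟨ *-cong (reflexive (≡.cong (λ σ → averaged σ (act g f)) hit)) (⟦⟧?-yes (op̃-≟ (translateσ g (partition (index σ))) τ) hit) ⟩
      averaged τ (act g f) * 1# ≈⟨ *-identityʳ _ ⟩
      averaged τ (act g f) ∎ where
      σ : OP̃ n r
      σ = untranslate g τ
      hit : translateσ g (partition (index σ)) ≡ τ
      hit = ≡.trans (≡.cong (translateσ g) (partition-index σ)) (translate-untranslate g τ)

  isomorphism : SR ≅ K[OP̃] ⊗ det
  isomorphism = record
    { to = to
    ; isIsomorphism = record
      { isModuleMonomorphism = record { isModuleHomomorphism = to-linear ; injective = λ {f} {g} → to-injective {f} {g} }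
      ; surjective = to-surjective
      }
    ; equivariant = to-equivariant
    }

-- Rational arithmetic

𝔽 : CommutativeRing 0ℓ 0ℓ
𝔽 = record { isCommutativeRing = ℚ-isCommutativeRing }

module Rationals where
  open ≡ using (refl; sym; trans; cong; cong₂; subst; subst₂)
  open import Data.Rational.Base using (½; ∣_∣; _≤_; _<_)
  open import Data.Rational.Properties public using (<⇒≤; ≤-refl; ≤-trans; <-≤-trans; ≤-<-trans; ≰⇒>)
  open CommutativeRing 𝔽 public using (_+_; _*_; -_; +-identityˡ; +-identityʳ; +-assoc; +-comm; *-identityˡ; *-identityʳ; *-assoc; *-comm; zeroˡ; zeroʳ; -‿inverseʳ; distribˡ; distribʳ)
  open Solver 𝔽 public
  open LinearAlgebra 𝔽 public using (fromℕ; x∙yz≈y∙xz; x∙yz≈z∙xy; x∙yz≈yz∙x; x∙yz≈yx∙z; xy∙z≈zx∙y)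
  open RawSemiringOps (Semiring.rawSemiring (CommutativeRing.semiring 𝔽)) public using (_^_)

  ≡⇒≤ : ∀ {p q} → p ≡ q → p ≤ q
  ≡⇒≤ refl = ≤-refl

  <⇒≱ : ∀ {p q} → p < q → ¬ (q ≤ p)
  <⇒≱ p<q q≤p = ℚ.<-irrefl refl (<-≤-trans p<q q≤p)

  0<1 : 0ℚ < 1ℚ
  0<1 = ℚ.positive⁻¹ 1ℚ

  0≤1 : 0ℚ ≤ 1ℚ
  0≤1 = <⇒≤ 0<1

  0<½ : 0ℚ < ½
  0<½ = ℚ.positive⁻¹ ½

  opaque
    unfolding _+ᵒ_

    close⇒ : ∀ {e} p q → Close e p q → ∣ p + - q ∣ < e
    close⇒ p q c = c

    ⇒close : ∀ {e} p q → ∣ p + - q ∣ < e → Close e p q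
    ⇒close p q c = c

    ½+½ : ½ + ½ ≡ 1ℚ
    ½+½ = refl

    +-mono-≤ : ∀ {a b c d} → a ≤ b → c ≤ d → a + c ≤ b + d
    +-mono-≤ = ℚ.+-mono-≤

    +-mono-≤-< : ∀ {a b c d} → a ≤ b → c < d → a + c < b + d
    +-mono-≤-< = ℚ.+-mono-≤-<

    *-mono-≤ : ∀ {a b c d} → 0ℚ ≤ a → a ≤ b → 0ℚ ≤ c → c ≤ d → a * c ≤ b * d
    *-mono-≤ {a} {b} {c} {d} 0≤a a≤b 0≤c c≤d = ≤-trans
      (ℚ.*-monoʳ-≤-nonNeg c {{ℚ.nonNegative 0≤c}} a≤b) (ℚ.*-monoˡ-≤-nonNeg b {{ℚ.nonNegative (≤-trans 0≤a a≤b)}} c≤d)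

    *-monoˡ : ∀ {a b c} → 0ℚ ≤ c → a ≤ b → a * c ≤ b * c
    *-monoˡ {c = c} 0≤c = ℚ.*-monoʳ-≤-nonNeg c {{ℚ.nonNegative 0≤c}}

    *-mono-< : ∀ {a b c} → 0ℚ < c → a < b → a * c < b * c
    *-mono-< {c = c} 0<c a<b = ℚ.*-monoˡ-<-pos c {{ℚ.positive 0<c}} a<b

    neg-mono-≤ : ∀ {a b} → a ≤ b → - b ≤ - a
    neg-mono-≤ = ℚ.neg-antimono-≤

    abs-+ : ∀ a b → ∣ a + b ∣ ≤ ∣ a ∣ + ∣ b ∣
    abs-+ = ℚ.∣p+q∣≤∣p∣+∣q∣

    abs-* : ∀ a b → ∣ a * b ∣ ≡ ∣ a ∣ * ∣ b ∣
    abs-* = ℚ.∣p*q∣≡∣p∣*∣q∣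

    abs-neg : ∀ a → ∣ - a ∣ ≡ ∣ a ∣
    abs-neg = ℚ.∣-p∣≡∣p∣

    ≤-abs : ∀ a → a ≤ ∣ a ∣
    ≤-abs a with ℚ.≤-total 0ℚ a
    ... | inj₁ 0≤a = ≡⇒≤ (sym (ℚ.0≤p⇒∣p∣≡p 0≤a))
    ... | inj₂ a≤0 = ≤-trans a≤0 (ℚ.0≤∣p∣ a)

    -- Total, with the value 0 at 0, so that it can be applied along a Cauchy sequence of which only
    -- a tail is known to be apart from 0.
    recip : ℚ → ℚ
    recip p with p ℚ.≟ 0ℚ
    ... | yes _ = 0ℚ
    ... | no p≢0 = ℚ.1/_ p {{ℚ.≢-nonZero p≢0}}

    recip-inverse : ∀ {p} → p ≢ 0ℚ → p * recip p ≡ 1ℚ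
    recip-inverse {p} p≢0 with p ℚ.≟ 0ℚ
    ... | yes e = contradiction e p≢0
    ... | no p≢0′ = ℚ.*-inverseʳ p {{ℚ.≢-nonZero p≢0′}}

    recip-pos : ∀ {p} → 0ℚ < p → 0ℚ < recip p
    recip-pos {p} 0<p with p ℚ.≟ 0ℚ
    ... | yes e = contradiction (subst (0ℚ <_) e 0<p) (ℚ.<-irrefl refl)
    ... | no p≢0′ = ℚ.positive⁻¹ _ {{ℚ.1/pos⇒pos p {{ℚ.positive 0<p}}}}

    fromℕ-toℚᵘ : ∀ k → ℚ.toℚᵘ (fromℕ k) ℚᵘ.≃ ℚᵘ.mkℚᵘ (ℤ.+ k) 0
    fromℕ-toℚᵘ zero = ℚᵘ.≃-refl
    fromℕ-toℚᵘ (suc k) = ℚᵘ.≃-trans (ℚ.toℚᵘ-homo-+ 1ℚ (fromℕ k)) (ℚᵘ.≃-trans (ℚᵘ.+-congʳ (ℚ.toℚᵘ 1ℚ) (fromℕ-toℚᵘ k))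
      (ℚᵘ.*≡* (cong (ℤ._* ℤ.+ 1) (trans (cong₂ ℤ._+_ (ℤ.*-identityʳ (ℤ.+ 1)) (ℤ.*-identityʳ (ℤ.+ k))) refl))))

    archimedes : ∀ p → ∃ λ k → p ≤ fromℕ k
    archimedes p@(ℚ.mkℚ a d _) = ℤ.∣ a ∣ , ℚ.toℚᵘ-cancel-≤ (ℚᵘ.≤-respʳ-≃ (ℚᵘ.≃-sym (fromℕ-toℚᵘ ℤ.∣ a ∣))
      (ℚᵘ.*≤* (ℤ.≤-trans (ℤ.≤-reflexive (ℤ.*-identityʳ a)) (ℤ.≤-trans (a≤∣a∣ a)
        (ℤ.≤-trans (ℤ.≤-reflexive (sym (ℤ.*-identityʳ (ℤ.+ ℤ.∣ a ∣)))) (ℤ.*-monoˡ-≤-nonNeg (ℤ.+ ℤ.∣ a ∣) (ℤ.+≤+ (s≤s z≤n))))))))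
      where
      a≤∣a∣ : ∀ a → a ℤ.≤ ℤ.+ ℤ.∣ a ∣
      a≤∣a∣ (ℤ.+ n) = ℤ.≤-refl
      a≤∣a∣ ℤ.-[1+ n ] = ℤ.-≤+

  abs-nonneg : ∀ a → 0ℚ ≤ ∣ a ∣
  abs-nonneg = ℚ.0≤∣p∣

  abs-≥0 : ∀ {a} → 0ℚ ≤ a → ∣ a ∣ ≡ a
  abs-≥0 = ℚ.0≤p⇒∣p∣≡p

  abs-swap : ∀ a b → ∣ a + - b ∣ ≡ ∣ b + - a ∣
  abs-swap a b = trans (sym (abs-neg (a + - b))) (cong ∣_∣ (solve 2 (λ a b → :- (a :- b) := b :- a) refl a b))

  0≤+ : ∀ {a b} → 0ℚ ≤ a → 0ℚ ≤ b → 0ℚ ≤ a + b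
  0≤+ {a} {b} p q = subst (_≤ a + b) (+-identityˡ 0ℚ) (+-mono-≤ p q)

  0≤* : ∀ {a b} → 0ℚ ≤ a → 0ℚ ≤ b → 0ℚ ≤ a * b
  0≤* {a} {b} p q = subst (_≤ a * b) (zeroˡ 0ℚ) (*-mono-≤ ≤-refl p ≤-refl q)

  0<* : ∀ {a b} → 0ℚ < a → 0ℚ < b → 0ℚ < a * b
  0<* {a} {b} p q = subst (_< a * b) (zeroˡ b) (*-mono-< q p)

  0<⇒≢0 : ∀ {a} → 0ℚ < a → a ≢ 0ℚ
  0<⇒≢0 0<a refl = ℚ.<-irrefl refl 0<a

  *-recip : ∀ {a} → 0ℚ < a → a * recip a ≡ 1ℚ
  *-recip 0<a = recip-inverse (0<⇒≢0 0<a)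

  0≤fromℕ : ∀ k → 0ℚ ≤ fromℕ k
  0≤fromℕ zero = ≤-refl
  0≤fromℕ (suc k) = 0≤+ 0≤1 (0≤fromℕ k)

  fromℕ-mono : ∀ {j k} → j ℕ.≤ k → fromℕ j ≤ fromℕ k
  fromℕ-mono {k = k} z≤n = 0≤fromℕ k
  fromℕ-mono (s≤s j≤k) = +-mono-≤ ≤-refl (fromℕ-mono j≤k)

  1≤fromℕ : ∀ k → 1ℚ ≤ fromℕ (suc k)
  1≤fromℕ k = subst (_≤ fromℕ (suc k)) (+-identityʳ 1ℚ) (+-mono-≤ (≤-refl {1ℚ}) (0≤fromℕ k))

  0<^ : ∀ {a} k → 0ℚ < a → 0ℚ < a ^ k
  0<^ zero 0<a = 0<1
  0<^ (suc k) 0<a = 0<* 0<a (0<^ k 0<a)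

  ^≤1 : ∀ {a} k → 0ℚ ≤ a → a ≤ 1ℚ → a ^ k ≤ 1ℚ
  ^≤1 zero 0≤a a≤1 = ≤-refl
  ^≤1 {a} (suc k) 0≤a a≤1 = subst (a * a ^ k ≤_) (*-identityˡ 1ℚ) (*-mono-≤ 0≤a a≤1 (0≤^ k) (^≤1 k 0≤a a≤1)) where
    0≤^ : ∀ k → 0ℚ ≤ a ^ k
    0≤^ zero = 0≤1
    0≤^ (suc k) = 0≤* 0≤a (0≤^ k)

  ½x+½x : ∀ x → ½ * x + ½ * x ≡ x
  ½x+½x x = trans (sym (distribʳ x ½ ½)) (trans (cong (_* x) ½+½) (*-identityˡ x))

  ½-power : ∀ k → ½ ^ k * fromℕ (suc k) ≤ 1ℚ
  ½-power zero = ≡⇒≤ (trans (*-identityˡ _) (+-identityʳ 1ℚ))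
  ½-power (suc k) = ≤-trans (subst₂ _≤_
      (solve 3 (λ h p x → p :* (h :* (:1 :+ x)) := (h :* p) :* (:1 :+ x)) refl ½ (½ ^ k) (fromℕ (suc k)))
      (cong (½ ^ k *_) (trans (distribˡ ½ _ _) (½x+½x (fromℕ (suc k)))))
      (*-mono-≤ (<⇒≤ (0<^ k 0<½)) ≤-refl (0≤* (<⇒≤ 0<½) (0≤fromℕ (suc (suc k))))
        (*-mono-≤ (<⇒≤ 0<½) ≤-refl (0≤fromℕ (suc (suc k))) (+-mono-≤ (1≤fromℕ k) ≤-refl))))
    (½-power k)

  -- The bound of `½-power` makes powers of 1/2 decay at least like 1/(k + 1), and the Archimedean
  -- property does the rest.
  ½-small : ∀ C e → 0ℚ < e → ∃ λ k → C * ½ ^ k < e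
  ½-small C e 0<e = let k , C≤k = archimedes (C * recip e) in k , ≤-<-trans
    (subst₂ _≤_ (trans (solve 4 (λ c r h e → c :* r :* (h :* e) := c :* h :* (e :* r)) refl C (recip e) (½ ^ k) e)
        (trans (cong (C * ½ ^ k *_) (*-recip 0<e)) (*-identityʳ _)))
      (x∙yz≈yx∙z (fromℕ k) (½ ^ k) e)
      (*-monoˡ (0≤* (<⇒≤ (0<^ k 0<½)) (<⇒≤ 0<e)) C≤k))
    (subst (½ ^ k * fromℕ k * e <_) (*-identityˡ e) (*-mono-< 0<e (<-≤-trans (step k) (½-power k)))) where
    step : ∀ k → ½ ^ k * fromℕ k < ½ ^ k * fromℕ (suc k)
    step k = subst₂ _<_ (+-identityʳ _) (solve 2 (λ h k → h :* k :+ h := h :* (:1 :+ k)) refl (½ ^ k) (fromℕ k))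
      (+-mono-≤-< (≤-refl {½ ^ k * fromℕ k}) (0<^ k 0<½))

-- Coordinates of different orders of magnitude

-- Positions are counted from the end, because the coordinate at i is going to have the order
-- ε^(after i + 1), the last one being the largest.
after : Fin q → ℕ
after {suc q} zero = q
after (suc i) = after i

after+toℕ : (i : Fin q) → after i ℕ.+ suc (toℕ i) ≡ q
after+toℕ {suc q} zero = ℕ.+-comm q 1
after+toℕ {suc q} (suc i) = ≡.trans (ℕ.+-suc (after i) (suc (toℕ i))) (≡.cong suc (after+toℕ i))

after< : (i : Fin q) → after i ℕ.< q
after< i = ≡.subst (after i ℕ.<_) (after+toℕ i) (ℕ.m<m+n (after i) (s≤s z≤n))

after-injective : ∀ {i j : Fin q} → after i ≡ after j → i ≡ j
after-injective {i = zero} {zero} e = ≡.refl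
after-injective {i = zero} {suc j} e = contradiction (≡.sym e) (ℕ.<⇒≢ (after< j))
after-injective {i = suc i} {zero} e = contradiction e (ℕ.<⇒≢ (after< i))
after-injective {i = suc i} {suc j} e = ≡.cong suc (after-injective e)

after-surjective : ∀ a → a ℕ.< q → ∃ λ (i : Fin q) → after i ≡ a
after-surjective {suc q} a a<q with a ℕ.≟ q
... | yes ≡.refl = zero , ≡.refl
... | no a≢q = let i , e = after-surjective a (ℕ.≤∧≢⇒< (ℕ.s≤s⁻¹ a<q) a≢q) in suc i , e

triangle : ℕ → ℕ
triangle zero = 0
triangle (suc a) = triangle a ℕ.+ suc a

module Perturbation (K : CommutativeRing 0ℓ 0ℓ) (ε : CommutativeRing.Carrier K) where
  open CommutativeRing K hiding (zero)
  open LinearAlgebra K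
  open Solver K
  open Elementary K
  open Exp semiring using (^-congʳ; ^-homo-*)
  open SetoidReasoning setoid

  -- elem and welem of degree a at the point with coordinates εᵇ ηᵦ, divided by ε^(1 + ⋯ + a).
  G : (η : Fin q → Carrier) → ℕ → Carrier
  G η zero = 1#
  G {zero} η (suc a) = 0#
  G {suc q} η (suc a) = G (η ∘ suc) (suc a) + ε ^ (q ∸ a) * (η zero * G (η ∘ suc) a)

  H : (m η : Fin q → Carrier) → ℕ → Carrier
  H m η zero = 0#
  H {zero} m η (suc a) = 0#
  H {suc q} m η (suc a) = H (m ∘ suc) (η ∘ suc) (suc a) +
    ε ^ (q ∸ a) * (η zero * (H (m ∘ suc) (η ∘ suc) a + m zero * G (η ∘ suc) a))

  point′ : (Fin q → Carrier) → Fin q → Carrier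
  point′ η i = ε ^ suc (after i) * η i

  prod : (Fin q → Carrier) → Fin q → Carrier
  prod {suc zero} η zero = η zero
  prod {suc (suc q)} η zero = η zero * prod (η ∘ suc) zero
  prod η (suc i) = prod (η ∘ suc) i

  total : (Fin q → Carrier) → Fin q → Carrier
  total {suc zero} m zero = m zero
  total {suc (suc q)} m zero = m zero + total (m ∘ suc) zero
  total m (suc i) = total (m ∘ suc) i

  Rest : (m η : Fin q → Carrier) → Fin q → Carrier
  Rest m η zero = 0#
  Rest m η (suc i) = Rest (m ∘ suc) (η ∘ suc) i +
    ε ^ toℕ i * (η zero * (H (m ∘ suc) (η ∘ suc) (after i) + m zero * G (η ∘ suc) (after i)))

  G-beyond : ∀ (η : Fin q → Carrier) a → q ℕ.< a → G η a ≈ 0#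
  G-beyond {zero} η (suc a) lt = refl
  G-beyond {suc q} η (suc a) (s≤s lt) = trans (+-cong (G-beyond (η ∘ suc) (suc a) (ℕ.m<n⇒m<1+n lt)) (*-congˡ (*-congˡ (G-beyond (η ∘ suc) a lt))))
    (solve 2 (λ e h → :0 :+ e :* (h :* :0) := :0) refl _ _)

  H-beyond : ∀ (m η : Fin q → Carrier) a → q ℕ.< a → H m η a ≈ 0#
  H-beyond {zero} m η (suc a) lt = refl
  H-beyond {suc q} m η (suc a) (s≤s lt) = trans (+-cong (H-beyond (m ∘ suc) (η ∘ suc) (suc a) (ℕ.m<n⇒m<1+n lt))
      (*-congˡ (*-congˡ (+-cong (H-beyond (m ∘ suc) (η ∘ suc) a lt) (*-congˡ (G-beyond (η ∘ suc) a lt))))))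
    (solve 3 (λ e h m → :0 :+ e :* (h :* (:0 :+ m :* :0)) := :0) refl _ _ _)

  private
    shift : ∀ q a → a ℕ.≤ q → suc q ℕ.+ triangle a ≡ triangle (suc a) ℕ.+ (q ∸ a)
    shift q a a≤q = ≡.trans (ℕ.+-comm (suc q) (triangle a)) (≡.trans (≡.cong (λ q → triangle a ℕ.+ suc q) (≡.sym (ℕ.m+[n∸m]≡n a≤q)))
      (≡.sym (ℕ.+-assoc (triangle a) (suc a) (q ∸ a))))

    rescale : ∀ q a x → (q ℕ.< a → x ≈ 0#) → ε ^ suc q * (ε ^ triangle a * x) ≈ ε ^ triangle (suc a) * (ε ^ (q ∸ a) * x)
    rescale q a x z with a ℕ.≤? q
    ... | yes a≤q = trans (sym (*-assoc _ _ _)) (trans (*-congʳ (trans (sym (^-homo-* ε (suc q) (triangle a)))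
            (trans (^-congʳ ε (shift q a a≤q)) (^-homo-* ε (triangle (suc a)) (q ∸ a))))) (*-assoc _ _ _))
    ... | no a≰q = trans (trans (*-congˡ (trans (*-congˡ x≈0) (zeroʳ _))) (zeroʳ _)) (sym (trans (*-congˡ (trans (*-congˡ x≈0) (zeroʳ _))) (zeroʳ _)))
      where x≈0 = z (ℕ.≰⇒> a≰q)

  elem-scaled : ∀ (η : Fin q → Carrier) a → elem (point′ η) a ≈ ε ^ triangle a * G η a
  elem-scaled η zero = sym (*-identityˡ 1#)
  elem-scaled {zero} η (suc a) = sym (zeroʳ _)
  elem-scaled {suc q} η (suc a) = begin
    elem (point′ (η ∘ suc)) (suc a) + (ε ^ suc q * η zero) * elem (point′ (η ∘ suc)) a
      ≈⟨ +-cong (elem-scaled (η ∘ suc) (suc a)) (*-congˡ (elem-scaled (η ∘ suc) a)) ⟩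
    t * G (η ∘ suc) (suc a) + (ε ^ suc q * η zero) * (ε ^ triangle a * G (η ∘ suc) a)
      ≈⟨ +-congˡ (trans (solve 4 (λ e h t g → (e :* h) :* (t :* g) := e :* (t :* (h :* g))) refl _ _ _ _)
           (rescale q a _ λ lt → trans (*-congˡ (G-beyond (η ∘ suc) a lt)) (zeroʳ _))) ⟩
    t * G (η ∘ suc) (suc a) + t * (ε ^ (q ∸ a) * (η zero * G (η ∘ suc) a)) ≈⟨ distribˡ _ _ _ ⟨
    t * G η (suc a) ∎
    where t = ε ^ triangle (suc a)

  welem-scaled : ∀ (m η : Fin q → Carrier) a → welem m (point′ η) a ≈ ε ^ triangle a * H m η a
  welem-scaled m η zero = sym (zeroʳ _)
  welem-scaled {zero} m η (suc a) = sym (zeroʳ _)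
  welem-scaled {suc q} m η (suc a) = begin
    welem (m ∘ suc) (point′ (η ∘ suc)) (suc a) + (ε ^ suc q * η zero) * (welem (m ∘ suc) (point′ (η ∘ suc)) a + m zero * elem (point′ (η ∘ suc)) a)
      ≈⟨ +-cong (welem-scaled (m ∘ suc) (η ∘ suc) (suc a)) (*-congˡ (+-cong (welem-scaled (m ∘ suc) (η ∘ suc) a) (*-congˡ (elem-scaled (η ∘ suc) a)))) ⟩
    t * H (m ∘ suc) (η ∘ suc) (suc a) + (ε ^ suc q * η zero) * (ε ^ triangle a * h + m zero * (ε ^ triangle a * g))
      ≈⟨ +-congˡ (trans (solve 6 (λ e η t h m g → (e :* η) :* (t :* h :+ m :* (t :* g)) := e :* (t :* (η :* (h :+ m :* g)))) refl _ (η zero) _ h (m zero) g)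
           (rescale q a _ λ lt → trans (*-congˡ (trans (+-cong (H-beyond (m ∘ suc) (η ∘ suc) a lt) (*-congˡ (G-beyond (η ∘ suc) a lt)))
             (solve 1 (λ m → :0 :+ m :* :0 := :0) refl (m zero)))) (zeroʳ _))) ⟩
    t * H (m ∘ suc) (η ∘ suc) (suc a) + t * (ε ^ (q ∸ a) * (η zero * (h + m zero * g))) ≈⟨ distribˡ _ _ _ ⟨
    t * H m η (suc a) ∎ where
    t = ε ^ triangle (suc a)
    h = H (m ∘ suc) (η ∘ suc) a
    g = G (η ∘ suc) a

  G-top : (η : Fin (suc q) → Carrier) → G η (suc q) ≈ prod η zero
  G-top {zero} η = solve 1 (λ h → :0 :+ :1 :* (h :* :1) := h) refl (η zero)
  G-top {suc q} η = trans (+-cong (G-beyond (η ∘ suc) (suc (suc q)) ℕ.≤-refl) (*-cong (^-congʳ ε (ℕ.n∸n≡0 q)) (*-congˡ (G-top (η ∘ suc)))))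
    (solve 2 (λ h p → :0 :+ :1 :* (h :* p) := h :* p) refl (η zero) _)

  H-top : (m η : Fin (suc q) → Carrier) → H m η (suc q) ≈ total m zero * prod η zero
  H-top {zero} m η = solve 2 (λ h m → :0 :+ :1 :* (h :* (:0 :+ m :* :1)) := m :* h) refl (η zero) (m zero)
  H-top {suc q} m η = trans (+-cong (H-beyond (m ∘ suc) (η ∘ suc) (suc (suc q)) ℕ.≤-refl)
      (*-cong (^-congʳ ε (ℕ.n∸n≡0 q)) (*-congˡ (+-cong (H-top (m ∘ suc) (η ∘ suc)) (*-congˡ (G-top (η ∘ suc)))))))
    (solve 4 (λ h t p m → :0 :+ :1 :* (h :* (t :* p :+ m :* p)) := (m :+ t) :* (h :* p)) refl (η zero) _ _ (m zero))

  -- Among the sets of after i + 1 positions, the one consisting of i and all later positions has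
  -- the largest order of magnitude. It contributes the product of `total` and `prod`, and every
  -- other set has at least one more factor ε.
  H-split : ∀ (m η : Fin q → Carrier) i → H m η (suc (after i)) ≈ total m i * prod η i + ε * Rest m η i
  H-split {suc q} m η zero = trans (H-top m η) (solve 2 (λ t e → t := t :+ e :* :0) refl _ ε)
  H-split {suc q} m η (suc i) = trans (+-cong (H-split (m ∘ suc) (η ∘ suc) i) (*-congʳ (^-congʳ ε exponent)))
    (solve 5 (λ t e r p x → (t :+ e :* r) :+ (e :* p) :* x := t :+ e :* (r :+ p :* x)) refl _ ε _ (ε ^ toℕ i) _) where
    exponent : q ∸ after i ≡ suc (toℕ i)
    exponent = ≡.trans (≡.cong (_∸ after i) (≡.sym (after+toℕ i))) (ℕ.m+n∸m≡n (after i) (suc (toℕ i)))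

-- Invertibility of 1 - ζᵏ and of complex numbers

module RootsOfUnity (K : CommutativeRing 0ℓ 0ℓ) (local : LinearAlgebra.IsLocal K) where
  open CommutativeRing K hiding (zero)
  open LinearAlgebra K
  open Solver K
  open Exp semiring using (^-congˡ; ^-congʳ; ^-assocʳ)
  open SetoidReasoning setoid

  module _ (z : Carrier) where

    geo : ℕ → Carrier
    geo zero = 0#
    geo (suc k) = geo k + z ^ k

    geo-telescope : ∀ k → (1# + - z) * geo k ≈ 1# + - z ^ k
    geo-telescope zero = solve 1 (λ z → (:1 :- z) :* :0 := :1 :- :1) refl z
    geo-telescope (suc k) = trans (distribˡ _ _ _) (trans (+-congʳ (geo-telescope k))
      (solve 2 (λ p z → (:1 :- p) :+ (:1 :- z) :* p := :1 :- z :* p) refl (z ^ k) z))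

    -- Each 1 - zⁱ is a multiple of 1 - z. So if the geometric sum vanishes, the invertible number k
    -- is a multiple of 1 - z.
    geo-defect : ∀ k → ∃ λ q → (1# + - z) * q ≈ fromℕ k + - geo k
    geo-defect zero = 0# , solve 1 (λ z → (:1 :- z) :* :0 := :0 :- :0) refl z
    geo-defect (suc k) = let q , e = geo-defect k in q + geo k ,
      trans (distribˡ _ _ _) (trans (+-cong e (geo-telescope k))
        (solve 3 (λ f g p → (f :- g) :+ (:1 :- p) := (:1 :+ f) :- (g :+ p)) refl (fromℕ k) (geo k) (z ^ k)))

    pow-fixes : ∀ {S} → z * S ≈ S → ∀ k → z ^ k * S ≈ S
    pow-fixes e zero = *-identityˡ _
    pow-fixes e (suc k) = trans (*-assoc _ _ _) (trans (*-congˡ (pow-fixes e k)) e)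

    geo-multiple : ∀ {S} → z * S ≈ S → ∀ k → geo k * S ≈ fromℕ k * S
    geo-multiple e zero = refl
    geo-multiple e (suc k) = trans (distribʳ _ _ _) (trans (+-cong (geo-multiple e k) (pow-fixes e k))
      (solve 2 (λ f S → f :* S :+ S := (:1 :+ f) :* S) refl (fromℕ k) _))

    -- The idempotent (1 + z + ⋯ + z^(r-1)) / r is 0 or 1, and 1 is excluded.
    one-minus-root-unit : ∀ r → Unit (fromℕ r) → z ^ r ≈ 1# → ¬ (z ≈ 1#) → Unit (1# + - z)
    one-minus-root-unit r (u , ru) zr z≉1 = Sum.[ when-one , when-zero ]′ (local e (1# + - e) (solve 1 (λ e → e :+ (:1 :- e) := :1) refl e))
      where
      S e : Carrier
      S = geo r
      e = S * u
      x≈y : ∀ {x y} → x + - y ≈ 0# → x ≈ y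
      x≈y {x} {y} h = trans (solve 2 (λ x y → x := (x :- y) :+ y) refl x y) (trans (+-congʳ h) (+-identityˡ y))
      fixes : z * S ≈ S
      fixes = sym (x≈y (trans (solve 2 (λ z S → S :- z :* S := (:1 :- z) :* S) refl z S)
        (trans (geo-telescope r) (trans (+-congˡ (-‿cong zr)) (-‿inverseʳ 1#)))))
      idempotent : e * (1# + - e) ≈ 0#
      idempotent = begin
        e * (1# + - e) ≈⟨ solve 2 (λ S u → (S :* u) :* (:1 :- S :* u) := S :* u :- (S :* S) :* (u :* u)) refl S u ⟩
        S * u + - ((S * S) * (u * u)) ≈⟨ +-congˡ (-‿cong (*-congʳ (geo-multiple fixes r))) ⟩
        S * u + - ((fromℕ r * S) * (u * u)) ≈⟨ solve 3 (λ S u r → S :* u :- (r :* S) :* (u :* u) := S :* u :* (:1 :- r :* u)) refl S u (fromℕ r) ⟩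
        S * u * (1# + - (fromℕ r * u)) ≈⟨ *-congˡ (trans (+-congˡ (-‿cong ru)) (-‿inverseʳ 1#)) ⟩
        S * u * 0# ≈⟨ zeroʳ _ ⟩
        0# ∎
      when-one : Unit e → Unit (1# + - z)
      when-one ue = contradiction (begin
        z ≈⟨ *-identityʳ z ⟨
        z * 1# ≈⟨ *-congˡ e≈1 ⟨
        z * (S * u) ≈⟨ *-assoc _ _ _ ⟨
        (z * S) * u ≈⟨ *-congʳ fixes ⟩
        S * u ≈⟨ e≈1 ⟩
        1# ∎) z≉1 where
        e≈1 : e ≈ 1#
        e≈1 = sym (x≈y (unit-cancel ue idempotent))
      when-zero : Unit (1# + - e) → Unit (1# + - z)
      when-zero u1 = unit-factor (unit-cong (sym (proj₂ (geo-defect r))) (unit-cong (begin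
        fromℕ r ≈⟨ solve 1 (λ r → r := r :- :0) refl _ ⟩
        fromℕ r + - 0# ≈⟨ +-congˡ (-‿cong S≈0) ⟨
        fromℕ r + - S ∎) (u , ru))) where
        S≈0 : S ≈ 0#
        S≈0 = begin
          S ≈⟨ *-identityʳ S ⟨
          S * 1# ≈⟨ *-congˡ ru ⟨
          S * (fromℕ r * u) ≈⟨ x∙yz≈y∙xz S _ u ⟩
          fromℕ r * e ≈⟨ *-congˡ (unit-cancel u1 (trans (*-comm _ _) idempotent)) ⟩
          fromℕ r * 0# ≈⟨ zeroʳ _ ⟩
          0# ∎

  one-minus-power-unit : ∀ {r′ ζ} → Unit (fromℕ (suc r′)) → IsPrimitiveRoot K (suc r′) ζ →
    ∀ k → 0 ℕ.< k → k ℕ.< suc r′ → Unit (1# + - (ζ ^ k))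
  one-minus-power-unit {r′} {ζ} u (ζʳ , ζᵏ≉1) k 0<k k<r = one-minus-root-unit (ζ ^ k) (suc r′) u (begin
    (ζ ^ k) ^ suc r′ ≈⟨ ^-assocʳ ζ k (suc r′) ⟩
    ζ ^ (k ℕ.* suc r′) ≈⟨ ^-congʳ ζ (ℕ.*-comm k (suc r′)) ⟩
    ζ ^ (suc r′ ℕ.* k) ≈⟨ ^-assocʳ ζ (suc r′) k ⟨
    (ζ ^ suc r′) ^ k ≈⟨ ^-congˡ k ζʳ ⟩
    1# ^ k ≈⟨ one^ k ⟩
    1# ∎) (ζᵏ≉1 k 0<k k<r)

module Conjugates (R : CommutativeRing 0ℓ 0ℓ) where
  open CommutativeRing R hiding (refl; sym; trans)
  open Complexification R
  open Solver R

  norm-unit : ∀ z → LinearAlgebra.Unit R (re z * re z + im z * im z) → LinearAlgebra.Unit commutativeRing z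
  norm-unit (x +i y) (u , e) = (x * u) +i (- (y * u)) ,
    (CommutativeRing.trans R (solve 3 (λ x y u → x :* (x :* u) :- y :* (:- (y :* u)) := (x :* x :+ y :* y) :* u) (CommutativeRing.refl R) x y u) e) ,
    solve 3 (λ x y u → x :* (:- (y :* u)) :+ y :* (x :* u) := :0) (CommutativeRing.refl R) x y u

-- Real and complex numbers as local rings

open Rationals
open ≡ using (refl; sym; trans; cong; cong₂; subst; subst₂)
open import Data.Rational.Base using (½; ∣_∣; _≤_; _<_)

IsCauchy : (ℕ → ℚ) → Set
IsCauchy f = ∀ e → 0ℚ < e → ∃ λ N → ∀ j k → N ℕ.≤ j → N ℕ.≤ k → ∣ f j + - f k ∣ < e

-- The ring of real numbers behind an opaque boundary, seen through its sequences.
opaque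
  R : CommutativeRing 0ℓ 0ℓ
  R = ℝ-commutativeRing

private module R = CommutativeRing R

opaque
  unfolding R

  at : R.Carrier → ℕ → ℚ
  at = seq

  limit : (f : ℕ → ℚ) → IsCauchy f → R.Carrier
  limit f c = mkℝ f λ e 0<e → let N , h = c e 0<e in N , λ j k j≥ k≥ → ⇒close (f j) (f k) (h j k j≥ k≥)

  at-limit : ∀ f c k → at (limit f c) k ≡ f k
  at-limit f c k = refl

  at-+ : ∀ a b k → at (a R.+ b) k ≡ at a k + at b k
  at-+ a b k = refl

  at-* : ∀ a b k → at (a R.* b) k ≡ at a k * at b k
  at-* a b k = refl

  at-neg : ∀ a k → at (R.- a) k ≡ - at a k
  at-neg a k = refl

  at-0 : ∀ k → at R.0# k ≡ 0ℚ
  at-0 k = refl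

  at-1 : ∀ k → at R.1# k ≡ 1ℚ
  at-1 k = refl

  at-cauchy : ∀ a → IsCauchy (at a)
  at-cauchy a e 0<e = let N , h = cauchy a e 0<e in N , λ j k j≥ k≥ → close⇒ (seq a j) (seq a k) (h j k j≥ k≥)

  ≈-intro : ∀ {a b} → (∀ e → 0ℚ < e → ∃ λ N → ∀ k → N ℕ.≤ k → ∣ at a k + - at b k ∣ < e) → a R.≈ b
  ≈-intro {a} {b} h = mk≈ λ e 0<e → let N , c = h e 0<e in N , λ k k≥ → ⇒close (seq a k) (seq b k) (c k k≥)

  ≈-elim : ∀ {a b} → a R.≈ b → ∀ e → 0ℚ < e → ∃ λ N → ∀ k → N ℕ.≤ k → ∣ at a k + - at b k ∣ < e
  ≈-elim {a} {b} p e 0<e = let N , c = close p e 0<e in N , λ k k≥ → close⇒ (seq a k) (seq b k) (c k k≥)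

module Reals where

  Apart : R.Carrier → Set
  Apart a = ∃ λ δ → 0ℚ < δ × ∃ λ N → ∀ k → N ℕ.≤ k → δ ≤ ∣ at a k ∣

  difference-0 : ∀ {e p q} → 0ℚ < e → p ≡ q → ∣ p + - q ∣ < e
  difference-0 {e} {p} 0<e refl = subst (λ x → ∣ x ∣ < e) (sym (-‿inverseʳ p)) 0<e

  apart⇒≢0 : ∀ {δ x} → 0ℚ < δ → δ ≤ ∣ x ∣ → x ≢ 0ℚ
  apart⇒≢0 0<δ δ≤ refl = <⇒≱ 0<δ δ≤

  recip-close : ∀ {δ e x y} → 0ℚ < δ → 0ℚ < e → δ ≤ ∣ x ∣ → δ ≤ ∣ y ∣ → ∣ x + - y ∣ < e * δ * δ → ∣ recip x + - recip y ∣ < e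
  recip-close {δ} {e} {x} {y} 0<δ 0<e δ≤x δ≤y xy = ≰⇒> λ e≤w → <⇒≱ xy (≤-trans
    (*-mono-≤ (0≤* (<⇒≤ 0<e) (<⇒≤ 0<δ)) (*-mono-≤ (<⇒≤ 0<e) e≤w (<⇒≤ 0<δ) δ≤x) (<⇒≤ 0<δ) δ≤y) (≡⇒≤ product)) where
    w = recip x + - recip y
    product : ∣ w ∣ * ∣ x ∣ * ∣ y ∣ ≡ ∣ x + - y ∣
    product = trans (trans (cong (_* ∣ y ∣) (sym (abs-* w x))) (sym (abs-* (w * x) y)))
      (trans (cong ∣_∣ (trans (solve 4 (λ u v x y → (u :- v) :* x :* y := (x :* u) :* y :- (y :* v) :* x) refl (recip x) (recip y) x y)
        (trans (cong₂ (λ a b → a * y + - (b * x)) (recip-inverse (apart⇒≢0 0<δ δ≤x)) (recip-inverse (apart⇒≢0 0<δ δ≤y)))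
          (cong₂ (λ a b → a + - b) (*-identityˡ y) (*-identityˡ x))))) (abs-swap y x))

  apart⇒unit : ∀ {a} → Apart a → LinearAlgebra.Unit R a
  apart⇒unit {a} (δ , 0<δ , N , h) = b , ≈-intro λ e 0<e → N , λ k k≥ → difference-0 0<e
    (trans (at-* a b k) (trans (cong (at a k *_) (at-limit _ _ k)) (trans (recip-inverse (apart⇒≢0 0<δ (h k k≥))) (sym (at-1 k)))))
    where
    b : R.Carrier
    b = limit (λ k → recip (at a k)) λ e 0<e →
      let M , c = at-cauchy a (e * δ * δ) (0<* (0<* 0<e 0<δ) 0<δ)
      in N ℕ.⊔ M , λ j k j≥ k≥ → recip-close 0<δ 0<e
           (h j (ℕ.≤-trans (ℕ.m≤m⊔n N M) j≥)) (h k (ℕ.≤-trans (ℕ.m≤m⊔n N M) k≥))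
           (c j k (ℕ.≤-trans (ℕ.m≤n⊔m N M) j≥) (ℕ.≤-trans (ℕ.m≤n⊔m N M) k≥))

  ⅛ ¼ ⅜ : ℚ
  ⅛ = ½ * (½ * ½)
  ¼ = ½ * ½
  ⅜ = ¼ + ⅛

  0<⅛ : 0ℚ < ⅛
  0<⅛ = 0<* 0<½ (0<* 0<½ 0<½)

  opaque
    unfolding _+ᵒ_
    ⅞<1 : ⅜ + ⅜ + ⅛ < 1ℚ
    ⅞<1 = toWitness {a? = (⅜ + ⅜ + ⅛) ℚ.<? 1ℚ} tt

  abs-lower : ∀ {x y c d} → c + d ≤ ∣ x ∣ → ∣ x + - y ∣ < d → c ≤ ∣ y ∣
  abs-lower {x} {y} {c} {d} cd≤ xy = subst₂ _≤_ (solve 2 (λ c d → (c :+ d) :- d := c) refl c d) (solve 2 (λ a d → (a :+ d) :- d := a) refl ∣ y ∣ d)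
    (+-mono-≤ (≤-trans cd≤ (≤-trans (subst (λ z → ∣ z ∣ ≤ ∣ y ∣ + ∣ x + - y ∣) (solve 2 (λ x y → y :+ (x :- y) := x) refl x y) (abs-+ y (x + - y)))
      (+-mono-≤ (≤-refl {∣ y ∣}) (<⇒≤ xy)))) (≤-refl { - d}))

  -- Take an index from which a + b is within 1/8 of 1 and both sequences vary by less than 1/8. As
  -- 3/8 + 3/8 + 1/8 < 1, one of the two has absolute value at least 3/8 there, hence at least 1/4
  -- from then on. The rational comparison at this index is decidable.
  apart-summand : ∀ a b → a R.+ b R.≈ R.1# → Apart a ⊎ Apart b
  apart-summand a b a+b = decide (⅜ ℚ.≤? ∣ at a N ∣) (⅜ ℚ.≤? ∣ at b N ∣) where
    N₀ = proj₁ (≈-elim a+b ⅛ 0<⅛)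
    N₁ = proj₁ (at-cauchy a ⅛ 0<⅛)
    N₂ = proj₁ (at-cauchy b ⅛ 0<⅛)
    N = N₀ ℕ.⊔ (N₁ ℕ.⊔ N₂)
    0≤₁ : N₁ ℕ.≤ N
    0≤₁ = ℕ.≤-trans (ℕ.m≤m⊔n N₁ N₂) (ℕ.m≤n⊔m N₀ _)
    0≤₂ : N₂ ℕ.≤ N
    0≤₂ = ℕ.≤-trans (ℕ.m≤n⊔m N₁ N₂) (ℕ.m≤n⊔m N₀ _)
    decide : Dec (⅜ ≤ ∣ at a N ∣) → Dec (⅜ ≤ ∣ at b N ∣) → Apart a ⊎ Apart b
    decide (yes p) _ = inj₁ (¼ , 0<* 0<½ 0<½ , N , λ k k≥ → abs-lower p
      ((proj₂ (at-cauchy a ⅛ 0<⅛) N k 0≤₁ (ℕ.≤-trans 0≤₁ k≥))))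
    decide (no _) (yes p) = inj₂ (¼ , 0<* 0<½ 0<½ , N , λ k k≥ → abs-lower p
      ((proj₂ (at-cauchy b ⅛ 0<⅛) N k 0≤₂ (ℕ.≤-trans 0≤₂ k≥))))
    decide (no p) (no q) = contradiction (≤-trans bound (+-mono-≤ (+-mono-≤ (<⇒≤ (≰⇒> p)) (<⇒≤ (≰⇒> q))) (<⇒≤ near))) (<⇒≱ ⅞<1)
      where
      near : ∣ 1ℚ + - (at a N + at b N) ∣ < ⅛
      near = subst (_< ⅛) (abs-swap (at a N + at b N) 1ℚ) (subst₂ (λ x y → ∣ x + - y ∣ < ⅛) (at-+ a b N) (at-1 N) (proj₂ (≈-elim a+b ⅛ 0<⅛) N (ℕ.m≤m⊔n N₀ _)))
      bound : 1ℚ ≤ ∣ at a N ∣ + ∣ at b N ∣ + ∣ 1ℚ + - (at a N + at b N) ∣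
      bound = ≤-trans (subst (λ z → 1ℚ ≤ ∣ z ∣) (solve 2 (λ s o → o := s :+ (o :- s)) refl (at a N + at b N) 1ℚ) ≤-refl)
        (≤-trans (abs-+ (at a N + at b N) _) (+-mono-≤ (abs-+ (at a N) (at b N)) ≤-refl))

  square-abs : ∀ x → x * x ≡ ∣ x ∣ * ∣ x ∣
  square-abs x with ℚ.∣p∣≡p∨∣p∣≡-p x
  ... | inj₁ e = cong₂ _*_ (sym e) (sym e)
  ... | inj₂ e = trans (negneg x) (cong₂ _*_ (sym (trans e (neg x))) (sym (trans e (neg x)))) where
    opaque
      unfolding _+ᵒ_
      neg : ∀ x → ℚ.- x ≡ - x
      neg x = refl
    negneg : ∀ x → x * x ≡ (- x) * (- x)
    negneg = solve 1 (λ x → x :* x := (:- x) :* (:- x)) refl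

  apart-norm : ∀ {a} b → Apart a → Apart (a R.* a R.+ b R.* b)
  apart-norm {a} b (δ , 0<δ , N , h) = δ * δ , 0<* 0<δ 0<δ , N , λ k k≥ → subst (λ x → δ * δ ≤ ∣ x ∣)
    (sym (trans (at-+ _ _ k) (cong₂ _+_ (at-* a a k) (at-* b b k))))
    (≤-trans (subst₂ _≤_ (+-identityʳ _) (cong₂ _+_ (sym (square-abs (at a k))) (sym (square-abs (at b k))))
      (+-mono-≤ (*-mono-≤ (<⇒≤ 0<δ) (h k k≥) (<⇒≤ 0<δ) (h k k≥)) (0≤* (abs-nonneg (at b k)) (abs-nonneg (at b k))))) (≤-abs _))

C : CommutativeRing 0ℓ 0ℓ
C = Complexification.commutativeRing R

module Complexes where
  open Reals
  open Complexification R using (re; im)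
  open LinearAlgebra C using (Unit; IsLocal) renaming (fromℕ to fromℕ′)

  apart-re⇒unit : ∀ {z} → Apart (re z) → Unit z
  apart-re⇒unit {z} ap = Conjugates.norm-unit R z (apart⇒unit (apart-norm {re z} (im z) ap))

  -- The real parts have sum 1, and a number whose real part is apart from 0 has an invertible norm.
  C-local : IsLocal
  C-local z w e = Sum.map (apart-re⇒unit {z}) (apart-re⇒unit {w}) (apart-summand (re z) (re w) (proj₁ e))

  at-fromℕ : ∀ m k → at (re (fromℕ′ m)) k ≡ fromℕ m
  at-fromℕ zero k = at-0 k
  at-fromℕ (suc m) k = trans (at-+ _ _ k) (cong₂ _+_ (at-1 k) (at-fromℕ m k))

  C-fromℕ-unit : ∀ m → Unit (fromℕ′ (suc m))
  C-fromℕ-unit m = apart-re⇒unit (1ℚ , 0<1 , 0 , λ k _ → ≤-trans (subst (1ℚ ≤_) (sym (at-fromℕ (suc m) k)) (1≤fromℕ m)) (≤-abs _))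

open Reals

-- Contraction to the evaluation points

-- Bounded Lipschitz functions, where Rel d u v says that u and v are at distance at most d.
module Lipschitz {S : Set} (Valid : S → Set) (Rel : ℚ → S → S → Set)
  (rel-valid : ∀ {d u v} → Rel d u v → Valid u × Valid v) (rel-≥0 : ∀ {d u v} → Rel d u v → 0ℚ ≤ d) where

  record Nice (f : S → ℚ) : Set where
    field
      B Λ : ℚ
      0≤B : 0ℚ ≤ B
      0≤Λ : 0ℚ ≤ Λ
      norm≤ : ∀ u → Valid u → ∣ f u ∣ ≤ B
      lip : ∀ {d u v} → Rel d u v → ∣ f u + - f v ∣ ≤ Λ * d

  open Nice

  nice-param : ∀ {f B} → 0ℚ ≤ B → (∀ u → Valid u → ∣ f u ∣ ≤ B) → (∀ {d u v} → Rel d u v → f u ≡ f v) → Nice f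
  nice-param {f} {B} 0≤B bd eq = record { B = B ; Λ = 0ℚ ; 0≤B = 0≤B ; 0≤Λ = ≤-refl ; norm≤ = bd
    ; lip = λ {d} {u} {v} ρ → ≡⇒≤ (trans (cong ∣_∣ (trans (cong (λ x → x + - f v) (eq ρ)) (-‿inverseʳ (f v)))) (sym (zeroˡ d))) }

  nice-const : ∀ c → Nice (λ _ → c)
  nice-const c = nice-param (abs-nonneg c) (λ _ _ → ≤-refl) (λ _ → refl)

  nice-+ : ∀ {f g} → Nice f → Nice g → Nice (λ u → f u + g u)
  nice-+ {f} {g} F G = record { B = B F + B G ; Λ = Λ F + Λ G ; 0≤B = 0≤+ (0≤B F) (0≤B G) ; 0≤Λ = 0≤+ (0≤Λ F) (0≤Λ G)
    ; norm≤ = λ u p → ≤-trans (abs-+ (f u) (g u)) (+-mono-≤ (norm≤ F u p) (norm≤ G u p))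
    ; lip = λ {d} {u} {v} ρ → subst₂ _≤_
        (cong ∣_∣ (solve 4 (λ a b c d → (a :- b) :+ (c :- d) := (a :+ c) :- (b :+ d)) refl (f u) (f v) (g u) (g v))) (sym (distribʳ d (Λ F) (Λ G)))
        (≤-trans (abs-+ (f u + - f v) (g u + - g v)) (+-mono-≤ (lip F ρ) (lip G ρ))) }

  nice-* : ∀ {f g} → Nice f → Nice g → Nice (λ u → f u * g u)
  nice-* {f} {g} F G = record { B = B F * B G ; Λ = B F * Λ G + Λ F * B G ; 0≤B = 0≤* (0≤B F) (0≤B G)
    ; 0≤Λ = 0≤+ (0≤* (0≤B F) (0≤Λ G)) (0≤* (0≤Λ F) (0≤B G))
    ; norm≤ = λ u p → subst (_≤ B F * B G) (sym (abs-* (f u) (g u))) (*-mono-≤ (abs-nonneg _) (norm≤ F u p) (abs-nonneg _) (norm≤ G u p))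
    ; lip = λ {d} {u} {v} ρ → subst₂ _≤_
        (cong ∣_∣ (solve 4 (λ a b c d → a :* (c :- d) :+ (a :- b) :* d := a :* c :- b :* d) refl (f u) (f v) (g u) (g v)))
        (solve 5 (λ x y z w d → x :* (y :* d) :+ (z :* d) :* w := (x :* y :+ z :* w) :* d) refl (B F) (Λ G) (Λ F) (B G) d)
        (≤-trans (abs-+ (f u * (g u + - g v)) ((f u + - f v) * g v)) (+-mono-≤
          (subst (_≤ B F * (Λ G * d)) (sym (abs-* (f u) (g u + - g v))) (*-mono-≤ (abs-nonneg _) (norm≤ F u (proj₁ (rel-valid ρ))) (abs-nonneg _) (lip G ρ)))
          (subst (_≤ (Λ F * d) * B G) (sym (abs-* (f u + - f v) (g v))) (*-mono-≤ (abs-nonneg _) (lip F ρ) (abs-nonneg _) (norm≤ G v (proj₂ (rel-valid ρ))))))) }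

  nice-^ : ∀ {f} → Nice f → ∀ k → Nice (λ u → f u ^ k)
  nice-^ F zero = nice-const 1ℚ
  nice-^ F (suc k) = nice-* F (nice-^ F k)

  recip-anti : ∀ {a b} → 0ℚ < a → a ≤ b → recip b ≤ recip a
  recip-anti {a} {b} 0<a a≤b = subst₂ _≤_
    (trans (x∙yz≈z∙xy a (recip a) (recip b)) (trans (cong (recip b *_) (*-recip 0<a)) (*-identityʳ _)))
    (trans (x∙yz≈y∙xz b (recip a) (recip b)) (trans (cong (recip a *_) (*-recip 0<b)) (*-identityʳ _)))
    (*-monoˡ (0≤* (<⇒≤ (recip-pos 0<a)) (<⇒≤ (recip-pos 0<b))) a≤b) where
    0<b : 0ℚ < b
    0<b = <-≤-trans 0<a a≤b

  nice-recip : ∀ {f δ} → 0ℚ < δ → Nice f → (∀ u → Valid u → δ ≤ f u) → Nice (λ u → recip (f u))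
  nice-recip {f} {δ} 0<δ F below = record { B = recip δ ; Λ = recip δ * recip δ * Λ F ; 0≤B = 0≤r ; 0≤Λ = 0≤* (0≤* 0≤r 0≤r) (0≤Λ F)
    ; norm≤ = bd
    ; lip = λ {d} {u} {v} ρ → subst₂ _≤_ (cong ∣_∣ (difference (pos u (proj₁ (rel-valid ρ))) (pos v (proj₂ (rel-valid ρ)))))
        (sym (*-assoc _ _ _))
        (subst (_≤ recip δ * recip δ * (Λ F * d)) (sym (trans (abs-* (recip (f u) * recip (f v)) _) (cong₂ _*_ (abs-* (recip (f u)) (recip (f v))) (abs-swap (f v) (f u)))))
          (*-mono-≤ (0≤* (abs-nonneg _) (abs-nonneg _))
            (*-mono-≤ (abs-nonneg _) (bd u (proj₁ (rel-valid ρ))) (abs-nonneg _) (bd v (proj₂ (rel-valid ρ)))) (abs-nonneg _) (lip F ρ))) }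
    where
    0≤r : 0ℚ ≤ recip δ
    0≤r = <⇒≤ (recip-pos 0<δ)
    pos : ∀ u → Valid u → 0ℚ < f u
    pos u p = <-≤-trans 0<δ (below u p)
    bd : ∀ u → Valid u → ∣ recip (f u) ∣ ≤ recip δ
    bd u p = subst (_≤ recip δ) (sym (abs-≥0 (<⇒≤ (recip-pos (pos u p))))) (recip-anti 0<δ (below u p))
    difference : ∀ {x y} → 0ℚ < x → 0ℚ < y → recip x * recip y * (y + - x) ≡ recip x + - recip y
    difference {x} {y} 0<x 0<y = trans (solve 4 (λ x y s t → s :* t :* (y :- x) := s :* (y :* t) :- t :* (x :* s)) refl x y (recip x) (recip y))
      (cong₂ (λ a b → a + - b) (trans (cong (recip x *_) (*-recip 0<y)) (*-identityʳ _)) (trans (cong (recip y *_) (*-recip 0<x)) (*-identityʳ _)))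

  module _ (ε : S → ℚ) (niceε : Nice ε) where
    private
      module P u = Perturbation 𝔽 (ε u)

    nice-G : (η : Fin q → S → ℚ) → (∀ i → Nice (η i)) → ∀ a → Nice (λ u → P.G u (λ i → η i u) a)
    nice-G η h zero = nice-const 1ℚ
    nice-G {zero} η h (suc a) = nice-const 0ℚ
    nice-G {suc q} η h (suc a) = nice-+ (nice-G (η ∘ suc) (h ∘ suc) (suc a))
      (nice-* (nice-^ niceε (q ∸ a)) (nice-* (h zero) (nice-G (η ∘ suc) (h ∘ suc) a)))

    nice-H : (m η : Fin q → S → ℚ) → (∀ i → Nice (m i)) → (∀ i → Nice (η i)) → ∀ a → Nice (λ u → P.H u (λ i → m i u) (λ i → η i u) a)
    nice-H m η g h zero = nice-const 0ℚ
    nice-H {zero} m η g h (suc a) = nice-const 0ℚ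
    nice-H {suc q} m η g h (suc a) = nice-+ (nice-H (m ∘ suc) (η ∘ suc) (g ∘ suc) (h ∘ suc) (suc a))
      (nice-* (nice-^ niceε (q ∸ a)) (nice-* (h zero) (nice-+ (nice-H (m ∘ suc) (η ∘ suc) (g ∘ suc) (h ∘ suc) a)
        (nice-* (g zero) (nice-G (η ∘ suc) (h ∘ suc) a)))))

    nice-Rest : (m η : Fin q → S → ℚ) → (∀ i → Nice (m i)) → (∀ i → Nice (η i)) → ∀ i → Nice (λ u → P.Rest u (λ i → m i u) (λ i → η i u) i)
    nice-Rest m η g h zero = nice-const 0ℚ
    nice-Rest m η g h (suc i) = nice-+ (nice-Rest (m ∘ suc) (η ∘ suc) (g ∘ suc) (h ∘ suc) i)
      (nice-* (nice-^ niceε (toℕ i)) (nice-* (h zero) (nice-+ (nice-H (m ∘ suc) (η ∘ suc) (g ∘ suc) (h ∘ suc) (after i))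
        (nice-* (g zero) (nice-G (η ∘ suc) (h ∘ suc) (after i))))))

-- The value following x i, or 1 after the last one.
next : (Fin q → ℚ) → Fin q → ℚ
next {suc zero} x zero = 1ℚ
next {suc (suc q)} x zero = x (suc zero)
next x (suc i) = next (x ∘ suc) i

-- With η = ratio x, the product of η over i and all later positions telescopes to x i. These
-- products are the unknowns in which the equations nearly decouple.
ratio : (Fin q → ℚ) → Fin q → ℚ
ratio x i = x i * recip (next x i)

module _ (ε : ℚ) where
  open Perturbation 𝔽 ε

  prod-ratio : (x : Fin q → ℚ) → (∀ i → 0ℚ < x i) → ∀ i → prod (ratio x) i ≡ x i
  prod-ratio {suc zero} x h zero = trans (cong (x zero *_) (trans (sym (*-identityˡ _)) (*-recip 0<1))) (*-identityʳ _)
  prod-ratio {suc (suc q)} x h zero = trans (cong (ratio x zero *_) (prod-ratio (x ∘ suc) (h ∘ suc) zero))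
    (trans (*-assoc _ _ _) (trans (cong (x zero *_) (trans (*-comm _ _) (*-recip (h (suc zero))))) (*-identityʳ _)))
  prod-ratio {suc zero} x h (suc ())
  prod-ratio {suc (suc q)} x h (suc i) = prod-ratio (x ∘ suc) (h ∘ suc) i

  total-≥1 : (m : Fin q → ℚ) → (∀ i → 1ℚ ≤ m i) → ∀ i → 1ℚ ≤ total m i
  total-≥1 {suc zero} m h zero = h zero
  total-≥1 {suc (suc q)} m h zero = subst (_≤ total m zero) (+-identityʳ 1ℚ) (+-mono-≤ (h zero) (≤-trans 0≤1 (total-≥1 (m ∘ suc) (h ∘ suc) zero)))
  total-≥1 {suc q} m h (suc i) = total-≥1 (m ∘ suc) (h ∘ suc) i

  total-≤ : ∀ (m : Fin q → ℚ) {ν} → 0ℚ ≤ ν → (∀ i → m i ≤ ν) → ∀ i → total m i ≤ fromℕ q * ν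
  total-≤ {suc zero} m {ν} 0≤ν h zero = ≤-trans (h zero) (≡⇒≤ (sym (trans (cong (_* ν) (+-identityʳ 1ℚ)) (*-identityˡ ν))))
  total-≤ {suc (suc q)} m {ν} 0≤ν h zero = ≤-trans (+-mono-≤ (h zero) (total-≤ (m ∘ suc) 0≤ν (h ∘ suc) zero))
    (≡⇒≤ (solve 2 (λ ν f → ν :+ f :* ν := (:1 :+ f) :* ν) refl ν (fromℕ (suc q))))
  total-≤ {suc q} m {ν} 0≤ν h (suc i) = ≤-trans (total-≤ (m ∘ suc) 0≤ν (h ∘ suc) i) (*-monoˡ 0≤ν (fromℕ-mono (ℕ.n≤1+n q)))

2ℚ 4ℚ 8ℚ 16ℚ : ℚ
2ℚ = 1ℚ + 1ℚ
4ℚ = 2ℚ + 2ℚ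
8ℚ = 4ℚ + 4ℚ
16ℚ = 8ℚ + 8ℚ

0≤2 : 0ℚ ≤ 2ℚ
0≤2 = 0≤+ 0≤1 0≤1

0≤4 : 0ℚ ≤ 4ℚ
0≤4 = 0≤+ 0≤2 0≤2

0≤8 : 0ℚ ≤ 8ℚ
0≤8 = 0≤+ 0≤4 0≤4

1≤2 : 1ℚ ≤ 2ℚ
1≤2 = subst (_≤ 2ℚ) (+-identityʳ 1ℚ) (+-mono-≤ (≤-refl {1ℚ}) 0≤1)

½≤1 : ½ ≤ 1ℚ
½≤1 = subst₂ _≤_ (+-identityʳ ½) ½+½ (+-mono-≤ (≤-refl {½}) (<⇒≤ 0<½))

small : (C : Fin k → ℚ) → (∀ i → 0ℚ ≤ C i) → ∃ λ ε → 0ℚ < ε × ε ≤ 1ℚ × (∀ i → ε * C i ≤ ½)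
small {k} C 0≤C = ½ * recip D , 0<* 0<½ (recip-pos 0<D) , ε≤1 , λ i →
  subst₂ _≤_ (x∙yz≈yz∙x (C i) ½ (recip D)) (trans (x∙yz≈y∙xz D ½ (recip D))
    (trans (cong (½ *_) (*-recip 0<D)) (*-identityʳ ½))) (*-monoˡ (0≤* (<⇒≤ 0<½) (<⇒≤ (recip-pos 0<D))) (C≤D C 0≤C i)) where
  add : ∀ {k} → (Fin k → ℚ) → ℚ
  add {zero} C = 1ℚ
  add {suc k} C = C zero + add (C ∘ suc)
  D = add C
  1≤add : ∀ {k} (C : Fin k → ℚ) → (∀ i → 0ℚ ≤ C i) → 1ℚ ≤ add C
  1≤add {zero} C h = ≤-refl
  1≤add {suc k} C h = subst (_≤ add C) (+-identityˡ 1ℚ) (+-mono-≤ (h zero) (1≤add (C ∘ suc) (h ∘ suc)))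
  0<D : 0ℚ < D
  0<D = <-≤-trans 0<1 (1≤add C 0≤C)
  C≤D : ∀ {k} (C : Fin k → ℚ) → (∀ i → 0ℚ ≤ C i) → ∀ i → C i ≤ add C
  C≤D {suc k} C h zero = subst (_≤ add C) (+-identityʳ _) (+-mono-≤ (≤-refl {C zero}) (≤-trans 0≤1 (1≤add (C ∘ suc) (h ∘ suc))))
  C≤D {suc k} C h (suc i) = subst (_≤ add C) (+-identityˡ _) (+-mono-≤ (h zero) (C≤D (C ∘ suc) (h ∘ suc) i))
  ε≤1 : ½ * recip D ≤ 1ℚ
  ε≤1 = subst (½ * recip D ≤_) (trans (*-identityˡ _) (*-recip 0<D))
    (*-mono-≤ (<⇒≤ 0<½) (≤-trans ½≤1 ≤-refl) (<⇒≤ (recip-pos 0<D)) (subst (_≤ D * recip D) (*-identityˡ _) (*-monoˡ (<⇒≤ (recip-pos 0<D)) (1≤add C 0≤C))))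

module Transport (K L : CommutativeRing 0ℓ 0ℓ) (h : CommutativeRing.Carrier K → CommutativeRing.Carrier L) where
  private
    module K = CommutativeRing K
    module L = CommutativeRing L
    module Eᴷ = Elementary K
    module Eᴸ = Elementary L

  module Homomorphism (h-0 : h K.0# L.≈ L.0#) (h-1 : h K.1# L.≈ L.1#) (h-+ : ∀ a b → h (a K.+ b) L.≈ h a L.+ h b)
    (h-* : ∀ a b → h (a K.* b) L.≈ h a L.* h b) where

    fromℕ-transport : ∀ m → h (LinearAlgebra.fromℕ K m) L.≈ LinearAlgebra.fromℕ L m
    fromℕ-transport zero = h-0
    fromℕ-transport (suc m) = L.trans (h-+ _ _) (L.+-cong h-1 (fromℕ-transport m))

    elem-transport : ∀ {Y : Fin q → K.Carrier} {Y′} → (∀ i → h (Y i) L.≈ Y′ i) → ∀ a → h (Eᴷ.elem Y a) L.≈ Eᴸ.elem Y′ a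
    elem-transport e zero = h-1
    elem-transport {zero} e (suc a) = h-0
    elem-transport {suc q} e (suc a) = L.trans (h-+ _ _) (L.+-cong (elem-transport (e ∘ suc) (suc a))
      (L.trans (h-* _ _) (L.*-cong (e zero) (elem-transport (e ∘ suc) a))))

    welem-transport : ∀ {w Y : Fin q → K.Carrier} {w′ Y′} → (∀ i → h (w i) L.≈ w′ i) → (∀ i → h (Y i) L.≈ Y′ i) →
      ∀ a → h (Eᴷ.welem w Y a) L.≈ Eᴸ.welem w′ Y′ a
    welem-transport d e zero = h-0
    welem-transport {zero} d e (suc a) = h-0
    welem-transport {suc q} d e (suc a) = L.trans (h-+ _ _) (L.+-cong (welem-transport (d ∘ suc) (e ∘ suc) (suc a))
      (L.trans (h-* _ _) (L.*-cong (e zero) (L.trans (h-+ _ _) (L.+-cong (welem-transport (d ∘ suc) (e ∘ suc) a)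
        (L.trans (h-* _ _) (L.*-cong (d zero) (elem-transport (e ∘ suc) a))))))))

module Embedding (R : CommutativeRing 0ℓ 0ℓ) where
  open CommutativeRing R using (0#) renaming (refl to ≈-refl; Carrier to RCarrier)
  open Complexification R
  private
    module C = CommutativeRing commutativeRing
    module S = Solver R

  real : RCarrier → C.Carrier
  real a = a +i 0#

  real-cong : ∀ {a b} → CommutativeRing._≈_ R a b → real a C.≈ real b
  real-cong e = e , ≈-refl

  real-+ : ∀ a b → real (CommutativeRing._+_ R a b) C.≈ real a C.+ real b
  real-+ a b = ≈-refl , S.solve 0 (S.:0 S.:= S.:0 S.:+ S.:0) ≈-refl

  real-* : ∀ a b → real (CommutativeRing._*_ R a b) C.≈ real a C.* real b
  real-* a b = S.solve 2 (λ a b → a S.:* b S.:= a S.:* b S.:- S.:0 S.:* S.:0) ≈-refl a b , S.solve 2 (λ a b → S.:0 S.:= a S.:* S.:0 S.:+ S.:0 S.:* b) ≈-refl a b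

private
  module W = Elementary 𝔽
  module Wᴿ = Elementary R
  module At k = Transport.Homomorphism R 𝔽 (λ a → at a k) (at-0 k) (at-1 k) (λ a b → at-+ a b k) (λ a b → at-* a b k)

fromℕ-at : ∀ m k → at (LinearAlgebra.fromℕ R m) k ≡ fromℕ m
fromℕ-at m k = At.fromℕ-transport k m

welem-at : ∀ k {w Y : Fin q → R.Carrier} {w′ Y′ : Fin q → ℚ} → (∀ i → at (w i) k ≡ w′ i) → (∀ i → at (Y i) k ≡ Y′ i) →
  ∀ a → at (Wᴿ.welem w Y a) k ≡ W.welem w′ Y′ a
welem-at k = At.welem-transport k

module Contraction (n q : ℕ) where

  -- All totals of weights are at most `bound`. So if the remainder ε rest is at most 1/2 in
  -- absolute value, the solution (1 - ε rest) / total lies between δ and 2, and the ratios of such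
  -- values lie between `lower` and `upper`.
  ν bound δ lower upper : ℚ
  ν = fromℕ n
  bound = 1ℚ + fromℕ q * ν
  δ = recip (2ℚ * bound)
  lower = δ * recip 2ℚ
  upper = 2ℚ * recip δ

  -- Scale and weights belong to the state so that the constants of `Nice` are uniform in them.
  -- Hence ε depends on n and q only, and so do the prescribed values, which are powers of ε.
  record State : Set where
    constructor state
    field
      scale : ℚ
      weight : Fin q → ℚ
      value : Fin q → ℚ
  open State

  record Valid (u : State) : Set where
    field
      0≤ε : 0ℚ ≤ scale u
      ε≤1 : scale u ≤ 1ℚ
      1≤m : ∀ i → 1ℚ ≤ weight u i
      m≤ν : ∀ i → weight u i ≤ ν
      δ≤x : ∀ i → δ ≤ value u i
      x≤2 : ∀ i → value u i ≤ 2ℚ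
  open Valid

  record Near (d : ℚ) (u v : State) : Set where
    field
      same-scale : scale u ≡ scale v
      same-weight : weight u ≡ weight v
      valid : Valid u × Valid v
      0≤d : 0ℚ ≤ d
      near : ∀ i → ∣ value u i + - value v i ∣ ≤ d
  open Near

  open Lipschitz Valid Near valid 0≤d
  open Nice

  0≤ν : 0ℚ ≤ ν
  0≤ν = 0≤fromℕ n

  1≤bound : 1ℚ ≤ bound
  1≤bound = subst (_≤ bound) (+-identityʳ 1ℚ) (+-mono-≤ (≤-refl {1ℚ}) (0≤* (0≤fromℕ q) 0≤ν))

  0<2 : 0ℚ < 2ℚ
  0<2 = <-≤-trans 0<1 1≤2

  0<bound : 0ℚ < bound
  0<bound = <-≤-trans 0<1 1≤bound

  0<2bound : 0ℚ < 2ℚ * bound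
  0<2bound = 0<* 0<2 0<bound

  0<δ : 0ℚ < δ
  0<δ = recip-pos 0<2bound

  recip-1 : recip 1ℚ ≡ 1ℚ
  recip-1 = trans (sym (*-identityˡ _)) (*-recip 0<1)

  recip≤1 : ∀ {a} → 1ℚ ≤ a → recip a ≤ 1ℚ
  recip≤1 {a} 1≤a = subst (recip a ≤_) recip-1 (recip-anti 0<1 1≤a)

  δ≤1 : δ ≤ 1ℚ
  δ≤1 = recip≤1 (subst (_≤ 2ℚ * bound) (*-identityˡ 1ℚ) (*-mono-≤ 0≤1 1≤2 0≤1 1≤bound))

  0<x : ∀ {u} → Valid u → ∀ i → 0ℚ < value u i
  0<x p i = <-≤-trans 0<δ (δ≤x p i)

  nice-scale : Nice scale
  nice-scale = nice-param 0≤1 (λ u p → subst (_≤ 1ℚ) (sym (abs-≥0 (0≤ε p))) (ε≤1 p)) same-scale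

  nice-weight : ∀ i → Nice (λ u → weight u i)
  nice-weight i = nice-param 0≤ν (λ u p → subst (_≤ ν) (sym (abs-≥0 (≤-trans 0≤1 (1≤m p i)))) (m≤ν p i)) (λ ρ → cong (λ m → m i) (same-weight ρ))

  nice-value : ∀ i → Nice (λ u → value u i)
  nice-value i = record { B = 2ℚ ; Λ = 1ℚ ; 0≤B = 0≤2 ; 0≤Λ = 0≤1
    ; norm≤ = λ u p → subst (_≤ 2ℚ) (sym (abs-≥0 (<⇒≤ (0<x p i)))) (x≤2 p i)
    ; lip = λ {d} ρ → subst (_ ≤_) (sym (*-identityˡ d)) (near ρ i) }

  nice-next : ∀ {j} (x : Fin j → State → ℚ) → (∀ i → Nice (x i)) → ∀ i → Nice (λ u → next (λ l → x l u) i)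
  nice-next {suc zero} x h zero = nice-const 1ℚ
  nice-next {suc (suc j)} x h zero = h (suc zero)
  nice-next {suc j} x h (suc i) = nice-next (x ∘ suc) (h ∘ suc) i

  next-bounds : ∀ {j} (x : Fin j → ℚ) → (∀ i → δ ≤ x i × x i ≤ 2ℚ) → ∀ i → δ ≤ next x i × next x i ≤ 2ℚ
  next-bounds {suc zero} x h zero = δ≤1 , 1≤2
  next-bounds {suc (suc j)} x h zero = h (suc zero)
  next-bounds {suc j} x h (suc i) = next-bounds (x ∘ suc) (h ∘ suc) i

  next-valid : ∀ u → Valid u → ∀ i → δ ≤ next (value u) i × next (value u) i ≤ 2ℚ
  next-valid u p = next-bounds (value u) λ i → δ≤x p i , x≤2 p i

  nice-ratio : ∀ i → Nice (λ u → ratio (value u) i)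
  nice-ratio i = nice-* (nice-value i) (nice-recip 0<δ (nice-next (λ i u → value u i) nice-value i) λ u p → proj₁ (next-valid u p i))

  ratio-bounds : ∀ u → Valid u → ∀ i → lower ≤ ratio (value u) i × ratio (value u) i ≤ upper
  ratio-bounds u p i =
    *-mono-≤ (<⇒≤ 0<δ) (δ≤x p i) (<⇒≤ (recip-pos 0<2)) (recip-anti 0<next (proj₂ (next-valid u p i))) ,
    *-mono-≤ (<⇒≤ (0<x p i)) (x≤2 p i) (<⇒≤ (recip-pos 0<next)) (recip-anti 0<δ (proj₁ (next-valid u p i))) where
    0<next : 0ℚ < next (value u) i
    0<next = <-≤-trans 0<δ (proj₁ (next-valid u p i))

  rest : Fin q → State → ℚ
  rest i u = Perturbation.Rest 𝔽 (scale u) (weight u) (ratio (value u)) i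

  opaque
    nice-rest : ∀ i → Nice (rest i)
    nice-rest = nice-Rest scale nice-scale (λ i u → weight u i) (λ i u → ratio (value u) i) nice-weight nice-ratio

  0<lower : 0ℚ < lower
  0<lower = 0<* 0<δ (recip-pos 0<2)

  0<upper : 0ℚ < upper
  0<upper = 0<* 0<2 (recip-pos 0<δ)

  -- Entry 0 keeps different orders of magnitude apart in `gap`; the other entries keep the
  -- iteration within its bounds and make it contract by 1/2.
  constants : Fin (suc q) → ℚ
  constants zero = upper * recip lower
  constants (suc i) = B (nice-rest i) + Λ (nice-rest i)

  opaque
    choice : ∃ λ ε → 0ℚ < ε × ε ≤ 1ℚ × (∀ i → ε * constants i ≤ ½)
    choice = small constants λ where
      zero → 0≤* (<⇒≤ 0<upper) (<⇒≤ (recip-pos 0<lower))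
      (suc i) → 0≤+ (0≤B (nice-rest i)) (0≤Λ (nice-rest i))

  ε : ℚ
  ε = proj₁ choice

  0<ε : 0ℚ < ε
  0<ε = proj₁ (proj₂ choice)

  ε-≤1 : ε ≤ 1ℚ
  ε-≤1 = proj₁ (proj₂ (proj₂ choice))

  ε-upper : ε * upper ≤ ½ * lower
  ε-upper = subst (_≤ ½ * lower) (trans (solve 4 (λ e u r l → (e :* (u :* r)) :* l := e :* u :* (l :* r)) refl ε upper (recip lower) lower)
    (trans (cong (ε * upper *_) (*-recip 0<lower)) (*-identityʳ _))) (*-monoˡ (<⇒≤ 0<lower) (proj₂ (proj₂ (proj₂ choice)) zero))

  private
    ε-part : ∀ i {c} → c ≤ constants (suc i) → 0ℚ ≤ c → ε * c ≤ ½
    ε-part i le 0≤c = ≤-trans (*-mono-≤ (<⇒≤ 0<ε) ≤-refl 0≤c le) (proj₂ (proj₂ (proj₂ choice)) (suc i))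

  ε-B : ∀ i → ε * B (nice-rest i) ≤ ½
  ε-B i = ε-part i (subst (_≤ constants (suc i)) (+-identityʳ _) (+-mono-≤ (≤-refl {B (nice-rest i)}) (0≤Λ (nice-rest i)))) (0≤B (nice-rest i))

  ε-Λ : ∀ i → ε * Λ (nice-rest i) ≤ ½
  ε-Λ i = ε-part i (subst (_≤ constants (suc i)) (+-identityˡ _) (+-mono-≤ (0≤B (nice-rest i)) (≤-refl {Λ (nice-rest i)}))) (0≤Λ (nice-rest i))

  module Fixed (m : Fin q → ℚ) (m-ok : ∀ i → 1ℚ ≤ m i × m i ≤ ν) where
    open Perturbation 𝔽 ε

    M : Fin q → ℚ
    M = total m

    1≤M : ∀ i → 1ℚ ≤ M i
    1≤M = total-≥1 ε m (proj₁ ∘ m-ok)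

    M≤bound : ∀ i → M i ≤ bound
    M≤bound i = ≤-trans (total-≤ ε m 0≤ν (proj₂ ∘ m-ok) i) (subst (_≤ bound) (+-identityˡ _) (+-mono-≤ 0≤1 (≤-refl {fromℕ q * ν})))

    0<M : ∀ i → 0ℚ < M i
    0<M i = <-≤-trans 0<1 (1≤M i)

    at-state : (Fin q → ℚ) → State
    at-state = state ε m

    -- The equation M i x i + ε rest = 1, solved for its main term.
    step : (Fin q → ℚ) → Fin q → ℚ
    step x i = (1ℚ + - (ε * rest i (at-state x))) * recip (M i)

    δ-split : δ ≡ ½ * recip bound
    δ-split = trans (sym (*-identityʳ δ)) (trans (cong (δ *_) (sym (trans (cong₂ _*_ 2·½ (*-recip 0<bound)) (*-identityˡ 1ℚ))))
      (trans (solve 5 (λ d t h b r → d :* ((t :* h) :* (b :* r)) := ((t :* b) :* d) :* (h :* r)) refl δ 2ℚ ½ bound (recip bound))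
        (trans (cong (_* (½ * recip bound)) (*-recip 0<2bound)) (*-identityˡ _)))) where
      2·½ : 2ℚ * ½ ≡ 1ℚ
      2·½ = trans (solve 1 (λ h → (:1 :+ :1) :* h := h :+ h) refl ½) ½+½

    recip-M : ∀ i → recip bound ≤ recip (M i)
    recip-M i = recip-anti (0<M i) (M≤bound i)

    make-valid : ∀ {x} → (∀ i → δ ≤ x i × x i ≤ 2ℚ) → Valid (at-state x)
    make-valid h = record { 0≤ε = <⇒≤ 0<ε ; ε≤1 = ε-≤1 ; 1≤m = proj₁ ∘ m-ok ; m≤ν = proj₂ ∘ m-ok ; δ≤x = proj₁ ∘ h ; x≤2 = proj₂ ∘ h }

    ∣a∣≤ : ∀ {a c} → ∣ a ∣ ≤ c → a ≤ c × - c ≤ a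
    ∣a∣≤ {a} {c} h = ≤-trans (≤-abs a) h , subst (- c ≤_) (solve 1 (λ a → :- (:- a) := a) refl a)
      (neg-mono-≤ (≤-trans (≤-abs (- a)) (subst (_≤ c) (sym (abs-neg a)) h)))

    scaled-rest : ∀ {x} → Valid (at-state x) → ∀ i → ∣ ε * rest i (at-state x) ∣ ≤ ½
    scaled-rest p i = ≤-trans (≡⇒≤ (trans (abs-* ε _) (cong (_* ∣ rest i (at-state _) ∣) (abs-≥0 (<⇒≤ 0<ε)))))
      (≤-trans (*-mono-≤ (<⇒≤ 0<ε) ≤-refl (abs-nonneg _) (norm≤ (nice-rest i) _ p)) (ε-B i))

    step-bounds : ∀ {x} → Valid (at-state x) → ∀ i → δ ≤ step x i × step x i ≤ 2ℚ
    step-bounds {x} p i =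
      subst (_≤ step x i) (sym δ-split) (*-mono-≤ (<⇒≤ 0<½) ½≤ (<⇒≤ (recip-pos 0<bound)) (recip-M i)) ,
      subst (step x i ≤_) (*-identityʳ 2ℚ) (*-mono-≤ (≤-trans (<⇒≤ 0<½) ½≤) ≤2 (<⇒≤ (recip-pos (0<M i))) (recip≤1 (1≤M i))) where
      r = ε * rest i (at-state x)
      bounds = ∣a∣≤ (scaled-rest p i)
      ½≤ : ½ ≤ 1ℚ + - r
      ½≤ = subst (_≤ 1ℚ + - r) (trans (cong (_+ - ½) (sym ½+½)) (solve 1 (λ h → (h :+ h) :- h := h) refl ½)) (+-mono-≤ (≤-refl {1ℚ}) (neg-mono-≤ (proj₁ bounds)))
      ≤2 : 1ℚ + - r ≤ 2ℚ
      ≤2 = +-mono-≤ (≤-refl {1ℚ}) (≤-trans (neg-mono-≤ (proj₂ bounds)) (≤-trans (≡⇒≤ (solve 1 (λ h → :- (:- h) := h) refl ½)) ½≤1))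

    step-near : ∀ {d x y} → Near d (at-state x) (at-state y) → ∀ i → ∣ step x i + - step y i ∣ ≤ ½ * d
    step-near {d} {x} {y} ρ i = ≤-trans
      (≡⇒≤ (trans (cong ∣_∣ (solve 4 (λ e a b r → (:1 :- e :* a) :* r :- (:1 :- e :* b) :* r := (e :* (b :- a)) :* r) refl ε a b (recip (M i))))
        (trans (abs-* _ _) (cong₂ _*_ (trans (abs-* ε _) (cong₂ _*_ (abs-≥0 (<⇒≤ 0<ε)) (abs-swap b a))) (abs-≥0 (<⇒≤ (recip-pos (0<M i))))))))
      (subst (ε * ∣ a + - b ∣ * recip (M i) ≤_) (*-identityʳ _) (*-mono-≤ (0≤* (<⇒≤ 0<ε) (abs-nonneg _))
        (≤-trans (*-mono-≤ (<⇒≤ 0<ε) ≤-refl (abs-nonneg _) (lip (nice-rest i) ρ))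
          (subst (_≤ ½ * d) (*-assoc _ _ _) (*-monoˡ (0≤d ρ) (ε-Λ i)))) (<⇒≤ (recip-pos (0<M i))) (recip≤1 (1≤M i)))) where
      a = rest i (at-state x)
      b = rest i (at-state y)

    xs : ℕ → Fin q → ℚ
    xs zero i = recip (M i)
    xs (suc k) = step (xs k)

    xs-valid : ∀ k → Valid (at-state (xs k))
    xs-valid zero = make-valid λ i → ≤-trans (subst (_≤ recip bound) (sym δ-split) (subst (½ * recip bound ≤_) (*-identityˡ _) (*-monoˡ (<⇒≤ (recip-pos 0<bound)) ½≤1)))
      (recip-M i) , ≤-trans (recip≤1 (1≤M i)) 1≤2
    xs-valid (suc k) = make-valid (step-bounds (xs-valid k))

    make-near : ∀ {d} j k → 0ℚ ≤ d → (∀ i → ∣ xs j i + - xs k i ∣ ≤ d) → Near d (at-state (xs j)) (at-state (xs k))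
    make-near j k 0≤d h = record { same-scale = refl ; same-weight = refl ; valid = xs-valid j , xs-valid k ; 0≤d = 0≤d ; near = h }

    0≤½^ : ∀ k → 0ℚ ≤ ½ ^ k
    0≤½^ k = <⇒≤ (0<^ k 0<½)

    consecutive : ∀ k i → ∣ xs k i + - xs (suc k) i ∣ ≤ 4ℚ * ½ ^ k
    consecutive zero i = subst (∣ xs 0 i + - xs 1 i ∣ ≤_) (sym (*-identityʳ 4ℚ))
      (≤-trans (abs-+ (xs 0 i) (- xs 1 i)) (+-mono-≤ (norm≤ (nice-value i) _ (xs-valid 0))
        (subst (_≤ 2ℚ) (sym (abs-neg (xs 1 i))) (norm≤ (nice-value i) _ (xs-valid 1)))))
    consecutive (suc k) i = subst (∣ xs (suc k) i + - xs (suc (suc k)) i ∣ ≤_) (x∙yz≈y∙xz ½ 4ℚ (½ ^ k))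
      (step-near (make-near k (suc k) (0≤* 0≤4 (0≤½^ k)) (consecutive k)) i)

    triangle-≤ : ∀ a b c → ∣ a + - c ∣ ≤ ∣ a + - b ∣ + ∣ b + - c ∣
    triangle-≤ a b c = subst (λ x → ∣ x ∣ ≤ ∣ a + - b ∣ + ∣ b + - c ∣) (solve 3 (λ a b c → (a :- b) :+ (b :- c) := a :- c) refl a b c) (abs-+ (a + - b) (b + - c))

    tail : ∀ j k i → ∣ xs k i + - xs (j ℕ.+ k) i ∣ ≤ 8ℚ * ½ ^ k
    tail zero k i = subst (_≤ 8ℚ * ½ ^ k) (sym (cong ∣_∣ (-‿inverseʳ (xs k i)))) (0≤* 0≤8 (0≤½^ k))
    tail (suc j) k i = ≤-trans (triangle-≤ (xs k i) (xs (suc k) i) _) (≤-trans (+-mono-≤ (consecutive k i)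
        (subst (λ l → ∣ xs (suc k) i + - xs l i ∣ ≤ 8ℚ * ½ ^ suc k) (ℕ.+-suc j k) (tail j (suc k) i)))
      (≡⇒≤ (trans (solve 3 (λ t h p → t :* p :+ (t :+ t) :* (h :* p) := t :* p :+ t :* ((h :+ h) :* p)) refl 4ℚ ½ (½ ^ k))
        (trans (cong (λ o → 4ℚ * ½ ^ k + 4ℚ * (o * ½ ^ k)) ½+½) (solve 2 (λ t p → t :* p :+ t :* (:1 :* p) := (t :+ t) :* p) refl 4ℚ (½ ^ k))))))

    spread : ∀ N j k → N ℕ.≤ j → N ℕ.≤ k → ∀ i → ∣ xs j i + - xs k i ∣ ≤ 16ℚ * ½ ^ N
    spread N j k N≤j N≤k i = ≤-trans (triangle-≤ (xs j i) (xs N i) (xs k i)) (≤-trans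
      (+-mono-≤ (subst (_≤ 8ℚ * ½ ^ N) (abs-swap (xs N i) (xs j i)) (from j N≤j)) (from k N≤k)) (≡⇒≤ (sym (distribʳ (½ ^ N) 8ℚ 8ℚ))))
      where
      from : ∀ j → N ℕ.≤ j → ∣ xs N i + - xs j i ∣ ≤ 8ℚ * ½ ^ N
      from j N≤j = subst (λ l → ∣ xs N i + - xs l i ∣ ≤ 8ℚ * ½ ^ N) (ℕ.m∸n+n≡m N≤j) (tail (j ∸ N) N i)

    0≤16½^ : ∀ N → 0ℚ ≤ 16ℚ * ½ ^ N
    0≤16½^ N = 0≤* (0≤+ 0≤8 0≤8) (0≤½^ N)

    nice⇒cauchy : ∀ {f} → Nice f → IsCauchy (λ k → f (at-state (xs k)))
    nice⇒cauchy {f} F e 0<e = let N , lt = ½-small (Λ F * 16ℚ) e 0<e in N , λ j k N≤j N≤k →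
      ≤-<-trans (lip F (make-near j k (0≤16½^ N) (spread N j k N≤j N≤k))) (subst (_< e) (*-assoc (Λ F) 16ℚ (½ ^ N)) lt)

    coordinate : Fin q → ℕ → ℚ
    coordinate i k = point′ (ratio (xs k)) i

    limit-point : Fin q → R.Carrier
    limit-point i = limit (coordinate i) (nice⇒cauchy (nice-* (nice-const (ε ^ suc (after i))) (nice-ratio i)))

    coordinate-bounds : ∀ k i → lower ≤ ratio (xs k) i × ratio (xs k) i ≤ upper
    coordinate-bounds k = ratio-bounds (at-state (xs k)) (xs-valid k)

    -- The defect of an iterate in the equation is a multiple of its distance to the next iterate,
    -- since the latter solves the equation with the old remainder.
    welem-near : ∀ k i → W.welem m (λ i → coordinate i k) (suc (after i)) + - ε ^ triangle (suc (after i)) ≡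
                 ε ^ triangle (suc (after i)) * (M i * (xs k i + - xs (suc k) i))
    welem-near k i = trans (cong (λ x → x + - t) (trans (welem-scaled m (ratio (xs k)) (suc (after i))) (cong (t *_)
        (trans (H-split m (ratio (xs k)) i) (cong (λ x → M i * x + ε * rest i (at-state (xs k))) (prod-ratio ε (xs k) (0<x (xs-valid k)) i))))))
      (trans (solve 4 (λ t M x r → t :* (M :* x :+ r) :- t := t :* (M :* x :- (:1 :- r))) refl t (M i) (xs k i) (ε * rest i (at-state (xs k))))
        (trans (cong (λ y → t * (M i * xs k i + - y)) (sym solved)) (solve 4 (λ t M x y → t :* (M :* x :- M :* y) := t :* (M :* (x :- y))) refl t (M i) (xs k i) (xs (suc k) i))))
      where
      t = ε ^ triangle (suc (after i))
      solved : M i * xs (suc k) i ≡ 1ℚ + - (ε * rest i (at-state (xs k)))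
      solved = trans (x∙yz≈y∙xz (M i) a (recip (M i))) (trans (cong (a *_) (*-recip (0<M i))) (*-identityʳ _))
        where a = 1ℚ + - (ε * rest i (at-state (xs k)))

    welem-close : ∀ i e → 0ℚ < e → ∃ λ N → ∀ k → N ℕ.≤ k →
      ∣ W.welem m (λ i → coordinate i k) (suc (after i)) + - ε ^ triangle (suc (after i)) ∣ < e
    welem-close i e 0<e = let N , lt = ½-small (bound * 16ℚ) e 0<e in N , λ k N≤k → ≤-<-trans
      (≤-trans (≡⇒≤ (trans (cong ∣_∣ (welem-near k i)) (trans (abs-* _ _) (cong₂ _*_ (abs-≥0 (<⇒≤ (0<^ (triangle (suc (after i))) 0<ε)))
          (trans (abs-* _ _) (cong (_* ∣ xs k i + - xs (suc k) i ∣) (abs-≥0 (<⇒≤ (0<M i)))))))))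
        (subst (_ ≤_) (*-identityˡ _) (*-mono-≤ (<⇒≤ (0<^ (triangle (suc (after i))) 0<ε)) (^≤1 (triangle (suc (after i))) (<⇒≤ 0<ε) ε-≤1) (0≤* (<⇒≤ (0<M i)) (abs-nonneg _))
          (*-mono-≤ (<⇒≤ (0<M i)) (M≤bound i) (abs-nonneg _) (spread N k (suc k) N≤k (ℕ.m≤n⇒m≤1+n N≤k) i)))))
      (subst (_< e) (*-assoc bound 16ℚ (½ ^ N)) lt)

  -- The coordinates at different positions are of different orders of magnitude.
  gap : ∀ {a b η η′} → a ℕ.< b → lower ≤ η → 0ℚ ≤ η′ → η′ ≤ upper → ½ * lower * ε ^ a ≤ ∣ ε ^ a * η + - (ε ^ b * η′) ∣
  gap {a} {b} {η} {η′} a<b lo 0≤η′ hi = ≤-trans (subst₂ _≤_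
      (trans (solve 3 (λ h l p → p :* l :- h :* l :* p := (:1 :- h) :* l :* p) refl ½ lower (ε ^ a)) (cong (λ h → h * lower * ε ^ a) 1-½))
      refl (+-mono-≤ (*-mono-≤ (0≤^a a) ≤-refl (<⇒≤ 0<lower) lo) (neg-mono-≤ small-term))) (≤-abs _) where
    0≤^a : ∀ a → 0ℚ ≤ ε ^ a
    0≤^a a = <⇒≤ (0<^ a 0<ε)
    1-½ : 1ℚ + - ½ ≡ ½
    1-½ = trans (cong (_+ - ½) (sym ½+½)) (solve 1 (λ h → (h :+ h) :- h := h) refl ½)
    power-drop : ∀ {a b} → a ℕ.< b → ε ^ b ≤ ε ^ a * ε
    power-drop {zero} {suc b} (s≤s _) = subst (_≤ 1ℚ * ε) (*-comm (ε ^ b) ε) (*-monoˡ (<⇒≤ 0<ε) (^≤1 b (<⇒≤ 0<ε) ε-≤1))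
    power-drop {suc a} {suc b} (s≤s lt) = subst (ε ^ suc b ≤_) (sym (*-assoc ε (ε ^ a) ε)) (*-mono-≤ (<⇒≤ 0<ε) ≤-refl (0≤^a b) (power-drop lt))
    small-term : ε ^ b * η′ ≤ ½ * lower * ε ^ a
    small-term = ≤-trans (*-mono-≤ (0≤^a b) (power-drop a<b) 0≤η′ hi) (subst₂ _≤_
      (xy∙z≈zx∙y ε upper (ε ^ a)) refl (*-monoˡ (0≤^a a) ε-upper))

-- Evaluation points in the complex numbers

module _ (n : ℕ) where
  private
    module C = CommutativeRing C
    open Embedding R
    module Real = Transport.Homomorphism R C real C.refl C.refl real-+ real-*
    open Complexes

  bounded? : (w : Vec ℕ q) → Dec (Bounded n w)
  bounded? w = Fin.all? λ b → (1 ℕ.≤? lookup w b) ×-dec (lookup w b ℕ.≤? n)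

  weights-ok : (w : Vec ℕ q) → Bounded n w → ∀ i → 1ℚ ≤ fromℕ (lookup w i) × fromℕ (lookup w i) ≤ fromℕ n
  weights-ok w ok i = subst (_≤ fromℕ (lookup w i)) (+-identityʳ 1ℚ) (fromℕ-mono (proj₁ (ok i))) , fromℕ-mono (proj₂ (ok i))

  pointAt : (w : Vec ℕ q) → Dec (Bounded n w) → Fin q → R.Carrier
  pointAt {q} w (yes ok) = Contraction.Fixed.limit-point n q (fromℕ ∘ lookup w) (weights-ok w ok)
  -- Default for weights that are not bounded by 1 and n.
  pointAt w (no _) = λ _ → R.0#

  constant : ℚ → R.Carrier
  constant c = limit (λ _ → c) λ e 0<e → 0 , λ _ _ _ _ → difference-0 0<e refl

  levelAt : ∀ q a → Dec (a ℕ.< q) → R.Carrier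
  levelAt q a (yes _) = constant (Contraction.ε n q ^ triangle (suc a))
  -- There is no set of a + 1 positions among q when a is at least q, so the weighted elementary
  -- polynomial is 0.
  levelAt q a (no _) = R.0#

  on-levelᴿ : (w : Vec ℕ q) → Bounded n w → ∀ (d : Dec (Bounded n w)) a (lt : Dec (a ℕ.< q)) →
    Wᴿ.welem (LinearAlgebra.fromℕ R ∘ lookup w) (pointAt w d) (suc a) R.≈ levelAt q a lt
  on-levelᴿ w ok (no ¬ok) a lt = contradiction ok ¬ok
  on-levelᴿ {q} w ok (yes ok′) a (no ≮) = ≈-intro λ e 0<e → 0 , λ k _ → difference-0 0<e
    (trans (welem-at k (λ j → fromℕ-at (lookup w j) k) (λ j → at-limit (coordinate j) _ k) (suc a))
      (trans (welem-scaled (fromℕ ∘ lookup w) (ratio (xs k)) (suc a))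
        (trans (cong (ε ^ triangle (suc a) *_) (H-beyond (fromℕ ∘ lookup w) (ratio (xs k)) (suc a) (s≤s (ℕ.≮⇒≥ ≮))))
          (trans (zeroʳ _) (sym (at-0 k)))))) where
    open Contraction n q
    open Fixed (fromℕ ∘ lookup w) (weights-ok w ok′)
    open Perturbation 𝔽 ε
  on-levelᴿ {q} w ok (yes ok′) a (yes lt) = let i , e = after-surjective a lt in
    subst (λ a → Wᴿ.welem (LinearAlgebra.fromℕ R ∘ lookup w) limit-point (suc a) R.≈ constant (ε ^ triangle (suc a))) e (converges i)
    where
    open Contraction n q
    open Fixed (fromℕ ∘ lookup w) (weights-ok w ok′)
    converges : ∀ i → Wᴿ.welem (LinearAlgebra.fromℕ R ∘ lookup w) limit-point (suc (after i)) R.≈ constant (ε ^ triangle (suc (after i)))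
    converges i = ≈-intro λ e 0<e → let N , h = welem-close i e 0<e in N , λ k k≥ →
      subst₂ (λ x y → ∣ x + - y ∣ < e)
        (sym (welem-at k (λ j → fromℕ-at (lookup w j) k) (λ j → at-limit (coordinate j) _ k) (suc (after i))))
        (sym (at-limit (λ _ → ε ^ triangle (suc (after i))) _ k)) (h k k≥)

  nonzeroᴿ : (w : Vec ℕ q) → Bounded n w → ∀ d b → Apart (pointAt w d b)
  nonzeroᴿ w ok (no ¬ok) b = contradiction ok ¬ok
  nonzeroᴿ {q} w ok (yes ok′) b = ε ^ suc (after b) * lower , 0<* (0<^ (suc (after b)) 0<ε) 0<lower , 0 , λ k _ →
    subst (λ x → ε ^ suc (after b) * lower ≤ ∣ x ∣) (sym (at-limit _ _ k))
      (≤-trans (*-mono-≤ (<⇒≤ (0<^ (suc (after b)) 0<ε)) ≤-refl (<⇒≤ 0<lower) (proj₁ (coordinate-bounds k b))) (≤-abs _)) where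
    open Contraction n q
    open Fixed (fromℕ ∘ lookup w) (weights-ok w ok′)

  separateᴿ : (w w′ : Vec ℕ q) → Bounded n w → Bounded n w′ → ∀ d d′ {b b′} → b ≢ b′ → Apart (pointAt w d b R.+ R.- pointAt w′ d′ b′)
  separateᴿ w w′ ok ok′ (no ¬ok) d′ _ = contradiction ok ¬ok
  separateᴿ w w′ ok ok′ (yes _) (no ¬ok) _ = contradiction ok′ ¬ok
  separateᴿ {q} w w′ ok ok′ (yes o) (yes o′) {b} {b′} b≢b′ = by-order (ℕ.<-cmp (after b) (after b′)) where
    open Contraction n q
    module F = Fixed (fromℕ ∘ lookup w) (weights-ok w o)
    module F′ = Fixed (fromℕ ∘ lookup w′) (weights-ok w′ o′)
    0≤ratio : ∀ {η} → lower ≤ η → 0ℚ ≤ η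
    0≤ratio h = ≤-trans (<⇒≤ 0<lower) h
    difference : ∀ k → at (F.limit-point b R.+ R.- F′.limit-point b′) k ≡ F.coordinate b k + - F′.coordinate b′ k
    difference k = trans (at-+ _ _ k) (cong₂ _+_ (at-limit _ _ k) (trans (at-neg _ k) (cong -_ (at-limit _ _ k))))
    positive : ∀ a → 0ℚ < ½ * lower * ε ^ a
    positive a = 0<* (0<* 0<½ 0<lower) (0<^ a 0<ε)
    by-order : Tri (after b ℕ.< after b′) (after b ≡ after b′) (after b′ ℕ.< after b) → Apart (F.limit-point b R.+ R.- F′.limit-point b′)
    by-order (tri≈ _ e _) = contradiction (after-injective e) b≢b′
    by-order (tri< lt _ _) = ½ * lower * ε ^ suc (after b) , positive (suc (after b)) , 0 , λ k _ →
      subst (λ x → ½ * lower * ε ^ suc (after b) ≤ ∣ x ∣) (sym (difference k))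
        (gap (s≤s lt) (proj₁ (F.coordinate-bounds k b)) (0≤ratio (proj₁ (F′.coordinate-bounds k b′))) (proj₂ (F′.coordinate-bounds k b′)))
    by-order (tri> _ _ gt) = ½ * lower * ε ^ suc (after b′) , positive (suc (after b′)) , 0 , λ k _ →
      subst (½ * lower * ε ^ suc (after b′) ≤_) (trans (abs-swap (F′.coordinate b′ k) (F.coordinate b k)) (cong ∣_∣ (sym (difference k))))
        (gap (s≤s gt) (proj₁ (F′.coordinate-bounds k b′)) (0≤ratio (proj₁ (F.coordinate-bounds k b))) (proj₂ (F.coordinate-bounds k b)))

  opaque
    complex-points : Points C n
    complex-points = record
      { point = λ w b → real (pointAt w (bounded? w) b)
      ; level = λ q a → real (levelAt q a (a ℕ.<? q))
      ; on-level = λ {q} w ok a → C.trans (C.sym (Real.welem-transport (λ i → Real.fromℕ-transport (lookup w i))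
          (λ _ → C.refl) (suc a))) (real-cong (on-levelᴿ w ok (bounded? w) a (a ℕ.<? q)))
      ; nonzero = λ w ok b → apart-re⇒unit {real (pointAt w (bounded? w) b)} (nonzeroᴿ w ok (bounded? w) b)
      ; separate = λ w w′ ok ok′ {b} {b′} b≢b′ → apart-re⇒unit {real (pointAt w (bounded? w) b) C.+ C.- real (pointAt w′ (bounded? w′) b′)}
          (separateᴿ w w′ ok ok′ (bounded? w) (bounded? w′) b≢b′)
      }

-- The theorem over the complex numbers

coinvariants≅ : ∀ n r′ (ζ : CommutativeRing.Carrier C) → IsPrimitiveRoot C (suc r′) ζ →
  Representations._≅_ C (Superspace.SR C n (suc r′) ζ)
    (Representations._⊗_ C (Superspace.K[OP̃] C n (suc r′) ζ) (Superspace.det C n (suc r′) ζ))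
coinvariants≅ n r′ ζ ζ-primitive = Coinvariants.isomorphism C n r′ ζ record
  { local = C-local
  ; fromℕ-unit = C-fromℕ-unit
  ; ζʳ = proj₁ ζ-primitive
  ; root-unit = RootsOfUnity.one-minus-power-unit C C-local (C-fromℕ-unit r′) ζ-primitive
  ; points = complex-points n
  }
  where open Complexes

opaque
  unfolding R

  R≡ℝ : R ≡ ℝ-commutativeRing
  R≡ℝ = ≡.refl

-- The reals are treated as opaque up to here; the result is transported along this equality.
C≡ℂ : C ≡ ℂ
C≡ℂ = ≡.cong Complexification.commutativeRing R≡ℝ

Claim : CommutativeRing 0ℓ 0ℓ → ℕ → ∀ r → .(NonZero r) → Set
Claim K n r nz = (ζ : CommutativeRing.Carrier K) → IsPrimitiveRoot K r ζ →
  Representations._≅_ K (Superspace.SR K n r {{nz}} ζ)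
    (Representations._⊗_ K (Superspace.K[OP̃] K n r {{nz}} ζ) (Superspace.det K n r {{nz}} ζ))

by-successors : (P : ∀ r → .(NonZero r) → Set) → (∀ r′ → P (suc r′) (record { nonZero = tt })) → ∀ r .(nz : NonZero r) → P r nz
by-successors P f (suc r′) nz = f r′

C-claim : ∀ n r′ → Claim C n (suc r′) (record { nonZero = tt })
C-claim n r′ = coinvariants≅ n r′

ℂ-claim : ∀ n r′ → Claim ℂ n (suc r′) (record { nonZero = tt })
ℂ-claim = ≡.subst (λ K → ∀ n r′ → Claim K n (suc r′) (record { nonZero = tt })) {C} {ℂ} C≡ℂ C-claim

claim : ∀ n r .(nz : NonZero r) → Claim ℂ n r nz
claim n = by-successors (Claim ℂ n) (ℂ-claim n)

theorem4p23 :
  (n r : ℕ) .{{_ : NonZero n}} .{{_ : NonZero r}} →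
  (ζ : CommutativeRing.Carrier ℂ) → IsPrimitiveRoot ℂ r ζ →
  let open Representations ℂ
      open Superspace ℂ n r ζ
  in SR ≅ K[OP̃] ⊗ det
theorem4p23 n r {{_}} {{nz}} = claim n r nz
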